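{- Let $d>0$ be a prime and $n\geq 1$. Then $\Sigma(n,d)\cong C'(n,d)$ and $S(n,d)\cong C'(n,d)/\langle X\rangle$. If $d$ is a prime power that is not a prime, these isomorphisms also hold whenever $\gcd(n,d)=1$, but they do not always hold when $\gcd(n,d)\neq 1$.
   Context: For a prime power $q$ and $n\ge1$, let $X$ be the $n\times n$ matrix over $\mathbb{F}_q$ of multiplication by $x$ on $\mathbb{F}_q[x]/(x^n-1)$ in the basis $1,x,\dots,x^{n-1}$ (the permutation matrix of an $n$-cycle). $\mathbb{F}_q[X]$ is the algebra of $n\times n$ circulant matrices; $C(n,q)$ is its group of units and $C'(n,q)=\{C\in C(n,q): C\mathbf 1=\mathbf 1\}$, where $\mathbf 1$ is the all-ones vector; $\langle X\rangle\le C'(n,q)$ is the cyclic subgroup generated by $X$. For integers $n\ge1$, $d\ge2$: in $\mathbb{Q}[x]/(x^n-1)$ (exponents taken mod $n$) put $e_v=x^v-1$, $\epsilon_v=d\,e_v-e_{dv}$; let $\mathcal Z_n$ be the $\mathbb{Z}$-span of $e_1,\dots,e_{n-1}$ and $\mathcal E_{n,d}$ the $\mathbb{Z}$-span of $\epsilon_1,\dots,\epsilon_{n-1}$; $\Sigma(n,d)=\mathcal Z_n/\mathcal E_{n,d}$. Let $f_v=dx^v-\sum_{i=0}^{d-1}x^{dv+i}$ and $S(n,d)=\mathcal Z_n/\langle f_1,\dots,f_{n-1}\rangle_{\mathbb{Z}}$ (this group is isomorphic to the sandpile group of the generalized de Bruijn graph with vertex set $\mathbb{Z}_n$ and arcs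 $v\to dv+i$, $0\le i\le d-1$). -}

module Defs where

open import Level using (0ℓ)
open import Data.Nat as ℕ using (ℕ; zero; suc; NonZero; _∸_; _^_; _≤_)
open import Data.Nat.DivMod using (_mod_)
open import Data.Nat.Primality using (Prime)
open import Data.Fin as Fin using (Fin; toℕ)
open import Data.Integer as ℤ using (ℤ)
open import Data.Bool using (if_then_else_)
open import Data.Product using (Σ; ∃; ∃₂; _×_)
open import Relation.Nullary using (¬_; does)
open import Relation.Binary.PropositionalEquality using (_≡_)
open import Algebra.Bundles using (CommutativeRing)

IsPrimePower : ℕ → Set
IsPrimePower q = ∃₂ λ p k → Prime p × (1 ≤ k) × (q ≡ p ^ k)

record FiniteField (q : ℕ) : Set₁ where
  field
    commRing : CommutativeRing 0ℓ 0ℓ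
  open CommutativeRing commRing public
  field
    0≉1       : ¬ (0# ≈ 1#)
    inverse   : ∀ x → ¬ (x ≈ 0#) → ∃ λ y → x * y ≈ 1#
    enum      : Fin q → Carrier
    enum-inj  : ∀ i j → enum i ≈ enum j → i ≡ j
    enum-surj : ∀ x → ∃ λ i → enum i ≈ x

record GroupIso (A : Set) (_~_ : A → A → Set) (_+_ : A → A → A)
                (B : Set) (InB : B → Set) (_≈_ : B → B → Set) (_·_ : B → B → B) : Set where
  field
    φ      : A → B
    φ-in   : ∀ a → InB (φ a)
    φ-wd   : ∀ a a′ → a ~ a′ → φ a ≈ φ a′
    φ-hom  : ∀ a a′ → φ (a + a′) ≈ (φ a · φ a′)
    φ-inj  : ∀ a a′ → φ a ≈ φ a′ → a ~ a′
    φ-surj : ∀ b → InB b → ∃ λ a → φ a ≈ b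

∑ℤ : ∀ {k} → (Fin k → ℤ) → ℤ
∑ℤ {zero}  f = ℤ.0ℤ
∑ℤ {suc k} f = f Fin.zero ℤ.+ ∑ℤ (λ i → f (Fin.suc i))

-- The groups Σ(n,d) and S(n,d).
-- Elements of ℚ[x]/(x^n-1) that occur here all have integer coefficients,
-- so we compute in ℤ[x]/(x^n-1), represented by coefficient vectors Fin n → ℤ
-- (coefficient of x^j at index j).

module Sandpile (n : ℕ) {{_ : NonZero n}} (d : ℕ) where

  Poly : Set
  Poly = Fin n → ℤ

  mono : ℕ → Poly
  mono k j = if does (j Fin.≟ (k mod n)) then ℤ.1ℤ else ℤ.0ℤ

  _-ₚ_ : Poly → Poly → Poly
  (p -ₚ r) j = p j ℤ.- r j

  _·ₚ_ : ℤ → Poly → Poly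
  (a ·ₚ p) j = a ℤ.* p j

  e : ℕ → Poly
  e v = mono v -ₚ mono 0

  ε : ℕ → Poly
  ε v = ((ℤ.+ d) ·ₚ e v) -ₚ e (d ℕ.* v)

  f : ℕ → Poly
  f v = ((ℤ.+ d) ·ₚ mono v) -ₚ (λ j → ∑ℤ {d} (λ i → mono (d ℕ.* v ℕ.+ toℕ i) j))

  Idx : Set
  Idx = Fin (n ∸ 1)

  idx : Idx → ℕ
  idx i = suc (toℕ i)

  comb : (Idx → ℤ) → (ℕ → Poly) → Poly
  comb a g j = ∑ℤ (λ i → a i ℤ.* g (idx i) j)

  InSpan : (ℕ → Poly) → Poly → Set
  InSpan g p = ∃ λ (a : Idx → ℤ) → ∀ j → p j ≡ comb a g j

  -- Elements of 𝒵_n = ℤ-span of e_1,…,e_{n-1}, given by their coefficients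
  -- (the e_v are linearly independent), with addition.
  Zn : Set
  Zn = Idx → ℤ

  _+z_ : Zn → Zn → Zn
  (a +z b) i = a i ℤ.+ b i

  ι : Zn → Poly
  ι a = comb a e

  _~Σ_ : Zn → Zn → Set
  a ~Σ b = InSpan ε (ι a -ₚ ι b)

  _~S_ : Zn → Zn → Set
  a ~S b = InSpan f (ι a -ₚ ι b)

module Circulant {q : ℕ} (F : FiniteField q) (n : ℕ) {{_ : NonZero n}} where
  open FiniteField F

  ∑F : ∀ {k} → (Fin k → Carrier) → Carrier
  ∑F {zero}  g = 0#
  ∑F {suc k} g = g Fin.zero + ∑F (λ i → g (Fin.suc i))

  Mat : Set
  Mat = Fin n → Fin n → Carrier

  _≈ₘ_ : Mat → Mat → Set
  A ≈ₘ B = ∀ i j → A i j ≈ B i j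

  _⊗_ : Mat → Mat → Mat
  (A ⊗ B) i j = ∑F (λ k → A i k * B k j)

  Iₘ : Mat
  Iₘ i j = if does (i Fin.≟ j) then 1# else 0#

  -- X: multiplication by x on 𝔽_q[x]/(x^n-1) in the basis 1,x,…,x^{n-1}:
  -- column j has a single 1, in row (j+1) mod n.
  Xₘ : Mat
  Xₘ i j = if does (i Fin.≟ (suc (toℕ j) mod n)) then 1# else 0#

  X^ : ℕ → Mat
  X^ zero    = Iₘ
  X^ (suc k) = Xₘ ⊗ X^ k

  InFX : Mat → Set
  InFX C = ∃ λ (c : Fin n → Carrier) → ∀ i j → C i j ≈ ∑F (λ k → c k * X^ (toℕ k) i j)

  IsUnit : Mat → Set
  IsUnit C = ∃ λ D → InFX D × ((C ⊗ D) ≈ₘ Iₘ) × ((D ⊗ C) ≈ₘ Iₘ)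

  Fixes𝟏 : Mat → Set
  Fixes𝟏 C = ∀ i → ∑F (λ j → C i j) ≈ 1#

  InC′ : Mat → Set
  InC′ C = InFX C × IsUnit C × Fixes𝟏 C

  _≈X_ : Mat → Mat → Set
  A ≈X B = ∃ λ k → A ≈ₘ (X^ k ⊗ B)

Σ≅C′ : (n : ℕ) {{_ : NonZero n}} (d : ℕ) → FiniteField d → Set
Σ≅C′ n d F = GroupIso Zn _~Σ_ _+z_ Mat InC′ _≈ₘ_ _⊗_
  where open Sandpile n d
        open Circulant F n

S≅C′/X : (n : ℕ) {{_ : NonZero n}} (d : ℕ) → FiniteField d → Set
S≅C′/X n d F = GroupIso Zn _~S_ _+z_ Mat InC′ _≈X_ _⊗_
  where open Sandpile n d
        open Circulant F n

{-# OPTIONS --safe #-}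
-- Suppose first that gcd(n,q) = 1. Over a field containing the n-th roots of unity ω, the
-- transform u ↦ (u(ω^v))_v identifies C'(n,q) with the vectors θ of nonzero values such that
-- θ(0) = 1 and θ(qv) = θ(v)^q; these are the characters of Σ(n,q), which a duality for finite
-- abelian groups turns back into elements of Σ(n,q). Multiplication by x - 1 embeds S(n,q)
-- into Σ(n,q) as the kernel of y ↦ val y ∈ ℤ/n; restricting characters to this kernel kills
-- exactly the characters y ↦ ω^(k val y), which correspond to the powers of X.
--
-- If q = p is prime and n = p n₁, then x^v ↦ x^(v mod n₁) on Σ(n,p), and u ↦ u^p (a polynomial
-- in x^p) on C'(n,p), are surjections onto Σ(n₁,p) and C'(n₁,p) whose kernels are the
-- p-torsion, so an isomorphism for n₁ lifts to one for n once the p-torsion subgroups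
-- have the same size; likewise for S and C'/⟨X⟩.
--
-- For 𝔽₄ and n = 2 every element of C' is an involution, while Σ(2,4) is cyclic of order 4.
module Submission where

open import Defs
open import Algebra.Bundles using (AbelianGroup; CommutativeRing; CommutativeMonoid)
import Algebra.Properties.CommutativeSemigroup as CommutativeSemigroup
import Algebra.Properties.CommutativeSemiring.Exp as CommutativeExponent
import Algebra.Properties.Group as GroupProperties
import Algebra.Properties.Ring as RingProperties
import Algebra.Properties.Semiring.Exp as Exponent
import Algebra.Properties.Semiring.Mult as Multiple
import Algebra.Properties.Semiring.Sum as Summation
open import Data.Bool using (if_then_else_; T)
open import Data.Empty using (⊥; ⊥-elim)
open import Data.Fin as Fin using (Fin; toℕ; fromℕ<)
open import Data.Fin.Patterns using (0F; 1F)
open import Data.Fin.Permutation using (Permutation; _⟨$⟩ʳ_; permutation)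
import Data.Fin.Properties as Fin
open import Data.Integer as ℤ using (ℤ; +_; 0ℤ; 1ℤ)
import Data.Integer.DivMod as ℤ
import Data.Integer.Divisibility.Signed as ℤ
import Data.Integer.Properties as ℤ
open import Data.Integer.Tactic.RingSolver using (solve-∀)
open import Data.List using ([]; _∷_)
open import Data.List.Relation.Unary.All using ([]; _∷_)
open import Data.Nat as ℕ using (ℕ; zero; suc; NonZero; z≤n; s≤s)
open import Data.Nat.Combinatorics using (_C_; nC1≡n; nCn≡1; nCk+nC[k+1]≡[n+1]C[k+1]; k>n⇒nCk≡0)
open import Data.Nat.Coprimality as ℕ using (coprime-Bézout; prime⇒coprime)
open import Data.Nat.DivMod as ℕ using (_%_; _/_; _mod_)
open import Data.Nat.Divisibility as ℕ using (_∣_; divides)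
open import Data.Nat.GCD as ℕ using (gcd)
open import Data.Nat.Induction using (<-wellFounded; <-rec)
open import Data.Nat.ListAction using (product)
open import Data.Nat.Primality using (Prime; prime⇒nonZero; prime⇒irreducible; prime⇒nonTrivial; euclidsLemma; prime?; ¬prime[0]; ¬prime[1]; prime[2])
open import Data.Nat.Primality.Factorisation using (factorise)
import Data.Nat.Properties as ℕ
open import Data.Nat.Solver using (module +-*-Solver)
open import Data.Product using (Σ; ∃; _×_; _,_; proj₁; proj₂)
open import Data.Sum using (_⊎_; inj₁; inj₂)
open import Data.Unit using (⊤; tt)
open import Data.Vec as Vec using ([]; _∷_)
open import Function using (_∘_)
open import Induction.WellFounded using (Acc; acc)
open import Level using (0ℓ)
open import Relation.Binary.PropositionalEquality as ≡ using (_≡_; _≢_)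
import Relation.Binary.Reasoning.Setoid as Reasoning
open import Relation.Nullary using (¬_; Dec; yes; no; does)
open import Relation.Nullary.Decidable using (¬?; _×-dec_; decidable-stable; dec-true; dec-false; map′; _→-dec_; from-yes; from-no)

-- A finite abelian group and its dual are isomorphic but not naturally, so the duality depends on a
-- choice: a perfect pairing, built by splitting off cyclic summands. It is applied to Σ(n,q) and,
-- separately, to the kernel of val. The roots of unity come from Q = q^m - 1 with n dividing Q. In
-- F[x]/(x^Q - 1) the q^m-th power fixes coefficients and exponents, so y^(Q+1) = y for all y, and
-- an idempotent cuts out a field in which x has exact order Q. When p divides n, F[x]/(x^n - 1) is
-- not a product of fields and the transform fails. Multiplication by p on ℤ/n factors through ℤ/n₁
-- with an injective second factor, which is why the kernels are exactly the p-torsion. The two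
-- torsion groups are compared through integer vectors modulo p on one side and coefficients in the
-- field on the other, so the field has to be ℤ/p. For S and C'/⟨X⟩ there remains an ambiguity by
-- powers of X^n₁; a linear functional Λ removes it and at the same time computes val.

-- Finite abelian groups

module Additive (G : AbelianGroup 0ℓ 0ℓ) where
  open AbelianGroup G public
    renaming ( _∙_ to infixl 6 _+_; ε to 0#; _⁻¹ to infix 8 -_
             ; ∙-cong to +-cong; ∙-congˡ to +-congˡ; ∙-congʳ to +-congʳ
             ; assoc to +-assoc; comm to +-comm
             ; identityˡ to +-identityˡ; identityʳ to +-identityʳ
             ; inverseˡ to -‿inverseˡ; inverseʳ to -‿inverseʳ; ⁻¹-cong to -‿cong )
    hiding (_-_)
  open import Algebra.Properties.CommutativeMonoid.Mult commutativeMonoid public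
    renaming (_×_ to infixr 7 _·_)
  open import Algebra.Properties.Group group public
    using () renaming (ε⁻¹≈ε to -0≈0; x∙y⁻¹≈ε⇒x≈y to x-y≈0⇒x≈y; inverseʳ-unique to neg-unique; ∙-cancelˡ to +-cancelˡ; ∙-cancelʳ to +-cancelʳ)
  open import Algebra.Properties.AbelianGroup G public
    using () renaming (⁻¹-∙-comm to -‿+-comm)
  open import Algebra.Properties.CommutativeSemigroup commutativeSemigroup public
    using () renaming (interchange to +-interchange)
  open import Relation.Binary.Reasoning.Setoid setoid public

  infixl 6 _-_
  _-_ : Carrier → Carrier → Carrier
  x - y = x + - y

  sub-cong : ∀ {x x′ y y′} → x ≈ x′ → y ≈ y′ → x - y ≈ x′ - y′
  sub-cong e f = +-cong e (-‿cong f)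

  x-y+y : ∀ x y → x - y + y ≈ x
  x-y+y x y = trans (+-assoc _ _ _) (trans (+-congˡ (-‿inverseˡ y)) (+-identityʳ x))

  x+y-y : ∀ x y → x + y - y ≈ x
  x+y-y x y = trans (+-assoc _ _ _) (trans (+-congˡ (-‿inverseʳ y)) (+-identityʳ x))

  x≈y⇒x-y≈0 : ∀ {x y} → x ≈ y → x - y ≈ 0#
  x≈y⇒x-y≈0 {x} {y} e = trans (+-congʳ e) (-‿inverseʳ y)

  +--interchange : ∀ x y x′ y′ → (x + y) - (x′ + y′) ≈ (x - x′) + (y - y′)
  +--interchange x y x′ y′ = trans (+-congˡ (sym (-‿+-comm x′ y′))) (+-interchange _ _ _ _)

  x-0≈x : ∀ x → x - 0# ≈ x
  x-0≈x x = trans (+-congˡ -0≈0) (+-identityʳ x)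

  x-[x-y]≈y : ∀ x y → x - (x - y) ≈ y
  x-[x-y]≈y x y = begin
    x - (x + - y)           ≈⟨ +-congʳ (sym (+-identityʳ x)) ⟩
    (x + 0#) - (x + - y)    ≈⟨ +--interchange _ _ _ _ ⟩
    (x - x) + (0# - - y)    ≈⟨ +-cong (-‿inverseʳ x) (+-identityˡ _) ⟩
    0# + - - y              ≈⟨ +-identityˡ _ ⟩
    - - y                   ≈⟨ sym (neg-unique (- y) y (-‿inverseˡ y)) ⟩
    y                       ∎

  ·-zeroʳ : ∀ n → n · 0# ≈ 0#
  ·-zeroʳ zero = refl
  ·-zeroʳ (suc n) = trans (+-identityˡ _) (·-zeroʳ n)

  ·-neg : ∀ n x → n · (- x) ≈ - (n · x)
  ·-neg n x = neg-unique _ _ (begin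
    n · x + n · (- x)  ≈⟨ sym (×-distrib-+ x (- x) n) ⟩
    n · (x - x)        ≈⟨ ×-congʳ n (-‿inverseʳ x) ⟩
    n · 0#             ≈⟨ ·-zeroʳ n ⟩
    0#                 ∎)

  ·-comm : ∀ m n x → m · n · x ≈ n · m · x
  ·-comm m n x = trans (×-assocˡ x m n) (trans (×-congˡ (ℕ.*-comm m n)) (sym (×-assocˡ x n m)))

  ·-multiple : ∀ {m n x} → m · x ≈ 0# → m ∣ n → n · x ≈ 0#
  ·-multiple {m} {x = x} e (divides k ≡.refl) =
    trans (sym (×-assocˡ x k m)) (trans (×-congʳ k e) (·-zeroʳ k))

  -- One of the two truncated differences is 0, so no case distinction is asked of the caller.
  ·-≡∸ : ∀ {i j x} → (i ℕ.∸ j) · x ≈ 0# → (j ℕ.∸ i) · x ≈ 0# → i · x ≈ j · x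
  ·-≡∸ {i} {j} {x} e f with ℕ.≤-total i j
  ... | inj₁ i≤j = begin
        i · x                       ≈⟨ sym (+-identityʳ _) ⟩
        i · x + 0#                  ≈⟨ +-congˡ (sym f) ⟩
        i · x + (j ℕ.∸ i) · x       ≈⟨ sym (×-homo-+ x i (j ℕ.∸ i)) ⟩
        (i ℕ.+ (j ℕ.∸ i)) · x       ≈⟨ ×-congˡ (ℕ.m+[n∸m]≡n i≤j) ⟩
        j · x                       ∎
  ... | inj₂ j≤i = begin
        i · x                       ≈⟨ ×-congˡ (≡.sym (ℕ.m+[n∸m]≡n j≤i)) ⟩
        (j ℕ.+ (i ℕ.∸ j)) · x       ≈⟨ ×-homo-+ x j (i ℕ.∸ j) ⟩
        j · x + (i ℕ.∸ j) · x       ≈⟨ +-congˡ e ⟩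
        j · x + 0#                  ≈⟨ +-identityʳ _ ⟩
        j · x                       ∎

  ·-∸ : ∀ {i j x} → i · x ≈ j · x → (i ℕ.∸ j) · x ≈ 0#
  ·-∸ {i} {j} {x} e with ℕ.≤-total i j
  ... | inj₁ i≤j = ×-congˡ (ℕ.m≤n⇒m∸n≡0 i≤j)
  ... | inj₂ j≤i = +-cancelˡ (j · x) _ _ (begin
        j · x + (i ℕ.∸ j) · x     ≈⟨ sym (×-homo-+ x j (i ℕ.∸ j)) ⟩
        (j ℕ.+ (i ℕ.∸ j)) · x     ≈⟨ ×-congˡ (ℕ.m+[n∸m]≡n j≤i) ⟩
        i · x                     ≈⟨ e ⟩
        j · x                     ≈⟨ sym (+-identityʳ _) ⟩
        j · x + 0#                ∎)

-- Membership is decidable because orders, images and preimages are found by exhaustive search.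
record Subgroup (G : AbelianGroup 0ℓ 0ℓ) : Set₁ where
  open Additive G
  field
    Mem    : Carrier → Set
    mem?   : ∀ x → Dec (Mem x)
    resp   : ∀ {x y} → x ≈ y → Mem x → Mem y
    mem-0  : Mem 0#
    mem-+  : ∀ {x y} → Mem x → Mem y → Mem (x + y)
    mem-neg : ∀ {x} → Mem x → Mem (- x)

  mem-- : ∀ {x y} → Mem x → Mem y → Mem (x - y)
  mem-- p q = mem-+ p (mem-neg q)

  mem-· : ∀ n {x} → Mem x → Mem (n · x)
  mem-· zero p = mem-0
  mem-· (suc n) p = mem-+ p (mem-· n p)

record Least (P : ℕ → Set) (r : ℕ) : Set where
  constructor least
  field
    pos   : NonZero r
    holds : P r
    below : ∀ t → NonZero t → t ℕ.< r → ¬ P t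

least? : (P : ℕ → Set) → (∀ t → Dec (P t)) → ∀ N → .{{NonZero N}} → P N → ∃ λ r → Least P r × r ℕ.≤ N
least? P P? N@(suc N-1) PN = go N-1 1 (ℕ.+-comm N-1 1) _ (λ { (suc t) _ (s≤s ()) }) (s≤s z≤n)
  where
  go : ∀ fuel r → fuel ℕ.+ r ≡ N → NonZero r → (∀ t → NonZero t → t ℕ.< r → ¬ P t) → 1 ℕ.≤ r → ∃ λ r → Least P r × r ℕ.≤ N
  go zero r ≡.refl nz b 1≤r = r , least nz PN b , ℕ.≤-refl
  go (suc f) r e nz b 1≤r with P? r
  ... | yes p = r , least nz p b , ℕ.≤-trans (ℕ.m≤n+m r (suc f)) (ℕ.≤-reflexive e)
  ... | no ¬p = go f (suc r) (≡.trans (ℕ.+-suc f r) e) _ b′ (s≤s z≤n)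
    where
    b′ : ∀ t → NonZero t → t ℕ.< suc r → ¬ P t
    b′ t nz′ (s≤s t≤r) with ℕ.m≤n⇒m<n∨m≡n t≤r
    ... | inj₁ t<r = b t nz′ t<r
    ... | inj₂ ≡.refl = ¬p

module _ (G : AbelianGroup 0ℓ 0ℓ) where
  open Additive G

  -- The remainder of t by r is again a multiplier that brings `a` into the subgroup, and it is
  -- smaller than r.
  order-divides : (H : Subgroup G) → let open Subgroup H in
    ∀ {a r} → Least (λ t → Mem (t · a)) r → ∀ t → Mem (t · a) → r ∣ t
  order-divides H {a} {r} (least pos ra below) t ta = ℕ.m%n≡0⇒n∣m t r rem≡0
    where
    open Subgroup H
    instance _ = pos
    rem-mem : Mem ((t % r) · a)
    rem-mem = resp (begin
        t · a - (t / r) · (r · a)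
          ≈⟨ sub-cong (×-congˡ (ℕ.m≡m%n+[m/n]*n t r)) (×-assocˡ a (t / r) r) ⟩
        (t % r ℕ.+ (t / r) ℕ.* r) · a - ((t / r) ℕ.* r) · a
          ≈⟨ +-congʳ (×-homo-+ a (t % r) _) ⟩
        (t % r) · a + ((t / r) ℕ.* r) · a - ((t / r) ℕ.* r) · a
          ≈⟨ x+y-y _ _ ⟩
        (t % r) · a ∎) (mem-- ta (mem-· (t / r) ra))
    rem≡0 : t % r ≡ 0
    rem≡0 with t % r | rem-mem | ℕ.m%n<n t r
    ... | zero  | _ | _  = ≡.refl
    ... | suc k | m | lt = ⊥-elim (below (suc k) _ lt m)

module Extension (A B : AbelianGroup 0ℓ 0ℓ) where
  private
    module A = Additive A
    module B = Additive B

  -- φ is total, but is only constrained on the subgroup.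
  record PartialHom : Set₁ where
    field
      dom    : Subgroup A
    open Subgroup dom public
    field
      φ      : A.Carrier → B.Carrier
      φ-cong : ∀ {x y} → Mem x → x A.≈ y → φ x B.≈ φ y
      φ-+    : ∀ {x y} → Mem x → Mem y → φ (x A.+ y) B.≈ φ x B.+ φ y

    φ-0 : φ A.0# B.≈ B.0#
    φ-0 = B.+-cancelˡ (φ A.0#) _ _ (begin
      φ A.0# B.+ φ A.0#   ≈⟨ B.sym (φ-+ mem-0 mem-0) ⟩
      φ (A.0# A.+ A.0#)   ≈⟨ φ-cong (mem-+ mem-0 mem-0) (A.+-identityˡ _) ⟩
      φ A.0#              ≈⟨ B.sym (B.+-identityʳ _) ⟩
      φ A.0# B.+ B.0#     ∎) where open B using (begin_; step-≈-⟩; _∎)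

    φ-neg : ∀ {x} → Mem x → φ (A.- x) B.≈ B.- φ x
    φ-neg {x} p = B.neg-unique _ _ (begin
      φ x B.+ φ (A.- x)   ≈⟨ B.sym (φ-+ p (mem-neg p)) ⟩
      φ (x A.+ A.- x)     ≈⟨ φ-cong (mem-+ p (mem-neg p)) (A.-‿inverseʳ x) ⟩
      φ A.0#              ≈⟨ φ-0 ⟩
      B.0#                ∎) where open B using (begin_; step-≈-⟩; _∎)

    φ-- : ∀ {x y} → Mem x → Mem y → φ (x A.- y) B.≈ φ x B.- φ y
    φ-- p q = B.trans (φ-+ p (mem-neg q)) (B.+-congˡ (φ-neg q))

    φ-· : ∀ n {x} → Mem x → φ (n A.· x) B.≈ n B.· φ x
    φ-· zero p = φ-0
    φ-· (suc n) p = B.trans (φ-+ p (mem-· n p)) (B.+-congˡ (φ-· n p))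

  record _Extends_ (h′ h : PartialHom) : Set where
    private
      module h = PartialHom h
      module h′ = PartialHom h′
    field
      mem-ext : ∀ {x} → h.Mem x → h′.Mem x
      φ-ext   : ∀ {x} → h.Mem x → h′.φ x B.≈ h.φ x

  ext-refl : ∀ {h} → h Extends h
  ext-refl = record { mem-ext = λ p → p ; φ-ext = λ _ → B.refl }

  ext-trans : ∀ {h h′ h″} → h″ Extends h′ → h′ Extends h → h″ Extends h
  ext-trans f g = record
    { mem-ext = λ p → F.mem-ext (G.mem-ext p)
    ; φ-ext = λ p → B.trans (F.φ-ext (G.mem-ext p)) (G.φ-ext p) }
    where module F = _Extends_ f
          module G = _Extends_ g

  -- Adjoins `a` to the domain and sends it to `b`. Here r is the order of `a` modulo the domain, so
  -- r b = φ(r a) is the only condition for the value φ(x - t a) + t b to be independent of t.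
  module OneStep (h : PartialHom) (a : A.Carrier) {r : ℕ}
                 (ord : Least (λ t → PartialHom.Mem h (t A.· a)) r)
                 (b : B.Carrier) (rb : r B.· b B.≈ PartialHom.φ h (r A.· a)) where
    open PartialHom h
    open Least ord renaming (holds to ra)
    instance _ = pos

    -- Bounding t by the relative order keeps membership decidable; `to-Mem′` reduces an arbitrary t
    -- modulo r.
    Mem′ : A.Carrier → Set
    Mem′ x = ∃ λ (t : Fin r) → Mem (x A.- toℕ t A.· a)

    mem?′ : ∀ x → Dec (Mem′ x)
    mem?′ x = Fin.any? (λ t → mem? _)

    to-Mem′ : ∀ {x} t → Mem (x A.- t A.· a) → Mem′ x
    to-Mem′ {x} t p = fromℕ< (ℕ.m%n<n t r) , resp (begin
        x A.- t A.· a A.+ k A.· (r A.· a)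
          ≈⟨ A.+-cong (A.+-congˡ (A.-‿cong e)) (A.×-assocˡ a k r) ⟩
        x A.- (u A.+ v) A.+ v
          ≈⟨ A.+-congʳ (A.+-congˡ (A.sym (A.-‿+-comm u v))) ⟩
        x A.+ (A.- u A.- v) A.+ v
          ≈⟨ A.+-congʳ (A.sym (A.+-assoc _ _ _)) ⟩
        x A.- u A.- v A.+ v
          ≈⟨ A.x-y+y _ _ ⟩
        x A.- u
          ≈⟨ A.+-congˡ (A.-‿cong (A.×-congˡ (≡.sym (Fin.toℕ-fromℕ< (ℕ.m%n<n t r))))) ⟩
        x A.- toℕ (fromℕ< (ℕ.m%n<n t r)) A.· a ∎)
      (mem-+ p (mem-· k ra))
      where
      open A using (begin_; step-≈-⟩; _∎)
      k = t / r
      u = (t % r) A.· a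
      v = (k ℕ.* r) A.· a
      e : t A.· a A.≈ u A.+ v
      e = A.trans (A.×-congˡ (ℕ.m≡m%n+[m/n]*n t r)) (A.×-homo-+ a (t % r) _)

    φ-r· : ∀ k → φ ((k ℕ.* r) A.· a) B.≈ (k ℕ.* r) B.· b
    φ-r· k = begin
      φ ((k ℕ.* r) A.· a)  ≈⟨ φ-cong (resp (A.×-assocˡ a k r) (mem-· k ra)) (A.sym (A.×-assocˡ a k r)) ⟩
      φ (k A.· r A.· a)    ≈⟨ φ-· k ra ⟩
      k B.· φ (r A.· a)    ≈⟨ B.×-congʳ k (B.sym rb) ⟩
      k B.· r B.· b        ≈⟨ B.×-assocˡ b k r ⟩
      (k ℕ.* r) B.· b      ∎
      where open B using (begin_; step-≈-⟩; _∎)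

    value : A.Carrier → ℕ → B.Carrier
    value x t = φ (x A.- t A.· a) B.+ t B.· b

    -- If both t and t + s describe x, then s a lies in the domain, so r divides s and `rb` allows s
    -- a to be moved from the φ part to the `b` part.
    value-shift : ∀ x t s → Mem (x A.- t A.· a) → Mem (x A.- (t ℕ.+ s) A.· a) → value x t B.≈ value x (t ℕ.+ s)
    value-shift x t s p q with order-divides A dom ord s sa
      where
      sa : Mem (s A.· a)
      sa = resp (begin
        x A.- t A.· a A.- (x A.- (t ℕ.+ s) A.· a)
          ≈⟨ A.+--interchange x (A.- (t A.· a)) x (A.- ((t ℕ.+ s) A.· a)) ⟩
        x A.- x A.+ (A.- (t A.· a) A.- (A.- ((t ℕ.+ s) A.· a)))
          ≈⟨ A.+-cong (A.-‿inverseʳ x) (A.+-congˡ (A.-‿cong (A.-‿cong (A.×-homo-+ a t s)))) ⟩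
        A.0# A.+ (A.- (t A.· a) A.- (A.- (t A.· a A.+ s A.· a)))
          ≈⟨ A.+-identityˡ _ ⟩
        A.- (t A.· a) A.- (A.- (t A.· a A.+ s A.· a))
          ≈⟨ A.+-congˡ (A.-‿cong (A.sym (A.-‿+-comm _ _))) ⟩
        A.- (t A.· a) A.- (A.- (t A.· a) A.- s A.· a)
          ≈⟨ A.x-[x-y]≈y _ _ ⟩
        s A.· a ∎) (mem-- p q)
        where open A using (begin_; step-≈-⟩; _∎)
    ... | divides k ≡.refl = begin
        φ (x A.- t A.· a) B.+ t B.· b
          ≈⟨ B.+-congʳ (φ-cong p (A.sym rearr)) ⟩
        φ (x A.- (t ℕ.+ s) A.· a A.+ s A.· a) B.+ t B.· b
          ≈⟨ B.+-congʳ (φ-+ q (resp (A.×-assocˡ a k r) (mem-· k ra))) ⟩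
        φ (x A.- (t ℕ.+ s) A.· a) B.+ φ (s A.· a) B.+ t B.· b
          ≈⟨ B.+-congʳ (B.+-congˡ (φ-r· k)) ⟩
        φ (x A.- (t ℕ.+ s) A.· a) B.+ s B.· b B.+ t B.· b
          ≈⟨ B.+-assoc _ _ _ ⟩
        φ (x A.- (t ℕ.+ s) A.· a) B.+ (s B.· b B.+ t B.· b)
          ≈⟨ B.+-congˡ (B.trans (B.+-comm _ _) (B.sym (B.×-homo-+ b t s))) ⟩
        φ (x A.- (t ℕ.+ s) A.· a) B.+ (t ℕ.+ s) B.· b ∎
      where
      open B using (begin_; step-≈-⟩; _∎)
      rearr : x A.- (t ℕ.+ s) A.· a A.+ s A.· a A.≈ x A.- t A.· a
      rearr = A.trans (A.+-congʳ (A.trans (A.+-congˡ (A.trans (A.-‿cong (A.×-homo-+ a t s)) (A.sym (A.-‿+-comm _ _)))) (A.sym (A.+-assoc _ _ _)))) (A.x-y+y _ _)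

    value-unique : ∀ x t t′ → Mem (x A.- t A.· a) → Mem (x A.- t′ A.· a) → value x t B.≈ value x t′
    value-unique x t t′ p q with ℕ.≤-total t t′
    ... | inj₁ t≤t′ with t′ ℕ.∸ t | ℕ.m+[n∸m]≡n t≤t′
    ...   | s | ≡.refl = value-shift x t s p q
    value-unique x t t′ p q | inj₂ t′≤t with t ℕ.∸ t′ | ℕ.m+[n∸m]≡n t′≤t
    ...   | s | ≡.refl = B.sym (value-shift x t′ s q p)

    φ′ : A.Carrier → B.Carrier
    φ′ x with mem?′ x
    ... | yes (t , _) = value x (toℕ t)
    ... | no _ = B.0#

    φ′-value : ∀ x t → Mem (x A.- t A.· a) → φ′ x B.≈ value x t
    φ′-value x t p with mem?′ x
    ... | yes (u , q) = value-unique x (toℕ u) t q p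
    ... | no ¬q = ⊥-elim (¬q (to-Mem′ t p))

    x-0a : ∀ x → x A.≈ x A.- 0 A.· a
    x-0a x = A.sym (A.x-0≈x x)

    sum-mem : ∀ x y t u → Mem (x A.- t A.· a) → Mem (y A.- u A.· a) → Mem (x A.+ y A.- (t ℕ.+ u) A.· a)
    sum-mem x y t u p q = resp (A.trans (A.sym (A.+--interchange _ _ _ _)) (A.+-congˡ (A.-‿cong (A.sym (A.×-homo-+ a t u))))) (mem-+ p q)

    dom′ : Subgroup A
    dom′ = record
      { Mem = Mem′
      ; mem? = mem?′
      ; resp = λ { e (t , p) → t , resp (A.+-congʳ e) p }
      ; mem-0 = to-Mem′ 0 (resp (x-0a _) mem-0)
      ; mem-+ = λ { {x} {y} (t , p) (u , q) → to-Mem′ (toℕ t ℕ.+ toℕ u) (sum-mem x y (toℕ t) (toℕ u) p q) }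
      -- Multipliers are natural numbers, so -t is represented by t (r - 1), which is congruent to
      -- it modulo r.
      ; mem-neg = λ { {x} (t , p) → to-Mem′ (toℕ t ℕ.* ℕ.pred r) (resp (neg-eq x (toℕ t)) (mem-- (mem-neg p) (mem-· (toℕ t) ra))) }
      }
      where
      open A using (begin_; step-≈-⟩; _∎)
      r≡ : ∀ t → t ℕ.+ t ℕ.* ℕ.pred r ≡ t ℕ.* r
      r≡ t = ≡.trans (≡.sym (ℕ.*-suc t (ℕ.pred r))) (≡.cong (t ℕ.*_) (ℕ.suc-pred r))
      neg-eq : ∀ x t → A.- (x A.- t A.· a) A.- t A.· r A.· a A.≈ A.- x A.- (t ℕ.* ℕ.pred r) A.· a
      neg-eq x t = begin
        A.- (x A.- t A.· a) A.- t A.· r A.· a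
          ≈⟨ A.-‿+-comm _ _ ⟩
        A.- (x A.- t A.· a A.+ t A.· r A.· a)
          ≈⟨ A.-‿cong (A.+-congˡ (A.trans (A.×-assocˡ a t r) (A.trans (A.×-congˡ (≡.sym (r≡ t))) (A.×-homo-+ a t _)))) ⟩
        A.- (x A.- t A.· a A.+ (t A.· a A.+ (t ℕ.* ℕ.pred r) A.· a))
          ≈⟨ A.-‿cong (A.trans (A.sym (A.+-assoc _ _ _)) (A.+-congʳ (A.x-y+y _ _))) ⟩
        A.- (x A.+ (t ℕ.* ℕ.pred r) A.· a)
          ≈⟨ A.sym (A.-‿+-comm _ _) ⟩
        A.- x A.- (t ℕ.* ℕ.pred r) A.· a ∎

    extended : PartialHom
    extended = record
      { dom = dom′
      ; φ = φ′
      ; φ-cong = λ { {x} {y} (t , p) e → B.trans (φ′-value x (toℕ t) p)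
                     (B.trans (B.+-congʳ (φ-cong p (A.+-congʳ e)))
                       (B.sym (φ′-value y (toℕ t) (resp (A.+-congʳ e) p)))) }
      ; φ-+ = λ { {x} {y} (t , p) (u , q) → hom x y (toℕ t) (toℕ u) p q }
      }
      where
      open B using (begin_; step-≈-⟩; _∎)
      hom : ∀ x y t u → Mem (x A.- t A.· a) → Mem (y A.- u A.· a) → φ′ (x A.+ y) B.≈ φ′ x B.+ φ′ y
      hom x y t u p q = begin
        φ′ (x A.+ y)
          ≈⟨ φ′-value _ (t ℕ.+ u) (sum-mem x y t u p q) ⟩
        φ (x A.+ y A.- (t ℕ.+ u) A.· a) B.+ (t ℕ.+ u) B.· b
          ≈⟨ B.+-cong (φ-cong (sum-mem x y t u p q) (A.trans (A.+-congˡ (A.-‿cong (A.×-homo-+ a t u))) (A.+--interchange _ _ _ _))) (B.×-homo-+ b t u) ⟩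
        φ ((x A.- t A.· a) A.+ (y A.- u A.· a)) B.+ (t B.· b B.+ u B.· b)
          ≈⟨ B.+-congʳ (φ-+ p q) ⟩
        φ (x A.- t A.· a) B.+ φ (y A.- u A.· a) B.+ (t B.· b B.+ u B.· b)
          ≈⟨ B.+-interchange _ _ _ _ ⟩
        value x t B.+ value y u
          ≈⟨ B.+-cong (B.sym (φ′-value x t p)) (B.sym (φ′-value y u q)) ⟩
        φ′ x B.+ φ′ y ∎

    extends : extended Extends h
    extends = record
      { mem-ext = λ p → to-Mem′ 0 (resp (x-0a _) p)
      ; φ-ext = λ {x} p → B.trans (φ′-value x 0 (resp (x-0a x) p))
                  (B.trans (B.+-identityʳ _) (φ-cong (resp (x-0a x) p) (A.sym (x-0a x)))) }

    1a : Mem (a A.- 1 A.· a)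
    1a = resp (A.sym (A.x≈y⇒x-y≈0 (A.sym (A.×-homo-1 a)))) mem-0

    a∈ : Mem′ a
    a∈ = to-Mem′ 1 1a

    φ′-a : φ′ a B.≈ b
    φ′-a = begin
      φ′ a                              ≈⟨ φ′-value a 1 1a ⟩
      φ (a A.- 1 A.· a) B.+ 1 B.· b     ≈⟨ B.+-cong (φ-cong 1a (A.x≈y⇒x-y≈0 (A.sym (A.×-homo-1 a)))) (B.×-homo-1 b) ⟩
      φ A.0# B.+ b                      ≈⟨ B.+-congʳ φ-0 ⟩
      B.0# B.+ b                        ≈⟨ B.+-identityˡ b ⟩
      b                                 ∎
      where open B using (begin_; step-≈-⟩; _∎)

  -- Finiteness takes the place of Zorn's lemma: the listed elements are adjoined one after another
  -- while `Inv` is preserved.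
  extend-all : ∀ {N} (enum : Fin N → A.Carrier) → (∀ x → ∃ λ i → enum i A.≈ x) →
    (Inv : PartialHom → Set) →
    (∀ h → Inv h → ∀ a → ∃ λ h′ → Inv h′ × (h′ Extends h) × PartialHom.Mem h′ a) →
    ∀ h → Inv h → ∃ λ h′ → Inv h′ × (h′ Extends h) × (∀ x → PartialHom.Mem h′ x)
  extend-all {N} enum surj Inv step h inv =
    let h′ , inv′ , e , mem = go N enum h inv
    in h′ , inv′ , e , λ x → PartialHom.resp h′ (proj₂ (surj x)) (mem (proj₁ (surj x)))
    where
    go : ∀ k (g : Fin k → A.Carrier) h → Inv h →
         ∃ λ h′ → Inv h′ × (h′ Extends h) × (∀ i → PartialHom.Mem h′ (g i))
    go zero g h inv = h , inv , ext-refl , λ ()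
    go (suc k) g h inv =
      let h₁ , inv₁ , e₁ , m₁ = step h inv (g Fin.zero)
          h₂ , inv₂ , e₂ , m₂ = go k (g ∘ Fin.suc) h₁ inv₁
      in h₂ , inv₂ , ext-trans e₂ e₁ , λ { Fin.zero → _Extends_.mem-ext e₂ m₁ ; (Fin.suc i) → m₂ i }

-- The enumeration may repeat elements, since groups with a coarse equality are listed through
-- representatives.
record IsFinite (A : AbelianGroup 0ℓ 0ℓ) : Set where
  open AbelianGroup A using (Carrier; _≈_)
  field
    size : ℕ
    enum : Fin size → Carrier
    enum-surj : ∀ x → ∃ λ i → enum i ≈ x
    _≟_  : ∀ x y → Dec (x ≈ y)

record Hom (A B : AbelianGroup 0ℓ 0ℓ) : Set where
  private
    module A = Additive A
    module B = Additive B
  field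
    fun  : A.Carrier → B.Carrier
    cong : ∀ {x y} → x A.≈ y → fun x B.≈ fun y
    homo : ∀ x y → fun (x A.+ y) B.≈ fun x B.+ fun y

  homo-0 : fun A.0# B.≈ B.0#
  homo-0 = B.+-cancelˡ (fun A.0#) _ _
    (B.trans (B.sym (homo _ _)) (B.trans (cong (A.+-identityˡ _)) (B.sym (B.+-identityʳ _))))

  homo-neg : ∀ x → fun (A.- x) B.≈ B.- fun x
  homo-neg x = B.neg-unique _ _ (B.trans (B.sym (homo _ _)) (B.trans (cong (A.-‿inverseʳ x)) homo-0))

  homo-- : ∀ x y → fun (x A.- y) B.≈ fun x B.- fun y
  homo-- x y = B.trans (homo _ _) (B.+-congˡ (homo-neg y))

  homo-· : ∀ n x → fun (n A.· x) B.≈ n B.· fun x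
  homo-· zero x = homo-0
  homo-· (suc n) x = B.trans (homo _ _) (B.+-congˡ (homo-· n x))

record Iso (A B : AbelianGroup 0ℓ 0ℓ) : Set where
  private
    module A = Additive A
    module B = Additive B
  field hom : Hom A B
  open Hom hom public
  field
    inj  : ∀ x y → fun x B.≈ fun y → x A.≈ y
    surj : ∀ y → ∃ λ x → fun x B.≈ y

module _ (A : AbelianGroup 0ℓ 0ℓ) (_≟_ : ∀ x y → Dec (AbelianGroup._≈_ A x y)) where
  open Additive A

  -- A list without repetitions up to equality, as the pigeonhole arguments on p-torsion have to
  -- count elements.
  record Distinct {N} (g : Fin N → Carrier) (P : Carrier → Set) : Set where
    field
      k     : ℕ
      α     : Fin k → Carrier
      α-P   : ∀ i → P (α i)
      α-inj : ∀ i j → α i ≈ α j → i ≡ j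
      α-surj : ∀ i → P (g i) → ∃ λ j → α j ≈ g i

  distinct : ∀ {N} (g : Fin N → Carrier) {P : Carrier → Set} → (∀ x → Dec (P x)) → Distinct g P
  distinct {zero} g P? = record { k = 0 ; α = λ () ; α-P = λ () ; α-inj = λ () ; α-surj = λ () }
  distinct {suc N} g {P} P? with distinct (g ∘ Fin.suc) P?
  ... | D with P? (g Fin.zero) | Fin.any? (λ j → Distinct.α D j ≟ g Fin.zero)
  ...   | no ¬p | _ = record { Distinct D ; α-surj = λ { Fin.zero p → ⊥-elim (¬p p) ; (Fin.suc i) p → Distinct.α-surj D i p } }
  ...   | yes p | yes e = record { Distinct D ; α-surj = λ { Fin.zero p → e ; (Fin.suc i) p → Distinct.α-surj D i p } }
  ...   | yes p | no ¬e = record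
    { k = suc (Distinct.k D)
    ; α = α′
    ; α-P = λ { Fin.zero → p ; (Fin.suc i) → Distinct.α-P D i }
    ; α-inj = α′-inj
    ; α-surj = λ { Fin.zero _ → Fin.zero , refl ; (Fin.suc i) p → Fin.suc (proj₁ (Distinct.α-surj D i p)) , proj₂ (Distinct.α-surj D i p) }
    }
    where
    α′ : Fin (suc (Distinct.k D)) → Carrier
    α′ Fin.zero = g Fin.zero
    α′ (Fin.suc i) = Distinct.α D i
    α′-inj : ∀ i j → α′ i ≈ α′ j → i ≡ j
    α′-inj Fin.zero Fin.zero e = ≡.refl
    α′-inj Fin.zero (Fin.suc j) e = ⊥-elim (¬e (j , sym e))
    α′-inj (Fin.suc i) Fin.zero e = ⊥-elim (¬e (i , e))
    α′-inj (Fin.suc i) (Fin.suc j) e = ≡.cong Fin.suc (Distinct.α-inj D i j e)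

-- A ≅ B follows from pA ≅ pB (here: images of β and γ) and a bijection A[p] ↔ B[p].
-- The isomorphism pA ≅ pB is extended to an injection by adjoining one element a
-- at a time; if no p-th part of φ(pa) were available outside the image so far, then
-- A[p] would inject into A[p] ∖ {0}.
module Lift
  (A B G H : AbelianGroup 0ℓ 0ℓ) {p : ℕ} (p-prime : Prime p)
  (finA : IsFinite A) (_≟B_ : ∀ x y → Dec (AbelianGroup._≈_ B x y))
  (β : Hom A G) (γ : Hom B H) (f : Iso G H)
  where

  private
    module A = Additive A
    module B = Additive B
    module G = Additive G
    module H = Additive H
    module β = Hom β
    module γ = Hom γ
    module f = Iso f

  module _
    (β-surj : ∀ y → ∃ λ x → β.fun x G.≈ y)
    (β-ker  : ∀ x → β.fun x G.≈ G.0# → p A.· x A.≈ A.0#)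
    (β-ker⁻ : ∀ x → p A.· x A.≈ A.0# → β.fun x G.≈ G.0#)
    (γ-surj : ∀ y → ∃ λ x → γ.fun x H.≈ y)
    (γ-ker  : ∀ x → γ.fun x H.≈ H.0# → p B.· x B.≈ B.0#)
    (γ-ker⁻ : ∀ x → p B.· x B.≈ B.0# → γ.fun x H.≈ H.0#)
    -- `τ` and `τ′` are injections of sets in the two directions. They need not be homomorphisms and
    -- may depend on the torsion proof, because only cardinalities are compared.
    (τ : ∀ a → p A.· a A.≈ A.0# → B.Carrier)
    (τ-tors : ∀ a pa → p B.· τ a pa B.≈ B.0#)
    (τ-refl : ∀ a pa a′ pa′ → τ a pa B.≈ τ a′ pa′ → a A.≈ a′)
    (τ′ : ∀ b → p B.· b B.≈ B.0# → A.Carrier)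
    (τ′-tors : ∀ b pb → p A.· τ′ b pb A.≈ A.0#)
    (τ′-refl : ∀ b pb b′ pb′ → τ′ b pb A.≈ τ′ b′ pb′ → b B.≈ b′)
    where

    open IsFinite finA renaming (size to N)
    open Extension A B

    instance _ = prime⇒nonZero p-prime

    -- An arbitrary lift of `f` ∘ `β` through `γ`. It is not additive, but it is determined up to
    -- the kernel of `γ`, which is B[p]; so p · ψ is a homomorphism, and its value at a depends on p
    -- a alone.
    ψ : A.Carrier → B.Carrier
    ψ a = proj₁ (γ-surj (f.fun (β.fun a)))

    γψ : ∀ a → γ.fun (ψ a) H.≈ f.fun (β.fun a)
    γψ a = proj₂ (γ-surj (f.fun (β.fun a)))

    p·-γ : ∀ x y → γ.fun x H.≈ γ.fun y → p B.· x B.≈ p B.· y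
    p·-γ x y e = B.x-y≈0⇒x≈y _ _ (B.trans (B.+-congˡ (B.sym (B.·-neg p y))) (B.trans (B.sym (B.×-distrib-+ x (B.- y) p))
      (γ-ker _ (H.trans (γ.homo-- x y) (H.x≈y⇒x-y≈0 e)))))

    β-p· : ∀ x y → p A.· x A.≈ p A.· y → β.fun x G.≈ β.fun y
    β-p· x y e = G.x-y≈0⇒x≈y _ _ (G.trans (G.sym (β.homo-- x y)) (β-ker⁻ _ (A.trans (A.×-distrib-+ x (A.- y) p)
      (A.trans (A.+-congˡ (A.·-neg p y)) (A.x≈y⇒x-y≈0 e)))))

    ψ-resp : ∀ x y → p A.· x A.≈ p A.· y → p B.· ψ x B.≈ p B.· ψ y
    ψ-resp x y e = p·-γ _ _ (H.trans (γψ x) (H.trans (f.cong (β-p· x y e)) (H.sym (γψ y))))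

    ψ-+ : ∀ x y → p B.· ψ (x A.+ y) B.≈ p B.· ψ x B.+ p B.· ψ y
    ψ-+ x y = B.trans (p·-γ _ _ (H.trans (γψ _) (H.trans (f.cong (β.homo x y)) (H.trans (f.homo _ _)
      (H.trans (H.+-cong (H.sym (γψ x)) (H.sym (γψ y))) (H.sym (γ.homo _ _))))))) (B.×-distrib-+ _ _ p)

    ψ-inj : ∀ x → p B.· ψ x B.≈ B.0# → p A.· x A.≈ A.0#
    ψ-inj x e = β-ker x (f.inj _ _ (H.trans (H.sym (γψ x)) (H.trans (γ-ker⁻ _ e) (H.sym f.homo-0))))

    -- `p·-mem` forces every order modulo the domain to divide p, and `φ-p·` pins φ on pA to the
    -- given isomorphism of pA with pB.
    record Inv (h : PartialHom) : Set where
      open PartialHom h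
      field
        p·-mem : ∀ y → Mem (p A.· y)
        φ-p·   : ∀ y → φ (p A.· y) B.≈ p B.· ψ y
        φ-inj  : ∀ x → Mem x → φ x B.≈ B.0# → x A.≈ A.0#

    Mem₀ : A.Carrier → Set
    Mem₀ x = ∃ λ i → p A.· enum i A.≈ x

    mem₀? : ∀ x → Dec (Mem₀ x)
    mem₀? x = Fin.any? (λ i → _ ≟ _)

    p·-mem₀ : ∀ {x} y → p A.· y A.≈ x → Mem₀ x
    p·-mem₀ y e with enum-surj y
    ... | i , ei = i , A.trans (A.×-congʳ p ei) e

    φ₀ : A.Carrier → B.Carrier
    φ₀ x with mem₀? x
    ... | yes (i , _) = p B.· ψ (enum i)
    ... | no _ = B.0#

    φ₀-p· : ∀ {x} y → p A.· y A.≈ x → φ₀ x B.≈ p B.· ψ y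
    φ₀-p· {x} y e with mem₀? x
    ... | yes (i , ei) = ψ-resp _ _ (A.trans ei (A.sym e))
    ... | no ¬m = ⊥-elim (¬m (p·-mem₀ y e))

    h₀ : PartialHom
    h₀ = record
      { dom = record
        { Mem = Mem₀ ; mem? = mem₀?
        ; resp = λ { e (i , ei) → i , A.trans ei e }
        ; mem-0 = p·-mem₀ A.0# (A.·-zeroʳ p)
        ; mem-+ = λ { (i , ei) (j , ej) → p·-mem₀ (enum i A.+ enum j) (A.trans (A.×-distrib-+ _ _ p) (A.+-cong ei ej)) }
        ; mem-neg = λ { (i , ei) → p·-mem₀ (A.- enum i) (A.trans (A.·-neg p _) (A.-‿cong ei)) }
        }
      ; φ = φ₀
      ; φ-cong = λ { (i , ei) e → B.trans (φ₀-p· _ ei) (B.sym (φ₀-p· _ (A.trans ei e))) }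
      ; φ-+ = λ { (i , ei) (j , ej) → B.trans (φ₀-p· (enum i A.+ enum j) (A.trans (A.×-distrib-+ _ _ p) (A.+-cong ei ej)))
                  (B.trans (ψ-+ _ _) (B.+-cong (B.sym (φ₀-p· _ ei)) (B.sym (φ₀-p· _ ej)))) }
      }

    inv₀ : Inv h₀
    inv₀ = record
      { p·-mem = λ y → p·-mem₀ y A.refl
      ; φ-p· = λ y → φ₀-p· y A.refl
      ; φ-inj = λ { x (i , ei) e → A.trans (A.sym ei) (ψ-inj (enum i) (B.trans (B.sym (φ₀-p· _ ei)) e)) }
      }

    tors? : ∀ a → Dec (p A.· a A.≈ A.0#)
    tors? a = _ ≟ _

    open Distinct (distinct A _≟_ enum tors?)

    index : ∀ a → p A.· a A.≈ A.0# → ∃ λ j → α j A.≈ a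
    index a pa with enum-surj a
    ... | i , ei with α-surj i (A.trans (A.×-congʳ p ei) pa)
    ...   | j , ej = j , A.trans ej ei

    index-inj : ∀ a pa a′ pa′ → proj₁ (index a pa) ≡ proj₁ (index a′ pa′) → a A.≈ a′
    index-inj a pa a′ pa′ e = A.trans (A.sym (proj₂ (index a pa)))
      (A.trans (A.reflexive (≡.cong α e)) (proj₂ (index a′ pa′)))

    module Step (h : PartialHom) (inv : Inv h) (a : A.Carrier) where
      open PartialHom h
      open Inv inv

      Im : B.Carrier → Set
      Im z = ∃ λ i → Mem (enum i) × φ (enum i) B.≈ z

      im? : ∀ z → Dec (Im z)
      im? z = Fin.any? (λ i → mem? _ ×-dec (_ ≟B _))

      to-Im : ∀ {z} x → Mem x → φ x B.≈ z → Im z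
      to-Im x m e with enum-surj x
      ... | i , ei = i , resp (A.sym ei) m , B.trans (φ-cong (resp (A.sym ei) m) ei) e

      Im-- : ∀ {y z} → Im y → Im z → Im (y B.- z)
      Im-- (i , m , e) (j , m′ , e′) = to-Im _ (mem-- m m′) (B.trans (φ-- m m′) (B.sub-cong e e′))

      Im-· : ∀ n {y} → Im y → Im (n B.· y)
      Im-· n (i , m , e) = to-Im _ (mem-· n m) (B.trans (φ-· n m) (B.×-congʳ n e))

      Im-resp : ∀ {y z} → y B.≈ z → Im y → Im z
      Im-resp e (i , m , e′) = i , m , B.trans e′ e

      φ-injective : ∀ {x y} → Mem x → Mem y → φ x B.≈ φ y → x A.≈ y
      φ-injective m m′ e = A.x-y≈0⇒x≈y _ _ (φ-inj _ (mem-- m m′) (B.trans (φ-- m m′) (B.x≈y⇒x-y≈0 e)))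

      Result : Set₁
      Result = ∃ λ h′ → Inv h′ × (h′ Extends h) × PartialHom.Mem h′ a

      -- A vanishing value φ(x - t a) + t b puts t b into the image, so injectivity survives as soon
      -- as no t b with 0 < t < r lies there.
      extend : ∀ {r} → Least (λ t → Mem (t A.· a)) r → ∀ b → r B.· b B.≈ φ (r A.· a) →
               (∀ (t : Fin r) → NonZero (toℕ t) → ¬ Im (toℕ t B.· b)) → Result
      extend {r} lr b rb avoid = E.extended , inv′ , E.extends , E.a∈
        where
        module E = OneStep h a lr b rb
        open _Extends_ E.extends
        zero-case : ∀ x (t : Fin r) → Mem (x A.- toℕ t A.· a) → E.value x (toℕ t) B.≈ B.0# → x A.≈ A.0#
        zero-case x t m e with toℕ t in eq
        ... | zero = A.trans (E.x-0a x) (φ-inj _ m (B.trans (B.sym (B.+-identityʳ _)) e))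
        ... | suc s = ⊥-elim (avoid t (≡.subst NonZero (≡.sym eq) _)
                       (to-Im _ (mem-neg m) (B.trans (φ-neg m) (B.sym (B.trans (B.×-congˡ eq) (B.neg-unique _ _ e))))))
        inv′ : Inv E.extended
        inv′ = record
          { p·-mem = λ y → mem-ext (p·-mem y)
          ; φ-p· = λ y → B.trans (φ-ext (p·-mem y)) (φ-p· y)
          ; φ-inj = λ { x (t , m) e → zero-case x t m (B.trans (B.sym (E.φ′-value x (toℕ t) m)) e) }
          }

      -- One p-th part of φ(p a) for every p-torsion element of A, obtained by moving `ψ a` along
      -- `τ`.
      candidate : Fin k → B.Carrier
      candidate i = ψ a B.+ τ (α i) (α-P i)

      p·candidate : ∀ i → p B.· candidate i B.≈ φ (p A.· a)
      p·candidate i = B.trans (B.×-distrib-+ _ _ p) (B.trans (B.+-congˡ (τ-tors _ _)) (B.trans (B.+-identityʳ _) (B.sym (φ-p· a))))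

      some-free : ¬ Mem a → ∃ λ i → ¬ Im (candidate i)
      some-free a∉ with Fin.any? (λ i → ¬? (im? (candidate i)))
      ... | yes r = r
      ... | no none = ⊥-elim impossible
        where
        hit : ∀ i → Im (candidate i)
        hit i = decidable-stable (im? _) (λ ¬h → none (i , ¬h))
        d : Fin k → A.Carrier
        d i = enum (proj₁ (hit i)) A.- a
        d-tors : ∀ i → p A.· d i A.≈ A.0#
        d-tors i with hit i
        ... | j , m , e = A.trans (A.×-distrib-+ _ _ p) (A.trans (A.+-congˡ (A.·-neg p a)) (A.x≈y⇒x-y≈0
                (φ-injective (mem-· p m) (p·-mem a) (B.trans (φ-· p m) (B.trans (B.×-congʳ p e) (p·candidate i))))))
        d≉0 : ∀ i → ¬ (d i A.≈ A.0#)
        d≉0 i e with hit i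
        ... | j , m , _ = a∉ (resp (A.x-y≈0⇒x≈y _ _ e) m)
        d-inj : ∀ i j → d i A.≈ d j → i ≡ j
        d-inj i j e with hit i | hit j
        ... | i′ , m , ei | j′ , m′ , ej = α-inj i j (τ-refl _ _ _ _ (B.+-cancelˡ (ψ a) _ _
                (B.trans (B.sym ei) (B.trans (φ-cong m (A.+-cancelʳ _ _ _ e)) ej))))
        F : Fin (suc k) → Fin k
        F Fin.zero = proj₁ (index A.0# (A.·-zeroʳ p))
        F (Fin.suc i) = proj₁ (index (d i) (d-tors i))
        impossible : ⊥
        impossible with Fin.pigeonhole (ℕ.n<1+n k) F
        ... | Fin.zero , Fin.zero , () , _
        ... | Fin.zero , Fin.suc j , _ , e = d≉0 j (A.sym (index-inj _ _ _ _ e))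
        ... | Fin.suc i , Fin.suc j , i<j , e = ℕ.<-irrefl (≡.cong (toℕ ∘ Fin.suc) (d-inj i j (index-inj _ _ _ _ e))) i<j

      -- Bézout for p and t: the image contains p b, so together with t b it would contain b.
      free-multiples : ∀ b → p B.· b B.≈ φ (p A.· a) → ¬ Im b → ∀ (t : Fin p) → NonZero (toℕ t) → ¬ Im (toℕ t B.· b)
      free-multiples b pb b∉ t nz tb = b∉ (bezout (coprime-Bézout (prime⇒coprime p-prime {{nz}} (Fin.toℕ<n t))))
        where
        pb∈ : Im (p B.· b)
        pb∈ = to-Im _ (p·-mem a) (B.sym pb)
        solve : ∀ {u v} → 1 ℕ.+ u ≡ v → v B.· b B.- u B.· b B.≈ b
        solve {u} e = B.trans (B.+-congʳ (B.×-congˡ (≡.sym e))) (B.x+y-y b (u B.· b))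
        bezout : ℕ.Bézout.Identity.Identity 1 p (toℕ t) → Im b
        bezout (ℕ.Bézout.Identity.+- x y e) = Im-resp (B.trans (B.sub-cong (B.×-assocˡ b x p) (B.×-assocˡ b y (toℕ t))) (solve e)) (Im-- (Im-· x pb∈) (Im-· y tb))
        bezout (ℕ.Bézout.Identity.-+ x y e) = Im-resp (B.trans (B.sub-cong (B.×-assocˡ b y (toℕ t)) (B.×-assocˡ b x p)) (solve e)) (Im-- (Im-· y tb) (Im-· x pb∈))

      step : Result
      step with mem? a
      ... | yes a∈ = h , inv , ext-refl , a∈
      ... | no a∉ with least? (λ t → Mem (t A.· a)) (λ t → mem? _) p (p·-mem a)
      ...   | r , lr , _ with prime⇒irreducible p-prime (order-divides A dom lr p (p·-mem a))
      ...     | inj₁ ≡.refl = ⊥-elim (a∉ (resp (A.×-homo-1 a) (Least.holds lr)))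
      ...     | inj₂ ≡.refl with some-free a∉
      ...       | i , free = extend lr (candidate i) (p·candidate i) (free-multiples _ (p·candidate i) free)

    iso : Iso A B
    iso with extend-all enum enum-surj Inv Step.step h₀ inv₀
    ... | h , inv , _ , total = record
      { hom = record { fun = φ ; cong = φ-cong (total _) ; homo = λ x y → φ-+ (total x) (total y) }
      ; inj = λ x y e → Step.φ-injective h inv x (total x) (total y) e
      ; surj = onto
      }
      where
      open PartialHom h
      open Inv inv
      φ-tors : ∀ i → p B.· φ (α i) B.≈ B.0#
      φ-tors i = B.trans (B.sym (φ-· p (total _))) (B.trans (φ-cong (total _) (α-P i)) φ-0)
      -- φ embeds A[p] into B[p] and `τ′` embeds B[p] into A[p]; a y that is missed would give one
      -- element of A[p] too many.
      tors-onto : ∀ y → p B.· y B.≈ B.0# → ∃ λ i → φ (α i) B.≈ y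
      tors-onto y py with Fin.any? (λ i → φ (α i) ≟B y)
      ... | yes r = r
      ... | no none = ⊥-elim impossible
        where
        F : Fin (suc k) → Fin k
        F Fin.zero = proj₁ (index (τ′ y py) (τ′-tors _ _))
        F (Fin.suc i) = proj₁ (index (τ′ (φ (α i)) (φ-tors i)) (τ′-tors _ _))
        impossible : ⊥
        impossible with Fin.pigeonhole (ℕ.n<1+n k) F
        ... | Fin.zero , Fin.zero , () , _
        ... | Fin.zero , Fin.suc j , _ , e = none (j , B.sym (τ′-refl _ _ _ _ (index-inj _ _ _ _ e)))
        ... | Fin.suc i , Fin.suc j , i<j , e = ℕ.<-irrefl (≡.cong (toℕ ∘ Fin.suc)
                (α-inj i j (Step.φ-injective h inv A.0# (total _) (total _) (τ′-refl _ _ _ _ (index-inj _ _ _ _ e))))) i<j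
      -- With a chosen so that `f` carries β(a) to γ(y), φ(a) and y agree after multiplication by p;
      -- they differ by p-torsion, which `tors-onto` reaches.
      onto : ∀ y → ∃ λ x → φ x B.≈ y
      onto y with f.surj (γ.fun y)
      ... | g , fg with β-surj g
      ...   | a , βa = a A.+ α (proj₁ t) , B.trans (φ-+ (total _) (total _)) (B.trans (B.+-congˡ (proj₂ t))
                         (B.trans (B.+-comm _ _) (B.x-y+y y (φ a))))
        where
        γφ : p B.· y B.≈ p B.· φ a
        γφ = B.trans (p·-γ y (ψ a) (H.trans (H.sym fg) (H.trans (f.cong (G.sym βa)) (H.sym (γψ a)))))
               (B.trans (B.sym (φ-p· a)) (φ-· p (total a)))
        t = tors-onto (y B.- φ a) (B.trans (B.×-distrib-+ _ _ p) (B.trans (B.+-congˡ (B.·-neg p _)) (B.x≈y⇒x-y≈0 γφ)))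

-- Characters with values in a cyclic group and perfect pairings

count : ∀ {k} {P : Fin k → Set} → (∀ i → Dec (P i)) → ℕ
count {zero} P? = 0
count {suc k} P? with P? Fin.zero
... | yes _ = suc (count (P? ∘ Fin.suc))
... | no _ = count (P? ∘ Fin.suc)

count-≤ : ∀ {k} {P Q : Fin k → Set} (P? : ∀ i → Dec (P i)) (Q? : ∀ i → Dec (Q i)) → (∀ i → P i → Q i) → count P? ℕ.≤ count Q?
count-≤ {zero} P? Q? P⊆Q = z≤n
count-≤ {suc k} P? Q? P⊆Q with P? Fin.zero | Q? Fin.zero
... | yes _ | yes _ = s≤s (count-≤ (P? ∘ Fin.suc) (Q? ∘ Fin.suc) (P⊆Q ∘ Fin.suc))
... | yes p | no ¬q = ⊥-elim (¬q (P⊆Q _ p))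
... | no _  | yes _ = ℕ.m≤n⇒m≤1+n (count-≤ (P? ∘ Fin.suc) (Q? ∘ Fin.suc) (P⊆Q ∘ Fin.suc))
... | no _  | no _  = count-≤ (P? ∘ Fin.suc) (Q? ∘ Fin.suc) (P⊆Q ∘ Fin.suc)

count-< : ∀ {k} {P Q : Fin k → Set} (P? : ∀ i → Dec (P i)) (Q? : ∀ i → Dec (Q i)) → (∀ i → P i → Q i) →
          ∀ i → Q i → ¬ P i → count P? ℕ.< count Q?
count-< {suc k} P? Q? P⊆Q Fin.zero q ¬p with P? Fin.zero | Q? Fin.zero
... | yes p | _     = ⊥-elim (¬p p)
... | no _  | no ¬q = ⊥-elim (¬q q)
... | no _  | yes _ = s≤s (count-≤ (P? ∘ Fin.suc) (Q? ∘ Fin.suc) (P⊆Q ∘ Fin.suc))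
count-< {suc k} P? Q? P⊆Q (Fin.suc i) q ¬p with P? Fin.zero | Q? Fin.zero
... | yes _ | yes _ = s≤s (count-< (P? ∘ Fin.suc) (Q? ∘ Fin.suc) (P⊆Q ∘ Fin.suc) i q ¬p)
... | yes p | no ¬q = ⊥-elim (¬q (P⊆Q _ p))
... | no _  | yes _ = ℕ.m≤n⇒m≤1+n (count-< (P? ∘ Fin.suc) (Q? ∘ Fin.suc) (P⊆Q ∘ Fin.suc) i q ¬p)
... | no _  | no _  = count-< (P? ∘ Fin.suc) (Q? ∘ Fin.suc) (P⊆Q ∘ Fin.suc) i q ¬p

argmax : ∀ {k} {P : Fin k → Set} (P? : ∀ i → Dec (P i)) (f : Fin k → ℕ) → ∃ P →
         ∃ λ i → P i × (∀ j → P j → f j ℕ.≤ f i)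
argmax {suc k} {P} P? f e with Fin.any? (P? ∘ Fin.suc) | P? Fin.zero
... | no none | no ¬p = ⊥-elim (lem e)
  where
  lem : ¬ ∃ P
  lem (Fin.zero , p) = ¬p p
  lem (Fin.suc i , p) = none (i , p)
... | no none | yes p = Fin.zero , p , λ { Fin.zero _ → ℕ.≤-refl ; (Fin.suc j) q → ⊥-elim (none (j , q)) }
... | yes e′ | p? with argmax (P? ∘ Fin.suc) (f ∘ Fin.suc) e′
...   | i , pi , m with p? | ℕ.≤-total (f Fin.zero) (f (Fin.suc i))
...     | no ¬p | _ = Fin.suc i , pi , λ { Fin.zero p → ⊥-elim (¬p p) ; (Fin.suc j) q → m j q }
...     | yes p | inj₁ le = Fin.suc i , pi , λ { Fin.zero _ → le ; (Fin.suc j) q → m j q }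
...     | yes p | inj₂ le = Fin.zero , p , λ { Fin.zero _ → ℕ.≤-refl ; (Fin.suc j) q → ℕ.≤-trans (m j q) le }

record IsCyclic (M : AbelianGroup 0ℓ 0ℓ) (Q : ℕ) : Set where
  open Additive M
  field
    z    : Carrier
    log  : ∀ y → ∃ λ i → i · z ≈ y
    ord  : ∀ i → i · z ≈ 0# → Q ∣ i
    kill : Q · z ≈ 0#

-- Duality with values in a cyclic group M of order Q annihilating A: characters of
-- subgroups extend, and every subgroup H carries a perfect pairing H × H → M.
module Duality
  (A M : AbelianGroup 0ℓ 0ℓ) (finA : IsFinite A) (Q : ℕ) .{{_ : NonZero Q}} (cyc : IsCyclic M Q)
  (Q· : ∀ x → AbelianGroup._≈_ A (Additive._·_ A Q x) (Additive.0# A))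
  where

  private
    module A = Additive A
    module M = Additive M

  open IsFinite finA renaming (size to N)
  open IsCyclic cyc
  open Extension A M

  -- Adjoining `a` of relative order r requires an r-th part of φ(r a) = t z. With Q = s r one has s
  -- t z = φ(Q a) = 0, so Q divides s t and r divides t.
  extend-character : ∀ h → ∃ λ h′ → (h′ Extends h) × (∀ x → PartialHom.Mem h′ x)
  extend-character h = let h′ , _ , e , t = extend-all enum enum-surj (λ _ → ⊤) step h tt in h′ , e , t
    where
    step : ∀ h → ⊤ → ∀ a → ∃ λ h′ → ⊤ × (h′ Extends h) × PartialHom.Mem h′ a
    step h _ a with least? (λ t → PartialHom.Mem h (t A.· a)) (λ t → PartialHom.mem? h _) Q
                      (PartialHom.resp h (A.sym (Q· a)) (PartialHom.mem-0 h))
    ... | r , lr , _ with order-divides A (PartialHom.dom h) lr Q (PartialHom.resp h (A.sym (Q· a)) (PartialHom.mem-0 h))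
                        | log (PartialHom.φ h (r A.· a))
    ...   | divides s Q≡sr | t , tz = E.extended , tt , E.extends , E.a∈
      where
      open PartialHom h
      ra = Least.holds lr
      r∣t : r ∣ t
      r∣t = ℕ.*-cancelˡ-∣ s {{ℕ.m*n≢0⇒m≢0 s {{≡.subst NonZero Q≡sr (ℕ.≢-nonZero (ℕ.≢-nonZero⁻¹ Q))}}}}
              (≡.subst (_∣ s ℕ.* t) Q≡sr (ord _ (begin
        (s ℕ.* t) M.· z       ≈⟨ M.sym (M.×-assocˡ z s t) ⟩
        s M.· t M.· z         ≈⟨ M.×-congʳ s tz ⟩
        s M.· φ (r A.· a)     ≈⟨ M.sym (φ-· s ra) ⟩
        φ (s A.· r A.· a)     ≈⟨ φ-cong (mem-· s ra) (A.trans (A.×-assocˡ a s r) (A.trans (A.×-congˡ (≡.sym Q≡sr)) (Q· a))) ⟩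
        φ A.0#                ≈⟨ φ-0 ⟩
        M.0#                  ∎)))
        where open M using (begin_; step-≈-⟩; _∎)
      module E = OneStep h a lr (ℕ.quotient r∣t M.· z) (M.trans (M.×-assocˡ z r _)
        (M.trans (M.×-congˡ (≡.sym (ℕ.m∣n⇒n≡m*quotient r∣t))) tz))

  -- Nondegeneracy and completeness together say that x ↦ ⟨ x , _ ⟩ is an isomorphism of H with its
  -- group of characters.
  record Pairing (H : Subgroup A) : Set₁ where
    open Subgroup H
    field
      ⟨_,_⟩  : A.Carrier → A.Carrier → M.Carrier
      ⟨⟩-cong : ∀ {x x′ y y′} → Mem x → Mem y → x A.≈ x′ → y A.≈ y′ → ⟨ x , y ⟩ M.≈ ⟨ x′ , y′ ⟩
      ⟨⟩-+ˡ  : ∀ {x x′ y} → Mem x → Mem x′ → Mem y → ⟨ x A.+ x′ , y ⟩ M.≈ ⟨ x , y ⟩ M.+ ⟨ x′ , y ⟩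
      ⟨⟩-+ʳ  : ∀ {x y y′} → Mem x → Mem y → Mem y′ → ⟨ x , y A.+ y′ ⟩ M.≈ ⟨ x , y ⟩ M.+ ⟨ x , y′ ⟩
      nondegenerate : ∀ {x} → Mem x → (∀ {y} → Mem y → ⟨ x , y ⟩ M.≈ M.0#) → x A.≈ A.0#
      complete : ∀ (θ : PartialHom) → (∀ {x} → Mem x → PartialHom.Mem θ x) →
                 ∃ λ x → Mem x × (∀ {y} → Mem y → PartialHom.φ θ y M.≈ ⟨ x , y ⟩)

    ⟨⟩-0ʳ : ∀ {x} → Mem x → ⟨ x , A.0# ⟩ M.≈ M.0#
    ⟨⟩-0ʳ mx = M.+-cancelˡ _ _ _ (M.trans (M.sym (⟨⟩-+ʳ mx mem-0 mem-0)) (M.trans (⟨⟩-cong mx (mem-+ mem-0 mem-0) A.refl (A.+-identityˡ _)) (M.sym (M.+-identityʳ _))))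

  order : ∀ x → ∃ λ r → Least (λ t → t A.· x A.≈ A.0#) r × r ℕ.≤ Q
  order x = least? (λ t → t A.· x A.≈ A.0#) (λ t → _ ≟ _) Q (Q· x)

  trivial : Subgroup A
  trivial = record
    { Mem = λ x → x A.≈ A.0# ; mem? = _≟ A.0# ; resp = λ e f → A.trans (A.sym e) f
    ; mem-0 = A.refl ; mem-+ = λ e f → A.trans (A.+-cong e f) (A.+-identityˡ _)
    ; mem-neg = λ e → A.trans (A.-‿cong e) A.-0≈0 }

  zero-hom : PartialHom
  zero-hom = record { dom = trivial ; φ = λ _ → M.0# ; φ-cong = λ _ _ → M.refl ; φ-+ = λ _ _ → M.sym (M.+-identityˡ _) }

  -- Splitting off a cyclic summand ⟨a⟩ of maximal order m: a character χ with χ(a) = g z,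
  -- g = Q / m, takes all its values in ⟨g z⟩, so H = ⟨a⟩ ⊕ (H ∩ ker χ).
  module Split (H : Subgroup A) (a : A.Carrier) (a∈ : Subgroup.Mem H a)
    {m : ℕ} (lm : Least (λ t → t A.· a A.≈ A.0#) m)
    (maximal : ∀ x → Subgroup.Mem H x → ∃ λ r → Least (λ t → t A.· x A.≈ A.0#) r × r ℕ.≤ m)
    (g : ℕ) (Q≡gm : Q ≡ g ℕ.* m)
    (χ-hom : PartialHom) (total : ∀ x → PartialHom.Mem χ-hom x)
    (χa : PartialHom.φ χ-hom a M.≈ g M.· z) where

    open Subgroup H

    instance
      g≢0 : NonZero g
      g≢0 = ℕ.m*n≢0⇒m≢0 g {{≡.subst NonZero Q≡gm (ℕ.≢-nonZero (ℕ.≢-nonZero⁻¹ Q))}}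
      m≢0 : NonZero m
      m≢0 = Least.pos lm

    w : M.Carrier
    w = g M.· z

    open PartialHom χ-hom using () renaming (φ to χ; φ-0 to χ-0)

    χ-cong : ∀ {x y} → x A.≈ y → χ x M.≈ χ y
    χ-cong = PartialHom.φ-cong χ-hom (total _)
    χ-+ : ∀ x y → χ (x A.+ y) M.≈ χ x M.+ χ y
    χ-+ x y = PartialHom.φ-+ χ-hom (total x) (total y)
    χ-- : ∀ x y → χ (x A.- y) M.≈ χ x M.- χ y
    χ-- x y = PartialHom.φ-- χ-hom (total x) (total y)
    χ-· : ∀ n x → χ (n A.· x) M.≈ n M.· χ x
    χ-· n x = PartialHom.φ-· χ-hom n (total x)

    -- Here the maximality of m enters: x has order r ≤ m, and r d z = 0 gives g m = Q ≤ r d ≤ m d.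
    no-small-value : ∀ x d → Mem x → d ∣ g → χ x M.≈ d M.· z → d ≡ g
    no-small-value x d x∈ d∣g e with maximal x x∈
    ... | r , lr , r≤m = ℕ.≤-antisym (ℕ.∣⇒≤ d∣g) (ℕ.*-cancelʳ-≤ g d m (begin
        g ℕ.* m ≡⟨ ≡.sym Q≡gm ⟩
        Q       ≤⟨ ℕ.∣⇒≤ {{ℕ.m*n≢0 r d}} (ord _ (M.trans (M.sym (M.×-assocˡ z r d)) (M.trans (M.×-congʳ r (M.sym e))
                     (M.trans (M.sym (χ-· r x)) (M.trans (χ-cong (Least.holds lr)) χ-0))))) ⟩
        r ℕ.* d ≤⟨ ℕ.*-monoˡ-≤ d r≤m ⟩
        m ℕ.* d ≡⟨ ℕ.*-comm m d ⟩
        d ℕ.* m ∎))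
      where
      open ℕ.≤-Reasoning
      instance _ = Least.pos lr
      instance
        d≢0 : NonZero d
        d≢0 = ℕ.m*n≢0⇒n≢0 (ℕ.quotient d∣g) {{≡.subst NonZero (ℕ.m∣n⇒n≡quotient*m d∣g) g≢0}}

    -- With χ(x) = t z, a Bézout combination of x and `a` has the value gcd(t,g) z; `no-small-value`
    -- turns this gcd into g.
    g∣log : ∀ x → Mem x → g ∣ proj₁ (log (χ x))
    g∣log x x∈ with log (χ x)
    ... | t , tz = ≡.subst (_∣ t) (gcd≡g (ℕ.Bézout.identity (ℕ.gcd-GCD t g))) (ℕ.gcd[m,n]∣m t g)
      where
      d = gcd t g
      χ· : ∀ α → χ (α A.· x) M.≈ (α ℕ.* t) M.· z
      χ· α = M.trans (χ-· α x) (M.trans (M.×-congʳ α (M.sym tz)) (M.×-assocˡ z α t))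
      χ·a : ∀ β → χ (β A.· a) M.≈ (β ℕ.* g) M.· z
      χ·a β = M.trans (χ-· β a) (M.trans (M.×-congʳ β χa) (M.×-assocˡ z β g))
      solve : ∀ {u v} → d ℕ.+ u ≡ v → v M.· z M.- u M.· z M.≈ d M.· z
      solve {u} e = M.trans (M.+-congʳ (M.trans (M.×-congˡ (≡.sym e)) (M.×-homo-+ z d u))) (M.x+y-y _ (u M.· z))
      gcd≡g : ℕ.Bézout.Identity.Identity d t g → d ≡ g
      gcd≡g (ℕ.Bézout.Identity.+- α β e) = no-small-value (α A.· x A.- β A.· a) d (mem-- (mem-· α x∈) (mem-· β a∈)) (ℕ.gcd[m,n]∣n t g)
        (M.trans (χ-- _ _) (M.trans (M.sub-cong (χ· α) (χ·a β)) (solve e)))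
      gcd≡g (ℕ.Bézout.Identity.-+ α β e) = no-small-value (β A.· a A.- α A.· x) d (mem-- (mem-· β a∈) (mem-· α x∈)) (ℕ.gcd[m,n]∣n t g)
        (M.trans (χ-- _ _) (M.trans (M.sub-cong (χ·a β) (χ· α)) (solve e)))

    coord : A.Carrier → ℕ
    coord x = proj₁ (log (χ x)) / g

    χ-coord : ∀ {x} → Mem x → χ x M.≈ coord x M.· w
    χ-coord {x} x∈ = M.trans (M.sym (proj₂ (log (χ x)))) (M.trans (M.×-congˡ (≡.sym (ℕ.m/n*n≡m (g∣log x x∈)))) (M.sym (M.×-assocˡ z (coord x) g)))

    -- A coordinate is determined only modulo m. Both `w` and `a` have order m, so multiples of `a`
    -- can be compared through multiples of `w`.
    w⇒a : ∀ {i j} → i M.· w M.≈ j M.· w → i A.· a A.≈ j A.· a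
    w⇒a {i} {j} e = A.·-≡∸ {i} {j} (half {i} {j} e) (half {j} {i} (M.sym e))
      where
      half : ∀ {i j} → i M.· w M.≈ j M.· w → (i ℕ.∸ j) A.· a A.≈ A.0#
      half {i} {j} e = A.·-multiple {m} {i ℕ.∸ j} {a} (Least.holds lm) (ℕ.*-cancelʳ-∣ g (≡.subst (_∣ (i ℕ.∸ j) ℕ.* g) (≡.trans Q≡gm (ℕ.*-comm g m))
        (ord _ (M.trans (M.sym (M.×-assocˡ z (i ℕ.∸ j) g)) (M.·-∸ {i} {j} e)))))

    H′ : Subgroup A
    H′ = record
      { Mem = λ x → Mem x × χ x M.≈ M.0#
      ; mem? = λ x → mem? x ×-dec χ0? x
      ; resp = λ { e (p , q) → resp e p , M.trans (M.sym (χ-cong e)) q }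
      ; mem-0 = mem-0 , χ-0
      ; mem-+ = λ { (p , q) (p′ , q′) → mem-+ p p′ , M.trans (χ-+ _ _) (M.trans (M.+-cong q q′) (M.+-identityˡ _)) }
      ; mem-neg = λ { {x} (p , q) → mem-neg p , M.trans (χ-cong (A.sym (A.+-identityˡ _))) (M.trans (χ-- _ _)
                    (M.trans (M.sub-cong χ-0 q) (M.-‿inverseʳ _))) }
      }
      where
      χ0? : ∀ x → Dec (χ x M.≈ M.0#)
      χ0? x with log (χ x)
      ... | t , tz with Q ℕ.∣? t
      ...   | yes d = yes (M.trans (M.sym tz) (M.·-multiple kill d))
      ...   | no ¬d = no (λ e → ¬d (ord t (M.trans tz e)))
    module H′ = Subgroup H′

    proj : A.Carrier → A.Carrier
    proj x = x A.- coord x A.· a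

    coord-w-+ : ∀ {x y} → Mem x → Mem y → coord (x A.+ y) M.· w M.≈ coord x M.· w M.+ coord y M.· w
    coord-w-+ p q = M.trans (M.sym (χ-coord (mem-+ p q))) (M.trans (χ-+ _ _) (M.+-cong (χ-coord p) (χ-coord q)))

    coord-w-cong : ∀ {x y} → Mem x → x A.≈ y → coord x M.· w M.≈ coord y M.· w
    coord-w-cong p e = M.trans (M.sym (χ-coord p)) (M.trans (χ-cong e) (χ-coord (resp e p)))

    proj∈ : ∀ {x} → Mem x → H′.Mem (proj x)
    proj∈ {x} p = mem-- p (mem-· (coord x) a∈) , M.trans (χ-- _ _) (M.x≈y⇒x-y≈0
      (M.trans (χ-coord p) (M.sym (M.trans (χ-· (coord x) a) (M.×-congʳ (coord x) χa)))))

    proj-cong : ∀ {x y} → Mem x → x A.≈ y → proj x A.≈ proj y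
    proj-cong {x} {y} p e = A.sub-cong e (w⇒a {coord x} {coord y} (coord-w-cong p e))

    proj-+ : ∀ {x y} → Mem x → Mem y → proj (x A.+ y) A.≈ proj x A.+ proj y
    proj-+ {x} {y} p q = A.trans (A.+-congˡ (A.-‿cong (A.trans
      (w⇒a {coord (x A.+ y)} {coord x ℕ.+ coord y} (M.trans (coord-w-+ p q) (M.sym (M.×-homo-+ w (coord x) _))))
      (A.×-homo-+ a (coord x) _)))) (A.+--interchange _ _ _ _)

    proj-a : proj a A.≈ A.0#
    proj-a = A.x≈y⇒x-y≈0 (A.trans (A.sym (A.×-homo-1 a)) (w⇒a {1} {coord a} (M.trans (M.×-homo-1 w) (M.trans (M.sym χa) (χ-coord a∈)))))

    coord-ker : ∀ {y} → H′.Mem y → coord y A.· a A.≈ A.0#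
    coord-ker {y} (p , q) = w⇒a {coord y} {0} (M.trans (M.sym (χ-coord p)) q)

    proj-ker : ∀ {y} → H′.Mem y → proj y A.≈ y
    proj-ker y∈ = A.trans (A.+-congˡ (A.-‿cong (coord-ker y∈))) (A.x-0≈x _)

    a∉H′ : ¬ (m ≡ 1) → ¬ H′.Mem a
    a∉H′ m≢1 (_ , e) = m≢1 (ℕ.∣1⇒≡1 (ℕ.*-cancelˡ-∣ g (≡.subst (_∣ g ℕ.* 1) Q≡gm
      (≡.subst (Q ∣_) (≡.sym (ℕ.*-identityʳ g)) (ord g (M.trans (M.sym χa) e))))))

    -- The orthogonal sum of the pairing (i a, j a) ↦ i j w on the cyclic summand and the given
    -- pairing on its complement.
    pairing : Pairing H′ → Pairing H
    pairing R = record
      { ⟨_,_⟩ = pair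
      ; ⟨⟩-cong = λ {x} {x′} {y} {y′} p q e f → M.+-cong
          (M.trans (M.×-congʳ (coord x) (coord-w-cong q f)) (M.trans (M.·-comm (coord x) (coord y′) w)
            (M.trans (M.×-congʳ (coord y′) (coord-w-cong p e)) (M.·-comm (coord y′) (coord x′) w))))
          (R.⟨⟩-cong (proj∈ p) (proj∈ q) (proj-cong p e) (proj-cong q f))
      ; ⟨⟩-+ˡ = λ {x} {x′} {y} p p′ q → M.trans (M.+-cong
          (M.trans (M.·-comm (coord (x A.+ x′)) (coord y) w) (M.trans (M.×-congʳ (coord y) (coord-w-+ p p′)) (M.trans (M.×-distrib-+ _ _ (coord y))
             (M.+-cong (M.·-comm (coord y) (coord x) w) (M.·-comm (coord y) (coord x′) w)))))
          (M.trans (R.⟨⟩-cong (proj∈ (mem-+ p p′)) (proj∈ q) (proj-+ p p′) A.refl) (R.⟨⟩-+ˡ (proj∈ p) (proj∈ p′) (proj∈ q))))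
          (M.+-interchange _ _ _ _)
      ; ⟨⟩-+ʳ = λ {x} {y} {y′} p q q′ → M.trans (M.+-cong
          (M.trans (M.×-congʳ (coord x) (coord-w-+ q q′)) (M.×-distrib-+ _ _ (coord x)))
          (M.trans (R.⟨⟩-cong (proj∈ p) (proj∈ (mem-+ q q′)) A.refl (proj-+ q q′)) (R.⟨⟩-+ʳ (proj∈ p) (proj∈ q) (proj∈ q′))))
          (M.+-interchange _ _ _ _)
      ; nondegenerate = nondeg
      ; complete = compl
      }
      where
      module R = Pairing R
      pair : A.Carrier → A.Carrier → M.Carrier
      pair x y = coord x M.· (coord y M.· w) M.+ R.⟨ proj x , proj y ⟩
      coord-a : coord a M.· w M.≈ w
      coord-a = M.trans (M.sym (χ-coord a∈)) χa
      nondeg : ∀ {x} → Mem x → (∀ {y} → Mem y → pair x y M.≈ M.0#) → x A.≈ A.0#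
      nondeg {x} x∈ f = R.nondegenerate x∈′ λ {y} y∈ → begin
          R.⟨ x , y ⟩                 ≈⟨ R.⟨⟩-cong x∈′ y∈ (A.sym (proj-ker x∈′)) (A.sym (proj-ker y∈)) ⟩
          R.⟨ proj x , proj y ⟩       ≈⟨ M.sym (M.+-identityˡ _) ⟩
          M.0# M.+ R.⟨ proj x , proj y ⟩
            ≈⟨ M.+-congʳ (M.sym (M.trans (M.×-congʳ (coord x) (M.trans (M.sym (χ-coord (proj₁ y∈))) (proj₂ y∈))) (M.·-zeroʳ (coord x)))) ⟩
          pair x y                    ≈⟨ f (proj₁ y∈) ⟩
          M.0#                        ∎
        where
        open M using (begin_; step-≈-⟩; _∎)
        x∈′ : H′.Mem x
        x∈′ = x∈ , (begin
          χ x                             ≈⟨ χ-coord x∈ ⟩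
          coord x M.· w                   ≈⟨ M.×-congʳ (coord x) (M.sym coord-a) ⟩
          coord x M.· coord a M.· w       ≈⟨ M.sym (M.+-identityʳ _) ⟩
          coord x M.· coord a M.· w M.+ M.0#
            ≈⟨ M.+-congˡ (M.sym (M.trans (R.⟨⟩-cong (proj∈ x∈) (proj∈ a∈) A.refl proj-a) (R.⟨⟩-0ʳ (proj∈ x∈)))) ⟩
          pair x a                        ≈⟨ f a∈ ⟩
          M.0#                            ∎)
      compl : ∀ (θ : PartialHom) → (∀ {x} → Mem x → PartialHom.Mem θ x) →
              ∃ λ x → Mem x × (∀ {y} → Mem y → PartialHom.φ θ y M.≈ pair x y)
      compl θ sub with R.complete θ (λ p → sub (proj₁ p)) | log (PartialHom.φ θ a)
      ... | x′ , x′∈ , e | t , tz = x , x∈ , λ {y} y∈ → begin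
          θ.φ y
            ≈⟨ θ.φ-cong (sub y∈) (A.sym (A.x-y+y y (coord y A.· a))) ⟩
          θ.φ (proj y A.+ coord y A.· a)
            ≈⟨ θ.φ-+ (sub (proj₁ (proj∈ y∈))) (sub (mem-· (coord y) a∈)) ⟩
          θ.φ (proj y) M.+ θ.φ (coord y A.· a)
            ≈⟨ M.+-comm _ _ ⟩
          θ.φ (coord y A.· a) M.+ θ.φ (proj y)
            ≈⟨ M.+-cong (θ.φ-· (coord y) (sub a∈)) (e (proj∈ y∈)) ⟩
          coord y M.· θ.φ a M.+ R.⟨ x′ , proj y ⟩
            ≈⟨ M.+-cong (M.trans (M.×-congʳ (coord y) (M.trans θa (M.sym coord-x))) (M.·-comm (coord y) (coord x) w))
                        (R.⟨⟩-cong x′∈ (proj∈ y∈) (A.sym proj-x) A.refl) ⟩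
          pair x y ∎
        where
        open M using (begin_; step-≈-⟩; _∎)
        module θ = PartialHom θ
        -- θ(a) is killed by m, hence is a multiple j w. The representing element has coordinate j
        -- and complement part x′.
        g∣t : g ∣ t
        g∣t = ℕ.*-cancelˡ-∣ m (≡.subst (_∣ m ℕ.* t) (≡.trans Q≡gm (ℕ.*-comm g m)) (ord _ (begin
          (m ℕ.* t) M.· z   ≈⟨ M.sym (M.×-assocˡ z m t) ⟩
          m M.· t M.· z     ≈⟨ M.×-congʳ m tz ⟩
          m M.· θ.φ a       ≈⟨ M.sym (θ.φ-· m (sub a∈)) ⟩
          θ.φ (m A.· a)     ≈⟨ θ.φ-cong (sub (mem-· m a∈)) (Least.holds lm) ⟩
          θ.φ A.0#          ≈⟨ θ.φ-0 ⟩
          M.0#              ∎)))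
        j = ℕ.quotient g∣t
        θa : θ.φ a M.≈ j M.· w
        θa = M.trans (M.sym tz) (M.trans (M.×-congˡ (ℕ.m∣n⇒n≡quotient*m g∣t)) (M.sym (M.×-assocˡ z j g)))
        x = j A.· a A.+ x′
        x∈ = mem-+ (mem-· j a∈) (proj₁ x′∈)
        coord-x : coord x M.· w M.≈ j M.· w
        coord-x = begin
          coord x M.· w             ≈⟨ M.sym (χ-coord x∈) ⟩
          χ x                       ≈⟨ χ-+ _ _ ⟩
          χ (j A.· a) M.+ χ x′      ≈⟨ M.+-cong (M.trans (χ-· j a) (M.×-congʳ j χa)) (proj₂ x′∈) ⟩
          j M.· w M.+ M.0#          ≈⟨ M.+-identityʳ _ ⟩
          j M.· w                   ∎
        proj-x : proj x A.≈ x′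
        proj-x = A.trans (A.+-congˡ (A.-‿cong (w⇒a {coord x} {j} coord-x)))
          (A.trans (A.+-congʳ (A.+-comm _ _)) (A.x+y-y x′ _))

  -- Recursion on the number of listed members. An element of maximal order m is sent to (Q / m) z,
  -- this character of its cyclic group extends to all of A, and the kernel inside H no longer
  -- contains the element.
  pairing : ∀ H → Pairing H
  pairing H = go H (<-wellFounded (size H))
    where
    size : Subgroup A → ℕ
    size H = count (λ i → Subgroup.mem? H (enum i))
    go : ∀ H → Acc ℕ._<_ (size H) → Pairing H
    go H (acc rec) with enum-surj A.0#
    ... | i₀ , e₀ with argmax (λ i → Subgroup.mem? H (enum i)) (λ i → proj₁ (order (enum i))) (i₀ , Subgroup.resp H (A.sym e₀) (Subgroup.mem-0 H))
    ...   | i , a∈ , max with proj₁ (order (enum i)) ℕ.≟ 1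
    ...     | yes m≡1 = record
      { ⟨_,_⟩ = λ _ _ → M.0# ; ⟨⟩-cong = λ _ _ _ _ → M.refl
      ; ⟨⟩-+ˡ = λ _ _ _ → M.sym (M.+-identityˡ _) ; ⟨⟩-+ʳ = λ _ _ _ → M.sym (M.+-identityˡ _)
      ; nondegenerate = λ x∈ _ → all-0 _ x∈
      ; complete = λ θ sub → A.0# , mem-0 , λ y∈ → M.trans (PartialHom.φ-cong θ (sub y∈) (all-0 _ y∈)) (PartialHom.φ-0 θ) }
      where
      open Subgroup H
      all-0 : ∀ x → Mem x → x A.≈ A.0#
      all-0 x x∈ with enum-surj x
      ... | j , ej with order (enum j) | ℕ.≤-trans (max j (resp (A.sym ej) x∈)) (ℕ.≤-reflexive m≡1)
      ...   | suc zero , least _ h _ , _ | _ = A.trans (A.sym ej) (A.trans (A.sym (A.×-homo-1 _)) h)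
      ...   | suc (suc _) , _ | s≤s ()
    ...     | no m≢1 = S.pairing (go S.H′ (rec (count-< (λ i → Subgroup.mem? S.H′ (enum i)) (λ i → mem? (enum i)) (λ _ → proj₁) i a∈ (S.a∉H′ m≢1))))
      where
      open Subgroup H
      lm = proj₁ (proj₂ (order (enum i)))
      maximal : ∀ x → Mem x → ∃ λ r → Least (λ t → t A.· x A.≈ A.0#) r × r ℕ.≤ proj₁ (order (enum i))
      maximal x x∈ with enum-surj x
      ... | j , ej with order (enum j) | max j (resp (A.sym ej) x∈)
      ...   | r , least p h b , _ | le = r , least p (A.trans (A.×-congʳ r (A.sym ej)) h)
                (λ t nz lt e → b t nz lt (A.trans (A.×-congʳ t ej) e)) , le
      m = proj₁ (order (enum i))
      m∣Q = order-divides A trivial lm Q (Q· (enum i))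
      g = ℕ.quotient m∣Q
      Q≡gm = ℕ.m∣n⇒n≡quotient*m m∣Q
      mw≈0 : m M.· (g M.· z) M.≈ M.0#
      mw≈0 = M.trans (M.×-assocˡ z m g) (M.trans (M.×-congˡ (≡.trans (ℕ.*-comm m g) (≡.sym Q≡gm))) kill)
      module E = OneStep zero-hom (enum i) lm (g M.· z) mw≈0
      character = extend-character E.extended
      module S = Split H (enum i) a∈ lm maximal g Q≡gm (proj₁ character) (proj₂ (proj₂ character))
        (M.trans (_Extends_.φ-ext (proj₁ (proj₂ character)) E.a∈) E.φ′-a)

-- Residues, finite sums and the ring R[x]/(x^n - 1)

toℕ-mod : ∀ a n .{{_ : NonZero n}} → toℕ (a mod n) ≡ a % n
toℕ-mod a n = Fin.toℕ-fromℕ< (ℕ.m%n<n a n)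

mod-cong : ∀ {a b} n .{{_ : NonZero n}} → a % n ≡ b % n → a mod n ≡ b mod n
mod-cong {a} {b} n e = Fin.toℕ-injective (≡.trans (toℕ-mod a n) (≡.trans e (≡.sym (toℕ-mod b n))))

mod-injective : ∀ {a b} n .{{_ : NonZero n}} → a mod n ≡ b mod n → a % n ≡ b % n
mod-injective {a} {b} n e = ≡.trans (≡.sym (toℕ-mod a n)) (≡.trans (≡.cong toℕ e) (toℕ-mod b n))

toℕ-mod-self : ∀ {n} .{{_ : NonZero n}} (i : Fin n) → toℕ i mod n ≡ i
toℕ-mod-self {n} i = Fin.toℕ-injective (≡.trans (toℕ-mod _ n) (ℕ.m<n⇒m%n≡m (Fin.toℕ<n i)))

module _ {n} .{{_ : NonZero n}} where
  %-+ˡ : ∀ a b → (a % n ℕ.+ b) % n ≡ (a ℕ.+ b) % n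
  %-+ˡ a b = ≡.trans (ℕ.%-distribˡ-+ (a % n) b n) (≡.trans (≡.cong (λ t → (t ℕ.+ b % n) % n) (ℕ.m%n%n≡m%n a n)) (≡.sym (ℕ.%-distribˡ-+ a b n)))

  %-+ʳ : ∀ a b → (a ℕ.+ b % n) % n ≡ (a ℕ.+ b) % n
  %-+ʳ a b = ≡.trans (ℕ.%-distribˡ-+ a (b % n) n) (≡.trans (≡.cong (λ t → (a % n ℕ.+ t) % n) (ℕ.m%n%n≡m%n b n)) (≡.sym (ℕ.%-distribˡ-+ a b n)))

  %-*ʳ : ∀ a b → (a ℕ.* (b % n)) % n ≡ (a ℕ.* b) % n
  %-*ʳ a b = ≡.trans (ℕ.%-distribˡ-* a (b % n) n) (≡.trans (≡.cong (λ t → (a % n ℕ.* t) % n) (ℕ.m%n%n≡m%n b n)) (≡.sym (ℕ.%-distribˡ-* a b n)))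

  infixl 6 _⊕_
  _⊕_ : Fin n → Fin n → Fin n
  i ⊕ j = (toℕ i ℕ.+ toℕ j) mod n

  ⊕-comm : ∀ i j → i ⊕ j ≡ j ⊕ i
  ⊕-comm i j = ≡.cong (_mod n) (ℕ.+-comm (toℕ i) (toℕ j))

  ⊕-modˡ : ∀ a (j : Fin n) → (a mod n) ⊕ j ≡ (a ℕ.+ toℕ j) mod n
  ⊕-modˡ a j = mod-cong n (≡.trans (≡.cong (λ t → (t ℕ.+ toℕ j) % n) (toℕ-mod a n)) (%-+ˡ a (toℕ j)))

  ⊕-modʳ : ∀ (i : Fin n) b → i ⊕ (b mod n) ≡ (toℕ i ℕ.+ b) mod n
  ⊕-modʳ i b = mod-cong n (≡.trans (≡.cong (λ t → (toℕ i ℕ.+ t) % n) (toℕ-mod b n)) (%-+ʳ (toℕ i) b))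

  ⊕-assoc : ∀ i j k → i ⊕ j ⊕ k ≡ i ⊕ (j ⊕ k)
  ⊕-assoc i j k = ≡.trans (⊕-modˡ _ k) (≡.trans (≡.cong (_mod n) (ℕ.+-assoc (toℕ i) _ _)) (≡.sym (⊕-modʳ i _)))

  mod-⊕ : ∀ a b → (a mod n) ⊕ (b mod n) ≡ (a ℕ.+ b) mod n
  mod-⊕ a b = ≡.trans (⊕-modˡ a (b mod n)) (mod-cong n (≡.trans (≡.cong (λ t → (a ℕ.+ t) % n) (toℕ-mod b n)) (%-+ʳ a b)))

  ⊕-identityˡ : ∀ i → (0 mod n) ⊕ i ≡ i
  ⊕-identityˡ i = ≡.trans (⊕-modˡ 0 i) (toℕ-mod-self i)

module Sums (R : CommutativeRing 0ℓ 0ℓ) where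
  open CommutativeRing R
  private module S = Summation semiring
  open import Algebra.Properties.Semiring.Mult semiring using () renaming (_×_ to infixr 8 _×ₙ_)
  open import Algebra.Properties.Ring ring using (-‿distribʳ-*)
  open import Algebra.Properties.AbelianGroup +-abelianGroup using () renaming (⁻¹-∙-comm to -‿+-comm)
  open import Algebra.Properties.Group +-group using () renaming (ε⁻¹≈ε to -0≈0)
  open import Algebra.Properties.CommutativeSemigroup *-commutativeSemigroup using (x∙yz≈y∙xz)
  open import Relation.Binary.Reasoning.Setoid setoid

  -- Abstract so that the unifier treats sum as injective.
  abstract
    sum : ∀ {k} → (Fin k → Carrier) → Carrier
    sum = S.sum

    sum-zero : (f : Fin 0 → Carrier) → sum f ≡ 0#
    sum-zero f = ≡.refl

    sum-suc : ∀ {k} (f : Fin (suc k) → Carrier) → sum f ≡ f Fin.zero + sum (f ∘ Fin.suc)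
    sum-suc f = ≡.refl

    sum-cong : ∀ {k} {f g : Fin k → Carrier} → (∀ i → f i ≈ g i) → sum f ≈ sum g
    sum-cong = S.sum-cong-≋

    sum-+ : ∀ {k} (f g : Fin k → Carrier) → sum (λ i → f i + g i) ≈ sum f + sum g
    sum-+ = S.∑-distrib-+

    sum-swap : ∀ {k l} (f : Fin k → Fin l → Carrier) → sum (λ i → sum (f i)) ≈ sum (λ j → sum (λ i → f i j))
    sum-swap = S.∑-comm

    *-sum : ∀ {k} x (f : Fin k → Carrier) → x * sum f ≈ sum (λ i → x * f i)
    *-sum = S.*-distribˡ-sum

    sum-* : ∀ {k} x (f : Fin k → Carrier) → sum f * x ≈ sum (λ i → f i * x)
    sum-* = S.*-distribʳ-sum

    sum-permute : ∀ {k l} (f : Fin l → Carrier) (π : Permutation k l) → sum f ≈ sum (λ i → f (π ⟨$⟩ʳ i))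
    sum-permute = S.sum-permute

    sum-const : ∀ k {x} → sum {k} (λ _ → x) ≈ k ×ₙ x
    sum-const = S.sum-replicate

    sum-0 : ∀ {k} {g : Fin k → Carrier} → (∀ i → g i ≈ 0#) → sum g ≈ 0#
    sum-0 {k} e = trans (S.sum-cong-≋ e) (S.sum-replicate-zero k)

  sum-neg : ∀ {k} (g : Fin k → Carrier) → sum (λ i → - g i) ≈ - sum g
  sum-neg {zero} g = trans (reflexive (sum-zero _)) (trans (sym -0≈0) (-‿cong (reflexive (≡.sym (sum-zero g)))))
  sum-neg {suc k} g = trans (reflexive (sum-suc _)) (trans (+-congˡ (sum-neg (g ∘ Fin.suc)))
    (trans (-‿+-comm _ _) (-‿cong (reflexive (≡.sym (sum-suc g))))))

  ind : ∀ {k} → Fin k → Fin k → Carrier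
  ind i j = if does (i Fin.≟ j) then 1# else 0#

  ind-≡ : ∀ {k} {i j : Fin k} → i ≡ j → ind i j ≈ 1#
  ind-≡ {i = i} {j} e rewrite dec-true (i Fin.≟ j) e = refl

  ind-≢ : ∀ {k} {i j : Fin k} → i ≢ j → ind i j ≈ 0#
  ind-≢ {i = i} {j} e rewrite dec-false (i Fin.≟ j) e = refl

  ind-sym : ∀ {k} (i j : Fin k) → ind i j ≈ ind j i
  ind-sym i j with i Fin.≟ j
  ... | yes e = sym (ind-≡ (≡.sym e))
  ... | no ¬e = sym (ind-≢ (¬e ∘ ≡.sym))

  sum-ind : ∀ {k} (i : Fin k) (g : Fin k → Carrier) → sum (λ j → ind i j * g j) ≈ g i
  sum-ind Fin.zero g = trans (reflexive (sum-suc _)) (trans (+-cong (*-identityˡ _) (sum-0 (λ j → zeroˡ _))) (+-identityʳ _))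
  sum-ind (Fin.suc i) g = trans (reflexive (sum-suc _)) (trans (+-cong (zeroˡ _) (sum-ind i (g ∘ Fin.suc))) (+-identityˡ _))

  sum-ind′ : ∀ {k} (i : Fin k) (g : Fin k → Carrier) → sum (λ j → ind j i * g j) ≈ g i
  sum-ind′ i g = trans (sum-cong (λ j → *-congʳ (ind-sym j i))) (sum-ind i g)

  -- The linear extension of x^v ↦ x^(f v). Multiplication by x, substitution of x^a for x and
  -- reduction to a smaller n are all instances.
  push : ∀ {k l} → (Fin k → Fin l) → (Fin k → Carrier) → Fin l → Carrier
  push f b w = sum (λ v → ind (f v) w * b v)

  sum-push : ∀ {k l} (f : Fin k → Fin l) b (g : Fin l → Carrier) →
             sum (λ w → push f b w * g w) ≈ sum (λ v → b v * g (f v))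
  sum-push f b g = begin
    sum (λ w → push f b w * g w)
      ≈⟨ sum-cong (λ w → sum-* (g w) (λ v → ind (f v) w * b v)) ⟩
    sum (λ w → sum (λ v → ind (f v) w * b v * g w))
      ≈⟨ sum-swap (λ w v → ind (f v) w * b v * g w) ⟩
    sum (λ v → sum (λ w → ind (f v) w * b v * g w))
      ≈⟨ sum-cong (λ v → sum-cong (λ w → trans (*-assoc _ _ _) (x∙yz≈y∙xz _ _ _))) ⟩
    sum (λ v → sum (λ w → b v * (ind (f v) w * g w)))
      ≈⟨ sum-cong (λ v → sym (*-sum (b v) (λ w → ind (f v) w * g w))) ⟩
    sum (λ v → b v * sum (λ w → ind (f v) w * g w))
      ≈⟨ sum-cong (λ v → *-congˡ (sum-ind (f v) g)) ⟩
    sum (λ v → b v * g (f v)) ∎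

  push-cong : ∀ {k l} (f : Fin k → Fin l) {b c} → (∀ v → b v ≈ c v) → ∀ w → push f b w ≈ push f c w
  push-cong f e w = sum-cong (λ v → *-congˡ (e v))

  push-cong-fun : ∀ {k l} {f g : Fin k → Fin l} b → (∀ v → f v ≡ g v) → ∀ w → push f b w ≈ push g b w
  push-cong-fun b e w = sum-cong (λ v → *-congʳ (reflexive (≡.cong (λ t → ind t w) (e v))))

  push-push : ∀ {k l m} (g : Fin l → Fin m) (f : Fin k → Fin l) b w → push g (push f b) w ≈ push (g ∘ f) b w
  push-push g f b w = begin
    sum (λ u → ind (g u) w * push f b u)   ≈⟨ sum-cong (λ u → *-comm _ _) ⟩
    sum (λ u → push f b u * ind (g u) w)   ≈⟨ sum-push f b (λ u → ind (g u) w) ⟩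
    sum (λ v → b v * ind (g (f v)) w)      ≈⟨ sum-cong (λ v → *-comm _ _) ⟩
    push (g ∘ f) b w                       ∎

  push-+ : ∀ {k l} (f : Fin k → Fin l) b c w → push f (λ v → b v + c v) w ≈ push f b w + push f c w
  push-+ f b c w = trans (sum-cong (λ v → distribˡ _ _ _)) (sum-+ (λ v → ind (f v) w * b v) (λ v → ind (f v) w * c v))

  push-neg : ∀ {k l} (f : Fin k → Fin l) b w → push f (λ v → - b v) w ≈ - push f b w
  push-neg f b w = trans (sum-cong (λ v → sym (-‿distribʳ-* _ _))) (sum-neg (λ v → ind (f v) w * b v))

  push-* : ∀ {k l} (f : Fin k → Fin l) c b w → push f (λ v → c * b v) w ≈ c * push f b w
  push-* f c b w = trans (sum-cong (λ v → x∙yz≈y∙xz _ _ _)) (sym (*-sum c (λ v → ind (f v) w * b v)))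

  push-ind : ∀ {k l} (f : Fin k → Fin l) i w → push f (ind i) w ≈ ind (f i) w
  push-ind f i w = trans (sum-cong (λ v → *-comm _ _)) (sum-ind i (λ v → ind (f v) w))

  push-id : ∀ {k} {f : Fin k → Fin k} → (∀ v → f v ≡ v) → ∀ b w → push f b w ≈ b w
  push-id e b w = trans (push-cong-fun b e w) (sum-ind′ w b)

  push-outside : ∀ {k l} (f : Fin k → Fin l) b w → (∀ v → f v ≡ w → b v ≈ 0#) → push f b w ≈ 0#
  push-outside f b w e = sum-0 term
    where
    term : ∀ v → ind (f v) w * b v ≈ 0#
    term v with f v Fin.≟ w
    ... | yes fv≡w = trans (*-identityˡ _) (e v fv≡w)
    ... | no _ = zeroˡ _

  push-injective : ∀ {k l} (f : Fin k → Fin l) → (∀ {i j} → f i ≡ f j → i ≡ j) → ∀ b v → push f b (f v) ≈ b v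
  push-injective f inj b v = trans (sum-cong term) (sum-ind′ v b)
    where
    term : ∀ u → ind (f u) (f v) * b u ≈ ind u v * b u
    term u with f u Fin.≟ f v | u Fin.≟ v
    ... | yes _ | yes _ = refl
    ... | no _  | no _  = refl
    ... | yes e | no ¬e = ⊥-elim (¬e (inj e))
    ... | no ¬e | yes e = ⊥-elim (¬e (≡.cong f e))

  sum-push-total : ∀ {k l} (f : Fin k → Fin l) b → sum (push f b) ≈ sum b
  sum-push-total f b = trans (sum-cong (λ w → sym (*-identityʳ _))) (trans (sum-push f b (λ _ → 1#)) (sum-cong (λ v → *-identityʳ _)))

module GroupRing (R : CommutativeRing 0ℓ 0ℓ) (n : ℕ) .{{_ : NonZero n}} where
  open CommutativeRing R
  open Sums R
  open import Relation.Binary.Reasoning.Setoid setoid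
  open import Algebra.Properties.CommutativeSemigroup *-commutativeSemigroup using (x∙yz≈y∙xz)

  Elt : Set
  Elt = Fin n → Carrier

  infix 4 _≋_
  _≋_ : Elt → Elt → Set
  u ≋ w = ∀ k → u k ≈ w k

  infixl 7 _⋆_
  -- Multiplication in R[x]/(x^n - 1): the i-th coefficient multiplies w shifted cyclically by i.
  _⋆_ : Elt → Elt → Elt
  (u ⋆ w) k = sum (λ i → u i * push (i ⊕_) w k)

  δ : ℕ → Elt
  δ a = ind (a mod n)

  -- A convolution is tested against an arbitrary function g. Associativity and the multiplicativity
  -- of evaluation, of the augmentation, of the circulant matrix and of `push` along a homomorphism
  -- all reduce to this.
  integrate : ∀ u w (g : Fin n → Carrier) → sum (λ k → (u ⋆ w) k * g k) ≈ sum (λ i → u i * sum (λ j → w j * g (i ⊕ j)))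
  integrate u w g = begin
    sum (λ k → (u ⋆ w) k * g k)
      ≈⟨ sum-cong (λ k → trans (sum-* (g k) (λ i → u i * push (i ⊕_) w k)) (sum-cong (λ i → *-assoc _ _ _))) ⟩
    sum (λ k → sum (λ i → u i * (push (i ⊕_) w k * g k)))
      ≈⟨ sum-swap (λ k i → u i * (push (i ⊕_) w k * g k)) ⟩
    sum (λ i → sum (λ k → u i * (push (i ⊕_) w k * g k)))
      ≈⟨ sum-cong (λ i → trans (sym (*-sum (u i) (λ k → push (i ⊕_) w k * g k))) (*-congˡ (sum-push (i ⊕_) w g))) ⟩
    sum (λ i → u i * sum (λ j → w j * g (i ⊕ j))) ∎

  ⋆-cong : ∀ {u u′ w w′} → u ≋ u′ → w ≋ w′ → u ⋆ w ≋ u′ ⋆ w′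
  ⋆-cong e f k = sum-cong (λ i → *-cong (e i) (push-cong (i ⊕_) f k))

  ⋆-comm : ∀ u w → u ⋆ w ≋ w ⋆ u
  ⋆-comm u w k = begin
    sum (λ i → u i * sum (λ j → ind (i ⊕ j) k * w j))
      ≈⟨ sum-cong (λ i → *-sum (u i) (λ j → ind (i ⊕ j) k * w j)) ⟩
    sum (λ i → sum (λ j → u i * (ind (i ⊕ j) k * w j)))
      ≈⟨ sum-swap (λ i j → u i * (ind (i ⊕ j) k * w j)) ⟩
    sum (λ j → sum (λ i → u i * (ind (i ⊕ j) k * w j)))
      ≈⟨ sum-cong (λ j → sum-cong (λ i → trans (*-congˡ (*-congʳ (reflexive (≡.cong (λ t → ind t k) (⊕-comm i j)))))
           (trans (sym (*-assoc _ _ _)) (trans (*-comm _ _) (*-congˡ (*-comm _ _)))))) ⟩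
    sum (λ j → sum (λ i → w j * (ind (j ⊕ i) k * u i)))
      ≈⟨ sum-cong (λ j → sym (*-sum (w j) (λ i → ind (j ⊕ i) k * u i))) ⟩
    sum (λ j → w j * sum (λ i → ind (j ⊕ i) k * u i)) ∎

  ⋆-assoc : ∀ u w x → (u ⋆ w) ⋆ x ≋ u ⋆ (w ⋆ x)
  ⋆-assoc u w x k = begin
    sum (λ l → (u ⋆ w) l * push (l ⊕_) x k)
      ≈⟨ integrate u w (λ l → push (l ⊕_) x k) ⟩
    sum (λ i → u i * sum (λ j → w j * push (i ⊕ j ⊕_) x k))
      ≈⟨ sum-cong (λ i → *-congˡ (sum-cong (λ j → *-congˡ (sum-cong (λ m →
           trans (*-comm _ _) (*-congˡ (reflexive (≡.cong (λ t → ind t k) (⊕-assoc i j m))))))))) ⟩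
    sum (λ i → u i * sum (λ j → w j * sum (λ m → x m * ind (i ⊕ (j ⊕ m)) k)))
      ≈⟨ sum-cong (λ i → *-congˡ (sym (integrate w x (λ l → ind (i ⊕ l) k)))) ⟩
    sum (λ i → u i * sum (λ l → (w ⋆ x) l * ind (i ⊕ l) k))
      ≈⟨ sum-cong (λ i → *-congˡ (sum-cong (λ l → *-comm _ _))) ⟩
    sum (λ i → u i * push (i ⊕_) (w ⋆ x) k) ∎

  δ⋆ : ∀ a w → δ a ⋆ w ≋ push (λ j → (a ℕ.+ toℕ j) mod n) w
  δ⋆ a w k = trans (sum-ind (a mod n) (λ i → push (i ⊕_) w k)) (push-cong-fun w (⊕-modˡ a) k)

  ⋆-identityˡ : ∀ w → δ 0 ⋆ w ≋ w
  ⋆-identityˡ w k = trans (δ⋆ 0 w k) (push-id toℕ-mod-self w k)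

  ⋆-distribʳ : ∀ w u u′ → (λ k → u k + u′ k) ⋆ w ≋ (λ k → (u ⋆ w) k + (u′ ⋆ w) k)
  ⋆-distribʳ w u u′ k = trans (sum-cong (λ i → distribʳ _ _ _)) (sum-+ (λ i → u i * push (i ⊕_) w k) (λ i → u′ i * push (i ⊕_) w k))

  commutativeRing : CommutativeRing 0ℓ 0ℓ
  commutativeRing = record
    { Carrier = Elt
    ; _≈_ = _≋_
    ; _+_ = λ u w k → u k + w k
    ; _*_ = _⋆_
    ; -_ = λ u k → - u k
    ; 0# = λ _ → 0#
    ; 1# = δ 0
    ; isCommutativeRing = record
      { isRing = record
        { +-isAbelianGroup = record
          { isGroup = record
            { isMonoid = record
              { isSemigroup = record
                { isMagma = record
                  { isEquivalence = record { refl = λ _ → refl ; sym = λ e k → sym (e k) ; trans = λ e f k → trans (e k) (f k) }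
                  ; ∙-cong = λ e f k → +-cong (e k) (f k) }
                ; assoc = λ x y z k → +-assoc _ _ _ }
              ; identity = (λ x k → +-identityˡ _) , (λ x k → +-identityʳ _) }
            ; inverse = (λ x k → -‿inverseˡ _) , (λ x k → -‿inverseʳ _)
            ; ⁻¹-cong = λ e k → -‿cong (e k) }
          ; comm = λ x y k → +-comm _ _ }
        ; *-cong = ⋆-cong
        ; *-assoc = ⋆-assoc
        ; *-identity = ⋆-identityˡ , (λ w k → trans (⋆-comm w (δ 0) k) (⋆-identityˡ w k))
        ; distrib = (λ w u u′ k → trans (⋆-comm w _ k) (trans (⋆-distribʳ w u u′ k) (+-cong (⋆-comm u w k) (⋆-comm u′ w k))))
                  , ⋆-distribʳ }
      ; *-comm = ⋆-comm }
    }

  δ-⋆ : ∀ a b → δ a ⋆ δ b ≋ δ (a ℕ.+ b)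
  δ-⋆ a b k = trans (δ⋆ a (δ b) k) (trans (push-ind (λ j → (a ℕ.+ toℕ j) mod n) (b mod n) k)
    (reflexive (≡.cong (λ t → ind t k) (≡.trans (≡.sym (⊕-modˡ a (b mod n))) (mod-⊕ a b)))))

  δ-% : ∀ {a b} → a % n ≡ b % n → δ a ≋ δ b
  δ-% e k = reflexive (≡.cong (λ t → ind t k) (mod-cong n e))

  scalar-⋆ : ∀ c u → (λ k → c * δ 0 k) ⋆ u ≋ (λ k → c * u k)
  scalar-⋆ c u k = begin
    sum (λ i → c * δ 0 i * push (i ⊕_) u k)      ≈⟨ sum-cong (λ i → *-assoc _ _ _) ⟩
    sum (λ i → c * (δ 0 i * push (i ⊕_) u k))    ≈⟨ sym (*-sum c (λ i → δ 0 i * push (i ⊕_) u k)) ⟩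
    c * (δ 0 ⋆ u) k                              ≈⟨ *-congˡ (⋆-identityˡ u k) ⟩
    c * u k                                      ∎

absorption : ∀ n k → suc k ℕ.* (suc n C suc k) ≡ suc n ℕ.* (n C k)
absorption zero zero = ≡.refl
absorption zero (suc k) = ≡.trans (≡.cong (suc (suc k) ℕ.*_) (k>n⇒nCk≡0 {1} {suc (suc k)} (s≤s (s≤s z≤n))))
  (≡.trans (ℕ.*-zeroʳ (suc (suc k))) (≡.sym (≡.trans (ℕ.*-identityˡ (0 C suc k)) (k>n⇒nCk≡0 {0} {suc k} (s≤s z≤n)))))
absorption (suc n) zero = begin
  1 ℕ.* (suc (suc n) C 1)     ≡⟨ ℕ.*-identityˡ _ ⟩
  suc (suc n) C 1             ≡⟨ nC1≡n (suc (suc n)) ⟩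
  suc (suc n)                 ≡⟨ ≡.sym (ℕ.*-identityʳ _) ⟩
  suc (suc n) ℕ.* 1           ∎
  where open ≡.≡-Reasoning
absorption (suc n) (suc k) = begin
  suc (suc k) ℕ.* (suc (suc n) C suc (suc k))
    ≡⟨ ≡.cong (suc (suc k) ℕ.*_) (≡.sym (nCk+nC[k+1]≡[n+1]C[k+1] (suc n) (suc k))) ⟩
  suc (suc k) ℕ.* (x ℕ.+ y)
    ≡⟨ +-*-Solver.solve 3 (λ k x y → (con 1 :+ (con 1 :+ k)) :* (x :+ y) := ((con 1 :+ k) :* x :+ x) :+ (con 1 :+ (con 1 :+ k)) :* y) ≡.refl k x y ⟩
  suc k ℕ.* x ℕ.+ x ℕ.+ suc (suc k) ℕ.* y
    ≡⟨ ≡.cong₂ (λ s t → s ℕ.+ x ℕ.+ t) (absorption n k) (absorption n (suc k)) ⟩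
  suc n ℕ.* u ℕ.+ x ℕ.+ suc n ℕ.* v
    ≡⟨ +-*-Solver.solve 4 (λ n u x v → (con 1 :+ n) :* u :+ x :+ (con 1 :+ n) :* v := x :+ (con 1 :+ n) :* (u :+ v)) ≡.refl n u x v ⟩
  x ℕ.+ suc n ℕ.* (u ℕ.+ v)
    ≡⟨ ≡.cong (λ t → x ℕ.+ suc n ℕ.* t) (nCk+nC[k+1]≡[n+1]C[k+1] n k) ⟩
  suc (suc n) ℕ.* (suc n C suc k) ∎
  where
  open ≡.≡-Reasoning
  open +-*-Solver
  x = suc n C suc k
  y = suc n C suc (suc k)
  u = n C k
  v = n C suc k

-- By `absorption`, p divides k times the binomial coefficient, and it does not divide k because 0 <
-- k < p.
prime∣binomial : ∀ {p} → Prime p → ∀ k → 0 ℕ.< k → k ℕ.< p → p ∣ p C k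
prime∣binomial {suc n} pr (suc k) _ k<p with euclidsLemma (suc k) (suc n C suc k) pr
  (≡.subst (suc n ∣_) (≡.sym (absorption n k)) (ℕ.m∣m*n (n C k)))
... | inj₁ d = ⊥-elim (ℕ.<⇒≱ k<p (ℕ.∣⇒≤ d))
... | inj₂ d = d
prime∣binomial {zero} pr (suc k) _ ()

-- Finite rings and fields

module CharP (R : CommutativeRing 0ℓ 0ℓ) {p : ℕ} (pr : Prime p) where
  open CommutativeRing R
  open Sums R
  open import Algebra.Properties.Semiring.Mult semiring renaming (_×_ to infixr 8 _×ₙ_)
  open import Algebra.Properties.Semiring.Exp semiring
  open import Algebra.Properties.Semiring.Sum semiring using () renaming (sum to sumˢ; sum-init-last to sumˢ-init-last; sum-cong-≋ to sumˢ-cong; sum-replicate-zero to sumˢ-0)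
  open import Algebra.Properties.CommutativeSemiring.Binomial commutativeSemiring
  open import Relation.Binary.Reasoning.Setoid setoid

  module _ (char : p ×ₙ 1# ≈ 0#) where

    ×-char : ∀ x {m} → p ∣ m → m ×ₙ x ≈ 0#
    ×-char x (divides k ≡.refl) = begin
      (k ℕ.* p) ×ₙ x           ≈⟨ ×-congʳ (k ℕ.* p) (sym (*-identityˡ x)) ⟩
      (k ℕ.* p) ×ₙ (1# * x)    ≈⟨ sym (×-assoc-* (k ℕ.* p) 1# x) ⟩
      ((k ℕ.* p) ×ₙ 1#) * x    ≈⟨ *-congʳ (×1-homo-* k p) ⟩
      (k ×ₙ 1#) * (p ×ₙ 1#) * x  ≈⟨ *-congʳ (trans (*-congˡ char) (zeroʳ _)) ⟩
      0# * x                   ≈⟨ zeroˡ x ⟩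
      0#                       ∎

    freshman : ∀ x y → (x + y) ^ p ≈ x ^ p + y ^ p
    freshman x y = go p ≡.refl
      where
      go : ∀ m → m ≡ p → (x + y) ^ m ≈ x ^ m + y ^ m
      go zero e = ⊥-elim (ℕ.≢-nonZero⁻¹ p {{prime⇒nonZero pr}} (≡.sym e))
      go (suc m) e = begin
        (x + y) ^ suc m
          ≈⟨ theorem (suc m) x y ⟩
        t Fin.zero + sumˢ (t ∘ Fin.suc)
          ≈⟨ +-congˡ (sumˢ-init-last (t ∘ Fin.suc)) ⟩
        t Fin.zero + (sumˢ (λ i → t (Fin.suc (Fin.inject₁ i))) + t (Fin.suc (Fin.fromℕ m)))
          ≈⟨ +-cong first (+-cong (trans (sumˢ-cong middle) (sumˢ-0 m)) last) ⟩
        y ^ suc m + (0# + x ^ suc m)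
          ≈⟨ trans (+-congˡ (+-identityˡ _)) (+-comm _ _) ⟩
        x ^ suc m + y ^ suc m ∎
        where
        t : Fin (suc (suc m)) → Carrier
        t = binomialTerm x y (suc m)
        first : t Fin.zero ≈ y ^ suc m
        first = trans (×-homo-1 _) (*-identityˡ _)
        last : t (Fin.suc (Fin.fromℕ m)) ≈ x ^ suc m
        last rewrite Fin.toℕ-fromℕ m | nCn≡1 (suc m) | ℕ.n∸n≡0 m = trans (×-homo-1 _) (*-identityʳ _)
        middle : ∀ i → t (Fin.suc (Fin.inject₁ i)) ≈ 0#
        middle i = ×-char _ (≡.subst (_∣ (suc m C suc (toℕ (Fin.inject₁ i)))) e
          (prime∣binomial (≡.subst Prime (≡.sym e) pr) _ (s≤s z≤n)
            (s≤s (≡.subst (ℕ._< m) (≡.sym (Fin.toℕ-inject₁ i)) (Fin.toℕ<n i)))))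

    frobenius-+ : ∀ κ x y → (x + y) ^ (p ℕ.^ κ) ≈ x ^ (p ℕ.^ κ) + y ^ (p ℕ.^ κ)
    frobenius-+ zero x y = trans (*-identityʳ _) (sym (+-cong (*-identityʳ x) (*-identityʳ y)))
    frobenius-+ (suc κ) x y = begin
      (x + y) ^ (p ℕ.* p ℕ.^ κ)             ≈⟨ sym (^-assocʳ _ p (p ℕ.^ κ)) ⟩
      ((x + y) ^ p) ^ (p ℕ.^ κ)             ≈⟨ ^-congˡ (p ℕ.^ κ) (freshman x y) ⟩
      (x ^ p + y ^ p) ^ (p ℕ.^ κ)           ≈⟨ frobenius-+ κ (x ^ p) (y ^ p) ⟩
      (x ^ p) ^ (p ℕ.^ κ) + (y ^ p) ^ (p ℕ.^ κ) ≈⟨ +-cong (^-assocʳ x p (p ℕ.^ κ)) (^-assocʳ y p (p ℕ.^ κ)) ⟩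
      x ^ (p ℕ.* p ℕ.^ κ) + y ^ (p ℕ.* p ℕ.^ κ) ∎

    frobenius-0 : ∀ κ → 0# ^ (p ℕ.^ κ) ≈ 0#
    frobenius-0 κ = 0^ (p ℕ.^ κ) {{ℕ.m^n≢0 p κ {{prime⇒nonZero pr}}}}
      where
      0^ : ∀ m .{{_ : NonZero m}} → 0# ^ m ≈ 0#
      0^ (suc m) = zeroˡ _

    frobenius-sum : ∀ κ {k} (f : Fin k → Carrier) → sum f ^ (p ℕ.^ κ) ≈ sum (λ i → f i ^ (p ℕ.^ κ))
    frobenius-sum κ {zero} f = trans (^-congˡ (p ℕ.^ κ) (reflexive (sum-zero f))) (trans (frobenius-0 κ) (sym (reflexive (sum-zero _))))
    frobenius-sum κ {suc k} f = begin
      sum f ^ (p ℕ.^ κ)                                   ≈⟨ ^-congˡ (p ℕ.^ κ) (reflexive (sum-suc f)) ⟩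
      (f Fin.zero + sum (f ∘ Fin.suc)) ^ (p ℕ.^ κ)        ≈⟨ frobenius-+ κ _ _ ⟩
      f Fin.zero ^ (p ℕ.^ κ) + sum (f ∘ Fin.suc) ^ (p ℕ.^ κ) ≈⟨ +-congˡ (frobenius-sum κ (f ∘ Fin.suc)) ⟩
      f Fin.zero ^ (p ℕ.^ κ) + sum (λ i → f (Fin.suc i) ^ (p ℕ.^ κ)) ≈⟨ sym (reflexive (sum-suc _)) ⟩
      sum (λ i → f i ^ (p ℕ.^ κ)) ∎

module _ (M : CommutativeMonoid 0ℓ 0ℓ) where
  open CommutativeMonoid M
  open import Algebra.Properties.CommutativeMonoid.Sum M using (sum-replicate-zero) renaming (sum to ⨁)

  single-sum : ∀ {k} (i : Fin k) a → ⨁ (λ j → if does (i Fin.≟ j) then a else ε) ≈ a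
  single-sum {suc k} Fin.zero a = trans (∙-congˡ (sum-replicate-zero k)) (identityʳ a)
  single-sum (Fin.suc i) a = trans (identityˡ _) (single-sum i a)

module FiniteFieldProperties {q : ℕ} (F : FiniteField q) where
  open FiniteField F
  open import Algebra.Properties.Semiring.Mult semiring renaming (_×_ to infixr 8 _×ₙ_)
  open import Algebra.Properties.Semiring.Exp semiring
  open import Algebra.Properties.Group +-group using () renaming (∙-cancelˡ to +-cancelˡ)
  open import Relation.Binary.Reasoning.Setoid setoid
  open Sums commRing
  import Algebra.Properties.CommutativeMonoid.Sum *-commutativeMonoid as ∏

  index : Carrier → Fin q
  index x = proj₁ (enum-surj x)

  enum-index : ∀ x → enum (index x) ≈ x
  enum-index x = proj₂ (enum-surj x)

  infix 4 _≟F_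
  _≟F_ : ∀ x y → Dec (x ≈ y)
  x ≟F y = map′ (λ e → trans (sym (enum-index x)) (trans (reflexive (≡.cong enum e)) (enum-index y)))
                (λ e → enum-inj _ _ (trans (enum-index x) (trans e (sym (enum-index y)))))
                (index x Fin.≟ index y)

  domain : ∀ {x y} → x * y ≈ 0# → ¬ x ≈ 0# → y ≈ 0#
  domain {x} {y} e x≉0 with inverse x x≉0
  ... | x⁻¹ , xx⁻¹ = begin
    y               ≈⟨ sym (*-identityˡ y) ⟩
    1# * y          ≈⟨ *-congʳ (sym (trans (*-comm _ _) xx⁻¹)) ⟩
    x⁻¹ * x * y     ≈⟨ *-assoc _ _ _ ⟩
    x⁻¹ * (x * y)   ≈⟨ trans (*-congˡ e) (zeroʳ _) ⟩
    0#              ∎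

  cancel : ∀ {x y z} → ¬ x ≈ 0# → x * y ≈ x * z → y ≈ z
  cancel {x} {y} {z} x≉0 e with inverse x x≉0
  ... | x⁻¹ , xx⁻¹ = trans (un y) (trans (*-congˡ e) (sym (un z)))
    where
    un : ∀ t → t ≈ x⁻¹ * (x * t)
    un t = trans (sym (*-identityˡ t)) (trans (*-congʳ (sym (trans (*-comm _ _) xx⁻¹))) (*-assoc _ _ _))

  reindex : (f g : Carrier → Carrier) → (∀ {x y} → x ≈ y → f x ≈ f y) → (∀ {x y} → x ≈ y → g x ≈ g y) →
            (∀ x → f (g x) ≈ x) → (∀ x → g (f x) ≈ x) → Permutation q q
  reindex f g f-cong g-cong fg gf = permutation (λ i → index (f (enum i))) (λ i → index (g (enum i)))
    (λ i → enum-inj _ _ (trans (enum-index _) (trans (f-cong (enum-index _)) (fg _))))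
    (λ i → enum-inj _ _ (trans (enum-index _) (trans (g-cong (enum-index _)) (gf _))))

  -- Translation by 1 permutes the field, so adding q times 1 leaves the sum of all elements
  -- unchanged.
  q×1≈0 : q ×ₙ 1# ≈ 0#
  q×1≈0 = +-cancelˡ (sum enum) _ _ (begin
    sum enum + q ×ₙ 1#                 ≈⟨ +-congˡ (sym (sum-const q)) ⟩
    sum enum + sum {q} (λ _ → 1#)      ≈⟨ sym (sum-+ enum (λ _ → 1#)) ⟩
    sum (λ i → enum i + 1#)            ≈⟨ sum-cong (λ i → sym (enum-index _)) ⟩
    sum (λ i → enum (π ⟨$⟩ʳ i))        ≈⟨ sym (sum-permute enum π) ⟩
    sum enum                           ≈⟨ sym (+-identityʳ _) ⟩
    sum enum + 0#                      ∎)
    where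
    π : Permutation q q
    π = reindex (_+ 1#) (_- 1#) +-congʳ +-congʳ
      (λ x → trans (+-assoc _ _ _) (trans (+-congˡ (-‿inverseˡ 1#)) (+-identityʳ x)))
      (λ x → trans (+-assoc _ _ _) (trans (+-congˡ (-‿inverseʳ 1#)) (+-identityʳ x)))

  -- A field has no zero divisors, and q · 1 is the κ-th power of p · 1.
  characteristic : ∀ p κ → q ≡ p ℕ.^ κ → p ×ₙ 1# ≈ 0#
  characteristic p κ e with (p ×ₙ 1#) ≟F 0#
  ... | yes z = z
  ... | no nz = ⊥-elim (power-≉0 κ (trans (×-congˡ (≡.sym e)) q×1≈0))
    where
    power-≉0 : ∀ κ → ¬ (p ℕ.^ κ) ×ₙ 1# ≈ 0#
    power-≉0 zero z = 0≉1 (sym (trans (sym (×-homo-1 1#)) z))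
    power-≉0 (suc κ) z = power-≉0 κ (domain (trans (sym (×1-homo-* p (p ℕ.^ κ))) z) nz)

  -- Multiplication by a nonzero a permutes the nonzero elements, so their product absorbs the
  -- factor a^(q-1).
  fermat : .{{NonZero q}} → ∀ a → a ^ q ≈ a
  fermat a with a ≟F 0#
  ... | yes a≈0 = trans (^-congˡ q a≈0) (trans (0^ q) (sym a≈0))
    where
    0^ : ∀ m .{{_ : NonZero m}} → 0# ^ m ≈ 0#
    0^ (suc m) = zeroˡ _
  ... | no a≉0 = begin
      a ^ q                           ≈⟨ sym (∏.sum-replicate q) ⟩
      ∏.sum {q} (λ _ → a)             ≈⟨ ∏.sum-cong-≋ (λ i → sym (g*h i)) ⟩
      ∏.sum (λ i → g i * h i)         ≈⟨ ∏.∑-distrib-+ g h ⟩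
      ∏.sum g * ∏.sum h               ≈⟨ *-cong ∏g≈1 (single-sum *-commutativeMonoid i₀ a) ⟩
      1# * a                          ≈⟨ *-identityˡ a ⟩
      a                               ∎
    where
    i₀ = index 0#
    a⁻¹ = proj₁ (inverse a a≉0)
    a⁻¹a : a⁻¹ * a ≈ 1#
    a⁻¹a = trans (*-comm _ _) (proj₂ (inverse a a≉0))
    -- The index of 0 is masked: `f` has a nonzero product, `g` is the factor that the permutation
    -- introduces into it, and `h` restores the constant a, so that a^q = ∏ g · ∏ h.
    f g h : Fin q → Carrier
    f i = if does (i₀ Fin.≟ i) then 1# else enum i
    g i = if does (i₀ Fin.≟ i) then 1# else a
    h i = if does (i₀ Fin.≟ i) then a else 1#
    g*h : ∀ i → g i * h i ≈ a
    g*h i with i₀ Fin.≟ i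
    ... | yes _ = *-identityˡ a
    ... | no _ = *-identityʳ a
    π : Permutation q q
    π = reindex (a *_) (a⁻¹ *_) *-congˡ *-congˡ
      (λ x → trans (sym (*-assoc _ _ _)) (trans (*-congʳ (proj₂ (inverse a a≉0))) (*-identityˡ x)))
      (λ x → trans (sym (*-assoc _ _ _)) (trans (*-congʳ a⁻¹a) (*-identityˡ x)))
    f-π : ∀ i → f (π ⟨$⟩ʳ i) ≈ g i * f i
    f-π i with i₀ Fin.≟ i | i₀ Fin.≟ index (a * enum i)
    ... | yes _ | yes _ = sym (*-identityˡ 1#)
    ... | no _  | no _  = enum-index _
    ... | yes ≡.refl | no ne = ⊥-elim (ne (enum-inj _ _ (trans (enum-index 0#)
            (sym (trans (enum-index _) (trans (*-congˡ (enum-index 0#)) (zeroʳ a)))))))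
    ... | no ne | yes e = ⊥-elim (ne (enum-inj _ _ (trans (enum-index 0#)
            (sym (domain (trans (sym (enum-index _)) (trans (reflexive (≡.cong enum (≡.sym e))) (enum-index 0#))) a≉0)))))
    f≉0 : ∀ i → ¬ f i ≈ 0#
    f≉0 i with i₀ Fin.≟ i
    ... | yes _ = λ e → 0≉1 (sym e)
    ... | no ne = λ e → ne (enum-inj _ _ (trans (enum-index 0#) (sym e)))
    ∏≉0 : ∀ {k} (t : Fin k → Carrier) → (∀ i → ¬ t i ≈ 0#) → ¬ ∏.sum t ≈ 0#
    ∏≉0 {zero} t nz e = 0≉1 (sym e)
    ∏≉0 {suc k} t nz e = ∏≉0 (t ∘ Fin.suc) (nz ∘ Fin.suc) (domain e (nz Fin.zero))
    ∏g≈1 : ∏.sum g ≈ 1#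
    ∏g≈1 = cancel (∏≉0 f f≉0) (begin
      ∏.sum f * ∏.sum g             ≈⟨ *-comm _ _ ⟩
      ∏.sum g * ∏.sum f             ≈⟨ sym (∏.∑-distrib-+ g f) ⟩
      ∏.sum (λ i → g i * f i)       ≈⟨ ∏.sum-cong-≋ (λ i → sym (f-π i)) ⟩
      ∏.sum (λ i → f (π ⟨$⟩ʳ i))    ≈⟨ sym (∏.sum-permute f π) ⟩
      ∏.sum f                       ≈⟨ sym (*-identityʳ _) ⟩
      ∏.sum f * 1#                  ∎)

prime-divisor : ∀ n → .{{NonZero n}} → n ≢ 1 → ∃ λ r → Prime r × r ∣ n
prime-divisor n n≢1 with factorise n
... | record { factors = [] ; isFactorisation = e } = ⊥-elim (n≢1 e)
... | record { factors = r ∷ rs ; isFactorisation = e ; factorsPrime = pr ∷ _ } = r , pr , ≡.subst (r ∣_) (≡.sym e) (ℕ.m∣m*n (product rs))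

-- In a finite ring where x ^ T is always an idempotent fixing x, one pass over the
-- elements finds an idempotent e below s ^ T such that e R is a field.
module ResidueField (R : CommutativeRing 0ℓ 0ℓ) where
  open CommutativeRing R
  open import Algebra.Properties.Semiring.Exp semiring
  open import Relation.Binary.Reasoning.Setoid setoid
  open import Algebra.Properties.Ring ring using (-‿distribʳ-*)
  open import Algebra.Properties.CommutativeSemigroup *-commutativeSemigroup using (x∙yz≈y∙xz; interchange)

  module Search (_≟_ : ∀ x y → Dec (x ≈ y)) (T : ℕ) .{{_ : NonZero T}} (regular : ∀ x → x ^ T * x ≈ x) where

    idem : ∀ x → x ^ T * x ^ T ≈ x ^ T
    idem x = go T ≡.refl
      where
      go : ∀ t → t ≡ T → x ^ t * x ^ t ≈ x ^ t
      go zero e = *-identityˡ 1#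
      go (suc t) ≡.refl = trans (sym (*-assoc _ _ _)) (*-congʳ (regular x))

    record Below (e : Carrier) {k} (g : Fin k → Carrier) : Set where
      field
        e′      : Carrier
        below   : e′ * e ≈ e′
        e′-idem : e′ * e′ ≈ e′
        e′≉0    : ¬ e′ ≈ 0#
        split   : ∀ i → e′ * g i ≈ 0# ⊎ e′ * g i ^ T ≈ e′

    -- If e x^T is zero, then e kills x = x^T x. Otherwise e is replaced by the idempotent e x^T,
    -- below which x is a unit.
    search : ∀ {k} (g : Fin k → Carrier) e → e * e ≈ e → ¬ e ≈ 0# → Below e g
    search {zero} g e ee e≉0 = record { e′ = e ; below = ee ; e′-idem = ee ; e′≉0 = e≉0 ; split = λ () }
    search {suc k} g e ee e≉0 with (e * g Fin.zero ^ T) ≟ 0#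
    ... | yes z = record { e′ = e′ ; below = below ; e′-idem = e′-idem ; e′≉0 = e′≉0
                         ; split = λ { Fin.zero → inj₁ zero-case ; (Fin.suc i) → split i } }
      where
      open Below (search (g ∘ Fin.suc) e ee e≉0)
      x = g Fin.zero
      zero-case : e′ * x ≈ 0#
      zero-case = begin
        e′ * x                 ≈⟨ *-cong (sym below) (sym (regular x)) ⟩
        e′ * e * (x ^ T * x)   ≈⟨ trans (*-assoc _ _ _) (*-congˡ (sym (*-assoc _ _ _))) ⟩
        e′ * (e * x ^ T * x)   ≈⟨ *-congˡ (trans (*-congʳ z) (zeroˡ x)) ⟩
        e′ * 0#                ≈⟨ zeroʳ e′ ⟩
        0#                     ∎
    ... | no nz = record { e′ = e′ ; below = below′ ; e′-idem = e′-idem ; e′≉0 = e′≉0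
                         ; split = λ { Fin.zero → inj₂ unit-case ; (Fin.suc i) → split i } }
      where
      xT = g Fin.zero ^ T
      e₁ = e * xT
      e₁-idem : e₁ * e₁ ≈ e₁
      e₁-idem = trans (interchange e xT e xT) (*-cong ee (idem (g Fin.zero)))
      open Below (search (g ∘ Fin.suc) e₁ e₁-idem nz)
      below′ : e′ * e ≈ e′
      below′ = begin
        e′ * e              ≈⟨ *-congʳ (sym below) ⟩
        e′ * (e * xT) * e   ≈⟨ trans (*-assoc _ _ _) (*-congˡ (trans (*-comm _ _) (trans (sym (*-assoc _ _ _)) (*-congʳ ee)))) ⟩
        e′ * (e * xT)       ≈⟨ below ⟩
        e′                  ∎
      unit-case : e′ * xT ≈ e′
      unit-case = begin
        e′ * xT              ≈⟨ *-congʳ (sym below) ⟩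
        e′ * (e * xT) * xT   ≈⟨ trans (*-assoc _ _ _) (*-congˡ (trans (*-assoc _ _ _) (*-congˡ (idem (g Fin.zero))))) ⟩
        e′ * (e * xT)        ≈⟨ below ⟩
        e′                   ∎

  -- The ring e R is realised on the carrier of R by the coarser equality e x = e y, so that no
  -- subset has to be formed and the operations stay the same.
  module Localisation (e : Carrier) where

    localised : CommutativeRing 0ℓ 0ℓ
    localised = record
      { Carrier = Carrier
      ; _≈_ = λ x y → e * x ≈ e * y
      ; _+_ = _+_ ; _*_ = _*_ ; -_ = -_ ; 0# = 0# ; 1# = 1#
      ; isCommutativeRing = record
        { isRing = record
          { +-isAbelianGroup = record
            { isGroup = record
              { isMonoid = record
                { isSemigroup = record
                  { isMagma = record
                    { isEquivalence = record { refl = refl ; sym = sym ; trans = trans }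
                    ; ∙-cong = λ f g → trans (distribˡ _ _ _) (trans (+-cong f g) (sym (distribˡ _ _ _))) }
                  ; assoc = λ x y z → *-congˡ (+-assoc x y z) }
                ; identity = (λ x → *-congˡ (+-identityˡ x)) , (λ x → *-congˡ (+-identityʳ x)) }
              ; inverse = (λ x → *-congˡ (-‿inverseˡ x)) , (λ x → *-congˡ (-‿inverseʳ x))
              ; ⁻¹-cong = λ f → trans (sym (-‿distribʳ-* _ _)) (trans (-‿cong f) (-‿distribʳ-* _ _)) }
            ; comm = λ x y → *-congˡ (+-comm x y) }
          ; *-cong = λ {x} {y} {u} {v} f g → begin
              e * (x * u)   ≈⟨ sym (*-assoc _ _ _) ⟩
              e * x * u     ≈⟨ *-congʳ f ⟩
              e * y * u     ≈⟨ trans (*-assoc _ _ _) (x∙yz≈y∙xz _ _ _) ⟩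
              y * (e * u)   ≈⟨ *-congˡ g ⟩
              y * (e * v)   ≈⟨ x∙yz≈y∙xz _ _ _ ⟩
              e * (y * v)   ∎
          ; *-assoc = λ x y z → *-congˡ (*-assoc x y z)
          ; *-identity = (λ x → *-congˡ (*-identityˡ x)) , (λ x → *-congˡ (*-identityʳ x))
          ; distrib = (λ x y z → *-congˡ (distribˡ x y z)) , (λ x y z → *-congˡ (distribʳ x y z)) }
        ; *-comm = λ x y → *-congˡ (*-comm x y) }
      }

module GroupRingFrobenius (F : CommutativeRing 0ℓ 0ℓ) (n : ℕ) .{{_ : NonZero n}} where
  open CommutativeRing F
  open import Algebra.Properties.Semiring.Mult semiring renaming (_×_ to infixr 8 _×ₙ_)
  module Fexp = Exponent semiring
  open Sums F
  open GroupRing F n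
  module GR = CommutativeRing commutativeRing
  module GS = Sums commutativeRing
  module GE = Exponent GR.semiring
  module GM = Multiple GR.semiring
  module R = Reasoning setoid

  emb : Carrier → Elt
  emb c k = c * δ 0 k

  emb-* : ∀ c d → emb (c * d) ≋ emb c ⋆ emb d
  emb-* c d k = trans (*-assoc _ _ _) (sym (scalar-⋆ c (emb d) k))

  emb-^ : ∀ c m → emb c GE.^ m ≋ emb (c Fexp.^ m)
  emb-^ c zero k = sym (*-identityˡ _)
  emb-^ c (suc m) k = trans (⋆-cong {u = emb c} (λ _ → refl) (emb-^ c m) k) (sym (emb-* c (c Fexp.^ m) k))

  δ-^ : ∀ a m → δ a GE.^ m ≋ δ (m ℕ.* a)
  δ-^ a zero k = refl
  δ-^ a (suc m) k = trans (⋆-cong {u = δ a} (λ _ → refl) (δ-^ a m) k) (δ-⋆ a (m ℕ.* a) k)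

  sum-at : ∀ {l} (f : Fin l → Elt) k → GS.sum f k ≈ sum (λ i → f i k)
  sum-at {zero} f k = trans (GR.reflexive (GS.sum-zero f) k) (sym (reflexive (sum-zero _)))
  sum-at {suc l} f k = trans (GR.reflexive (GS.sum-suc f) k) (trans (+-congˡ (sum-at (f ∘ Fin.suc) k)) (sym (reflexive (sum-suc _))))

  ×-at : ∀ m (u : Elt) k → (m GM.× u) k ≈ m ×ₙ u k
  ×-at zero u k = refl
  ×-at (suc m) u k = +-congˡ (×-at m u k)

  expand : ∀ u → u ≋ GS.sum (λ j → emb (u j) ⋆ δ (toℕ j))
  expand u k = sym (trans (sum-at (λ j → emb (u j) ⋆ δ (toℕ j)) k) (trans (sum-cong (λ j → trans (scalar-⋆ (u j) (δ (toℕ j)) k)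
    (trans (*-comm _ _) (*-congʳ (reflexive (≡.cong (λ t → ind t k) (toℕ-mod-self j))))))) (push-id {f = λ j → j} (λ _ → ≡.refl) u k)))

  module _ {p} (pr : Prime p) (char : p ×ₙ 1# ≈ 0#) (κ : ℕ) (fixed : ∀ c → c Fexp.^ (p ℕ.^ κ) ≈ c) where

    GR-char : p GM.× GR.1# GR.≈ GR.0#
    GR-char k = trans (×-at p (δ 0) k) (CharP.×-char F pr char (δ 0 k) ℕ.∣-refl)

    -- When the p^κ-th power fixes the coefficients, raising to that power only substitutes x^(p^κ)
    -- for x.
    frobenius : ∀ u → u GE.^ (p ℕ.^ κ) ≋ push (λ j → (p ℕ.^ κ ℕ.* toℕ j) mod n) u
    frobenius u k = begin
      (u GE.^ N) k
        ≈⟨ GE.^-congˡ N (expand u) k ⟩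
      (GS.sum (λ j → emb (u j) ⋆ δ (toℕ j)) GE.^ N) k
        ≈⟨ CharP.frobenius-sum commutativeRing pr GR-char κ (λ j → emb (u j) ⋆ δ (toℕ j)) k ⟩
      GS.sum (λ j → (emb (u j) ⋆ δ (toℕ j)) GE.^ N) k
        ≈⟨ sum-at (λ j → (emb (u j) ⋆ δ (toℕ j)) GE.^ N) k ⟩
      sum (λ j → ((emb (u j) ⋆ δ (toℕ j)) GE.^ N) k)
        ≈⟨ sum-cong term ⟩
      push (λ j → (N ℕ.* toℕ j) mod n) u k ∎
      where
      open R
      N = p ℕ.^ κ
      term : ∀ j → ((emb (u j) ⋆ δ (toℕ j)) GE.^ N) k ≈ ind ((N ℕ.* toℕ j) mod n) k * u j
      term j = begin
        ((emb (u j) ⋆ δ (toℕ j)) GE.^ N) k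
          ≈⟨ CommutativeExponent.^-distrib-* GR.commutativeSemiring (emb (u j)) (δ (toℕ j)) N k ⟩
        (emb (u j) GE.^ N ⋆ δ (toℕ j) GE.^ N) k
          ≈⟨ ⋆-cong (GR.trans (emb-^ (u j) N) (λ l → *-congʳ (fixed (u j)))) (δ-^ (toℕ j) N) k ⟩
        (emb (u j) ⋆ δ (N ℕ.* toℕ j)) k
          ≈⟨ scalar-⋆ (u j) (δ (N ℕ.* toℕ j)) k ⟩
        u j * ind ((N ℕ.* toℕ j) mod n) k
          ≈⟨ *-comm _ _ ⟩
        ind ((N ℕ.* toℕ j) mod n) k * u j ∎

module PowerOne (R : CommutativeRing 0ℓ 0ℓ) where
  open CommutativeRing R
  open Exponent semiring
  open import Relation.Binary.Reasoning.Setoid setoid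

  1^ : ∀ m → 1# ^ m ≈ 1#
  1^ zero = refl
  1^ (suc m) = trans (*-identityˡ _) (1^ m)

  power-∣ : ∀ x {a b} → x ^ a ≈ 1# → a ∣ b → x ^ b ≈ 1#
  power-∣ x {a} e (divides k ≡.refl) = begin
    x ^ (k ℕ.* a)   ≈⟨ ^-congʳ x (ℕ.*-comm k a) ⟩
    x ^ (a ℕ.* k)   ≈⟨ sym (^-assocʳ x a k) ⟩
    (x ^ a) ^ k     ≈⟨ ^-congˡ k e ⟩
    1# ^ k          ≈⟨ 1^ k ⟩
    1#              ∎

  power-∸ : ∀ x {a b c} → x ^ b ≈ 1# → x ^ c ≈ 1# → a ℕ.+ b ≡ c → x ^ a ≈ 1#
  power-∸ x {a} {b} e f ≡.refl = begin
    x ^ a             ≈⟨ sym (*-identityʳ _) ⟩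
    x ^ a * 1#        ≈⟨ *-congˡ (sym e) ⟩
    x ^ a * x ^ b     ≈⟨ sym (^-homo-* x a b) ⟩
    x ^ (a ℕ.+ b)     ≈⟨ f ⟩
    1#                ∎

  power-gcd : ∀ x a b → x ^ a ≈ 1# → x ^ b ≈ 1# → x ^ gcd a b ≈ 1#
  power-gcd x a b e f with ℕ.Bézout.identity (ℕ.gcd-GCD a b)
  ... | ℕ.Bézout.Identity.+- u v eq = power-∸ x {gcd a b} {v ℕ.* b} {u ℕ.* a} (power-∣ x {b} f (ℕ.n∣m*n v)) (power-∣ x {a} e (ℕ.n∣m*n u)) eq
  ... | ℕ.Bézout.Identity.-+ u v eq = power-∸ x {gcd a b} {u ℕ.* a} {v ℕ.* b} (power-∣ x {a} e (ℕ.n∣m*n u)) (power-∣ x {b} f (ℕ.n∣m*n v)) eq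

  power-% : ∀ x n .{{_ : NonZero n}} → x ^ n ≈ 1# → ∀ a → x ^ (a % n) ≈ x ^ a
  power-% x n e a = begin
    x ^ (a % n)                               ≈⟨ sym (*-identityʳ _) ⟩
    x ^ (a % n) * 1#                          ≈⟨ *-congˡ (sym (power-∣ x {n} e (ℕ.n∣m*n (a / n)))) ⟩
    x ^ (a % n) * x ^ ((a / n) ℕ.* n)         ≈⟨ sym (^-homo-* x (a % n) _) ⟩
    x ^ (a % n ℕ.+ (a / n) ℕ.* n)             ≈⟨ ^-congʳ x (≡.sym (ℕ.m≡m%n+[m/n]*n a n)) ⟩
    x ^ a                                     ∎

-- `power` stands for the field axiom: it distinguishes 0 from the rest and yields the inverse
-- x^(Q-1).
record SplittingField {q : ℕ} (F : FiniteField q) (Q : ℕ) : Set₁ where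
  private module F = FiniteField F
  field
    K : CommutativeRing 0ℓ 0ℓ
  open CommutativeRing K public
  open Exponent semiring public
  field
    _≟_   : ∀ x y → Dec (x ≈ y)
    1≉0   : ¬ 1# ≈ 0#
    power : ∀ x → x ≈ 0# ⊎ x ^ Q ≈ 1#
    ζ     : Carrier
    ζ^Q   : ζ ^ Q ≈ 1#
    ζ-order : ∀ t → ζ ^ t ≈ 1# → Q ∣ t
    emb   : F.Carrier → Carrier
    emb-cong : ∀ {c d} → c F.≈ d → emb c ≈ emb d
    emb-+ : ∀ c d → emb (c F.+ d) ≈ emb c + emb d
    emb-* : ∀ c d → emb (c F.* d) ≈ emb c * emb d
    emb-1 : emb F.1# ≈ 1#

-- F[x]/(x^Q - 1) is a product of fields, and x has order less than Q exactly in those where x^(Q/r)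
-- = 1 for some prime r dividing Q. The product s of all 1 - x^(Q/r) vanishes in these; since s is
-- not 0, another factor remains.
module Splitting {q : ℕ} (F : FiniteField q) {p κ} (pr : Prime p) (q≡p^κ : q ≡ p ℕ.^ κ)
                 (m Q : ℕ) .{{_ : NonZero Q}} (Q+1≡q^m : suc Q ≡ q ℕ.^ m) where
  open FiniteField F
  open FiniteFieldProperties F
  open Sums commRing
  open GroupRing commRing Q
  open GroupRingFrobenius commRing Q hiding (emb)
  module GP = RingProperties GR.ring
  module FE = Exponent semiring

  ι : ℕ → Elt
  ι c k = δ 0 k - δ c k

  ι⋆ : ∀ c u k → (ι c ⋆ u) k ≈ u k - (δ c ⋆ u) k
  ι⋆ c u k = trans (⋆-distribʳ u (δ 0) (λ l → - δ c l) k) (+-cong (⋆-identityˡ u k) (sym (GP.-‿distribˡ-* (δ c) u k)))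

  ι⋆-vanish : ∀ c u k → u k ≈ 0# → (∀ v → (c ℕ.+ toℕ v) mod Q ≡ k → u v ≈ 0#) → (ι c ⋆ u) k ≈ 0#
  ι⋆-vanish c u k e f = trans (ι⋆ c u k) (trans (+-cong e (-‿cong (trans (δ⋆ c u k) (push-outside _ u k f)))) (-‿inverseʳ 0#))

  -- The partial products of ∏ (1 - x ^ (Q / r)) over primes r ∣ Q are supported on
  -- multiples of Q / M, M the product of the primes used, so the coefficient at 0 stays 1.
  record Stage (j : ℕ) : Set where
    field
      M : ℕ
      P : Elt
      coef-0  : P (0 mod Q) ≈ 1#
      support : ∀ k → ¬ Q ∣ M ℕ.* toℕ k → P k ≈ 0#
      primes  : ∀ r → Prime r → r ∣ M → r ℕ.≤ j
      factor  : ∀ r → Prime r → r ℕ.≤ j → ∀ c → c ℕ.* r ≡ Q → ∃ λ y → P ≋ ι c ⋆ y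

  stage : ∀ j → Stage j
  stage zero = record
    { M = 1 ; P = δ 0 ; coef-0 = ind-≡ {i = 0 mod Q} ≡.refl
    ; support = λ k ¬d → ind-≢ {i = 0 mod Q} {k} λ e → ¬d (≡.subst (Q ∣_)
        (≡.sym (≡.trans (ℕ.*-identityˡ _) (≡.trans (≡.cong toℕ (≡.sym e)) (≡.trans (toℕ-mod 0 Q) (ℕ.m*n%n≡0 0 Q))))) (Q ℕ.∣0))
    ; primes = λ r rp d → ⊥-elim (¬prime[1] (≡.subst Prime (ℕ.∣1⇒≡1 d) rp))
    ; factor = λ r rp r≤0 → ⊥-elim (¬prime[0] (≡.subst Prime (ℕ.n≤0⇒n≡0 r≤0) rp)) }
  stage (suc j) with prime? (suc j) ×-dec (suc j ℕ.∣? Q)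
  ... | no skip = record { Stage S
      ; primes = λ r rp d → ℕ.m≤n⇒m≤1+n (primes r rp d)
      ; factor = factor′ }
    where
    S = stage j
    open Stage S
    factor′ : ∀ r → Prime r → r ℕ.≤ suc j → ∀ c → c ℕ.* r ≡ Q → ∃ λ y → P ≋ ι c ⋆ y
    factor′ r rp r≤ c e with ℕ.m≤n⇒m<n∨m≡n r≤
    ... | inj₁ r<  = factor r rp (ℕ.s≤s⁻¹ r<) c e
    ... | inj₂ ≡.refl = ⊥-elim (skip (rp , divides c (≡.sym e)))
  ... | yes (rp , divides c₀ Q≡) = record
      { M = M ℕ.* suc j ; P = ι c₀ ⋆ P
      ; coef-0 = trans (ι⋆ c₀ P (0 mod Q)) (trans (+-cong coef-0 (-‿cong (trans (δ⋆ c₀ P (0 mod Q)) (push-outside _ P (0 mod Q) shifted))))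
          (trans (+-congˡ -0≈0) (+-identityʳ 1#)))
      ; support = λ k ¬d → ι⋆-vanish c₀ P k
          (support k (λ d → ¬d (≡.subst (Q ∣_) (swap M (toℕ k)) (ℕ.∣m⇒∣m*n (suc j) d))))
          (λ v e → support v (λ d → ¬d (≡.subst (λ t → Q ∣ M ℕ.* suc j ℕ.* toℕ t) e (∣-mod (M ℕ.* suc j) (c₀ ℕ.+ toℕ v)
             (≡.subst (Q ∣_) (≡.sym (expand-M (toℕ v))) (ℕ.∣m∣n⇒∣m+n (ℕ.n∣m*n M) (ℕ.∣m⇒∣m*n (suc j) d)))))))
      ; primes = primes′
      ; factor = factor′ }
    where
    S = stage j
    open Stage S
    open import Algebra.Properties.Group +-group using () renaming (ε⁻¹≈ε to -0≈0)
    swap : ∀ a b → a ℕ.* b ℕ.* suc j ≡ a ℕ.* suc j ℕ.* b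
    swap a b = +-*-Solver.solve 3 (λ a b r → a :* b :* r := a :* r :* b) ≡.refl a b (suc j)
      where open +-*-Solver
    expand-M : ∀ v → M ℕ.* suc j ℕ.* (c₀ ℕ.+ v) ≡ M ℕ.* Q ℕ.+ M ℕ.* v ℕ.* suc j
    expand-M v = ≡.trans (+-*-Solver.solve 4 (λ a r c v → a :* r :* (c :+ v) := a :* (c :* r) :+ a :* v :* r) ≡.refl M (suc j) c₀ v)
      (≡.cong (λ t → M ℕ.* t ℕ.+ M ℕ.* v ℕ.* suc j) (≡.sym Q≡))
      where open +-*-Solver
    ∣-mod : ∀ a b → Q ∣ a ℕ.* b → Q ∣ a ℕ.* toℕ (b mod Q)
    ∣-mod a b d = ≡.subst (λ t → Q ∣ a ℕ.* t) (≡.sym (toℕ-mod b Q)) (ℕ.m%n≡0⇒n∣m _ Q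
      (≡.trans (%-*ʳ a b) (ℕ.n∣m⇒m%n≡0 _ Q d)))
    instance
      c₀≢0 : NonZero c₀
      c₀≢0 = ℕ.m*n≢0⇒m≢0 c₀ {{≡.subst NonZero Q≡ (ℕ.≢-nonZero (ℕ.≢-nonZero⁻¹ Q))}}
    r∤M : ¬ suc j ∣ M
    r∤M d = ℕ.<-irrefl ≡.refl (primes (suc j) rp d)
    -- An exponent v ≡ -c₀ in the support would make Q = c₀ r divide M c₀, hence r divide M,
    -- although r exceeds all primes dividing M. So the shifted copy leaves the coefficient at 0
    -- alone.
    shifted : ∀ v → (c₀ ℕ.+ toℕ v) mod Q ≡ 0 mod Q → P v ≈ 0#
    shifted v e = support v λ d → r∤M (ℕ.*-cancelˡ-∣ c₀ (≡.subst₂ _∣_ Q≡ (ℕ.*-comm M c₀)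
      (ℕ.∣m+n∣m⇒∣n (≡.subst (Q ∣_) (≡.trans (ℕ.*-distribˡ-+ M c₀ (toℕ v)) (ℕ.+-comm (M ℕ.* c₀) _))
         (ℕ.∣n⇒∣m*n M (ℕ.m%n≡0⇒n∣m _ Q (≡.trans (mod-injective Q e) (ℕ.m*n%n≡0 0 Q))))) d)))
    primes′ : ∀ r → Prime r → r ∣ M ℕ.* suc j → r ℕ.≤ suc j
    primes′ r rp′ d with euclidsLemma M (suc j) rp′ d
    ... | inj₁ d′ = ℕ.m≤n⇒m≤1+n (primes r rp′ d′)
    ... | inj₂ d′ = ℕ.∣⇒≤ d′
    factor′ : ∀ r → Prime r → r ℕ.≤ suc j → ∀ c → c ℕ.* r ≡ Q → ∃ λ y → ι c₀ ⋆ P ≋ ι c ⋆ y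
    factor′ r rp′ r≤ c e with ℕ.m≤n⇒m<n∨m≡n r≤
    ... | inj₂ ≡.refl rewrite ℕ.*-cancelʳ-≡ c c₀ (suc j) (≡.trans e Q≡) = P , λ _ → refl
    ... | inj₁ r<  with factor r rp′ (ℕ.s≤s⁻¹ r<) c e
    ...   | y , P≋ = ι c₀ ⋆ y , GR.trans (GR.*-congˡ {ι c₀} P≋)
              (GR.trans (GR.sym (⋆-assoc (ι c₀) (ι c) y)) (GR.trans (GR.*-congʳ {y} (⋆-comm (ι c₀) (ι c))) (⋆-assoc (ι c) (ι c₀) y)))

  open Stage (stage Q) using (coef-0; factor) renaming (P to s)

  s≉0 : ¬ s ≋ (λ _ → 0#)
  s≉0 e = 0≉1 (trans (sym (e (0 mod Q))) coef-0)

  q^m-fixed : ∀ c → c FE.^ (p ℕ.^ (κ ℕ.* m)) ≈ c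
  q^m-fixed c = trans (FE.^-congʳ c (≡.trans (≡.sym (ℕ.^-*-assoc p κ m)) (≡.cong (ℕ._^ m) (≡.sym q≡p^κ)))) (go m)
    where
    instance
      q≢0 : NonZero q
      q≢0 = ≡.subst NonZero (≡.sym q≡p^κ) (ℕ.m^n≢0 p κ {{prime⇒nonZero pr}})
    go : ∀ m → c FE.^ (q ℕ.^ m) ≈ c
    go zero = *-identityʳ c
    go (suc m) = trans (sym (FE.^-assocʳ c q (q ℕ.^ m))) (trans (FE.^-congˡ (q ℕ.^ m) (fermat c)) (go m))

  -- Raising to the power Q + 1 = q^m fixes the coefficients and, as q^m ≡ 1 modulo Q, the exponents
  -- as well.
  regular : ∀ x → (x GE.^ Q) ⋆ x ≋ x
  regular x = GR.trans (⋆-comm (x GE.^ Q) x) (GR.trans (GE.^-congʳ x size)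
    (GR.trans (frobenius pr (characteristic p κ q≡p^κ) (κ ℕ.* m) q^m-fixed x) (push-id fixed-index x)))
    where
    size : suc Q ≡ p ℕ.^ (κ ℕ.* m)
    size = ≡.trans Q+1≡q^m (≡.trans (≡.cong (ℕ._^ m) q≡p^κ) (ℕ.^-*-assoc p κ m))
    fixed-index : ∀ v → (p ℕ.^ (κ ℕ.* m) ℕ.* toℕ v) mod Q ≡ v
    fixed-index v = ≡.trans (mod-cong Q (≡.trans (≡.cong (λ t → (t ℕ.* toℕ v) % Q) (≡.sym size))
      (≡.trans (≡.cong (_% Q) (≡.cong (toℕ v ℕ.+_) (ℕ.*-comm Q (toℕ v)))) (ℕ.[m+kn]%n≡m%n (toℕ v) (toℕ v) Q)))) (toℕ-mod-self v)

  _≟G_ : ∀ (u w : Elt) → Dec (u ≋ w)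
  u ≟G w = Fin.all? (λ k → u k ≟F w k)

  elements : Fin (q ℕ.^ Q) → Elt
  elements i k = enum (Fin.finToFun i k)

  elements-surj : ∀ u → ∃ λ i → elements i ≋ u
  elements-surj u = Fin.funToFin (index ∘ u) , λ k →
    trans (reflexive (≡.cong enum (Fin.finToFun-funToFin (index ∘ u) k))) (enum-index (u k))

  open ResidueField commutativeRing
  open Search _≟G_ Q regular

  -- The idempotent that generates the same ideal as s; below it, s is invertible.
  s^Q : Elt
  s^Q = s GE.^ Q

  s^Q≉0 : ¬ s^Q ≋ (λ _ → 0#)
  s^Q≉0 e = s≉0 (GR.trans (GR.sym (regular s)) (GR.trans (GR.*-congʳ {s} e) (GR.zeroˡ s)))

  module Assemble (B : Below s^Q elements) where
    open Below B renaming (e′ to e)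
    open Localisation e

    splittingField : SplittingField F Q
    splittingField = record
      { K = localised
      ; _≟_ = λ x y → (e ⋆ x) ≟G (e ⋆ y)
      ; 1≉0 = 1≉0
      ; power = power
      ; ζ = δ 1
      ; ζ^Q = ζ^Q
      ; ζ-order = ζ-order
      ; emb = emb
      ; emb-cong = λ f → GR.*-congˡ {e} (λ k → *-congʳ f)
      ; emb-+ = λ c d → GR.*-congˡ {e} (λ k → distribʳ _ _ _)
      ; emb-* = λ c d → GR.*-congˡ {e} (GRF.emb-* c d)
      ; emb-1 = GR.*-congˡ {e} (λ k → *-identityˡ _)
      }
      where
      module GRF = GroupRingFrobenius commRing Q
      open GRF using (emb)
      module K = CommutativeRing localised
      module KE = Exponent K.semiring
      open PowerOne localised
      -- Not definitional: the two exponentiations are over different raw monoids.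
      ^-same : ∀ x m → x KE.^ m K.≈ x GE.^ m
      ^-same x zero = K.refl {GR.1#}
      ^-same x (suc m) = K.*-congˡ {x} {x KE.^ m} {x GE.^ m} (^-same x m)
      δ^ : ∀ m → δ 1 KE.^ m K.≈ δ m
      δ^ m = K.trans {δ 1 KE.^ m} {δ 1 GE.^ m} {δ m} (^-same (δ 1) m)
        (GR.*-congˡ {e} (GR.trans (δ-^ 1 m) (δ-% (≡.cong (_% Q) (ℕ.*-identityʳ m)))))
      ζ^Q : δ 1 KE.^ Q K.≈ K.1#
      ζ^Q = K.trans {δ 1 KE.^ Q} {δ Q} {δ 0} (δ^ Q) (GR.*-congˡ {e} (δ-% (≡.trans (ℕ.n%n≡0 Q) (≡.sym (ℕ.m*n%n≡0 0 Q)))))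
      1≉0 : ¬ K.1# K.≈ K.0#
      1≉0 f = e′≉0 (GR.trans (GR.sym (GR.*-identityʳ e)) (GR.trans f (GR.zeroʳ e)))
      power : ∀ x → x K.≈ K.0# ⊎ x KE.^ Q K.≈ K.1#
      power x with elements-surj x
      ... | i , xi with split i
      ...   | inj₁ z = inj₁ (GR.trans (GR.*-congˡ {e} (GR.sym xi)) (GR.trans z (GR.sym (GR.zeroʳ e))))
      ...   | inj₂ z = inj₂ (GR.trans (GR.trans (^-same x Q) (GR.*-congˡ {e} {x GE.^ Q} {elements i GE.^ Q} (GE.^-congˡ Q {x} {elements i} (GR.sym xi)))) (GR.trans z (GR.sym (GR.*-identityʳ e))))
      s-unit : s KE.^ Q K.≈ K.1#
      s-unit = GR.trans (^-same s Q) (GR.trans below (GR.sym (GR.*-identityʳ e)))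
      -- The relation ζ^c = 1 would kill the factor 1 - x^c of s, whereas s^Q = 1 in the localised
      -- ring.
      proper : ∀ r → Prime r → ∀ c → c ℕ.* r ≡ Q → ¬ δ 1 KE.^ c K.≈ K.1#
      proper r rp c cr≡Q f with factor r rp (ℕ.∣⇒≤ (divides c (≡.sym cr≡Q))) c cr≡Q
      ... | y , s≋ = 1≉0 (K.trans {K.1#} {s KE.^ Q} {K.0#} (K.sym {s KE.^ Q} {K.1#} s-unit) (K.trans {s KE.^ Q} {K.0# KE.^ Q} {K.0#} (KE.^-congˡ Q {s} {K.0#} s~0) (0^ Q)))
        where
        0^ : ∀ t .{{_ : NonZero t}} → K.0# KE.^ t K.≈ K.0#
        0^ (suc t) = K.zeroˡ (K.0# KE.^ t)
        ι~0 : ι c K.≈ K.0#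
        ι~0 = K.trans {ι c} {δ 0 GR.- δ 0} {K.0#} (K.+-congˡ {K.1#} {GR.- δ c} {GR.- K.1#} (K.-‿cong {δ c} {K.1#} (K.trans {δ c} {δ 1 KE.^ c} {K.1#} (K.sym {δ 1 KE.^ c} {δ c} (δ^ c)) f))) (K.-‿inverseʳ K.1#)
        s~0 : s K.≈ K.0#
        s~0 = K.trans {s} {ι c ⋆ y} {K.0#} (GR.*-congˡ {e} s≋) (K.trans {ι c ⋆ y} {K.0# ⋆ y} {K.0#} (K.*-congʳ {y} {ι c} {K.0#} ι~0) (K.zeroˡ y))
      ζ-order : ∀ t → δ 1 KE.^ t K.≈ K.1# → Q ∣ t
      -- With g = gcd(t,Q) also ζ^g = 1. If g were a proper divisor of Q, a prime r dividing Q / g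
      -- would give ζ^(Q/r) = 1.
      ζ-order t f with ℕ.gcd[m,n]∣n t Q
      ... | divides c Q≡cg with c ℕ.≟ 1
      ...   | yes ≡.refl = ≡.subst (_∣ t) (≡.sym (≡.trans Q≡cg (ℕ.*-identityˡ (gcd t Q)))) (ℕ.gcd[m,n]∣m t Q)
      ...   | no c≢1 with prime-divisor c {{ℕ.m*n≢0⇒m≢0 c {{≡.subst NonZero Q≡cg (ℕ.≢-nonZero (ℕ.≢-nonZero⁻¹ Q))}}}} c≢1
      ...     | r , rp , divides d c≡dr = ⊥-elim (proper r rp (d ℕ.* g)
                  (≡.trans (+-*-Solver.solve 3 (λ d g r → d :* g :* r := d :* r :* g) ≡.refl d g r) (≡.trans (≡.cong (ℕ._* g) (≡.sym c≡dr)) (≡.sym Q≡cg)))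
                  (power-∣ (δ 1) {gcd t Q} (power-gcd (δ 1) t Q f ζ^Q) (ℕ.n∣m*n d)))
        where
        open +-*-Solver
        g = gcd t Q

  abstract
    splittingField : SplittingField F Q
    splittingField = Assemble.splittingField (search elements s^Q (idem s) s^Q≉0)

-- Fourier transform over a splitting field of x ^ Q - 1

module FourierTransform {q : ℕ} (F : FiniteField q) {p κ} (pr : Prime p) (q≡p^κ : q ≡ p ℕ.^ κ)
         {m Q : ℕ} .{{_ : NonZero κ}} .{{_ : NonZero m}} .{{_ : NonZero Q}} (Q+1≡q^m : suc Q ≡ q ℕ.^ m)
         (S : SplittingField F Q) where
  private
    module F = FiniteField F
    module FE = Exponent F.semiring
    module FM = Multiple F.semiring
    module FS = Sums F.commRing
  open FiniteFieldProperties F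
  open SplittingField S
  open CommutativeExponent commutativeSemiring using (^-distrib-*)
  open Multiple semiring using () renaming (_×_ to infixr 8 _×ₙ_; ×-homo-+ to ×ₙ-homo-+; ×-homo-1 to ×ₙ-homo-1; ×-congˡ to ×ₙ-congˡ; ×-assocˡ to ×ₙ-assocˡ; ×-congʳ to ×ₙ-congʳ)
  open RingProperties ring using (-‿distribˡ-*)
  open GroupProperties +-group using () renaming (∙-cancelˡ to +-cancelˡ; x∙y⁻¹≈ε⇒x≈y to x-y≈0⇒x≈y)
  open Sums K
  open PowerOne K
  open Reasoning setoid

  instance
    q≢0 : NonZero q
    q≢0 = ≡.subst NonZero (≡.sym q≡p^κ) (ℕ.m^n≢0 p κ {{prime⇒nonZero pr}})

  inv : Carrier → Carrier
  inv x = x ^ ℕ.pred Q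

  inv-right : ∀ x → ¬ x ≈ 0# → x * inv x ≈ 1#
  inv-right x x≉0 with power x
  ... | inj₁ z = ⊥-elim (x≉0 z)
  ... | inj₂ e = trans (^-congʳ x (ℕ.suc-pred Q)) e

  cancelˡ : ∀ x {y z} → ¬ x ≈ 0# → x * y ≈ x * z → y ≈ z
  cancelˡ x {y} {z} x≉0 e = trans (un y) (trans (*-congˡ e) (sym (un z)))
    where
    un : ∀ t → t ≈ inv x * (x * t)
    un t = trans (sym (*-identityˡ t)) (trans (*-congʳ (sym (trans (*-comm _ _) (inv-right x x≉0)))) (*-assoc _ _ _))

  emb-0 : emb F.0# ≈ 0#
  emb-0 = +-cancelˡ (emb F.0#) _ _ (trans (sym (emb-+ _ _)) (trans (emb-cong (F.+-identityˡ _)) (sym (+-identityʳ _))))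

  emb-sum : ∀ {k} (f : Fin k → F.Carrier) → emb (FS.sum f) ≈ sum (emb ∘ f)
  emb-sum {zero} f = trans (emb-cong (F.reflexive (FS.sum-zero f))) (trans emb-0 (sym (reflexive (sum-zero _))))
  emb-sum {suc k} f = trans (emb-cong (F.reflexive (FS.sum-suc f))) (trans (emb-+ _ _) (trans (+-congˡ (emb-sum (f ∘ Fin.suc))) (sym (reflexive (sum-suc _)))))

  emb-^ : ∀ c k → emb (c FE.^ k) ≈ emb c ^ k
  emb-^ c zero = emb-1
  emb-^ c (suc k) = trans (emb-* _ _) (*-congˡ (emb-^ c k))

  emb-× : ∀ k → emb (k FM.× F.1#) ≈ k ×ₙ 1#
  emb-× zero = emb-0
  emb-× (suc k) = trans (emb-+ _ _) (+-cong emb-1 (emb-× k))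

  emb-inj : ∀ {c d} → emb c ≈ emb d → c F.≈ d
  emb-inj {c} {d} e with (c F.- d) ≟F F.0#
  ... | yes z = GroupProperties.x∙y⁻¹≈ε⇒x≈y F.+-group c d z
  ... | no nz = ⊥-elim (1≉0 (begin
      1#                                      ≈⟨ sym emb-1 ⟩
      emb F.1#                                ≈⟨ emb-cong (F.sym (proj₂ (F.inverse _ nz))) ⟩
      emb ((c F.- d) F.* i)                   ≈⟨ emb-* _ _ ⟩
      emb (c F.- d) * emb i                   ≈⟨ *-congʳ (trans (emb-+ c (F.- d)) (trans (+-congʳ e) (trans (sym (emb-+ d (F.- d))) (trans (emb-cong (F.-‿inverseʳ d)) emb-0)))) ⟩
      0# * emb i                              ≈⟨ zeroˡ _ ⟩
      0#                                      ∎))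
    where i = proj₁ (F.inverse _ nz)

  charK : p ×ₙ 1# ≈ 0#
  charK = trans (sym (emb-× p)) (trans (emb-cong (characteristic p κ q≡p^κ)) emb-0)

  -- Q + 1 = q^m is 0 in characteristic p, so Q acts as -1.
  Q×1≉0 : ¬ Q ×ₙ 1# ≈ 0#
  Q×1≉0 e = 1≉0 (begin
    1#                  ≈⟨ sym (+-identityʳ 1#) ⟩
    1# + 0#             ≈⟨ +-congˡ (sym e) ⟩
    suc Q ×ₙ 1#         ≈⟨ CharP.×-char K pr charK 1# (≡.subst (p ∣_) (≡.sym Q+1≡q^m) p∣q^m) ⟩
    0#                  ∎)
    where
    p∣p^ : ∀ k → .{{_ : NonZero k}} → p ∣ p ℕ.^ k
    p∣p^ (suc k) = ℕ.m∣m*n (p ℕ.^ k)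
    q∣q^ : ∀ k → .{{_ : NonZero k}} → q ∣ q ℕ.^ k
    q∣q^ (suc k) = ℕ.m∣m*n (q ℕ.^ k)
    p∣q^m : p ∣ q ℕ.^ m
    p∣q^m = ℕ.∣-trans (≡.subst (p ∣_) (≡.sym q≡p^κ) (p∣p^ κ)) (q∣q^ m)

  geometric : ∀ y k → sum {k} (λ j → y ^ toℕ j) + y ^ k ≈ 1# + y * sum {k} (λ j → y ^ toℕ j)
  geometric y zero = trans (+-comm _ _) (+-congˡ (trans (reflexive (sum-zero _)) (trans (sym (zeroʳ y)) (*-congˡ (sym (reflexive (sum-zero _)))))))
  geometric y (suc k) = begin
    sum {suc k} (λ j → y ^ toℕ j) + y ^ suc k      ≈⟨ +-congʳ step ⟩
    1# + y * G + y * y ^ k                         ≈⟨ +-assoc _ _ _ ⟩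
    1# + (y * G + y * y ^ k)                       ≈⟨ +-congˡ (sym (distribˡ y G (y ^ k))) ⟩
    1# + y * (G + y ^ k)                           ≈⟨ +-congˡ (*-congˡ (geometric y k)) ⟩
    1# + y * (1# + y * G)                          ≈⟨ +-congˡ (*-congˡ (sym step)) ⟩
    1# + y * sum {suc k} (λ j → y ^ toℕ j)         ∎
    where
    G = sum {k} (λ j → y ^ toℕ j)
    step : sum {suc k} (λ j → y ^ toℕ j) ≈ 1# + y * G
    step = trans (reflexive (sum-suc _)) (+-congˡ (sym (*-sum y (λ j → y ^ toℕ j))))

  geometric-0 : ∀ y k → y ^ k ≈ 1# → ¬ y ≈ 1# → sum {k} (λ j → y ^ toℕ j) ≈ 0#
  geometric-0 y k e y≉1 = cancelˡ (1# - y) (λ z → y≉1 (sym (x-y≈0⇒x≈y _ _ z))) (begin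
    (1# - y) * G           ≈⟨ trans (distribʳ G 1# (- y)) (+-cong (*-identityˡ G) (sym (-‿distribˡ-* y G))) ⟩
    G - y * G              ≈⟨ +-congʳ G≈yG ⟩
    y * G - y * G          ≈⟨ -‿inverseʳ _ ⟩
    0#                     ≈⟨ sym (zeroʳ _) ⟩
    (1# - y) * 0#          ∎)
    where
    G = sum {k} (λ j → y ^ toℕ j)
    G≈yG : G ≈ y * G
    G≈yG = +-cancelˡ 1# _ _ (trans (+-comm _ _) (trans (+-congˡ (sym e)) (geometric y k)))

  module Orthogonality (n : ℕ) .{{_ : NonZero n}} (ω : Carrier) (ω^n : ω ^ n ≈ 1#) (ω-order : ∀ t → ω ^ t ≈ 1# → n ∣ t) where

    -- The inverse of `ω`, written as a power because exponents are natural numbers.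
    ω′ : Carrier
    ω′ = ω ^ ℕ.pred n

    ω*ω′ : ω * ω′ ≈ 1#
    ω*ω′ = trans (^-congʳ ω (ℕ.suc-pred n)) ω^n

    ω^*ω′^ : ∀ t → ω ^ t * ω′ ^ t ≈ 1#
    ω^*ω′^ t = trans (sym (^-distrib-* ω ω′ t)) (trans (^-congˡ t ω*ω′) (1^ t))

    merge : ∀ a b v → ω ^ (a ℕ.* v) * ω′ ^ (b ℕ.* v) ≈ (ω ^ (a ℕ.+ ℕ.pred n ℕ.* b)) ^ v
    merge a b v = begin
      ω ^ (a ℕ.* v) * ω′ ^ (b ℕ.* v)         ≈⟨ *-congˡ (trans (^-assocʳ ω (ℕ.pred n) (b ℕ.* v)) (^-congʳ ω (≡.sym (ℕ.*-assoc (ℕ.pred n) b v)))) ⟩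
      ω ^ (a ℕ.* v) * ω ^ (ℕ.pred n ℕ.* b ℕ.* v) ≈⟨ sym (^-homo-* ω (a ℕ.* v) _) ⟩
      ω ^ (a ℕ.* v ℕ.+ ℕ.pred n ℕ.* b ℕ.* v) ≈⟨ ^-congʳ ω (≡.sym (ℕ.*-distribʳ-+ v a (ℕ.pred n ℕ.* b))) ⟩
      ω ^ ((a ℕ.+ ℕ.pred n ℕ.* b) ℕ.* v)     ≈⟨ sym (^-assocʳ ω (a ℕ.+ ℕ.pred n ℕ.* b) v) ⟩
      (ω ^ (a ℕ.+ ℕ.pred n ℕ.* b)) ^ v       ∎

    pred-n : ∀ a b → a ℕ.+ ℕ.pred n ℕ.* b ℕ.+ b ≡ a ℕ.+ b ℕ.* n
    pred-n a b = ≡.trans (+-*-Solver.solve 3 (λ a b c → a :+ c :* b :+ b := a :+ b :* (con 1 :+ c)) ≡.refl a b (ℕ.pred n))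
      (≡.cong (λ t → a ℕ.+ b ℕ.* t) (ℕ.suc-pred n))
      where open +-*-Solver

    orthogonality : ∀ (j k : Fin n) → sum {n} (λ v → ω ^ (toℕ j ℕ.* toℕ v) * ω′ ^ (toℕ k ℕ.* toℕ v)) ≈ ind j k * (n ×ₙ 1#)
    orthogonality j k = trans (sum-cong (λ v → merge (toℕ j) (toℕ k) (toℕ v))) cases
      where
      -- Modulo n this is j - k, so the sum is geometric with ratio ω^(j-k).
      t = toℕ j ℕ.+ ℕ.pred n ℕ.* toℕ k
      cases : sum {n} (λ v → (ω ^ t) ^ toℕ v) ≈ ind j k * (n ×ₙ 1#)
      cases with j Fin.≟ k
      ... | no j≢k = trans (geometric-0 (ω ^ t) n (trans (^-assocʳ ω t n) (power-∣ ω {n} ω^n (ℕ.n∣m*n t)))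
              (λ e → j≢k (Fin.toℕ-injective (≡.trans (≡.sym (ℕ.m<n⇒m%n≡m (Fin.toℕ<n j))) (≡.trans (same (ω-order t e)) (ℕ.m<n⇒m%n≡m (Fin.toℕ<n k)))))))
              (sym (zeroˡ _))
        where
        same : n ∣ t → toℕ j % n ≡ toℕ k % n
        same d = ≡.trans (≡.sym (ℕ.[m+kn]%n≡m%n (toℕ j) (toℕ k) n)) (≡.trans (≡.cong (_% n) (≡.sym (pred-n (toℕ j) (toℕ k)))) (ℕ.%-remove-+ˡ (toℕ k) d))
      ... | yes ≡.refl = trans (sum-cong (λ v → trans (^-congˡ (toℕ v) one) (1^ (toℕ v)))) (trans (sum-const n) (sym (*-identityˡ _)))
        where
        one : ω ^ t ≈ 1#
        one = power-∣ ω {n} ω^n (divides (toℕ j) (≡.trans (≡.cong (ℕ._+ ℕ.pred n ℕ.* toℕ j) (≡.sym (ℕ.*-identityˡ (toℕ j))))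
          (≡.trans (≡.sym (ℕ.*-distribʳ-+ (toℕ j) 1 (ℕ.pred n))) (≡.trans (≡.cong (ℕ._* toℕ j) (ℕ.suc-pred n)) (ℕ.*-comm n (toℕ j))))))

  module ζO = Orthogonality Q ζ ζ^Q ζ-order

  -- If y were no power of ζ, then Σ_i (y ζ⁻ʲ)ⁱ would vanish for every j; summing over j gives Q = 0.
  log : ∀ y → ¬ y ≈ 0# → ∃ λ (j : Fin Q) → ζ ^ toℕ j ≈ y
  log y y≉0 with Fin.any? (λ (j : Fin Q) → (ζ ^ toℕ j) ≟ y)
  ... | yes r = r
  ... | no none = ⊥-elim (Q×1≉0 (begin
      Q ×ₙ 1#
        ≈⟨ sym (*-identityˡ _) ⟩
      1# * (Q ×ₙ 1#)
        ≈⟨ *-congʳ (^-congʳ y (≡.sym toℕ-z)) ⟩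
      y ^ toℕ z * (Q ×ₙ 1#)
        ≈⟨ sym (sum-ind z (λ i → y ^ toℕ i * (Q ×ₙ 1#))) ⟩
      sum {Q} (λ i → ind z i * (y ^ toℕ i * (Q ×ₙ 1#)))
        ≈⟨ sum-cong (λ i → trans (sym (*-assoc _ _ _)) (trans (*-congʳ (*-comm _ _)) (*-assoc _ _ _))) ⟩
      sum {Q} (λ i → y ^ toℕ i * (ind z i * (Q ×ₙ 1#)))
        ≈⟨ sum-cong (λ i → *-congˡ (sym (ζO.orthogonality z i))) ⟩
      sum {Q} (λ i → y ^ toℕ i * sum {Q} (λ j → ζ ^ (toℕ z ℕ.* toℕ j) * ζO.ω′ ^ (toℕ i ℕ.* toℕ j)))
        ≈⟨ sum-cong (λ i → *-sum (y ^ toℕ i) (λ j → ζ ^ (toℕ z ℕ.* toℕ j) * ζO.ω′ ^ (toℕ i ℕ.* toℕ j))) ⟩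
      sum {Q} (λ i → sum {Q} (λ j → y ^ toℕ i * (ζ ^ (toℕ z ℕ.* toℕ j) * ζO.ω′ ^ (toℕ i ℕ.* toℕ j))))
        ≈⟨ sum-swap (λ i j → y ^ toℕ i * (ζ ^ (toℕ z ℕ.* toℕ j) * ζO.ω′ ^ (toℕ i ℕ.* toℕ j))) ⟩
      sum {Q} (λ j → sum {Q} (λ i → y ^ toℕ i * (ζ ^ (toℕ z ℕ.* toℕ j) * ζO.ω′ ^ (toℕ i ℕ.* toℕ j))))
        ≈⟨ sum-0 (λ j → trans (sum-cong (λ i → term i j)) (geometric-0 (t j) Q (t^Q j) (t≉1 j))) ⟩
      0# ∎))
    where
    z : Fin Q
    z = 0 mod Q
    toℕ-z : toℕ z ≡ 0
    toℕ-z = ≡.trans (toℕ-mod 0 Q) (ℕ.m*n%n≡0 0 Q)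
    y^Q : y ^ Q ≈ 1#
    y^Q with power y
    ... | inj₁ e = ⊥-elim (y≉0 e)
    ... | inj₂ e = e
    t : Fin Q → Carrier
    t j = y * ζO.ω′ ^ toℕ j
    t^Q : ∀ j → t j ^ Q ≈ 1#
    t^Q j = trans (^-distrib-* y (ζO.ω′ ^ toℕ j) Q) (trans (*-cong y^Q (trans (^-assocʳ ζO.ω′ (toℕ j) Q) (trans (^-assocʳ ζ (ℕ.pred Q) (toℕ j ℕ.* Q))
      (power-∣ ζ {Q} ζ^Q (ℕ.∣n⇒∣m*n (ℕ.pred Q) (ℕ.n∣m*n (toℕ j))))))) (*-identityˡ 1#))
    t≉1 : ∀ j → ¬ t j ≈ 1#
    t≉1 j e = none (j , (begin
      ζ ^ toℕ j                                    ≈⟨ sym (*-identityʳ _) ⟩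
      ζ ^ toℕ j * 1#                               ≈⟨ *-congˡ (sym e) ⟩
      ζ ^ toℕ j * (y * ζO.ω′ ^ toℕ j)              ≈⟨ *-congˡ (*-comm _ _) ⟩
      ζ ^ toℕ j * (ζO.ω′ ^ toℕ j * y)              ≈⟨ sym (*-assoc _ _ _) ⟩
      ζ ^ toℕ j * ζO.ω′ ^ toℕ j * y                ≈⟨ *-congʳ (ζO.ω^*ω′^ (toℕ j)) ⟩
      1# * y                                       ≈⟨ *-identityˡ y ⟩
      y                                            ∎))
    term : ∀ i j → y ^ toℕ i * (ζ ^ (toℕ z ℕ.* toℕ j) * ζO.ω′ ^ (toℕ i ℕ.* toℕ j)) ≈ t j ^ toℕ i
    term i j = begin
      y ^ toℕ i * (ζ ^ (toℕ z ℕ.* toℕ j) * ζO.ω′ ^ (toℕ i ℕ.* toℕ j))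
        ≈⟨ *-congˡ (trans (*-congʳ (^-congʳ ζ (≡.cong (ℕ._* toℕ j) toℕ-z))) (*-identityˡ _)) ⟩
      y ^ toℕ i * ζO.ω′ ^ (toℕ i ℕ.* toℕ j)
        ≈⟨ *-congˡ (trans (^-congʳ ζO.ω′ (ℕ.*-comm (toℕ i) (toℕ j))) (sym (^-assocʳ ζO.ω′ (toℕ j) (toℕ i)))) ⟩
      y ^ toℕ i * (ζO.ω′ ^ toℕ j) ^ toℕ i
        ≈⟨ sym (^-distrib-* y (ζO.ω′ ^ toℕ j) (toℕ i)) ⟩
      t j ^ toℕ i ∎

  -- The q + 1 elements of F ∪ {y} would inject into {0} ∪ ⟨ζ ^ h⟩, h (q - 1) = Q.
  fixed⇒base : ∀ y → y ^ q ≈ y → ∃ λ c → emb c ≈ y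
  fixed⇒base y y^q with Fin.any? (λ i → emb (F.enum i) ≟ y)
  ... | yes (i , e) = F.enum i , e
  ... | no none = ⊥-elim impossible
    where
    q₁ = ℕ.pred q
    q≡1+q₁ : q ≡ suc q₁
    q≡1+q₁ = ≡.sym (ℕ.suc-pred q)
    factor : ∀ k → ∃ λ h → suc q₁ ℕ.^ k ≡ suc (h ℕ.* q₁)
    factor zero = 0 , ≡.refl
    factor (suc k) with factor k
    ... | h , e = h ℕ.+ q₁ ℕ.* h ℕ.+ 1 , ≡.trans (≡.cong (suc q₁ ℕ.*_) e)
      (+-*-Solver.solve 2 (λ a h → (con 1 :+ a) :* (con 1 :+ h :* a) := con 1 :+ (h :+ a :* h :+ con 1) :* a) ≡.refl q₁ h)
      where open +-*-Solver
    h = proj₁ (factor m)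
    Q≡hq₁ : Q ≡ h ℕ.* q₁
    Q≡hq₁ = ℕ.suc-injective (≡.trans Q+1≡q^m (≡.trans (≡.cong (ℕ._^ m) q≡1+q₁) (proj₂ (factor m))))
    instance
      h≢0 : NonZero h
      h≢0 = ℕ.m*n≢0⇒m≢0 h {{≡.subst NonZero Q≡hq₁ (ℕ.≢-nonZero (ℕ.≢-nonZero⁻¹ Q))}}
      q₁≢0 : NonZero q₁
      q₁≢0 = ℕ.m*n≢0⇒n≢0 h {{≡.subst NonZero Q≡hq₁ (ℕ.≢-nonZero (ℕ.≢-nonZero⁻¹ Q))}}
    code : ∀ x → x ^ q ≈ x → x ≈ 0# ⊎ (∃ λ (i : Fin q₁) → ζ ^ (toℕ i ℕ.* h) ≈ x)
    code x x^q with x ≟ 0#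
    ... | yes z = inj₁ z
    ... | no nz with log x nz
    ...   | j , ζj = inj₂ (k mod q₁ , trans (^-congʳ ζ (≡.cong (ℕ._* h) (toℕ-mod k q₁))) (trans reduce (trans (^-congʳ ζ (≡.sym j≡kh)) ζj)))
      where
      root : x ^ q₁ ≈ 1#
      root = cancelˡ x nz (trans (^-congʳ x (≡.sym q≡1+q₁)) (trans x^q (sym (*-identityʳ x))))
      h∣j : h ∣ toℕ j
      h∣j = ℕ.*-cancelʳ-∣ q₁ (≡.subst (_∣ toℕ j ℕ.* q₁) Q≡hq₁ (ζ-order _ (trans (sym (^-assocʳ ζ (toℕ j) q₁)) (trans (^-congˡ q₁ ζj) root))))
      k = ℕ.quotient h∣j
      j≡kh : toℕ j ≡ k ℕ.* h
      j≡kh = ℕ.m∣n⇒n≡quotient*m h∣j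
      reduce : ζ ^ ((k % q₁) ℕ.* h) ≈ ζ ^ (k ℕ.* h)
      reduce = begin
        ζ ^ ((k % q₁) ℕ.* h)       ≈⟨ ^-congʳ ζ (ℕ.*-comm (k % q₁) h) ⟩
        ζ ^ (h ℕ.* (k % q₁))       ≈⟨ sym (^-assocʳ ζ h (k % q₁)) ⟩
        (ζ ^ h) ^ (k % q₁)         ≈⟨ power-% (ζ ^ h) q₁ (trans (^-assocʳ ζ h q₁) (trans (^-congʳ ζ (≡.sym Q≡hq₁)) ζ^Q)) k ⟩
        (ζ ^ h) ^ k                ≈⟨ ^-assocʳ ζ h k ⟩
        ζ ^ (h ℕ.* k)              ≈⟨ ^-congʳ ζ (ℕ.*-comm h k) ⟩
        ζ ^ (k ℕ.* h)              ∎
    encode : ∀ {x} → x ≈ 0# ⊎ (∃ λ (i : Fin q₁) → ζ ^ (toℕ i ℕ.* h) ≈ x) → Fin (suc q₁)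
    encode (inj₁ _) = Fin.zero
    encode (inj₂ (i , _)) = Fin.suc i
    encode-reflects : ∀ {x x′} (c : x ≈ 0# ⊎ (∃ λ (i : Fin q₁) → ζ ^ (toℕ i ℕ.* h) ≈ x))
      (c′ : x′ ≈ 0# ⊎ (∃ λ (i : Fin q₁) → ζ ^ (toℕ i ℕ.* h) ≈ x′)) → encode c ≡ encode c′ → x ≈ x′
    encode-reflects (inj₁ e) (inj₁ e′) _ = trans e (sym e′)
    encode-reflects (inj₂ (i , e)) (inj₂ (.i , e′)) ≡.refl = trans (sym e) e′
    elt : Fin (suc q) → Carrier
    elt Fin.zero = y
    elt (Fin.suc i) = emb (F.enum i)
    elt-fixed : ∀ i → elt i ^ q ≈ elt i
    elt-fixed Fin.zero = y^q
    elt-fixed (Fin.suc i) = trans (sym (emb-^ (F.enum i) q)) (emb-cong (fermat (F.enum i)))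
    impossible : ⊥
    impossible with Fin.pigeonhole (≡.subst (ℕ._< suc q) q≡1+q₁ (ℕ.n<1+n q)) (λ i → encode (code (elt i) (elt-fixed i)))
    ... | i , j , i<j , e with i | j | encode-reflects (code (elt i) (elt-fixed i)) (code (elt j) (elt-fixed j)) e
    ...   | Fin.zero  | Fin.zero  | _ = ℕ.<-irrefl ≡.refl i<j
    ...   | Fin.zero  | Fin.suc b | f = none (b , sym f)
    ...   | Fin.suc a | Fin.zero  | f = none (a , f)
    ...   | Fin.suc a | Fin.suc b | f = ℕ.<-irrefl (≡.cong (suc ∘ toℕ) (F.enum-inj a b (emb-inj f))) i<j

  module Transform (n g : ℕ) .{{_ : NonZero n}} (Q≡gn : Q ≡ g ℕ.* n) where
    open GroupRing F.commRing n

    instance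
      g≢0 : NonZero g
      g≢0 = ℕ.m*n≢0⇒m≢0 g {{≡.subst NonZero Q≡gn (ℕ.≢-nonZero (ℕ.≢-nonZero⁻¹ Q))}}

    ω : Carrier
    ω = ζ ^ g

    ω^n : ω ^ n ≈ 1#
    ω^n = trans (^-assocʳ ζ g n) (trans (^-congʳ ζ (≡.sym Q≡gn)) ζ^Q)

    ω-order : ∀ t → ω ^ t ≈ 1# → n ∣ t
    ω-order t e = ℕ.*-cancelˡ-∣ g (≡.subst (_∣ g ℕ.* t) Q≡gn (ζ-order _ (trans (sym (^-assocʳ ζ g t)) e)))

    open Orthogonality n ω ω^n ω-order

    ω^% : ∀ a b → a % n ≡ b % n → ω ^ a ≈ ω ^ b
    ω^% a b e = trans (sym (power-% ω n ω^n a)) (trans (^-congʳ ω e) (power-% ω n ω^n b))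

    -- The value of the polynomial u at ω^v.
    ev : Elt → ℕ → Carrier
    ev u v = sum (λ j → emb (u j) * ω ^ (toℕ j ℕ.* v))

    ev-cong : ∀ {u w} v → u ≋ w → ev u v ≈ ev w v
    ev-cong v e = sum-cong (λ j → *-congʳ (emb-cong (e j)))

    ev-% : ∀ u a b → a % n ≡ b % n → ev u a ≈ ev u b
    ev-% u a b e = sum-cong (λ j → *-congˡ (ω^% (toℕ j ℕ.* a) (toℕ j ℕ.* b)
      (≡.trans (≡.sym (%-*ʳ (toℕ j) a)) (≡.trans (≡.cong (λ t → (toℕ j ℕ.* t) % n) e) (%-*ʳ (toℕ j) b)))))

    emb-ind : ∀ (i j : Fin n) → emb (FS.ind i j) ≈ ind i j
    emb-ind i j with i Fin.≟ j
    ... | yes _ = emb-1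
    ... | no _ = emb-0

    emb-push : ∀ {k} (f : Fin k → Fin n) b w → emb (FS.push f b w) ≈ push f (emb ∘ b) w
    emb-push f b w = trans (emb-sum (λ v → FS.ind (f v) w F.* b v)) (sum-cong (λ v → trans (emb-* _ _) (*-congʳ (emb-ind (f v) w))))

    ev-⋆ : ∀ u w v → ev (u ⋆ w) v ≈ ev u v * ev w v
    ev-⋆ u w v = begin
      sum (λ k → emb ((u ⋆ w) k) * G k)
        ≈⟨ sum-cong (λ k → *-congʳ (trans (emb-sum (λ i → u i F.* FS.push (i ⊕_) w k)) (sum-cong (λ i → trans (emb-* _ _) (*-congˡ (emb-push (i ⊕_) w k)))))) ⟩
      sum (λ k → (KR._⋆_ (emb ∘ u) (emb ∘ w)) k * G k)
        ≈⟨ KR.integrate (emb ∘ u) (emb ∘ w) G ⟩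
      sum (λ i → emb (u i) * sum (λ j → emb (w j) * G (i ⊕ j)))
        ≈⟨ sum-cong (λ i → *-congˡ (trans (sum-cong (λ j → trans (*-congˡ (split i j)) (trans (sym (*-assoc _ _ _)) (trans (*-congʳ (*-comm _ _)) (*-assoc _ _ _))))) (sym (*-sum (G i) (λ j → emb (w j) * G j))))) ⟩
      sum (λ i → emb (u i) * (G i * ev w v))
        ≈⟨ sum-cong (λ i → sym (*-assoc _ _ _)) ⟩
      sum (λ i → emb (u i) * G i * ev w v)
        ≈⟨ sym (sum-* (ev w v) (λ i → emb (u i) * G i)) ⟩
      ev u v * ev w v ∎
      where
      module KR = GroupRing K n
      G : Fin n → Carrier
      G k = ω ^ (toℕ k ℕ.* v)
      split : ∀ i j → G (i ⊕ j) ≈ G i * G j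
      split i j = trans (ω^% _ ((toℕ i ℕ.+ toℕ j) ℕ.* v) (≡.trans (≡.cong (λ t → (t ℕ.* v) % n) (toℕ-mod (toℕ i ℕ.+ toℕ j) n))
          (≡.trans (≡.cong (_% n) (ℕ.*-comm ((toℕ i ℕ.+ toℕ j) % n) v)) (≡.trans (%-*ʳ v (toℕ i ℕ.+ toℕ j)) (≡.cong (_% n) (ℕ.*-comm v (toℕ i ℕ.+ toℕ j)))))))
        (trans (^-congʳ ω (ℕ.*-distribʳ-+ v (toℕ i) (toℕ j))) (^-homo-* ω (toℕ i ℕ.* v) (toℕ j ℕ.* v)))

    ev-δ : ∀ a v → ev (δ a) v ≈ ω ^ (a ℕ.* v)
    ev-δ a v = trans (sum-cong (λ j → *-congʳ (emb-ind (a mod n) j))) (trans (sum-ind (a mod n) (λ j → ω ^ (toℕ j ℕ.* v)))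
      (ω^% _ _ (≡.trans (≡.cong (λ t → (t ℕ.* v) % n) (toℕ-mod a n)) (≡.trans (≡.cong (_% n) (ℕ.*-comm (a % n) v)) (≡.trans (%-*ʳ v a) (≡.cong (_% n) (ℕ.*-comm v a)))))))

    ev-0 : ∀ u → ev u 0 ≈ emb (FS.sum u)
    ev-0 u = trans (sum-cong (λ j → trans (*-congˡ (^-congʳ ω (ℕ.*-zeroʳ (toℕ j)))) (*-identityʳ _))) (sym (emb-sum u))

    frobeniusK : ∀ {k} (f : Fin k → Carrier) → sum f ^ q ≈ sum (λ i → f i ^ q)
    frobeniusK f = trans (^-congʳ (sum f) q≡p^κ) (trans (CharP.frobenius-sum K pr charK κ f) (sum-cong (λ i → ^-congʳ (f i) (≡.sym q≡p^κ))))

    ev-frobenius : ∀ u v → ev u (q ℕ.* v) ≈ ev u v ^ q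
    ev-frobenius u v = sym (trans (frobeniusK (λ j → emb (u j) * ω ^ (toℕ j ℕ.* v))) (sum-cong (λ j → begin
      (emb (u j) * ω ^ (toℕ j ℕ.* v)) ^ q        ≈⟨ ^-distrib-* _ _ q ⟩
      emb (u j) ^ q * (ω ^ (toℕ j ℕ.* v)) ^ q    ≈⟨ *-cong (trans (sym (emb-^ (u j) q)) (emb-cong (fermat (u j)))) (trans (^-assocʳ ω (toℕ j ℕ.* v) q)
            (^-congʳ ω (+-*-Solver.solve 3 (λ j v q → j :* v :* q := j :* (q :* v)) ≡.refl (toℕ j) v q))) ⟩
      emb (u j) * ω ^ (toℕ j ℕ.* (q ℕ.* v))      ∎)))
      where open +-*-Solver

    n×1≉0 : ¬ n ×ₙ 1# ≈ 0#
    n×1≉0 e = Q×1≉0 (trans (×ₙ-congˡ Q≡gn) (trans (sym (×ₙ-assocˡ 1# g n)) (trans (×ₙ-congʳ g e) (×ₙ-0 g))))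
      where
      ×ₙ-0 : ∀ k → k ×ₙ 0# ≈ 0#
      ×ₙ-0 zero = refl
      ×ₙ-0 (suc k) = trans (+-identityˡ _) (×ₙ-0 k)

    inverse-ev : ∀ u k → sum {n} (λ v → ev u (toℕ v) * ω′ ^ (toℕ k ℕ.* toℕ v)) ≈ emb (u k) * (n ×ₙ 1#)
    inverse-ev u k = begin
      sum {n} (λ v → ev u (toℕ v) * ω′ ^ (toℕ k ℕ.* toℕ v))
        ≈⟨ sum-cong (λ v → trans (sum-* (ω′ ^ (toℕ k ℕ.* toℕ v)) (λ j → emb (u j) * ω ^ (toℕ j ℕ.* toℕ v))) (sum-cong (λ j → *-assoc _ _ _))) ⟩
      sum {n} (λ v → sum (λ j → emb (u j) * (ω ^ (toℕ j ℕ.* toℕ v) * ω′ ^ (toℕ k ℕ.* toℕ v))))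
        ≈⟨ sum-swap (λ v j → emb (u j) * (ω ^ (toℕ j ℕ.* toℕ v) * ω′ ^ (toℕ k ℕ.* toℕ v))) ⟩
      sum (λ j → sum {n} (λ v → emb (u j) * (ω ^ (toℕ j ℕ.* toℕ v) * ω′ ^ (toℕ k ℕ.* toℕ v))))
        ≈⟨ sum-cong (λ j → trans (sym (*-sum (emb (u j)) (λ v → ω ^ (toℕ j ℕ.* toℕ v) * ω′ ^ (toℕ k ℕ.* toℕ v)))) (*-congˡ (orthogonality j k))) ⟩
      sum (λ j → emb (u j) * (ind j k * (n ×ₙ 1#)))
        ≈⟨ sum-cong (λ j → trans (sym (*-assoc _ _ _)) (trans (*-congʳ (*-comm _ _)) (*-assoc _ _ _))) ⟩
      sum (λ j → ind j k * (emb (u j) * (n ×ₙ 1#)))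
        ≈⟨ sum-ind′ k (λ j → emb (u j) * (n ×ₙ 1#)) ⟩
      emb (u k) * (n ×ₙ 1#) ∎

    ev-injective : ∀ {u w} → (∀ (v : Fin n) → ev u (toℕ v) ≈ ev w (toℕ v)) → u ≋ w
    ev-injective {u} {w} e k = emb-inj (cancelˡ (n ×ₙ 1#) n×1≉0 (trans (*-comm _ _) (trans (sym (inverse-ev u k))
      (trans (sum-cong (λ v → *-congʳ (e v))) (trans (inverse-ev w k) (*-comm _ _))))))

    -- Compatibility of χ with the q-th power makes the coefficients of its inverse transform
    -- invariant under Frobenius, and `fixed⇒base` places them in F.
    module Inverse (χ : Fin n → Carrier) (χ-frob : ∀ v → χ ((q ℕ.* toℕ v) mod n) ≈ χ v ^ q) where

      n⁻¹ : F.Carrier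
      n⁻¹ = proj₁ (F.inverse (n FM.× F.1#) (λ e → n×1≉0 (trans (sym (emb-× n)) (trans (emb-cong e) emb-0))))

      n*n⁻¹ : (n ×ₙ 1#) * emb n⁻¹ ≈ 1#
      n*n⁻¹ = trans (*-congʳ (sym (emb-× n))) (trans (sym (emb-* _ _)) (trans (emb-cong (proj₂ (F.inverse (n FM.× F.1#) (λ e → n×1≉0 (trans (sym (emb-× n)) (trans (emb-cong e) emb-0)))))) emb-1))

      y : Fin n → Carrier
      y j = emb n⁻¹ * sum (λ v → χ v * ω′ ^ (toℕ j ℕ.* toℕ v))

      q^m≡1 : ∀ a → (q ℕ.^ m ℕ.* a) % n ≡ a % n
      q^m≡1 a = ≡.trans (≡.cong (λ t → (t ℕ.* a) % n) (≡.trans (≡.sym Q+1≡q^m) (≡.cong suc Q≡gn)))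
        (≡.trans (≡.cong (λ t → (a ℕ.+ t) % n) (+-*-Solver.solve 3 (λ g n a → g :* n :* a := a :* g :* n) ≡.refl g n a)) (ℕ.[m+kn]%n≡m%n a (a ℕ.* g) n))
        where open +-*-Solver

      q·q^ : ∀ a → q ℕ.* (q ℕ.^ ℕ.pred m ℕ.* a) ≡ q ℕ.^ m ℕ.* a
      q·q^ a = ≡.trans (≡.sym (ℕ.*-assoc q (q ℕ.^ ℕ.pred m) a)) (≡.cong (λ t → q ℕ.^ t ℕ.* a) (ℕ.suc-pred m))

      ψ ψ⁻¹ : Fin n → Fin n
      ψ v = (q ℕ.* toℕ v) mod n
      ψ⁻¹ v = (q ℕ.^ ℕ.pred m ℕ.* toℕ v) mod n

      times-mod : ∀ a b → (a ℕ.* toℕ (b mod n)) mod n ≡ (a ℕ.* b) mod n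
      times-mod a b = mod-cong n (≡.trans (≡.cong (λ t → (a ℕ.* t) % n) (toℕ-mod b n)) (%-*ʳ a b))

      -- Multiplication by q permutes ℤ/n because q^m ≡ 1 modulo n; its inverse is multiplication by
      -- q^(m-1).
      π : Permutation n n
      π = permutation ψ ψ⁻¹
        (λ v → ≡.trans (times-mod q _) (≡.trans (mod-cong n (≡.trans (≡.cong (_% n) (q·q^ (toℕ v))) (q^m≡1 (toℕ v)))) (toℕ-mod-self v)))
        (λ v → ≡.trans (times-mod (q ℕ.^ ℕ.pred m) _) (≡.trans (mod-cong n (≡.trans (≡.cong (_% n) (≡.trans
          (+-*-Solver.solve 3 (λ a q v → a :* (q :* v) := q :* (a :* v)) ≡.refl (q ℕ.^ ℕ.pred m) q (toℕ v)) (q·q^ (toℕ v)))) (q^m≡1 (toℕ v)))) (toℕ-mod-self v)))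
        where open +-*-Solver

      ω′^n : ω′ ^ n ≈ 1#
      ω′^n = trans (^-assocʳ ω (ℕ.pred n) n) (power-∣ ω {n} ω^n (ℕ.n∣m*n (ℕ.pred n)))

      y-fixed : ∀ j → y j ^ q ≈ y j
      y-fixed j = begin
        (emb n⁻¹ * sum (λ v → χ v * ω′ ^ (toℕ j ℕ.* toℕ v))) ^ q
          ≈⟨ ^-distrib-* _ _ q ⟩
        emb n⁻¹ ^ q * sum (λ v → χ v * ω′ ^ (toℕ j ℕ.* toℕ v)) ^ q
          ≈⟨ *-cong (trans (sym (emb-^ n⁻¹ q)) (emb-cong (fermat n⁻¹))) (frobeniusK (λ v → χ v * ω′ ^ (toℕ j ℕ.* toℕ v))) ⟩
        emb n⁻¹ * sum (λ v → (χ v * ω′ ^ (toℕ j ℕ.* toℕ v)) ^ q)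
          ≈⟨ *-congˡ (sum-cong (λ v → trans (^-distrib-* _ _ q) (*-cong (sym (χ-frob v)) (shift v)))) ⟩
        emb n⁻¹ * sum (λ v → χ (ψ v) * ω′ ^ (toℕ j ℕ.* toℕ (ψ v)))
          ≈⟨ *-congˡ (sym (sum-permute (λ v → χ v * ω′ ^ (toℕ j ℕ.* toℕ v)) π)) ⟩
        y j ∎
        where
        open +-*-Solver
        shift : ∀ v → (ω′ ^ (toℕ j ℕ.* toℕ v)) ^ q ≈ ω′ ^ (toℕ j ℕ.* toℕ (ψ v))
        shift v = begin
          (ω′ ^ (toℕ j ℕ.* toℕ v)) ^ q          ≈⟨ ^-assocʳ ω′ (toℕ j ℕ.* toℕ v) q ⟩
          ω′ ^ (toℕ j ℕ.* toℕ v ℕ.* q)          ≈⟨ ^-congʳ ω′ (+-*-Solver.solve 3 (λ j v q → j :* v :* q := j :* (q :* v)) ≡.refl (toℕ j) (toℕ v) q) ⟩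
          ω′ ^ (toℕ j ℕ.* (q ℕ.* toℕ v))        ≈⟨ sym (power-% ω′ n ω′^n _) ⟩
          ω′ ^ ((toℕ j ℕ.* (q ℕ.* toℕ v)) % n)  ≈⟨ ^-congʳ ω′ (≡.trans (≡.sym (%-*ʳ (toℕ j) (q ℕ.* toℕ v))) (≡.cong (λ t → (toℕ j ℕ.* t) % n) (≡.sym (toℕ-mod (q ℕ.* toℕ v) n)))) ⟩
          ω′ ^ ((toℕ j ℕ.* toℕ (ψ v)) % n)      ≈⟨ power-% ω′ n ω′^n _ ⟩
          ω′ ^ (toℕ j ℕ.* toℕ (ψ v))            ∎

      u : Elt
      u j = proj₁ (fixed⇒base (y j) (y-fixed j))

      ev-u : ∀ w → ev u (toℕ w) ≈ χ w
      ev-u w = begin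
        sum (λ j → emb (u j) * ω ^ (toℕ j ℕ.* toℕ w))
          ≈⟨ sum-cong (λ j → trans (*-congʳ (proj₂ (fixed⇒base (y j) (y-fixed j)))) (*-assoc _ _ _)) ⟩
        sum (λ j → emb n⁻¹ * (sum (λ v → χ v * ω′ ^ (toℕ j ℕ.* toℕ v)) * ω ^ (toℕ j ℕ.* toℕ w)))
          ≈⟨ sym (*-sum (emb n⁻¹) (λ j → sum (λ v → χ v * ω′ ^ (toℕ j ℕ.* toℕ v)) * ω ^ (toℕ j ℕ.* toℕ w))) ⟩
        emb n⁻¹ * sum (λ j → sum (λ v → χ v * ω′ ^ (toℕ j ℕ.* toℕ v)) * ω ^ (toℕ j ℕ.* toℕ w))
          ≈⟨ *-congˡ (sum-cong (λ j → trans (sum-* (ω ^ (toℕ j ℕ.* toℕ w)) (λ v → χ v * ω′ ^ (toℕ j ℕ.* toℕ v))) (sum-cong (λ v → flip j v)))) ⟩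
        emb n⁻¹ * sum (λ j → sum (λ v → χ v * (ω ^ (toℕ w ℕ.* toℕ j) * ω′ ^ (toℕ v ℕ.* toℕ j))))
          ≈⟨ *-congˡ (sum-swap (λ j v → χ v * (ω ^ (toℕ w ℕ.* toℕ j) * ω′ ^ (toℕ v ℕ.* toℕ j)))) ⟩
        emb n⁻¹ * sum (λ v → sum (λ j → χ v * (ω ^ (toℕ w ℕ.* toℕ j) * ω′ ^ (toℕ v ℕ.* toℕ j))))
          ≈⟨ *-congˡ (sum-cong (λ v → trans (sym (*-sum (χ v) (λ j → ω ^ (toℕ w ℕ.* toℕ j) * ω′ ^ (toℕ v ℕ.* toℕ j)))) (*-congˡ (orthogonality w v)))) ⟩
        emb n⁻¹ * sum (λ v → χ v * (ind w v * (n ×ₙ 1#)))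
          ≈⟨ *-congˡ (sum-cong (λ v → trans (sym (*-assoc _ _ _)) (trans (*-congʳ (*-comm _ _)) (*-assoc _ _ _)))) ⟩
        emb n⁻¹ * sum (λ v → ind w v * (χ v * (n ×ₙ 1#)))
          ≈⟨ *-congˡ (sum-ind w (λ v → χ v * (n ×ₙ 1#))) ⟩
        emb n⁻¹ * (χ w * (n ×ₙ 1#))
          ≈⟨ trans (*-comm _ _) (trans (*-assoc _ _ _) (*-congˡ n*n⁻¹)) ⟩
        χ w * 1#
          ≈⟨ *-identityʳ _ ⟩
        χ w ∎
        where
        flip : ∀ j v → χ v * ω′ ^ (toℕ j ℕ.* toℕ v) * ω ^ (toℕ j ℕ.* toℕ w) ≈ χ v * (ω ^ (toℕ w ℕ.* toℕ j) * ω′ ^ (toℕ v ℕ.* toℕ j))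
        flip j v = trans (*-assoc _ _ _) (*-congˡ (trans (*-comm _ _) (*-cong (^-congʳ ω (ℕ.*-comm (toℕ j) (toℕ w))) (^-congʳ ω′ (ℕ.*-comm (toℕ j) (toℕ v))))))

-- The groups Σ(n,d) and S(n,d)

module SandpileLattice where

  open Sums ℤ.+-*-commutativeRing

  -- Elements of 𝒵_n are represented by functions on ℤ/n whose value at 0 is ignored.
  module _ (n : ℕ) .{{_ : NonZero n}} where

    origin : Fin n
    origin = 0 mod n

    infix 4 _≐_
    _≐_ : (Fin n → ℤ) → (Fin n → ℤ) → Set
    x ≐ y = ∀ w → w ≢ origin → x w ≡ y w

    mul : ℕ → Fin n → Fin n
    mul a v = (a ℕ.* toℕ v) mod n

    shift : Fin n → Fin n
    shift v = suc (toℕ v) mod n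

  module _ {n : ℕ} .{{_ : NonZero n}} where

    toℕ-origin : toℕ (origin n) ≡ 0
    toℕ-origin = ≡.trans (toℕ-mod 0 n) (ℕ.m*n%n≡0 0 n)

    mul-mod : ∀ a b → mul n a (b mod n) ≡ (a ℕ.* b) mod n
    mul-mod a b = mod-cong n (≡.trans (≡.cong (λ t → (a ℕ.* t) % n) (toℕ-mod b n)) (%-*ʳ a b))

    mul-mul : ∀ a b v → mul n a (mul n b v) ≡ mul n (a ℕ.* b) v
    mul-mul a b v = ≡.trans (mul-mod a _) (≡.cong (_mod n) (≡.sym (ℕ.*-assoc a b (toℕ v))))

    mul-1 : ∀ v → mul n 1 v ≡ v
    mul-1 v = ≡.trans (≡.cong (_mod n) (ℕ.*-identityˡ (toℕ v))) (toℕ-mod-self v)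

    mul-origin : ∀ a → mul n a (origin n) ≡ origin n
    mul-origin a = ≡.trans (mul-mod a 0) (≡.cong (_mod n) (ℕ.*-zeroʳ a))

    mul-cong : ∀ {a b} → a % n ≡ b % n → ∀ v → mul n a v ≡ mul n b v
    mul-cong {a} {b} e v = mod-cong n (≡.trans (≡.cong (_% n) (ℕ.*-comm a (toℕ v))) (≡.trans (≡.sym (%-*ʳ (toℕ v) a))
      (≡.trans (≡.cong (λ t → (toℕ v ℕ.* t) % n) e) (≡.trans (%-*ʳ (toℕ v) b) (≡.cong (_% n) (ℕ.*-comm (toℕ v) b))))))

    ≐-refl : ∀ {x} → _≐_ n x x
    ≐-refl w _ = ≡.refl

  -- The ignored entry of the source is pushed to the ignored entry of the target, so it influences
  -- nothing else.
  push-≐ : ∀ {n l} .{{_ : NonZero n}} .{{_ : NonZero l}} (f : Fin n → Fin l) → f (origin n) ≡ origin l →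
           ∀ {x y} → _≐_ n x y → _≐_ l (push f x) (push f y)
  push-≐ {n} {l} f f-origin {x} {y} e w w≢ = sum-cong term
    where
    term : ∀ v → ind (f v) w ℤ.* x v ≡ ind (f v) w ℤ.* y v
    term v with v Fin.≟ origin n
    ... | no v≢ = ≡.cong (ind (f v) w ℤ.*_) (e v v≢)
    ... | yes ≡.refl = ≡.trans (≡.cong (ℤ._* x v) z) (≡.sym (≡.cong (ℤ._* y v) z))
      where
      z : ind (f (origin n)) w ≡ 0ℤ
      z = ind-≢ {i = f (origin n)} {w} (λ eq → w≢ (≡.trans (≡.sym eq) f-origin))

  module Lattice (n : ℕ) .{{_ : NonZero n}} (d : ℕ) where

    Vec : Set
    Vec = Fin n → ℤ

    σ : Fin n → Fin n
    σ = mul n d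

    -- The element Σ b_v ε_v of the relation lattice, read off outside x^0.
    relator : Vec → Vec
    relator b w = + d ℤ.* b w ℤ.- push σ b w

    infix 4 _∼_
    record _∼_ (x y : Vec) : Set where
      constructor via
      field
        witness : Vec
        equation : ∀ w → w ≢ origin n → x w ℤ.- y w ≡ relator witness w

    relator-+ : ∀ b c w → relator (λ v → b v ℤ.+ c v) w ≡ relator b w ℤ.+ relator c w
    relator-+ b c w = ≡.trans (≡.cong (ℤ._-_ (+ d ℤ.* (b w ℤ.+ c w))) (push-+ σ b c w)) (lemma (+ d) (b w) (c w) (push σ b w) (push σ c w))
      where
      lemma : ∀ d b c s t → d ℤ.* (b ℤ.+ c) ℤ.- (s ℤ.+ t) ≡ d ℤ.* b ℤ.- s ℤ.+ (d ℤ.* c ℤ.- t)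
      lemma = solve-∀

    relator-* : ∀ k b w → relator (λ v → k ℤ.* b v) w ≡ k ℤ.* relator b w
    relator-* k b w = ≡.trans (≡.cong (ℤ._-_ (+ d ℤ.* (k ℤ.* b w))) (push-* σ k b w)) (lemma (+ d) k (b w) (push σ b w))
      where
      lemma : ∀ d k b s → d ℤ.* (k ℤ.* b) ℤ.- k ℤ.* s ≡ k ℤ.* (d ℤ.* b ℤ.- s)
      lemma = solve-∀

    relator-- : ∀ b c w → relator (λ v → b v ℤ.- c v) w ≡ relator b w ℤ.- relator c w
    relator-- b c w = ≡.trans (relator-+ b (λ v → ℤ.- c v) w) (≡.cong (ℤ._+_ (relator b w)) (≡.trans (≡.cong₂ ℤ._-_ (≡.sym (ℤ.neg-distribʳ-* (+ d) (c w))) (push-neg σ c w))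
      (lemma (+ d ℤ.* c w) (push σ c w))))
      where
      lemma : ∀ a b → ℤ.- a ℤ.- ℤ.- b ≡ ℤ.- (a ℤ.- b)
      lemma = solve-∀

    ≐⇒∼ : ∀ {x y} → _≐_ n x y → x ∼ y
    ≐⇒∼ {x} {y} e = via (λ _ → 0ℤ) (λ w w≢ → ≡.trans (≡.trans (≡.cong (ℤ._- y w) (e w w≢)) (ℤ.+-inverseʳ (y w)))
      (≡.sym (relator-* 0ℤ (λ _ → 0ℤ) w)))

    ∼-refl : ∀ {x} → x ∼ x
    ∼-refl = ≐⇒∼ ≐-refl

    ∼-sym : ∀ {x y} → x ∼ y → y ∼ x
    ∼-sym {x} {y} (via b e) = via (λ v → 0ℤ ℤ.- b v) (λ w w≢ → ≡.trans (lemma (x w) (y w))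
      (≡.trans (≡.cong₂ ℤ._-_ (≡.sym (relator-* 0ℤ (λ _ → 0ℤ) w)) (e w w≢)) (≡.sym (relator-- (λ _ → 0ℤ) b w))))
      where
      lemma : ∀ x y → y ℤ.- x ≡ 0ℤ ℤ.- (x ℤ.- y)
      lemma = solve-∀

    ∼-trans : ∀ {x y z} → x ∼ y → y ∼ z → x ∼ z
    ∼-trans {x} {y} {z} (via b e) (via c f) = via (λ v → b v ℤ.+ c v) (λ w w≢ → ≡.trans (lemma (x w) (y w) (z w))
      (≡.trans (≡.cong₂ ℤ._+_ (e w w≢) (f w w≢)) (≡.sym (relator-+ b c w))))
      where
      lemma : ∀ x y z → x ℤ.- z ≡ x ℤ.- y ℤ.+ (y ℤ.- z)
      lemma = solve-∀

    ∼-+ : ∀ {x x′ y y′} → x ∼ x′ → y ∼ y′ → (λ w → x w ℤ.+ y w) ∼ (λ w → x′ w ℤ.+ y′ w)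
    ∼-+ {x} {x′} {y} {y′} (via b e) (via c f) = via (λ v → b v ℤ.+ c v) (λ w w≢ → ≡.trans (lemma (x w) (x′ w) (y w) (y′ w))
      (≡.trans (≡.cong₂ ℤ._+_ (e w w≢) (f w w≢)) (≡.sym (relator-+ b c w))))
      where
      lemma : ∀ x x′ y y′ → x ℤ.+ y ℤ.- (x′ ℤ.+ y′) ≡ x ℤ.- x′ ℤ.+ (y ℤ.- y′)
      lemma = solve-∀

    ∼-* : ∀ k {x y} → x ∼ y → (λ w → k ℤ.* x w) ∼ (λ w → k ℤ.* y w)
    ∼-* k {x} {y} (via b e) = via (λ v → k ℤ.* b v) (λ w w≢ → ≡.trans (lemma k (x w) (y w)) (≡.trans (≡.cong (k ℤ.*_) (e w w≢)) (≡.sym (relator-* k b w))))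
      where
      lemma : ∀ k x y → k ℤ.* x ℤ.- k ℤ.* y ≡ k ℤ.* (x ℤ.- y)
      lemma = solve-∀

    ∼-neg : ∀ {x y} → x ∼ y → (λ w → ℤ.- x w) ∼ (λ w → ℤ.- y w)
    ∼-neg {x} {y} (via b e) = ∼-trans (≐⇒∼ (λ w _ → lemma (x w))) (∼-trans (∼-* (ℤ.- 1ℤ) (via b e)) (≐⇒∼ (λ w _ → ≡.sym (lemma (y w)))))
      where
      lemma : ∀ x → ℤ.- x ≡ ℤ.- 1ℤ ℤ.* x
      lemma = solve-∀

    -- The same pointwise operations serve Σ(n,d) and, with a coarser equality, S(n,d).
    pointwise : (_≈_ : Vec → Vec → Set) → (∀ {x y} → _≐_ n x y → x ≈ y) → (∀ {x y} → x ≈ y → y ≈ x) →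
      (∀ {x y z} → x ≈ y → y ≈ z → x ≈ z) → (∀ {x x′ y y′} → x ≈ x′ → y ≈ y′ → (λ w → x w ℤ.+ y w) ≈ (λ w → x′ w ℤ.+ y′ w)) →
      (∀ {x y} → x ≈ y → (λ w → ℤ.- x w) ≈ (λ w → ℤ.- y w)) → AbelianGroup 0ℓ 0ℓ
    pointwise _≈_ from ≈-sym ≈-trans ≈-+ ≈-neg = record
      { Carrier = Vec
      ; _≈_ = _≈_
      ; _∙_ = λ x y w → x w ℤ.+ y w
      ; ε = λ _ → 0ℤ
      ; _⁻¹ = λ x w → ℤ.- x w
      ; isAbelianGroup = record
        { isGroup = record
          { isMonoid = record
            { isSemigroup = record
              { isMagma = record
                { isEquivalence = record { refl = from ≐-refl ; sym = ≈-sym ; trans = ≈-trans }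
                ; ∙-cong = ≈-+ }
              ; assoc = λ x y z → from (λ w _ → ℤ.+-assoc (x w) (y w) (z w)) }
            ; identity = (λ x → from (λ w _ → ℤ.+-identityˡ (x w))) , (λ x → from (λ w _ → ℤ.+-identityʳ (x w))) }
          ; inverse = (λ x → from (λ w _ → ℤ.+-inverseˡ (x w))) , (λ x → from (λ w _ → ℤ.+-inverseʳ (x w)))
          ; ⁻¹-cong = ≈-neg }
        ; comm = λ x y → from (λ w _ → ℤ.+-comm (x w) (y w)) }
      }

    ΣGroup : AbelianGroup 0ℓ 0ℓ
    ΣGroup = pointwise _∼_ ≐⇒∼ ∼-sym ∼-trans ∼-+ ∼-neg

    module ΣG = Additive ΣGroup

    ·-at : ∀ k x w → (k ΣG.· x) w ≡ + k ℤ.* x w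
    ·-at zero x w = ≡.refl
    ·-at (suc k) x w = ≡.trans (≡.cong (ℤ._+_ (x w)) (·-at k x w)) (≡.sym (ℤ.suc-* (+ k) (x w)))

    -- These are the defining relations: in Σ(n,d), multiplication by d is the substitution x ↦ x^d.
    d·∼push : ∀ x → (λ w → + d ℤ.* x w) ∼ push σ x
    d·∼push x = via x (λ w _ → ≡.refl)

    d^·∼push : ∀ k x → (λ w → + (d ℕ.^ k) ℤ.* x w) ∼ push (mul n (d ℕ.^ k)) x
    d^·∼push zero x = ≐⇒∼ (λ w _ → ≡.trans (ℤ.*-identityˡ (x w)) (≡.sym (push-id mul-1 x w)))
    d^·∼push (suc k) x = ∼-trans (≐⇒∼ (λ w _ → ≡.trans (≡.cong (ℤ._* x w) (ℤ.pos-* d (d ℕ.^ k))) (ℤ.*-assoc (+ d) (+ (d ℕ.^ k)) (x w))))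
      (∼-trans (∼-* (+ d) (d^·∼push k x)) (∼-trans (d·∼push (push (mul n (d ℕ.^ k)) x))
        (≐⇒∼ (λ w _ → ≡.trans (push-push σ (mul n (d ℕ.^ k)) x w) (push-cong-fun x (mul-mul d (d ℕ.^ k)) w)))))

    relator-0⇒power : ∀ b → _≐_ n (relator b) (λ _ → 0ℤ) → ∀ k → _≐_ n (λ w → + (d ℕ.^ k) ℤ.* b w) (push (mul n (d ℕ.^ k)) b)
    relator-0⇒power b e zero w _ = ≡.trans (ℤ.*-identityˡ (b w)) (≡.sym (push-id mul-1 b w))
    relator-0⇒power b e (suc k) w w≢ = begin
      + (d ℕ.* d ℕ.^ k) ℤ.* b w
        ≡⟨ ≡.trans (≡.cong (ℤ._* b w) (ℤ.pos-* d (d ℕ.^ k))) (ℤ.*-assoc (+ d) (+ (d ℕ.^ k)) (b w)) ⟩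
      + d ℤ.* (+ (d ℕ.^ k) ℤ.* b w)
        ≡⟨ ≡.cong (+ d ℤ.*_) (relator-0⇒power b e k w w≢) ⟩
      + d ℤ.* push (mul n (d ℕ.^ k)) b w
        ≡⟨ ≡.sym (push-* (mul n (d ℕ.^ k)) (+ d) b w) ⟩
      push (mul n (d ℕ.^ k)) (λ v → + d ℤ.* b v) w
        ≡⟨ push-≐ (mul n (d ℕ.^ k)) (mul-origin (d ℕ.^ k)) (λ v v≢ → ℤ.i-j≡0⇒i≡j _ _ (e v v≢)) w w≢ ⟩
      push (mul n (d ℕ.^ k)) (push σ b) w
        ≡⟨ push-push (mul n (d ℕ.^ k)) σ b w ⟩
      push (λ v → mul n (d ℕ.^ k) (σ v)) b w
        ≡⟨ push-cong-fun b (λ v → ≡.trans (mul-mul (d ℕ.^ k) d v) (≡.cong (λ t → mul n t v) (ℕ.*-comm (d ℕ.^ k) d))) w ⟩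
      push (mul n (d ℕ.* d ℕ.^ k)) b w ∎
      where open ≡.≡-Reasoning

    -- By the pigeonhole principle two powers d^i < d^j agree modulo n. Since d^k acts on Σ(n,d) as
    -- x ↦ x^(d^k), their difference annihilates the group; finiteness and decidability follow
    -- without any determinant.
    module Periodic .{{_ : ℕ.NonTrivial d}} where

      private
        collision = Fin.pigeonhole (ℕ.n<1+n n) (λ (i : Fin (suc n)) → (d ℕ.^ toℕ i) mod n)
        i j : ℕ
        i = toℕ (proj₁ collision)
        j = toℕ (proj₁ (proj₂ collision))
        i<j : i ℕ.< j
        i<j = proj₁ (proj₂ (proj₂ collision))
        d^i≡d^j : (d ℕ.^ i) % n ≡ (d ℕ.^ j) % n
        d^i≡d^j = mod-injective n (proj₂ (proj₂ (proj₂ collision)))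
        d^i<d^j : d ℕ.^ i ℕ.< d ℕ.^ j
        d^i<d^j = ℕ.^-monoʳ-< d (ℕ.nonTrivial⇒n>1 d) i<j

      abstract
        exponent : ℕ
        exponent = d ℕ.^ j ℕ.∸ d ℕ.^ i

        exponent≢0 : NonZero exponent
        exponent≢0 = ℕ.>-nonZero (ℕ.m<n⇒0<n∸m d^i<d^j)

        exponent-* : ∀ t → + exponent ℤ.* t ≡ + (d ℕ.^ j) ℤ.* t ℤ.- + (d ℕ.^ i) ℤ.* t
        exponent-* t = ≡.trans (≡.cong (ℤ._* t) (≡.trans (≡.sym (ℤ.⊖-≥ (ℕ.<⇒≤ d^i<d^j))) (≡.sym (ℤ.m-n≡m⊖n (d ℕ.^ j) (d ℕ.^ i)))))
          (lemma (+ (d ℕ.^ j)) (+ (d ℕ.^ i)) t)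
          where
          lemma : ∀ a b t → (a ℤ.- b) ℤ.* t ≡ a ℤ.* t ℤ.- b ℤ.* t
          lemma = solve-∀

        exponent-kills : ∀ (x : Vec) → (λ w → + exponent ℤ.* x w) ∼ (λ _ → 0ℤ)
        exponent-kills x = ∼-trans {y = λ w → a w ℤ.- b w} (≐⇒∼ (λ w _ → exponent-* (x w)))
          (∼-trans {y = λ w → b w ℤ.- b w} (∼-+ {a} {b} {λ w → ℤ.- b w} {λ w → ℤ.- b w} a∼b ∼-refl) (≐⇒∼ (λ w _ → ℤ.+-inverseʳ (b w))))
          where
          a b : Vec
          a w = + (d ℕ.^ j) ℤ.* x w
          b w = + (d ℕ.^ i) ℤ.* x w
          a∼b : a ∼ b
          a∼b = ∼-trans (d^·∼push j x) (∼-trans {y = push (mul n (d ℕ.^ i)) x} (≐⇒∼ (λ w _ → push-cong-fun x (mul-cong (≡.sym d^i≡d^j)) w)) (∼-sym (d^·∼push i x)))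

        -- If d b = push σ b off the origin, iteration gives (d^j - d^i) b = 0 there. Thus the ε_v
        -- are linearly independent.
        relator-injective : ∀ b → _≐_ n (relator b) (λ _ → 0ℤ) → _≐_ n b (λ _ → 0ℤ)
        relator-injective b e w w≢ = ℤ.*-cancelˡ-≡ (+ exponent) (b w) 0ℤ {{exponent≢0}} (≡.trans (exponent-* (b w))
          (≡.trans (≡.trans (≡.cong₂ ℤ._-_ (≡.trans (relator-0⇒power b e j w w≢) (≡.trans (push-cong-fun b (mul-cong (≡.sym d^i≡d^j)) w) (≡.sym (relator-0⇒power b e i w w≢)))) ≡.refl)
            (ℤ.+-inverseʳ (+ (d ℕ.^ i) ℤ.* b w))) (≡.sym (ℤ.*-zeroʳ (+ exponent)))))

      private
        N = exponent
        instance _ = exponent≢0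

      residues : Fin (N ℕ.^ n) → Vec
      residues k w = + toℕ (Fin.finToFun {N} {n} k w)

      reduce : ∀ (x : Vec) → ∃ λ k → ∃ λ c → ∀ w → x w ≡ residues k w ℤ.+ + N ℤ.* c w
      reduce x = Fin.funToFin r , (λ w → x w ℤ./ℕ N) , λ w → ≡.trans (ℤ.a≡a%ℕn+[a/ℕn]*n (x w) N)
        (≡.cong₂ ℤ._+_ (≡.cong +_ (≡.sym (≡.trans (≡.cong toℕ (Fin.finToFun-funToFin r w)) (Fin.toℕ-fromℕ< _)))) (ℤ.*-comm (x w ℤ./ℕ N) (+ N)))
        where
        r : Fin n → Fin N
        r w = fromℕ< (ℤ.n%ℕd<d (x w) N)

      residues-surj : ∀ x → ∃ λ k → residues k ∼ x
      residues-surj x with reduce x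
      ... | k , c , e = k , ∼-sym (∼-trans {y = λ w → residues k w ℤ.+ + N ℤ.* c w} (≐⇒∼ (λ w _ → e w))
        (∼-trans {y = λ w → residues k w ℤ.+ 0ℤ} (∼-+ {residues k} {residues k} {λ w → + N ℤ.* c w} {λ _ → 0ℤ} ∼-refl (exponent-kills c))
          (≐⇒∼ (λ w _ → ℤ.+-identityʳ (residues k w)))))

      -- Every vector N c is a relator off the origin, so a witness matters only modulo N: finitely
      -- many are tried, each up to divisibility by N.
      _∼?_ : ∀ x y → Dec (x ∼ y)
      x ∼? y = map′ to from (Fin.any? (λ k → Fin.all? (λ w → ¬? (w Fin.≟ origin n) →-dec (+ N ℤ.∣? (x w ℤ.- y w ℤ.- relator (residues k) w)))))
        where
        to : (∃ λ k → ∀ w → w ≢ origin n → + N ℤ.∣ (x w ℤ.- y w ℤ.- relator (residues k) w)) → x ∼ y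
        to (k , f) = via (λ v → residues k v ℤ.+ b′ v) (λ w w≢ → ≡.trans (lemma (x w ℤ.- y w) (relator (residues k) w))
            (≡.trans (≡.cong (ℤ._+_ (relator (residues k) w)) (≡.trans (c-spec w w≢) (≡.trans (≡.sym (ℤ.+-identityʳ _)) (e′ w w≢)))) (≡.sym (relator-+ (residues k) b′ w))))
          where
          c : Vec
          c w with w Fin.≟ origin n
          ... | yes _ = 0ℤ
          ... | no w≢ = ℤ.quotient (f w w≢)
          c-spec : ∀ w → w ≢ origin n → x w ℤ.- y w ℤ.- relator (residues k) w ≡ + N ℤ.* c w
          c-spec w w≢ with w Fin.≟ origin n
          ... | yes e = ⊥-elim (w≢ e)
          ... | no ne = ≡.trans (ℤ._∣_.equality (f w ne)) (ℤ.*-comm (ℤ.quotient (f w ne)) (+ N))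
          killed : (λ w → + N ℤ.* c w) ∼ (λ _ → 0ℤ)
          killed = exponent-kills c
          b′ : Vec
          b′ = _∼_.witness killed
          e′ : ∀ w → w ≢ origin n → + N ℤ.* c w ℤ.- 0ℤ ≡ relator b′ w
          e′ = _∼_.equation killed
          lemma : ∀ a b → a ≡ b ℤ.+ (a ℤ.- b)
          lemma = solve-∀
        from : x ∼ y → ∃ λ k → ∀ w → w ≢ origin n → + N ℤ.∣ (x w ℤ.- y w ℤ.- relator (residues k) w)
        from (via b e) with reduce b
        ... | k , c , f = k , λ w w≢ → ℤ.divides (relator c w) (begin
              x w ℤ.- y w ℤ.- relator (residues k) w
                ≡⟨ ≡.cong (ℤ._- relator (residues k) w) (≡.trans (e w w≢) (≡.trans (≡.cong₂ (λ s t → + d ℤ.* s ℤ.- t) (f w) (push-cong σ f w))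
                     (≡.trans (relator-+ (residues k) (λ v → + N ℤ.* c v) w) (≡.cong (ℤ._+_ (relator (residues k) w)) (relator-* (+ N) c w))))) ⟩
              relator (residues k) w ℤ.+ + N ℤ.* relator c w ℤ.- relator (residues k) w
                ≡⟨ lemma (relator (residues k) w) (+ N) (relator c w) ⟩
              relator c w ℤ.* + N ∎)
          where
          open ≡.≡-Reasoning
          lemma : ∀ a b c → a ℤ.+ b ℤ.* c ℤ.- a ≡ c ℤ.* b
          lemma = solve-∀

      Σ-finite : IsFinite ΣGroup
      Σ-finite = record { size = N ℕ.^ n ; enum = residues ; enum-surj = residues-surj ; _≟_ = _∼?_ }

    -- Multiplication by x - 1 on the augmentation ideal; S(n,d) is Σ(n,d) restricted along it.
    μ : Vec → Vec
    μ x w = push (shift n) x w ℤ.- x w ℤ.- sum x ℤ.* ind (1 mod n) w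

    μ-+ : ∀ x y w → μ (λ v → x v ℤ.+ y v) w ≡ μ x w ℤ.+ μ y w
    μ-+ x y w = ≡.trans (≡.cong₂ (λ s t → s ℤ.- (x w ℤ.+ y w) ℤ.- t ℤ.* ind (1 mod n) w) (push-+ (shift n) x y w) (sum-+ x y))
      (lemma (push (shift n) x w) (push (shift n) y w) (x w) (y w) (sum x) (sum y) (ind (1 mod n) w))
      where
      lemma : ∀ s t x y a b i → s ℤ.+ t ℤ.- (x ℤ.+ y) ℤ.- (a ℤ.+ b) ℤ.* i ≡ s ℤ.- x ℤ.- a ℤ.* i ℤ.+ (t ℤ.- y ℤ.- b ℤ.* i)
      lemma = solve-∀

    μ-* : ∀ k x w → μ (λ v → k ℤ.* x v) w ≡ k ℤ.* μ x w
    μ-* k x w = ≡.trans (≡.cong₂ (λ s t → s ℤ.- k ℤ.* x w ℤ.- t ℤ.* ind (1 mod n) w) (push-* (shift n) k x w) (≡.sym (*-sum k x)))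
      (lemma (push (shift n) x w) (x w) (sum x) (ind (1 mod n) w) k)
      where
      lemma : ∀ s x a i k → k ℤ.* s ℤ.- k ℤ.* x ℤ.- k ℤ.* a ℤ.* i ≡ k ℤ.* (s ℤ.- x ℤ.- a ℤ.* i)
      lemma = solve-∀

    μ-neg : ∀ x w → μ (λ v → ℤ.- x v) w ≡ ℤ.- μ x w
    μ-neg x w = ≡.trans (≡.cong₂ (λ s t → s ℤ.- ℤ.- x w ℤ.- t ℤ.* ind (1 mod n) w) (push-neg (shift n) x w) (sum-neg x))
      (lemma (push (shift n) x w) (x w) (sum x) (ind (1 mod n) w))
      where
      lemma : ∀ s x a i → ℤ.- s ℤ.- ℤ.- x ℤ.- ℤ.- a ℤ.* i ≡ ℤ.- (s ℤ.- x ℤ.- a ℤ.* i)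
      lemma = solve-∀

    μ-ind : ∀ v w → μ (ind v) w ≡ ind (shift n v) w ℤ.- ind v w ℤ.- ind (1 mod n) w
    μ-ind v w = ≡.cong₂ (λ s t → s ℤ.- ind v w ℤ.- t) (push-ind (shift n) v w)
      (≡.trans (≡.cong (ℤ._* ind (1 mod n) w) (≡.trans (sum-cong (λ j → ≡.sym (ℤ.*-identityʳ (ind v j)))) (sum-ind v (λ _ → 1ℤ)))) (ℤ.*-identityˡ _))

    μ-expand : ∀ x w → μ x w ≡ sum (λ v → x v ℤ.* μ (ind v) w)
    μ-expand x w = ≡.sym (≡.trans (sum-cong (λ v → ≡.trans (≡.cong (x v ℤ.*_) (μ-ind v w)) (lemma (x v) (ind (shift n v) w) (ind v w) (ind (1 mod n) w))))
      (≡.trans (sum-+ (λ v → ind (shift n v) w ℤ.* x v ℤ.- ind v w ℤ.* x v) (λ v → ℤ.- (x v ℤ.* ind (1 mod n) w)))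
        (≡.cong₂ ℤ._+_ (≡.trans (sum-+ (λ v → ind (shift n v) w ℤ.* x v) (λ v → ℤ.- (ind v w ℤ.* x v)))
            (≡.cong (ℤ._+_ (push (shift n) x w)) (≡.trans (sum-neg (λ v → ind v w ℤ.* x v)) (≡.cong ℤ.-_ (sum-ind′ w x)))))
          (≡.trans (sum-neg (λ v → x v ℤ.* ind (1 mod n) w)) (≡.cong ℤ.-_ (≡.sym (sum-* (ind (1 mod n) w) x)))))))
      where
      lemma : ∀ x s i o → x ℤ.* (s ℤ.- i ℤ.- o) ≡ s ℤ.* x ℤ.- i ℤ.* x ℤ.+ ℤ.- (x ℤ.* o)
      lemma = solve-∀

    -- The entry at 0 stands for x^0 - 1 = 0; accordingly, the correction by the augmentation in `μ`
    -- makes the image of `ind (origin n)` vanish off the origin.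
    μ-≐ : ∀ {x y} → _≐_ n x y → _≐_ n (μ x) (μ y)
    μ-≐ {x} {y} e w w≢ = ≡.trans (μ-expand x w) (≡.trans (sum-cong term) (≡.sym (μ-expand y w)))
      where
      vanish : μ (ind (origin n)) w ≡ 0ℤ
      vanish = ≡.trans (μ-ind (origin n) w) (≡.trans (≡.cong₂ (λ s t → ind s w ℤ.- t ℤ.- ind (1 mod n) w) (≡.cong (λ t → suc t mod n) toℕ-origin)
        (ind-≢ {i = origin n} {w} (w≢ ∘ ≡.sym))) (lemma (ind (1 mod n) w)))
        where
        lemma : ∀ a → a ℤ.- 0ℤ ℤ.- a ≡ 0ℤ
        lemma = solve-∀
      term : ∀ v → x v ℤ.* μ (ind v) w ≡ y v ℤ.* μ (ind v) w
      term v with v Fin.≟ origin n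
      ... | no v≢ = ≡.cong (ℤ._* μ (ind v) w) (e v v≢)
      ... | yes ≡.refl = ≡.trans (≡.cong (x v ℤ.*_) vanish) (≡.trans (ℤ.*-zeroʳ (x v)) (≡.sym (≡.trans (≡.cong (y v ℤ.*_) vanish) (ℤ.*-zeroʳ (y v)))))

    _∼S_ : Vec → Vec → Set
    x ∼S y = μ x ∼ μ y

    SGroup : AbelianGroup 0ℓ 0ℓ
    SGroup = pointwise _∼S_ (λ e → ≐⇒∼ (μ-≐ e)) ∼-sym ∼-trans
      (λ {x} {x′} {y} {y′} e f → ∼-trans (≐⇒∼ (λ w _ → μ-+ x y w)) (∼-trans (∼-+ e f) (≐⇒∼ (λ w _ → ≡.sym (μ-+ x′ y′ w)))))
      (λ {x} {y} e → ∼-trans (≐⇒∼ (λ w _ → μ-neg x w)) (∼-trans (∼-neg e) (≐⇒∼ (λ w _ → ≡.sym (μ-neg y w)))))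

    -- The derivative at x = 1. Modulo n it identifies I / I² with ℤ/n, where I is the augmentation
    -- ideal, and I² = (x - 1) I is the image of `μ`.
    val : Vec → ℤ
    val x = sum (λ v → + toℕ v ℤ.* x v)

    val-≐ : ∀ {x y} → _≐_ n x y → val x ≡ val y
    val-≐ {x} {y} e = sum-cong term
      where
      term : ∀ v → + toℕ v ℤ.* x v ≡ + toℕ v ℤ.* y v
      term v with v Fin.≟ origin n
      ... | no v≢ = ≡.cong (+ toℕ v ℤ.*_) (e v v≢)
      ... | yes ≡.refl = ≡.trans (≡.cong (λ t → + t ℤ.* x v) toℕ-origin) (≡.sym (≡.cong (λ t → + t ℤ.* y v) toℕ-origin))

    val-+ : ∀ x y → val (λ v → x v ℤ.+ y v) ≡ val x ℤ.+ val y
    val-+ x y = ≡.trans (sum-cong (λ v → ℤ.*-distribˡ-+ (+ toℕ v) (x v) (y v))) (sum-+ (λ v → + toℕ v ℤ.* x v) (λ v → + toℕ v ℤ.* y v))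

    val-* : ∀ k x → val (λ v → k ℤ.* x v) ≡ k ℤ.* val x
    val-* k x = ≡.trans (sum-cong (λ v → lemma k (+ toℕ v) (x v))) (≡.sym (*-sum k (λ v → + toℕ v ℤ.* x v)))
      where
      lemma : ∀ k t x → t ℤ.* (k ℤ.* x) ≡ k ℤ.* (t ℤ.* x)
      lemma = solve-∀

    val-neg : ∀ x → val (λ v → ℤ.- x v) ≡ ℤ.- val x
    val-neg x = ≡.trans (sum-cong (λ v → ≡.sym (ℤ.neg-distribʳ-* (+ toℕ v) (x v)))) (sum-neg (λ v → + toℕ v ℤ.* x v))

    val-push : ∀ (f : Fin n → Fin n) x → val (push f x) ≡ sum (λ v → + toℕ (f v) ℤ.* x v)
    val-push f x = ≡.trans (sum-cong (λ w → ℤ.*-comm (+ toℕ w) (push f x w))) (≡.trans (sum-push f x (λ w → + toℕ w)) (sum-cong (λ v → ℤ.*-comm (x v) _)))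

    val-ind : ∀ i → val (ind i) ≡ + toℕ i
    val-ind i = ≡.trans (sum-cong (λ v → ℤ.*-comm (+ toℕ v) (ind i v))) (sum-ind i (λ v → + toℕ v))

    -- d v minus its residue modulo n is n ⌊d v / n⌋. The quotient is kept, and not only the
    -- divisibility by n, because it later provides the weights of Λ.
    val-relator : ∀ b → val (relator b) ≡ + n ℤ.* sum (λ v → + ((d ℕ.* toℕ v) / n) ℤ.* b v)
    val-relator b = begin
      val (relator b)
        ≡⟨ ≡.trans (val-+ (λ w → + d ℤ.* b w) (λ w → ℤ.- push σ b w)) (≡.cong₂ ℤ._+_ (val-* (+ d) b) (≡.trans (val-neg (push σ b)) (≡.cong ℤ.-_ (val-push σ b)))) ⟩
      + d ℤ.* val b ℤ.- sum (λ v → + toℕ (σ v) ℤ.* b v)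
        ≡⟨ ≡.cong₂ ℤ._+_ (*-sum (+ d) (λ v → + toℕ v ℤ.* b v)) (≡.sym (sum-neg (λ v → + toℕ (σ v) ℤ.* b v))) ⟩
      sum (λ v → + d ℤ.* (+ toℕ v ℤ.* b v)) ℤ.+ sum (λ v → ℤ.- (+ toℕ (σ v) ℤ.* b v))
        ≡⟨ ≡.sym (sum-+ (λ v → + d ℤ.* (+ toℕ v ℤ.* b v)) (λ v → ℤ.- (+ toℕ (σ v) ℤ.* b v))) ⟩
      sum (λ v → + d ℤ.* (+ toℕ v ℤ.* b v) ℤ.- + toℕ (σ v) ℤ.* b v)
        ≡⟨ sum-cong term ⟩
      sum (λ v → + n ℤ.* (+ ((d ℕ.* toℕ v) / n) ℤ.* b v))
        ≡⟨ ≡.sym (*-sum (+ n) (λ v → + ((d ℕ.* toℕ v) / n) ℤ.* b v)) ⟩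
      + n ℤ.* sum (λ v → + ((d ℕ.* toℕ v) / n) ℤ.* b v) ∎
      where
      open ≡.≡-Reasoning
      term : ∀ v → + d ℤ.* (+ toℕ v ℤ.* b v) ℤ.- + toℕ (σ v) ℤ.* b v ≡ + n ℤ.* (+ ((d ℕ.* toℕ v) / n) ℤ.* b v)
      term v = begin
        + d ℤ.* (+ toℕ v ℤ.* b v) ℤ.- + toℕ (σ v) ℤ.* b v
          ≡⟨ ≡.cong₂ (λ s t → s ℤ.- + t ℤ.* b v) (≡.sym (ℤ.*-assoc (+ d) (+ toℕ v) (b v))) (toℕ-mod (d ℕ.* toℕ v) n) ⟩
        + d ℤ.* + toℕ v ℤ.* b v ℤ.- + r ℤ.* b v
          ≡⟨ ≡.cong (λ s → s ℤ.* b v ℤ.- + r ℤ.* b v) (≡.trans (≡.sym (ℤ.pos-* d (toℕ v))) (≡.trans (≡.cong +_ (ℕ.m≡m%n+[m/n]*n (d ℕ.* toℕ v) n)) (≡.cong (ℤ._+_ (+ r)) (ℤ.pos-* k n)))) ⟩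
        (+ r ℤ.+ + k ℤ.* + n) ℤ.* b v ℤ.- + r ℤ.* b v
          ≡⟨ lemma (+ r) (+ k) (+ n) (b v) ⟩
        + n ℤ.* (+ k ℤ.* b v) ∎
        where
        r = (d ℕ.* toℕ v) % n
        k = (d ℕ.* toℕ v) / n
        lemma : ∀ r k n b → (r ℤ.+ k ℤ.* n) ℤ.* b ℤ.- r ℤ.* b ≡ n ℤ.* (k ℤ.* b)
        lemma = solve-∀

    val-∼ : ∀ {x y} → x ∼ y → + n ℤ.∣ (val x ℤ.- val y)
    val-∼ {x} {y} (via b e) = ℤ.divides (sum (λ v → + ((d ℕ.* toℕ v) / n) ℤ.* b v))
      (≡.trans (≡.sym (≡.trans (val-+ x (λ v → ℤ.- y v)) (≡.cong (ℤ._+_ (val x)) (val-neg y))))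
        (≡.trans (val-≐ {λ w → x w ℤ.- y w} {relator b} e) (≡.trans (val-relator b) (ℤ.*-comm (+ n) _))))

    partial : ℕ → Vec
    partial zero w = 0ℤ
    partial (suc v) w = partial v w ℤ.+ ind (v mod n) w

    -- (x - 1)(1 + x + ... + x^(v-1)) = x^v - 1, corrected by v (x - 1) because the partial sum has
    -- augmentation v.
    μ-partial : ∀ v → _≐_ n (μ (partial v)) (λ w → ind (v mod n) w ℤ.- + v ℤ.* ind (1 mod n) w)
    μ-partial zero w w≢ = ≡.trans (μ-* 0ℤ (λ _ → 0ℤ) w) (≡.sym (≡.cong (ℤ._- 0ℤ ℤ.* ind (1 mod n) w) (ind-≢ {i = origin n} {w} (w≢ ∘ ≡.sym))))
    μ-partial (suc v) w w≢ = ≡.trans (μ-+ (partial v) (ind (v mod n)) w) (≡.trans (≡.cong₂ ℤ._+_ (μ-partial v w w≢)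
        (≡.trans (μ-ind (v mod n) w) (≡.cong (λ t → ind t w ℤ.- ind (v mod n) w ℤ.- ind (1 mod n) w) (mod-cong n (≡.trans (≡.cong (λ t → suc t % n) (toℕ-mod v n)) (%-+ʳ 1 v))))))
      (lemma (ind (v mod n) w) (+ v) (ind (1 mod n) w) (ind (suc v mod n) w)))
      where
      lemma : ∀ a v i s → a ℤ.- v ℤ.* i ℤ.+ (s ℤ.- a ℤ.- i) ≡ s ℤ.- (1ℤ ℤ.+ v) ℤ.* i
      lemma = solve-∀

    -- Σ z_v `partial` v is mapped to z up to val z = k n times x - 1. Since `partial n` is mapped
    -- to -n (x - 1), subtracting k of it removes the error.
    μ-onto : ∀ z → + n ℤ.∣ val z → ∃ λ x → _≐_ n (μ x) z
    μ-onto z (ℤ.divides k e) = x , λ w w≢ → begin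
        μ x w
          ≡⟨ μ-+ x₁ (λ u → ℤ.- k ℤ.* partial n u) w ⟩
        μ x₁ w ℤ.+ μ (λ u → ℤ.- k ℤ.* partial n u) w
          ≡⟨ ≡.cong₂ ℤ._+_ (first w w≢) (≡.trans (μ-* (ℤ.- k) (partial n) w) (≡.cong (ℤ.- k ℤ.*_) (μ-partial n w w≢))) ⟩
        z w ℤ.- val z ℤ.* o w ℤ.+ ℤ.- k ℤ.* (ind (n mod n) w ℤ.- + n ℤ.* o w)
          ≡⟨ ≡.cong₂ (λ s t → z w ℤ.- s ℤ.* o w ℤ.+ ℤ.- k ℤ.* (t ℤ.- + n ℤ.* o w)) e
               (≡.trans (≡.cong (λ t → ind t w) (mod-cong n (≡.trans (ℕ.n%n≡0 n) (≡.sym (ℕ.m*n%n≡0 0 n))))) (ind-≢ {i = origin n} {w} (w≢ ∘ ≡.sym))) ⟩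
        z w ℤ.- k ℤ.* + n ℤ.* o w ℤ.+ ℤ.- k ℤ.* (0ℤ ℤ.- + n ℤ.* o w)
          ≡⟨ lemma (z w) k (+ n) (o w) ⟩
        z w ∎
      where
      open ≡.≡-Reasoning
      o : Vec
      o = ind (1 mod n)
      x₁ x : Vec
      x₁ u = sum (λ v → z v ℤ.* partial (toℕ v) u)
      x u = x₁ u ℤ.+ ℤ.- k ℤ.* partial n u
      lemma : ∀ z k n o → z ℤ.- k ℤ.* n ℤ.* o ℤ.+ ℤ.- k ℤ.* (0ℤ ℤ.- n ℤ.* o) ≡ z
      lemma = solve-∀
      μ-sum : ∀ {l} (g : Fin l → Vec) w → μ (λ u → sum (λ v → g v u)) w ≡ sum (λ v → μ (g v) w)
      μ-sum {l} g w = ≡.trans (μ-expand _ w) (≡.trans (sum-cong (λ u → sum-* (μ (ind u) w) (λ v → g v u)))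
        (≡.trans (sum-swap (λ u v → g v u ℤ.* μ (ind u) w)) (sum-cong (λ v → ≡.sym (μ-expand (g v) w)))))
      first : _≐_ n (μ x₁) (λ w → z w ℤ.- val z ℤ.* o w)
      first w w≢ = begin
        μ x₁ w
          ≡⟨ μ-sum (λ v u → z v ℤ.* partial (toℕ v) u) w ⟩
        sum (λ v → μ (λ u → z v ℤ.* partial (toℕ v) u) w)
          ≡⟨ sum-cong (λ v → ≡.trans (μ-* (z v) (partial (toℕ v)) w) (≡.trans (≡.cong (z v ℤ.*_) (μ-partial (toℕ v) w w≢))
               (≡.trans (≡.cong (λ t → z v ℤ.* (ind t w ℤ.- + toℕ v ℤ.* o w)) (toℕ-mod-self v)) (lemma′ (z v) (ind v w) (+ toℕ v) (o w))))) ⟩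
        sum (λ v → ind v w ℤ.* z v ℤ.+ ℤ.- (+ toℕ v ℤ.* z v ℤ.* o w))
          ≡⟨ sum-+ (λ v → ind v w ℤ.* z v) (λ v → ℤ.- (+ toℕ v ℤ.* z v ℤ.* o w)) ⟩
        sum (λ v → ind v w ℤ.* z v) ℤ.+ sum (λ v → ℤ.- (+ toℕ v ℤ.* z v ℤ.* o w))
          ≡⟨ ≡.cong₂ ℤ._+_ (sum-ind′ w z) (≡.trans (sum-neg (λ v → + toℕ v ℤ.* z v ℤ.* o w)) (≡.cong ℤ.-_ (≡.sym (sum-* (o w) (λ v → + toℕ v ℤ.* z v))))) ⟩
        z w ℤ.- val z ℤ.* o w ∎
        where
        lemma′ : ∀ z i t o → z ℤ.* (i ℤ.- t ℤ.* o) ≡ i ℤ.* z ℤ.+ ℤ.- (t ℤ.* z ℤ.* o)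
        lemma′ = solve-∀

    val-μ : ∀ x → + n ℤ.∣ val (μ x)
    val-μ x = ≡.subst (+ n ℤ.∣_) (≡.sym total) (sum-∣ _ (λ v → ℤ.∣n⇒∣m*n (x v) (term v)))
      where
      open ≡.≡-Reasoning
      sum-∣ : ∀ {l} (g : Fin l → ℤ) → (∀ v → + n ℤ.∣ g v) → + n ℤ.∣ sum g
      sum-∣ {zero} g h = ≡.subst (+ n ℤ.∣_) (≡.sym (sum-zero g)) (ℤ.divides 0ℤ ≡.refl)
      sum-∣ {suc l} g h = ≡.subst (+ n ℤ.∣_) (≡.sym (sum-suc g)) (ℤ.∣m∣n⇒∣m+n (h Fin.zero) (sum-∣ (g ∘ Fin.suc) (h ∘ Fin.suc)))
      total : val (μ x) ≡ sum (λ v → x v ℤ.* val (μ (ind v)))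
      total = ≡.trans (sum-cong (λ w → ≡.trans (≡.cong (+ toℕ w ℤ.*_) (μ-expand x w)) (*-sum (+ toℕ w) (λ v → x v ℤ.* μ (ind v) w))))
        (≡.trans (sum-swap (λ w v → + toℕ w ℤ.* (x v ℤ.* μ (ind v) w))) (sum-cong (λ v → ≡.trans (sum-cong (λ w → swap (+ toℕ w) (x v) (μ (ind v) w)))
          (≡.sym (*-sum (x v) (λ w → + toℕ w ℤ.* μ (ind v) w))))))
        where
        swap : ∀ a b c → a ℤ.* (b ℤ.* c) ≡ b ℤ.* (a ℤ.* c)
        swap = solve-∀
      nat : ∀ a → + (a % n) ≡ + a ℤ.- + n ℤ.* + (a / n)
      nat a = ≡.sym (≡.trans (≡.cong (ℤ._- + n ℤ.* + (a / n)) (≡.trans (≡.cong +_ (ℕ.m≡m%n+[m/n]*n a n)) (≡.cong (ℤ._+_ (+ (a % n))) (ℤ.pos-* (a / n) n))))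
        (lemma (+ (a % n)) (+ (a / n)) (+ n)))
        where
        lemma : ∀ r k n → r ℤ.+ k ℤ.* n ℤ.- n ℤ.* k ≡ r
        lemma = solve-∀
      term : ∀ v → + n ℤ.∣ val (μ (ind v))
      term v = ℤ.divides (+ (1 / n) ℤ.- + (suc (toℕ v) / n)) (begin
        val (μ (ind v))
          ≡⟨ sum-cong (λ w → ≡.cong (+ toℕ w ℤ.*_) (μ-ind v w)) ⟩
        val (λ w → ind (shift n v) w ℤ.- ind v w ℤ.- ind (1 mod n) w)
          ≡⟨ ≡.trans (val-+ (λ w → ind (shift n v) w ℤ.- ind v w) (λ w → ℤ.- ind (1 mod n) w)) (≡.cong₂ ℤ._+_
               (≡.trans (val-+ (ind (shift n v)) (λ w → ℤ.- ind v w)) (≡.cong₂ ℤ._+_ (val-ind (shift n v)) (≡.trans (val-neg (ind v)) (≡.cong ℤ.-_ (val-ind v)))))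
               (≡.trans (val-neg (ind (1 mod n))) (≡.cong ℤ.-_ (val-ind (1 mod n))))) ⟩
        + toℕ (shift n v) ℤ.- + toℕ v ℤ.- + toℕ (1 mod n)
          ≡⟨ ≡.cong₂ (λ s t → s ℤ.- + toℕ v ℤ.- t) (≡.trans (≡.cong +_ (toℕ-mod (suc (toℕ v)) n)) (nat (suc (toℕ v)))) (≡.trans (≡.cong +_ (toℕ-mod 1 n)) (nat 1)) ⟩
        (1ℤ ℤ.+ + toℕ v ℤ.- + n ℤ.* + (suc (toℕ v) / n)) ℤ.- + toℕ v ℤ.- (1ℤ ℤ.- + n ℤ.* + (1 / n))
          ≡⟨ lemma (+ toℕ v) (+ n) (+ (suc (toℕ v) / n)) (+ (1 / n)) ⟩
        (+ (1 / n) ℤ.- + (suc (toℕ v) / n)) ℤ.* + n ∎)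
        where
        lemma : ∀ v n a b → (1ℤ ℤ.+ v ℤ.- n ℤ.* a) ℤ.- v ℤ.- (1ℤ ℤ.- n ℤ.* b) ≡ (b ℤ.- a) ℤ.* n
        lemma = solve-∀

open SandpileLattice

-- The groups C'(n,q) and C'(n,q) / ⟨X⟩

module UnitGroup {q : ℕ} (F : FiniteField q) (n : ℕ) .{{_ : NonZero n}} where
  open FiniteField F
  open Sums commRing
  open GroupRing commRing n
  module GR = CommutativeRing commutativeRing
  open CommutativeSemigroup GR.*-commutativeSemigroup using (interchange)

  -- A circulant matrix fixes the all-ones vector exactly when its coefficients sum to 1. The
  -- inverse is carried as data, while equality compares `elt` only; inverses are unique by
  -- `inv-unique`.
  record Unit : Set where
    field
      elt inv : Elt
      inverseʳ : elt ⋆ inv ≋ δ 0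
      augmentation : sum elt ≈ 1#
  open Unit public

  sum-⋆ : ∀ u w → sum (u ⋆ w) ≈ sum u * sum w
  sum-⋆ u w = trans (sum-cong (λ k → sym (*-identityʳ _))) (trans (integrate u w (λ _ → 1#))
    (trans (sum-cong (λ i → *-congˡ (sum-cong (λ j → *-identityʳ (w j))))) (sym (sum-* (sum w) u))))

  sum-δ : ∀ a → sum (δ a) ≈ 1#
  sum-δ a = trans (sum-cong (λ j → sym (*-identityʳ _))) (sum-ind (a mod n) (λ _ → 1#))

  _·ᵤ_ : Unit → Unit → Unit
  x ·ᵤ y = record
    { elt = elt x ⋆ elt y ; inv = inv x ⋆ inv y
    ; inverseʳ = GR.trans (interchange (elt x) (elt y) (inv x) (inv y)) (GR.trans (GR.*-cong {elt x ⋆ inv x} {δ 0} (inverseʳ x) (inverseʳ y)) (⋆-identityˡ (δ 0)))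
    ; augmentation = trans (sum-⋆ (elt x) (elt y)) (trans (*-cong (augmentation x) (augmentation y)) (*-identityˡ 1#)) }

  1ᵤ : Unit
  1ᵤ = record { elt = δ 0 ; inv = δ 0 ; inverseʳ = ⋆-identityˡ (δ 0) ; augmentation = sum-δ 0 }

  _⁻¹ᵤ : Unit → Unit
  x ⁻¹ᵤ = record
    { elt = inv x ; inv = elt x
    ; inverseʳ = GR.trans (⋆-comm (inv x) (elt x)) (inverseʳ x)
    ; augmentation = trans (sym (*-identityˡ _)) (trans (*-congʳ (sym (augmentation x))) (trans (sym (sum-⋆ (elt x) (inv x)))
        (trans (sum-cong (inverseʳ x)) (sum-δ 0)))) }

  inv-unique : ∀ {u u′ v v′} → u ≋ u′ → u ⋆ v ≋ δ 0 → u′ ⋆ v′ ≋ δ 0 → v ≋ v′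
  inv-unique {u} {u′} {v} {v′} e f f′ =
    GR.trans (GR.sym (⋆-identityˡ v)) (GR.trans (GR.*-congʳ {v} (GR.sym f′)) (GR.trans (⋆-assoc u′ v′ v) (GR.trans (GR.*-congˡ {u′} (⋆-comm v′ v))
    (GR.trans (GR.sym (⋆-assoc u′ v v′)) (GR.trans (GR.*-congʳ {v′} (GR.trans (GR.*-congʳ {v} (GR.sym e)) f)) (⋆-identityˡ v′))))))

  CGroup : AbelianGroup 0ℓ 0ℓ
  CGroup = record
    { Carrier = Unit
    ; _≈_ = λ x y → elt x ≋ elt y
    ; _∙_ = _·ᵤ_ ; ε = 1ᵤ ; _⁻¹ = _⁻¹ᵤ
    ; isAbelianGroup = record
      { isGroup = record
        { isMonoid = record
          { isSemigroup = record
            { isMagma = record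
              { isEquivalence = record { refl = GR.refl ; sym = GR.sym ; trans = GR.trans }
              ; ∙-cong = ⋆-cong }
            ; assoc = λ x y z → ⋆-assoc (elt x) (elt y) (elt z) }
          ; identity = (λ x → ⋆-identityˡ (elt x)) , (λ x → GR.*-identityʳ (elt x)) }
        ; inverse = (λ x → GR.trans (⋆-comm (inv x) (elt x)) (inverseʳ x)) , inverseʳ
        ; ⁻¹-cong = λ {x} {y} e → inv-unique e (inverseʳ x) (inverseʳ y) }
      ; comm = λ x y → ⋆-comm (elt x) (elt y) }
    }

  infix 4 _≈X_
  record _≈X_ (x y : Unit) : Set where
    constructor by
    field
      power : ℕ
      shifted : elt x ≋ δ power ⋆ elt y

  δ-inverse : ∀ k → δ (k ℕ.* ℕ.pred n) ⋆ δ k ≋ δ 0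
  δ-inverse k = GR.trans (δ-⋆ (k ℕ.* ℕ.pred n) k) (δ-% (≡.trans (≡.cong (_% n) (≡.trans (ℕ.+-comm (k ℕ.* ℕ.pred n) k)
    (≡.trans (≡.sym (ℕ.*-suc k (ℕ.pred n))) (≡.cong (k ℕ.*_) (ℕ.suc-pred n))))) (≡.trans (ℕ.m*n%n≡0 k n) (≡.sym (ℕ.m*n%n≡0 0 n)))))

  ≈X-from : ∀ {x y} → elt x ≋ elt y → x ≈X y
  ≈X-from {x} {y} e = by 0 (GR.trans e (GR.sym (⋆-identityˡ (elt y))))

  ≈X-sym : ∀ {x y} → x ≈X y → y ≈X x
  ≈X-sym {x} {y} (by k e) = by (k ℕ.* ℕ.pred n) (GR.sym (GR.trans (GR.*-congˡ {δ (k ℕ.* ℕ.pred n)} e)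
    (GR.trans (GR.sym (⋆-assoc _ (δ k) (elt y))) (GR.trans (GR.*-congʳ {elt y} (δ-inverse k)) (⋆-identityˡ (elt y))))))

  ≈X-trans : ∀ {x y z} → x ≈X y → y ≈X z → x ≈X z
  ≈X-trans {x} {y} {z} (by k e) (by l f) = by (k ℕ.+ l) (GR.trans e (GR.trans (GR.*-congˡ {δ k} f)
    (GR.trans (GR.sym (⋆-assoc (δ k) (δ l) (elt z))) (GR.*-congʳ {elt z} (δ-⋆ k l)))))

  ≈X-· : ∀ {x x′ y y′} → x ≈X x′ → y ≈X y′ → (x ·ᵤ y) ≈X (x′ ·ᵤ y′)
  ≈X-· {x} {x′} {y} {y′} (by k e) (by l f) = by (k ℕ.+ l) (GR.trans (⋆-cong e f)
    (GR.trans (interchange (δ k) (elt x′) (δ l) (elt y′)) (GR.*-congʳ {elt x′ ⋆ elt y′} (δ-⋆ k l))))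

  ≈X-inv : ∀ {x y} → x ≈X y → (x ⁻¹ᵤ) ≈X (y ⁻¹ᵤ)
  ≈X-inv {x} {y} (by k e) = by (k ℕ.* ℕ.pred n) (inv-unique e (inverseʳ x) (GR.trans (interchange (δ k) (elt y) (δ (k ℕ.* ℕ.pred n)) (inv y))
    (GR.trans (⋆-cong (GR.trans (⋆-comm (δ k) _) (δ-inverse k)) (inverseʳ y)) (⋆-identityˡ (δ 0)))))

  XGroup : AbelianGroup 0ℓ 0ℓ
  XGroup = record
    { Carrier = Unit
    ; _≈_ = _≈X_
    ; _∙_ = _·ᵤ_ ; ε = 1ᵤ ; _⁻¹ = _⁻¹ᵤ
    ; isAbelianGroup = record
      { isGroup = record
        { isMonoid = record
          { isSemigroup = record
            { isMagma = record
              { isEquivalence = record { refl = λ {x} → ≈X-from {x} {x} GR.refl ; sym = ≈X-sym ; trans = ≈X-trans }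
              ; ∙-cong = ≈X-· }
            ; assoc = λ x y z → ≈X-from (⋆-assoc (elt x) (elt y) (elt z)) }
          ; identity = (λ x → ≈X-from (⋆-identityˡ (elt x))) , (λ x → ≈X-from (GR.*-identityʳ (elt x))) }
        ; inverse = (λ x → ≈X-from (GR.trans (⋆-comm (inv x) (elt x)) (inverseʳ x))) , (λ x → ≈X-from (inverseʳ x))
        ; ⁻¹-cong = ≈X-inv }
      ; comm = λ x y → ≈X-from (⋆-comm (elt x) (elt y)) }
    }

module _ {q : ℕ} {F : FiniteField q} {Q : ℕ} .{{_ : NonZero Q}} (S : SplittingField F Q) where
  open SplittingField S
  open PowerOne K
  open CommutativeSemigroup *-commutativeSemigroup using (interchange)

  record RootOfUnity : Set where
    constructor root
    field
      value : Carrier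
      isRoot : value ^ Q ≈ 1#
  open RootOfUnity public

  open import Algebra.Properties.CommutativeSemiring.Exp commutativeSemiring using (^-distrib-*)

  rootsOfUnity : AbelianGroup 0ℓ 0ℓ
  rootsOfUnity = record
    { Carrier = RootOfUnity
    ; _≈_ = λ x y → value x ≈ value y
    ; _∙_ = λ x y → root (value x * value y) (trans (^-distrib-* _ _ Q) (trans (*-cong (isRoot x) (isRoot y)) (*-identityˡ 1#)))
    ; ε = root 1# (1^ Q)
    ; _⁻¹ = λ x → root (value x ^ ℕ.pred Q) (trans (^-assocʳ (value x) (ℕ.pred Q) Q) (power-∣ (value x) {Q} (isRoot x) (ℕ.n∣m*n (ℕ.pred Q))))
    ; isAbelianGroup = record
      { isGroup = record
        { isMonoid = record
          { isSemigroup = record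
            { isMagma = record
              { isEquivalence = record { refl = refl ; sym = sym ; trans = trans }
              ; ∙-cong = *-cong }
            ; assoc = λ x y z → *-assoc _ _ _ }
          ; identity = (λ x → *-identityˡ _) , (λ x → *-identityʳ _) }
        ; inverse = (λ x → trans (*-comm _ _) (right x)) , right
        ; ⁻¹-cong = λ e → ^-congˡ (ℕ.pred Q) e }
      ; comm = λ x y → *-comm _ _ }
    }
    where
    right : ∀ x → value x * value x ^ ℕ.pred Q ≈ 1#
    right x = trans (^-congʳ (value x) (ℕ.suc-pred Q)) (isRoot x)

  ·-value : ∀ i x → value (Additive._·_ rootsOfUnity i x) ≈ value x ^ i
  ·-value zero x = refl
  ·-value (suc i) x = *-congˡ (·-value i x)

-- Serves twice: for ζ^k with an integer k, and, on the additive group of a field with p elements,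
-- for reduction of integers modulo p.
module IntegerPowers {M : AbelianGroup 0ℓ 0ℓ} {Q : ℕ} .{{_ : NonZero Q}} (cyc : IsCyclic M Q) where
  open Additive M
  open IsCyclic cyc

  ·z-cong : ∀ i j → + Q ℤ.∣ (+ i ℤ.- + j) → i · z ≈ j · z
  ·z-cong i j d = ·-≡∸ {i} {j} (half i j d) (half j i (≡.subst (+ Q ℤ.∣_) (lemma (+ i) (+ j)) (ℤ.∣m⇒∣-m d)))
    where
    lemma : ∀ a b → ℤ.- (a ℤ.- b) ≡ b ℤ.- a
    lemma = solve-∀
    half : ∀ i j → + Q ℤ.∣ (+ i ℤ.- + j) → (i ℕ.∸ j) · z ≈ 0#
    half i j d with ℕ.≤-total i j
    ... | inj₁ i≤j = ×-congˡ (ℕ.m≤n⇒m∸n≡0 i≤j)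
    ... | inj₂ j≤i = ·-multiple {Q} {i ℕ.∸ j} kill (ℤ.∣⇒∣ᵤ (≡.subst (+ Q ℤ.∣_) (≡.trans (ℤ.m-n≡m⊖n i j) (ℤ.⊖-≥ j≤i)) d))

  pow : ℤ → Carrier
  pow k = (k ℤ.%ℕ Q) · z

  private
    residue : ∀ k → + Q ℤ.∣ (+ (k ℤ.%ℕ Q) ℤ.- k)
    residue k = ℤ.divides (ℤ.- (k ℤ./ℕ Q)) (≡.trans (≡.cong (ℤ._-_ (+ (k ℤ.%ℕ Q))) (ℤ.a≡a%ℕn+[a/ℕn]*n k Q)) (lemma (+ (k ℤ.%ℕ Q)) (k ℤ./ℕ Q) (+ Q)))
      where
      lemma : ∀ r c q → r ℤ.- (r ℤ.+ c ℤ.* q) ≡ ℤ.- c ℤ.* q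
      lemma = solve-∀

  pow-nat : ∀ k i → + Q ℤ.∣ (k ℤ.- + i) → pow k ≈ i · z
  pow-nat k i d = ·z-cong (k ℤ.%ℕ Q) i (≡.subst (+ Q ℤ.∣_) (lemma (+ (k ℤ.%ℕ Q)) k (+ i)) (ℤ.∣m∣n⇒∣m+n (residue k) d))
    where
    lemma : ∀ r k i → r ℤ.- k ℤ.+ (k ℤ.- i) ≡ r ℤ.- i
    lemma = solve-∀

  pow-cong : ∀ k l → + Q ℤ.∣ (k ℤ.- l) → pow k ≈ pow l
  pow-cong k l d = pow-nat k (l ℤ.%ℕ Q) (≡.subst (+ Q ℤ.∣_) (lemma k l (+ (l ℤ.%ℕ Q))) (ℤ.∣m∣n⇒∣m+n d (ℤ.∣m⇒∣-m (residue l))))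
    where
    lemma : ∀ k l r → k ℤ.- l ℤ.+ ℤ.- (r ℤ.- l) ≡ k ℤ.- r
    lemma = solve-∀

  pow-+ : ∀ k l → pow (k ℤ.+ l) ≈ pow k + pow l
  pow-+ k l = trans (pow-nat (k ℤ.+ l) (k ℤ.%ℕ Q ℕ.+ l ℤ.%ℕ Q) (≡.subst (+ Q ℤ.∣_) (lemma k l (+ (k ℤ.%ℕ Q)) (+ (l ℤ.%ℕ Q)))
      (ℤ.∣m⇒∣-m (ℤ.∣m∣n⇒∣m+n (residue k) (residue l)))))
    (×-homo-+ z (k ℤ.%ℕ Q) (l ℤ.%ℕ Q))
    where
    lemma : ∀ k l r s → ℤ.- (r ℤ.- k ℤ.+ (s ℤ.- l)) ≡ k ℤ.+ l ℤ.- (r ℤ.+ s)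
    lemma = solve-∀

  pow-+n : ∀ i → pow (+ i) ≈ i · z
  pow-+n i = pow-nat (+ i) i (≡.subst (+ Q ℤ.∣_) (≡.sym (ℤ.+-inverseʳ (+ i))) (ℤ.divides 0ℤ ≡.refl))

  pow-0 : ∀ k → + Q ℤ.∣ k → pow k ≈ 0#
  pow-0 k d = pow-nat k 0 (≡.subst (+ Q ℤ.∣_) (≡.sym (ℤ.+-identityʳ k)) d)

sumHom : ∀ {A B : AbelianGroup 0ℓ 0ℓ} → Hom A B → Hom A B → Hom A B
sumHom {A} {B} f g = record
  { fun = λ x → Hom.fun f x + Hom.fun g x
  ; cong = λ e → +-cong (Hom.cong f e) (Hom.cong g e)
  ; homo = λ x y → trans (+-cong (Hom.homo f x y) (Hom.homo g x y)) (+-interchange _ _ _ _) }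
  where open Additive B

-- The case gcd(n,d) = 1

module CoprimeCase {q : ℕ} (F : FiniteField q) {p κ} (pr : Prime p) (q≡p^κ : q ≡ p ℕ.^ κ)
    {m Q : ℕ} .{{_ : NonZero κ}} .{{_ : NonZero m}} .{{_ : NonZero Q}} .{{_ : ℕ.NonTrivial q}} (Q+1≡q^m : suc Q ≡ q ℕ.^ m)
    (S : SplittingField F Q) (n g : ℕ) .{{_ : NonZero n}} (Q≡gn : Q ≡ g ℕ.* n) where

  open SplittingField S hiding (_+_)
  open FourierTransform F pr q≡p^κ Q+1≡q^m S hiding (inv)
  open Transform n g Q≡gn
  open UnitGroup F n
  open Lattice n q
  open Periodic
  open GroupRing (FiniteField.commRing F) n

  M : AbelianGroup 0ℓ 0ℓ
  M = rootsOfUnity S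
  module M = Additive M

  cyclic : IsCyclic M Q
  cyclic = record
    { z = root ζ ζ^Q
    ; log = λ y → let j , e = log (value y) (nonzero y) in toℕ j , trans (·-value S (toℕ j) (root ζ ζ^Q)) e
    ; ord = λ i e → ζ-order i (trans (sym (·-value S i (root ζ ζ^Q))) e)
    ; kill = trans (·-value S Q (root ζ ζ^Q)) ζ^Q }
    where
    nonzero : ∀ y → ¬ value y ≈ 0#
    nonzero y e = 1≉0 (trans (sym (isRoot y)) (trans (^-congˡ Q e) (0^ Q)))
      where
      0^ : ∀ t .{{_ : NonZero t}} → 0# ^ t ≈ 0#
      0^ (suc t) = zeroˡ _

  open IsCyclic cyclic using (z)
  open IntegerPowers cyclic

  Character : Set
  Character = Hom ΣGroup M

  -- (Q + 1) x = q^m x is x with v replaced by q^m v, and q^m ≡ 1 modulo n. So the Q-th roots of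
  -- unity carry all characters of Σ(n,q).
  Q·∼0 : ∀ x → (Q ΣG.· x) ∼ (λ _ → 0ℤ)
  Q·∼0 x = ΣG.+-cancelˡ x _ _ (ΣG.trans suc-Q (ΣG.sym (ΣG.+-identityʳ x)))
    where
    suc-Q : (suc Q ΣG.· x) ∼ x
    suc-Q = ∼-trans (≐⇒∼ (λ w _ → ≡.trans (·-at (suc Q) x w) (≡.cong (λ t → + t ℤ.* x w) Q+1≡q^m)))
      (∼-trans (d^·∼push m x) (≐⇒∼ (λ w _ → push-id fixed x w)))
      where
      open Sums ℤ.+-*-commutativeRing using (push-id)
      fixed : ∀ v → mul n (q ℕ.^ m) v ≡ v
      fixed v = ≡.trans (mul-cong {a = q ℕ.^ m} {1} (≡.trans (≡.cong (_% n) (≡.trans (≡.sym Q+1≡q^m) (≡.cong suc Q≡gn))) (ℕ.[m+kn]%n≡m%n 1 g n)) v) (mul-1 v)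

  open Duality ΣGroup M Σ-finite Q cyclic Q·∼0
  open Extension ΣGroup M using (PartialHom; module _Extends_)
  open Sums ℤ.+-*-commutativeRing

  at : Character → Fin n → Carrier
  at θ v = value (Hom.fun θ (ind v))

  module _ (θ : Character) where
    open Hom θ

    at-frobenius : ∀ v → at θ ((q ℕ.* toℕ v) mod n) ≈ at θ v ^ q
    at-frobenius v = trans (cong (∼-sym q·ind)) (trans (homo-· q (ind v)) (·-value S q (fun (ind v))))
      where
      q·ind : (q ΣG.· ind v) ∼ ind ((q ℕ.* toℕ v) mod n)
      q·ind = ∼-trans (≐⇒∼ (λ w _ → ·-at q (ind v) w)) (∼-trans (d·∼push (ind v)) (≐⇒∼ (λ w _ → push-ind σ v w)))

    at-origin : at θ (origin n) ≈ 1#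
    at-origin = trans (cong (≐⇒∼ {ind (origin n)} {λ _ → 0ℤ} (λ w w≢ → ind-≢ {i = origin n} {w} (w≢ ∘ ≡.sym)))) homo-0

  negHom : Character → Character
  negHom θ = record
    { fun = λ x → Hom.fun θ (ΣG.- x)
    ; cong = λ e → Hom.cong θ (∼-neg e)
    ; homo = λ x y → trans (Hom.cong θ (ΣG.sym (ΣG.-‿+-comm x y))) (Hom.homo θ (ΣG.- x) (ΣG.- y)) }

  abstract
    -- The inverse transform of v ↦ θ(e_v). Its inverse comes from -θ, and its augmentation is the
    -- value at v = 0.
    toUnit : Character → Unit
    toUnit θ = record
      { elt = u.u ; inv = v.u
      ; inverseʳ = ev-injective {u.u ⋆ v.u} {δ 0} (λ w → trans (ev-⋆ u.u v.u (toℕ w)) (trans (*-cong (u.ev-u w) (v.ev-u w))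
          (trans (sym (Hom.homo θ (ind w) (ΣG.- ind w))) (trans (Hom.cong θ (ΣG.-‿inverseʳ (ind w))) (trans (Hom.homo-0 θ) (sym (ev-δ 0 (toℕ w))))))))
      ; augmentation = emb-inj (trans (sym (ev-0 u.u)) (trans (ev-% u.u 0 (toℕ (origin n)) (≡.cong (_% n) (≡.sym toℕ-origin)))
          (trans (u.ev-u (origin n)) (trans (at-origin θ) (sym emb-1))))) }
      where
      module u = Inverse (at θ) (at-frobenius θ)
      module v = Inverse (at (negHom θ)) (at-frobenius (negHom θ))

    ev-toUnit : ∀ θ v → ev (elt (toUnit θ)) (toℕ v) ≈ at θ v
    ev-toUnit θ = Inverse.ev-u (at θ) (at-frobenius θ)

  -- A linear functional with coefficients l descends to a character as soon as it is
  -- compatible with the relations modulo Q.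
  module Functional (l : Fin n → ℕ) (l-origin : Q ∣ l (origin n)) (l-σ : ∀ v → + Q ℤ.∣ (+ q ℤ.* + l v ℤ.- + l (σ v))) where

    L : Vec → ℤ
    L x = sum (λ v → + l v ℤ.* x v)

    L-+ : ∀ x y → L (λ v → x v ℤ.+ y v) ≡ L x ℤ.+ L y
    L-+ x y = ≡.trans (sum-cong (λ v → ℤ.*-distribˡ-+ (+ l v) (x v) (y v))) (sum-+ (λ v → + l v ℤ.* x v) (λ v → + l v ℤ.* y v))

    L-neg : ∀ x → L (λ v → ℤ.- x v) ≡ ℤ.- L x
    L-neg x = ≡.trans (sum-cong (λ v → ≡.sym (ℤ.neg-distribʳ-* (+ l v) (x v)))) (sum-neg (λ v → + l v ℤ.* x v))

    L-ind : ∀ v → L (ind v) ≡ + l v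
    L-ind v = ≡.trans (sum-cong (λ w → ℤ.*-comm (+ l w) (ind v w))) (sum-ind v (λ w → + l w))

    sum-∣ : ∀ {k} (g : Fin k → ℤ) → (∀ v → + Q ℤ.∣ g v) → + Q ℤ.∣ sum g
    sum-∣ {zero} g h = ≡.subst (+ Q ℤ.∣_) (≡.sym (sum-zero g)) (ℤ.divides 0ℤ ≡.refl)
    sum-∣ {suc k} g h = ≡.subst (+ Q ℤ.∣_) (≡.sym (sum-suc g)) (ℤ.∣m∣n⇒∣m+n (h Fin.zero) (sum-∣ (g ∘ Fin.suc) (h ∘ Fin.suc)))

    L-relator : ∀ b → + Q ℤ.∣ L (relator b)
    L-relator b = ≡.subst (+ Q ℤ.∣_) (≡.sym eq) (sum-∣ (λ v → b v ℤ.* (+ q ℤ.* + l v ℤ.- + l (σ v))) (λ v → ℤ.∣n⇒∣m*n (b v) (l-σ v)))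
      where
      lemma₁ : ∀ l q b → l ℤ.* (q ℤ.* b) ≡ b ℤ.* (q ℤ.* l)
      lemma₁ = solve-∀
      lemma₂ : ∀ b s t → b ℤ.* s ℤ.+ ℤ.- (b ℤ.* t) ≡ b ℤ.* (s ℤ.- t)
      lemma₂ = solve-∀
      eq : L (relator b) ≡ sum (λ v → b v ℤ.* (+ q ℤ.* + l v ℤ.- + l (σ v)))
      eq = ≡.trans (L-+ (λ w → + q ℤ.* b w) (λ w → ℤ.- push σ b w))
        (≡.trans (≡.cong₂ ℤ._+_ (sum-cong (λ v → lemma₁ (+ l v) (+ q) (b v)))
          (≡.trans (L-neg (push σ b)) (≡.cong ℤ.-_ (≡.trans (sum-cong (λ w → ℤ.*-comm (+ l w) (push σ b w))) (sum-push σ b (λ w → + l w))))))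
        (≡.trans (≡.cong (ℤ._+_ (sum (λ v → b v ℤ.* (+ q ℤ.* + l v)))) (≡.sym (sum-neg (λ v → b v ℤ.* + l (σ v)))))
        (≡.trans (≡.sym (sum-+ (λ v → b v ℤ.* (+ q ℤ.* + l v)) (λ v → ℤ.- (b v ℤ.* + l (σ v)))))
          (sum-cong (λ v → lemma₂ (b v) (+ q ℤ.* + l v) (+ l (σ v)))))))

    L-off : ∀ x → _≐_ n x (λ _ → 0ℤ) → + Q ℤ.∣ L x
    L-off x e = sum-∣ (λ v → + l v ℤ.* x v) term
      where
      term : ∀ v → + Q ℤ.∣ (+ l v ℤ.* x v)
      term v with v Fin.≟ origin n
      ... | yes ≡.refl = ℤ.∣m⇒∣m*n (x v) (ℤ.∣ᵤ⇒∣ {+ Q} {+ l v} l-origin)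
      ... | no v≢ = ≡.subst (+ Q ℤ.∣_) (≡.sym (≡.trans (≡.cong (+ l v ℤ.*_) (e v v≢)) (ℤ.*-zeroʳ (+ l v)))) (ℤ.divides 0ℤ ≡.refl)

    character : Character
    character = record
      { fun = λ x → pow (L x)
      ; cong = λ { {x} {y} (via b e) → pow-cong (L x) (L y) (≡.subst (+ Q ℤ.∣_) (diff x y b)
          (ℤ.∣m∣n⇒∣m+n (L-off (λ w → x w ℤ.- y w ℤ.- relator b w) (λ w w≢ → ≡.trans (≡.cong (ℤ._- relator b w) (e w w≢)) (ℤ.+-inverseʳ (relator b w)))) (L-relator b))) }
      ; homo = λ x y → trans (reflexive (≡.cong (value ∘ pow) (L-+ x y))) (pow-+ (L x) (L y)) }
      where
      diff : ∀ x y b → L (λ w → x w ℤ.- y w ℤ.- relator b w) ℤ.+ L (relator b) ≡ L x ℤ.- L y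
      diff x y b = ≡.trans (≡.sym (L-+ (λ w → x w ℤ.- y w ℤ.- relator b w) (relator b)))
        (≡.trans (sum-cong (λ v → ≡.cong (+ l v ℤ.*_) (lemma (x v) (y v) (relator b v)))) (≡.trans (L-+ x (λ v → ℤ.- y v)) (≡.cong (ℤ._+_ (L x)) (L-neg y))))
        where
        lemma : ∀ x y r → x ℤ.- y ℤ.- r ℤ.+ r ≡ x ℤ.- y
        lemma = solve-∀

    at-character : ∀ v → Hom.fun character (ind v) M.≈ l v M.· z
    at-character v = trans (reflexive (≡.cong (value ∘ pow) (L-ind v))) (pow-+n (l v))

  -- The values u(ω^v) are powers ζ^(l v). These exponents define a character because u(1) = 1
  -- accounts for e_0 = 0 and u(ω^(q v)) = u(ω^v)^q for the relations ε_v.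
  module FromUnit (u : Unit) where

    e : Fin n → RootOfUnity S
    e v = root (ev (elt u) (toℕ v)) (unit-power (toℕ v))
      where
      unit-power : ∀ v → ev (elt u) v ^ Q ≈ 1#
      unit-power v with power (ev (elt u) v)
      ... | inj₂ r = r
      ... | inj₁ r = ⊥-elim (1≉0 (trans (sym (trans (ev-δ 0 v) refl)) (trans (ev-cong v (λ k → FiniteField.sym F (inverseʳ u k)))
              (trans (ev-⋆ (elt u) (inv u) v) (trans (*-congʳ r) (zeroˡ _))))))

    open IsCyclic cyclic using (ord) renaming (log to logM)

    l : Fin n → ℕ
    l v = proj₁ (logM (e v))

    l-spec : ∀ v → l v M.· z M.≈ e v
    l-spec v = proj₂ (logM (e v))

    e-σ : ∀ v → e (σ v) M.≈ q M.· e v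
    e-σ v = trans (ev-% (elt u) (toℕ (σ v)) (q ℕ.* toℕ v) (≡.trans (≡.cong (_% n) (toℕ-mod (q ℕ.* toℕ v) n)) (ℕ.m%n%n≡m%n (q ℕ.* toℕ v) n)))
      (trans (ev-frobenius (elt u) (toℕ v)) (sym (·-value S q (e v))))

    ·z-inj : ∀ i j → i M.· z M.≈ j M.· z → + Q ℤ.∣ (+ i ℤ.- + j)
    ·z-inj i j eq with ℕ.≤-total j i
    ... | inj₁ j≤i = ≡.subst (+ Q ℤ.∣_) (≡.sym (≡.trans (ℤ.m-n≡m⊖n i j) (ℤ.⊖-≥ j≤i))) (ℤ.∣ᵤ⇒∣ (ord (i ℕ.∸ j) (M.·-∸ {i} {j} eq)))
    ... | inj₂ i≤j = ≡.subst (+ Q ℤ.∣_) (≡.trans (≡.cong ℤ.-_ (≡.sym (≡.trans (ℤ.m-n≡m⊖n j i) (ℤ.⊖-≥ i≤j)))) (lemma (+ i) (+ j)))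
          (ℤ.∣m⇒∣-m (ℤ.∣ᵤ⇒∣ {+ Q} {+ (j ℕ.∸ i)} (ord (j ℕ.∸ i) (M.·-∸ {j} {i} (M.sym {i M.· z} {j M.· z} eq)))))
      where
      lemma : ∀ i j → ℤ.- (j ℤ.- i) ≡ i ℤ.- j
      lemma = solve-∀

    l-origin : Q ∣ l (origin n)
    l-origin = ord (l (origin n)) (trans (l-spec (origin n)) (trans (ev-% (elt u) (toℕ (origin n)) 0 (≡.cong (_% n) toℕ-origin))
      (trans (ev-0 (elt u)) (trans (emb-cong (augmentation u)) emb-1))))

    l-σ : ∀ v → + Q ℤ.∣ (+ q ℤ.* + l v ℤ.- + l (σ v))
    l-σ v = ≡.subst (λ t → + Q ℤ.∣ (t ℤ.- + l (σ v))) (ℤ.pos-* q (l v)) (·z-inj (q ℕ.* l v) (l (σ v))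
      (M.trans {(q ℕ.* l v) M.· z} {q M.· l v M.· z} {l (σ v) M.· z} (M.sym {q M.· l v M.· z} {(q ℕ.* l v) M.· z} (M.×-assocˡ z q (l v)))
        (M.trans {q M.· l v M.· z} {q M.· e v} {l (σ v) M.· z} (M.×-congʳ q {l v M.· z} {e v} (l-spec v))
          (M.trans {q M.· e v} {e (σ v)} {l (σ v) M.· z} (M.sym {e (σ v)} {q M.· e v} (e-σ v)) (M.sym {l (σ v) M.· z} {e (σ v)} (l-spec (σ v)))))))

    open Functional l l-origin l-σ using (character; at-character) public

    at-fromUnit′ : ∀ v → at character v ≈ ev (elt u) (toℕ v)
    at-fromUnit′ v = trans (at-character v) (l-spec v)

  abstract
    fromUnit : Unit → Character
    fromUnit u = FromUnit.character u

    at-fromUnit : ∀ u v → at (fromUnit u) v ≈ ev (elt u) (toℕ v)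
    at-fromUnit u = FromUnit.at-fromUnit′ u

  toUnit-cong : ∀ θ θ′ → (∀ v → at θ v ≈ at θ′ v) → elt (toUnit θ) ≋ elt (toUnit θ′)
  toUnit-cong θ θ′ e = ev-injective {elt (toUnit θ)} {elt (toUnit θ′)} (λ v → trans (ev-toUnit θ v) (trans (e v) (sym (ev-toUnit θ′ v))))

  toUnit-+ : ∀ θ θ′ → elt (toUnit (sumHom θ θ′)) ≋ elt (toUnit θ) ⋆ elt (toUnit θ′)
  toUnit-+ θ θ′ = ev-injective {elt (toUnit (sumHom θ θ′))} {elt (toUnit θ) ⋆ elt (toUnit θ′)} (λ v → trans (ev-toUnit (sumHom θ θ′) v)
    (trans (*-cong (sym (ev-toUnit θ v)) (sym (ev-toUnit θ′ v))) (sym (ev-⋆ (elt (toUnit θ)) (elt (toUnit θ′)) (toℕ v)))))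

  toUnit-fromUnit : ∀ u → elt (toUnit (fromUnit u)) ≋ elt u
  toUnit-fromUnit u = ev-injective {elt (toUnit (fromUnit u))} {elt u} (λ v → trans (ev-toUnit (fromUnit u) v) (at-fromUnit u v))

  -- Representatives modulo the exponent have natural coefficients, so x may be taken as a sum of
  -- natural multiples of the e_v.
  character-ext : ∀ (θ θ′ : Character) → (∀ v → Hom.fun θ (ind v) M.≈ Hom.fun θ′ (ind v)) → ∀ x → Hom.fun θ x M.≈ Hom.fun θ′ x
  character-ext θ θ′ e x = begin
    fun x                             ≈⟨ Hom.cong θ (∼-sym x∼) ⟩
    fun (combination (λ v → v) c)     ≈⟨ agree (λ v → v) c ⟩
    fun′ (combination (λ v → v) c)    ≈⟨ Hom.cong θ′ x∼ ⟩
    fun′ x                            ∎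
    where
    open import Relation.Binary.Reasoning.Setoid M.setoid
    open Hom θ using (fun)
    open Hom θ′ using () renaming (fun to fun′)
    combination : ∀ {l} → (Fin l → Fin n) → (Fin l → ℕ) → Vec
    combination f c w = sum (λ i → ind (f i) w ℤ.* + c i)
    k = proj₁ (residues-surj x)
    c : Fin n → ℕ
    c v = toℕ (Fin.finToFun {exponent} {n} k v)
    x∼ : combination (λ v → v) c ∼ x
    x∼ = ∼-trans {y = residues k} (≐⇒∼ (λ w _ → sum-ind′ w (residues k))) (proj₂ (residues-surj x))
    agree : ∀ {l} (f : Fin l → Fin n) (c : Fin l → ℕ) → fun (combination f c) M.≈ fun′ (combination f c)
    agree {zero} f c = begin
      fun (combination f c)     ≈⟨ Hom.cong θ none ⟩
      fun (λ _ → 0ℤ)            ≈⟨ Hom.homo-0 θ ⟩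
      M.0#                      ≈⟨ sym (Hom.homo-0 θ′) ⟩
      fun′ (λ _ → 0ℤ)           ≈⟨ Hom.cong θ′ (∼-sym none) ⟩
      fun′ (combination f c)    ∎
      where
      none : combination f c ∼ (λ _ → 0ℤ)
      none = ≐⇒∼ (λ w _ → sum-zero (λ i → ind (f i) w ℤ.* + c i))
    agree {suc l} f c = begin
      fun (combination f c)           ≈⟨ Hom.cong θ split ⟩
      fun (head ΣG.+ tail)            ≈⟨ Hom.homo θ head tail ⟩
      fun head M.+ fun tail           ≈⟨ M.+-cong {fun head} {fun′ head} {fun tail} {fun′ tail} heads (agree (f ∘ Fin.suc) (c ∘ Fin.suc)) ⟩
      fun′ head M.+ fun′ tail         ≈⟨ sym (Hom.homo θ′ head tail) ⟩
      fun′ (head ΣG.+ tail)           ≈⟨ Hom.cong θ′ (∼-sym split) ⟩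
      fun′ (combination f c)          ∎
      where
      v₀ = f Fin.zero
      c₀ = c Fin.zero
      head tail : Vec
      head = c₀ ΣG.· ind v₀
      tail = combination (f ∘ Fin.suc) (c ∘ Fin.suc)
      heads : fun head M.≈ fun′ head
      heads = begin
        fun (c₀ ΣG.· ind v₀)          ≈⟨ Hom.homo-· θ c₀ (ind v₀) ⟩
        c₀ M.· fun (ind v₀)           ≈⟨ M.×-congʳ c₀ {fun (ind v₀)} {fun′ (ind v₀)} (e v₀) ⟩
        c₀ M.· fun′ (ind v₀)          ≈⟨ sym (Hom.homo-· θ′ c₀ (ind v₀)) ⟩
        fun′ (c₀ ΣG.· ind v₀)         ∎
      split : combination f c ∼ (head ΣG.+ tail)
      split = ≐⇒∼ (λ w _ → ≡.trans (sum-suc (λ i → ind (f i) w ℤ.* + c i))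
        (≡.cong (ℤ._+ tail w) (≡.trans (ℤ.*-comm (ind v₀ w) (+ c₀)) (≡.sym (·-at c₀ (ind v₀) w)))))

  module WithPairing (H : Subgroup ΣGroup) (R : Pairing H) where
    open Subgroup H
    open Pairing R

    separated : ∀ {x x′} → Mem x → Mem x′ → (∀ {y} → Mem y → ⟨ x , y ⟩ M.≈ ⟨ x′ , y ⟩) → x ∼ x′
    separated {x} {x′} x∈ x′∈ e = ΣG.x-y≈0⇒x≈y x x′ (nondegenerate (mem-- x∈ x′∈) (λ {y} y∈ →
      M.+-cancelʳ ⟨ x′ , y ⟩ ⟨ x ΣG.- x′ , y ⟩ M.0# (trans (sym (⟨⟩-+ˡ (mem-- x∈ x′∈) x′∈ y∈))
        (trans (⟨⟩-cong (mem-+ (mem-- x∈ x′∈) x′∈) y∈ (ΣG.x-y+y x x′) ∼-refl) (trans (e y∈) (sym (M.+-identityˡ ⟨ x′ , y ⟩)))))))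

    paired : ∀ x → Mem x → PartialHom
    paired x x∈ = record { dom = H ; φ = λ y → ⟨ x , y ⟩ ; φ-cong = λ y∈ e → ⟨⟩-cong x∈ y∈ ∼-refl e ; φ-+ = λ y∈ y′∈ → ⟨⟩-+ʳ x∈ y∈ y′∈ }

    restrict : Character → PartialHom
    restrict θ = record { dom = H ; φ = Hom.fun θ ; φ-cong = λ _ → Hom.cong θ ; φ-+ = λ _ _ → Hom.homo θ _ _ }

  whole : Subgroup ΣGroup
  whole = record { Mem = λ _ → ⊤ ; mem? = λ _ → yes tt ; resp = λ _ _ → tt ; mem-0 = tt ; mem-+ = λ _ _ → tt ; mem-neg = λ _ → tt }

  module ΣIso (R : Pairing whole) where
    open Pairing R
    open WithPairing whole R

    ⟪_⟫ : Vec → Character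
    ⟪ x ⟫ = record { fun = λ y → ⟨ x , y ⟩ ; cong = λ e → ⟨⟩-cong tt tt ∼-refl e ; homo = λ y y′ → ⟨⟩-+ʳ tt tt tt }

    iso : Iso ΣGroup CGroup
    iso = record
      { hom = record
        { fun = λ x → toUnit ⟪ x ⟫
        ; cong = λ {x} {x′} e → toUnit-cong ⟪ x ⟫ ⟪ x′ ⟫ (λ v → ⟨⟩-cong tt tt e ∼-refl)
        ; homo = λ x y → GR.trans (toUnit-cong ⟪ x ΣG.+ y ⟫ (sumHom ⟪ x ⟫ ⟪ y ⟫) (λ v → ⟨⟩-+ˡ tt tt tt)) (toUnit-+ ⟪ x ⟫ ⟪ y ⟫) }
      ; inj = λ x x′ e → separated tt tt (λ {y} _ → character-ext ⟪ x ⟫ ⟪ x′ ⟫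
          (λ v → trans (sym (ev-toUnit ⟪ x ⟫ v)) (trans (ev-cong (toℕ v) e) (ev-toUnit ⟪ x′ ⟫ v))) y)
      ; surj = λ u → let θ = fromUnit u ; x , _ , e = complete (restrict θ) (λ m → m) in
          x , GR.trans (toUnit-cong ⟪ x ⟫ θ (λ v → sym (e {ind v} tt))) (toUnit-fromUnit u) }

  kernel : Subgroup ΣGroup
  kernel = record
    { Mem = λ x → + n ℤ.∣ val x
    ; mem? = λ x → + n ℤ.∣? val x
    ; resp = λ {x} {y} e d → ≡.subst (+ n ℤ.∣_) (lemma (val x) (val y)) (ℤ.∣m∣n⇒∣m+n d (ℤ.∣m⇒∣-m (val-∼ e)))
    ; mem-0 = ≡.subst (+ n ℤ.∣_) (≡.sym (val-* 0ℤ (λ _ → 0ℤ))) (ℤ.divides 0ℤ ≡.refl)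
    ; mem-+ = λ {x} {y} d d′ → ≡.subst (+ n ℤ.∣_) (≡.sym (val-+ x y)) (ℤ.∣m∣n⇒∣m+n d d′)
    ; mem-neg = λ {x} d → ≡.subst (+ n ℤ.∣_) (≡.sym (val-neg x)) (ℤ.∣m⇒∣-m d) }
    where
    lemma : ∀ a b → a ℤ.+ ℤ.- (a ℤ.- b) ≡ b
    lemma = solve-∀

  module Kernel = Subgroup kernel

  -- Characters agreeing on the kernel of val differ by y ↦ ω ^ (k val y), the character of X ^ k.
  agree⇒shift : ∀ (θ θ′ : Character) → (∀ {y} → Kernel.Mem y → Hom.fun θ y M.≈ Hom.fun θ′ y) → toUnit θ ≈X toUnit θ′
  agree⇒shift θ θ′ agree = by k (ev-injective {elt (toUnit θ)} {δ k ⋆ elt (toUnit θ′)} (λ v → trans (ev-toUnit θ v)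
      (trans (at-v v) (trans (*-congʳ (sym (ev-δ k (toℕ v)))) (trans (*-congˡ (sym (ev-toUnit θ′ v))) (sym (ev-⋆ (δ k) (elt (toUnit θ′)) (toℕ v))))))))
    where
    open IsCyclic cyclic using (ord) renaming (log to logM)
    o : Vec
    o = ind (1 mod n)
    ρ : RootOfUnity S
    ρ = Hom.fun θ o M.- Hom.fun θ′ o
    θo : Hom.fun θ o M.≈ ρ M.+ Hom.fun θ′ o
    θo = M.sym {ρ M.+ Hom.fun θ′ o} {Hom.fun θ o} (M.x-y+y (Hom.fun θ o) (Hom.fun θ′ o))
    val-·o : ∀ t → val (t ΣG.· o) ≡ + t ℤ.* + (1 % n)
    val-·o t = ≡.trans (≡.trans (sum-cong (λ v → ≡.cong (+ toℕ v ℤ.*_) (·-at t o v))) (val-* (+ t) o))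
      (≡.cong (+ t ℤ.*_) (≡.trans (val-ind (1 mod n)) (≡.cong +_ (toℕ-mod 1 n))))
    no∈ : Kernel.Mem (n ΣG.· o)
    no∈ = ≡.subst (+ n ℤ.∣_) (≡.sym (val-·o n)) (ℤ.∣m⇒∣m*n (+ (1 % n)) ℤ.∣-refl)
    nρ : n M.· ρ M.≈ M.0#
    nρ = M.+-cancelʳ (n M.· Hom.fun θ′ o) (n M.· ρ) M.0# (trans (sym (M.×-distrib-+ ρ (Hom.fun θ′ o) n))
      (trans (M.×-congʳ n {ρ M.+ Hom.fun θ′ o} {Hom.fun θ o} (M.sym {Hom.fun θ o} {ρ M.+ Hom.fun θ′ o} θo))
      (trans (sym (Hom.homo-· θ n o)) (trans (agree no∈) (trans (Hom.homo-· θ′ n o) (sym (M.+-identityˡ (n M.· Hom.fun θ′ o))))))))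
    j : ℕ
    j = proj₁ (logM ρ)
    jz : j M.· z M.≈ ρ
    jz = proj₂ (logM ρ)
    -- n ρ = 0 because n e_1 lies in the kernel of `val`; hence ρ is a power of ω = ζ^g.
    g∣j : g ∣ j
    g∣j = ℕ.*-cancelʳ-∣ n (≡.subst₂ _∣_ Q≡gn (ℕ.*-comm n j) (ord (n ℕ.* j) (trans (sym (M.×-assocˡ z n j)) (trans (M.×-congʳ n {j M.· z} {ρ} jz) nρ))))
    k : ℕ
    k = ℕ.quotient g∣j
    ρ-value : value ρ ≈ ω ^ k
    ρ-value = trans (sym jz) (trans (·-value S j z) (trans (^-congʳ ζ (ℕ.m∣n⇒n≡m*quotient g∣j)) (sym (^-assocʳ ζ g k))))
    at-v : ∀ v → at θ v ≈ ω ^ (k ℕ.* toℕ v) * at θ′ v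
    at-v v = begin
        at θ v
          ≈⟨ Hom.cong θ (ΣG.sym (ΣG.x-y+y (ind v) (t ΣG.· o))) ⟩
        value (Hom.fun θ ((ind v ΣG.- t ΣG.· o) ΣG.+ t ΣG.· o))
          ≈⟨ Hom.homo θ (ind v ΣG.- t ΣG.· o) (t ΣG.· o) ⟩
        value (Hom.fun θ (ind v ΣG.- t ΣG.· o) M.+ Hom.fun θ (t ΣG.· o))
          ≈⟨ *-cong (agree rest∈) (trans (Hom.homo-· θ t o) (trans (M.×-congʳ t {Hom.fun θ o} {ρ M.+ Hom.fun θ′ o} θo) (M.×-distrib-+ ρ (Hom.fun θ′ o) t))) ⟩
        value (Hom.fun θ′ (ind v ΣG.- t ΣG.· o)) * (value (t M.· ρ) * value (t M.· Hom.fun θ′ o))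
          ≈⟨ trans (sym (*-assoc _ _ _)) (trans (*-congʳ (*-comm _ _)) (*-assoc _ _ _)) ⟩
        value (t M.· ρ) * (value (Hom.fun θ′ (ind v ΣG.- t ΣG.· o)) * value (t M.· Hom.fun θ′ o))
          ≈⟨ *-cong (trans (·-value S t ρ) (trans (^-congˡ t ρ-value) (^-assocʳ ω k t))) (trans (*-congˡ (sym (Hom.homo-· θ′ t o)))
               (trans (sym (Hom.homo θ′ (ind v ΣG.- t ΣG.· o) (t ΣG.· o))) (Hom.cong θ′ (ΣG.x-y+y (ind v) (t ΣG.· o))))) ⟩
        ω ^ (k ℕ.* t) * at θ′ v ∎
      where
      open import Relation.Binary.Reasoning.Setoid setoid
      t = toℕ v
      rest∈ : Kernel.Mem (ind v ΣG.- t ΣG.· o)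
      rest∈ = ≡.subst (+ n ℤ.∣_) (≡.sym (≡.trans (val-+ (ind v) (ΣG.- (t ΣG.· o))) (≡.cong₂ ℤ._+_ (val-ind v) (≡.trans (val-neg (t ΣG.· o)) (≡.cong ℤ.-_ (val-·o t))))))
        (ℤ.divides (+ t ℤ.* + (1 / n)) (≡.trans (≡.cong (ℤ._- + t ℤ.* + (1 % n)) (≡.trans (≡.sym (ℤ.*-identityʳ (+ t))) (≡.cong (+ t ℤ.*_) one))) (lemma (+ t) (+ (1 % n)) (+ (1 / n)) (+ n))))
        where
        one : 1ℤ ≡ + (1 % n) ℤ.+ + (1 / n) ℤ.* + n
        one = ≡.trans (≡.cong +_ (ℕ.m≡m%n+[m/n]*n 1 n)) (≡.cong (ℤ._+_ (+ (1 % n))) (ℤ.pos-* (1 / n) n))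
        lemma : ∀ t r k n → t ℤ.* (r ℤ.+ k ℤ.* n) ℤ.- t ℤ.* r ≡ t ℤ.* k ℤ.* n
        lemma = solve-∀

  -- The factor X^k contributes the character y ↦ ω^(k val y), which is trivial where n divides val
  -- y.
  shift⇒agree : ∀ (θ θ′ : Character) → toUnit θ ≈X toUnit θ′ → ∀ {y} → Kernel.Mem y → Hom.fun θ y M.≈ Hom.fun θ′ y
  shift⇒agree θ θ′ (by k e) {y} y∈ = trans (character-ext θ (sumHom V.character θ′) same y)
      (trans (*-congʳ (pow-0 (V.L y) (≡.subst (+ Q ℤ.∣_) (≡.sym L-val) Q∣))) (*-identityˡ _))
    where
    l : Fin n → ℕ
    l v = k ℕ.* g ℕ.* toℕ v
    l-lemma : ∀ v → + Q ℤ.∣ (+ q ℤ.* + l v ℤ.- + l (σ v))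
    l-lemma v = ℤ.divides (+ k ℤ.* + b) (≡.trans (≡.cong₂ (λ s t → + q ℤ.* s ℤ.- t) (pos3 (toℕ v)) (≡.trans (pos3 (toℕ (σ v))) (≡.cong (λ t → + k ℤ.* + g ℤ.* + t) (toℕ-mod (q ℕ.* toℕ v) n))))
      (≡.trans (swap (+ q) (+ k) (+ g) (+ toℕ v) (+ a)) (≡.trans (≡.cong (λ s → + k ℤ.* + g ℤ.* (s ℤ.- + a)) (≡.trans (≡.sym (ℤ.pos-* q (toℕ v))) (≡.trans (≡.cong +_ (ℕ.m≡m%n+[m/n]*n (q ℕ.* toℕ v) n)) (≡.cong (ℤ._+_ (+ a)) (ℤ.pos-* b n)))))
      (≡.trans (final (+ k) (+ g) (+ a) (+ b) (+ n)) (≡.cong (+ k ℤ.* + b ℤ.*_) (≡.trans (≡.sym (ℤ.pos-* g n)) (≡.cong +_ (≡.sym Q≡gn))))))))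
      where
      a = (q ℕ.* toℕ v) % n
      b = (q ℕ.* toℕ v) / n
      pos3 : ∀ t → + (k ℕ.* g ℕ.* t) ≡ + k ℤ.* + g ℤ.* + t
      pos3 t = ≡.trans (ℤ.pos-* (k ℕ.* g) t) (≡.cong (ℤ._* + t) (ℤ.pos-* k g))
      swap : ∀ q k g t a → q ℤ.* (k ℤ.* g ℤ.* t) ℤ.- k ℤ.* g ℤ.* a ≡ k ℤ.* g ℤ.* (q ℤ.* t ℤ.- a)
      swap = solve-∀
      final : ∀ k g a b n → k ℤ.* g ℤ.* (a ℤ.+ b ℤ.* n ℤ.- a) ≡ k ℤ.* b ℤ.* (g ℤ.* n)
      final = solve-∀
    l-origin : Q ∣ l (origin n)
    l-origin = ≡.subst (Q ∣_) (≡.sym (≡.trans (≡.cong (k ℕ.* g ℕ.*_) toℕ-origin) (ℕ.*-zeroʳ (k ℕ.* g)))) (Q ℕ.∣0)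
    module V = Functional l l-origin l-lemma
    same : ∀ v → Hom.fun θ (ind v) M.≈ Hom.fun (sumHom V.character θ′) (ind v)
    same v = trans (sym (ev-toUnit θ v)) (trans (ev-cong (toℕ v) e) (trans (ev-⋆ (δ k) (elt (toUnit θ′)) (toℕ v))
      (*-cong (trans (ev-δ k (toℕ v)) (trans (^-assocʳ ζ g (k ℕ.* toℕ v)) (trans (^-congʳ ζ (≡.trans (≡.sym (ℕ.*-assoc g k (toℕ v))) (≡.cong (ℕ._* toℕ v) (ℕ.*-comm g k))))
        (trans (sym (·-value S (l v) z)) (sym (V.at-character v)))))) (ev-toUnit θ′ v))))
    L-val : V.L y ≡ + k ℤ.* + g ℤ.* val y
    L-val = ≡.trans (sum-cong (λ v → ≡.trans (≡.cong (ℤ._* y v) (≡.trans (ℤ.pos-* (k ℕ.* g) (toℕ v)) (≡.cong (ℤ._* + toℕ v) (ℤ.pos-* k g)))) (ℤ.*-assoc (+ k ℤ.* + g) (+ toℕ v) (y v))))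
      (≡.sym (*-sum (+ k ℤ.* + g) (λ v → + toℕ v ℤ.* y v)))
    Q∣ : + Q ℤ.∣ (+ k ℤ.* + g ℤ.* val y)
    Q∣ = ℤ.divides (+ k ℤ.* c) (≡.trans (≡.cong (+ k ℤ.* + g ℤ.*_) (ℤ._∣_.equality y∈)) (≡.trans (lemma (+ k) (+ g) c (+ n))
            (≡.cong (+ k ℤ.* c ℤ.*_) (≡.trans (≡.sym (ℤ.pos-* g n)) (≡.cong +_ (≡.sym Q≡gn))))))
      where
      c = ℤ.quotient y∈
      lemma : ∀ k g c n → k ℤ.* g ℤ.* (c ℤ.* n) ≡ k ℤ.* c ℤ.* (g ℤ.* n)
      lemma = solve-∀

  -- An element a is sent to the character y ↦ ⟨ μ a , y ⟩ of the kernel of `val`, extended to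
  -- Σ(n,q). The extension is a choice, but any two differ by a power of X.
  module SIso (R : Pairing kernel) (extend : ∀ h → ∃ λ h′ → Extension._Extends_ ΣGroup M h′ h × (∀ x → PartialHom.Mem h′ x)) where
    open Pairing R
    open WithPairing kernel R

    abstract
      extension : ∀ a → ∃ λ h′ → Extension._Extends_ ΣGroup M h′ (paired (μ a) (val-μ a)) × (∀ x → PartialHom.Mem h′ x)
      extension a = extend (paired (μ a) (val-μ a))

      θ : Vec → Character
      θ a = record { fun = PartialHom.φ h ; cong = λ {x} → PartialHom.φ-cong h (total x) ; homo = λ x y → PartialHom.φ-+ h (total x) (total y) }
        where
        h : PartialHom
        h = proj₁ (extension a)
        total : ∀ x → PartialHom.Mem h x
        total = proj₂ (proj₂ (extension a))

      θ-spec : ∀ a {y} → Kernel.Mem y → Hom.fun (θ a) y M.≈ ⟨ μ a , y ⟩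
      θ-spec a {y} y∈ = _Extends_.φ-ext (proj₁ (proj₂ (extension a))) {y} y∈

    private
      infixl 6 _⊹_
      _⊹_ : Vec → Vec → Vec
      (a ⊹ b) w = a w ℤ.+ b w

    μ-⟨⟩-cong : ∀ a x y → μ a ∼ x → Kernel.Mem y → Hom.fun (θ a) y M.≈ ⟨ x , y ⟩
    μ-⟨⟩-cong a x y e y∈ = trans (θ-spec a {y} y∈) (⟨⟩-cong {μ a} {x} {y} {y} (val-μ a) y∈ e ∼-refl)

    θ-cong : ∀ a b → μ a ∼ μ b → toUnit (θ a) ≈X toUnit (θ b)
    θ-cong a b e = agree⇒shift (θ a) (θ b) (λ {y} y∈ → trans (μ-⟨⟩-cong a (μ b) y e y∈) (sym (θ-spec b {y} y∈)))

    θ-homo : ∀ a b → toUnit (θ (a ⊹ b)) ≈X toUnit (sumHom (θ a) (θ b))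
    θ-homo a b = agree⇒shift (θ (a ⊹ b)) (sumHom (θ a) (θ b)) (λ {y} y∈ → trans (μ-⟨⟩-cong (a ⊹ b) (μ a ⊹ μ b) y (≐⇒∼ (λ w _ → μ-+ a b w)) y∈)
      (trans (⟨⟩-+ˡ {μ a} {μ b} {y} (val-μ a) (val-μ b) y∈) (sym (*-cong (θ-spec a {y} y∈) (θ-spec b {y} y∈)))))

    θ-inj : ∀ a b → toUnit (θ a) ≈X toUnit (θ b) → μ a ∼ μ b
    θ-inj a b e = separated {μ a} {μ b} (val-μ a) (val-μ b) (λ {y} y∈ → trans (sym (θ-spec a {y} y∈)) (trans (shift⇒agree (θ a) (θ b) e {y} y∈) (θ-spec b {y} y∈)))

    θ-onto : ∀ u → ∃ λ a → toUnit (θ a) ≈X u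
    θ-onto u = a , ≈X-trans {toUnit (θ a)} {toUnit θᵤ} {u}
        (agree⇒shift (θ a) θᵤ (λ {y} y∈ → trans (μ-⟨⟩-cong a x y (≐⇒∼ (proj₂ lift)) y∈) (sym (proj₂ (proj₂ completed) {y} y∈))))
        (≈X-from (toUnit-fromUnit u))
      where
      θᵤ = fromUnit u
      completed = complete (restrict θᵤ) (λ m → m)
      x : Vec
      x = proj₁ completed
      lift = μ-onto x (proj₁ (proj₂ completed))
      a : Vec
      a = proj₁ lift

    iso : Iso SGroup XGroup
    iso = record
      { hom = record
        { fun = λ a → toUnit (θ a)
        ; cong = λ {a} {b} → θ-cong a b
        ; homo = λ a b → ≈X-trans {toUnit (θ (a ⊹ b))} {toUnit (sumHom (θ a) (θ b))} {toUnit (θ a) ·ᵤ toUnit (θ b)} (θ-homo a b) (≈X-from (toUnit-+ (θ a) (θ b))) }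
      ; inj = θ-inj
      ; surj = θ-onto }

  isos : Iso ΣGroup CGroup × Iso SGroup XGroup
  isos = ΣIso.iso (pairing whole) , SIso.iso (pairing kernel) extend-character

S-finite : ∀ (n : ℕ) .{{_ : NonZero n}} (d : ℕ) .{{_ : ℕ.NonTrivial d}} → IsFinite (Lattice.SGroup n d)
S-finite n d = record { size = exponent ℕ.^ n ; enum = residues ; enum-surj = surj ; _≟_ = λ x y → μ x ∼? μ y }
  where
  open Lattice n d
  open Periodic
  surj : ∀ x → ∃ λ k → residues k ∼S x
  surj x with reduce x
  ... | k , c , e = k , ∼-sym (∼-trans {y = λ w → μ (residues k) w ℤ.+ + exponent ℤ.* μ c w}
      (≐⇒∼ (λ w w≢ → ≡.trans (μ-≐ {x} {λ w → residues k w ℤ.+ + exponent ℤ.* c w} (λ v _ → e v) w w≢)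
        (≡.trans (μ-+ (residues k) (λ v → + exponent ℤ.* c v) w) (≡.cong (ℤ._+_ (μ (residues k) w)) (μ-* (+ exponent) c w)))))
      (∼-trans {y = λ w → μ (residues k) w ℤ.+ 0ℤ} (∼-+ {μ (residues k)} {μ (residues k)} {λ w → + exponent ℤ.* μ c w} {λ _ → 0ℤ} ∼-refl (exponent-kills (μ c)))
        (≐⇒∼ (λ w _ → ℤ.+-identityʳ (μ (residues k) w)))))

module PrimeField {p : ℕ} (pr : Prime p) (F : FiniteField p) where
  open FiniteField F
  open FiniteFieldProperties F

  private
    module A = Additive +-abelianGroup

  zero-subgroup : Subgroup +-abelianGroup
  zero-subgroup = record
    { Mem = λ x → x ≈ 0# ; mem? = _≟F 0# ; resp = λ e f → trans (sym e) f
    ; mem-0 = refl ; mem-+ = λ e f → trans (+-cong e f) (+-identityˡ _) ; mem-neg = λ e → trans (-‿cong e) A.-0≈0 }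

  p·1 : p A.· 1# ≈ 0#
  p·1 = characteristic p 1 (≡.sym (ℕ.*-identityʳ p))

  additive-order : ∀ i → i A.· 1# ≈ 0# → p ∣ i
  additive-order i e with least? (λ t → t A.· 1# ≈ 0#) (λ t → _ ≟F _) p {{prime⇒nonZero pr}} p·1
  ... | r , lr , _ with prime⇒irreducible pr (order-divides +-abelianGroup zero-subgroup lr p p·1)
  ...   | inj₁ ≡.refl = ⊥-elim (0≉1 (sym (trans (sym (+-identityʳ 1#)) (Least.holds lr))))
  ...   | inj₂ ≡.refl = order-divides +-abelianGroup zero-subgroup lr i e

  -- The p multiples of 1 are distinct by `additive-order`, and F has p elements. This is false for
  -- a proper prime power, and it is what lets coefficients be lifted to integers.
  multiples-exhaust : ∀ c → ∃ λ (i : Fin p) → toℕ i A.· 1# ≈ c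
  multiples-exhaust c with Fin.any? (λ (i : Fin p) → (toℕ i A.· 1#) ≟F c)
  ... | yes r = r
  ... | no none = ⊥-elim impossible
    where
    f : Fin (suc p) → Carrier
    f Fin.zero = c
    f (Fin.suc i) = toℕ i A.· 1#
    same : ∀ {i j} → index (f i) ≡ index (f j) → f i ≈ f j
    same {i} {j} e = trans (sym (enum-index (f i))) (trans (reflexive (≡.cong enum e)) (enum-index (f j)))
    impossible : ⊥
    impossible with Fin.pigeonhole (ℕ.n<1+n p) (index ∘ f)
    ... | Fin.zero , Fin.zero , () , _
    ... | Fin.zero , Fin.suc j , _ , e = none (j , sym (same {Fin.zero} {Fin.suc j} e))
    ... | Fin.suc i , Fin.suc j , s≤s i<j , e = ℕ.<⇒≱ (ℕ.≤-<-trans (ℕ.m∸n≤m (toℕ j) (toℕ i)) (Fin.toℕ<n j))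
          (ℕ.∣⇒≤ {{ℕ.>-nonZero (ℕ.m<n⇒0<n∸m i<j)}} (additive-order (toℕ j ℕ.∸ toℕ i) (A.·-∸ {toℕ j} {toℕ i} (sym (same {Fin.suc i} {Fin.suc j} e)))))

  cyclic : IsCyclic +-abelianGroup p
  cyclic = record { z = 1# ; log = λ c → let i , e = multiples-exhaust c in toℕ i , e ; ord = additive-order ; kill = p·1 }

module _ (R : CommutativeRing 0ℓ 0ℓ) where
  open CommutativeRing R
  open Sums R

  push-⋆ : ∀ {n l} .{{_ : NonZero n}} .{{_ : NonZero l}} (f : Fin n → Fin l) → (∀ i j → f (i ⊕ j) ≡ f i ⊕ f j) →
           ∀ u w k → push f (GroupRing._⋆_ R n u w) k ≈ GroupRing._⋆_ R l (push f u) (push f w) k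
  push-⋆ {n} {l} f hom u w k = begin
    push f (GroupRing._⋆_ R n u w) k
      ≈⟨ sum-cong (λ v → *-comm _ _) ⟩
    sum (λ v → GroupRing._⋆_ R n u w v * ind (f v) k)
      ≈⟨ GroupRing.integrate R n u w (λ v → ind (f v) k) ⟩
    sum (λ i → u i * sum (λ j → w j * ind (f (i ⊕ j)) k))
      ≈⟨ sum-cong (λ i → *-congˡ (sum-cong (λ j → *-congˡ (reflexive (≡.cong (λ t → ind t k) (hom i j)))))) ⟩
    sum (λ i → u i * sum (λ j → w j * ind (f i ⊕ f j) k))
      ≈⟨ sum-cong (λ i → *-congˡ (sym (sum-push f w (λ b → ind (f i ⊕ b) k)))) ⟩
    sum (λ i → u i * sum (λ b → push f w b * ind (f i ⊕ b) k))
      ≈⟨ sum-cong (λ i → *-congˡ (sum-cong (λ b → *-comm _ _))) ⟩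
    sum (λ i → u i * push (f i ⊕_) (push f w) k)
      ≈⟨ sym (sum-push f u (λ a → push (a ⊕_) (push f w) k)) ⟩
    GroupRing._⋆_ R l (push f u) (push f w) k ∎
    where open import Relation.Binary.Reasoning.Setoid setoid

-- From n / p to n in characteristic p

-- Multiplication by p on ℤ/n factors as the reduction `ρ` to ℤ/n₁ followed by the injection `κ`, w
-- ↦ p w. In the opposite order the two compose to multiplication by p on ℤ/n₁.
module IndexMaps (p n₁ n : ℕ) .{{_ : NonZero n₁}} .{{_ : NonZero n}} (n≡ : n ≡ n₁ ℕ.* p) where

  ρ : Fin n → Fin n₁
  ρ v = toℕ v mod n₁

  κ : Fin n₁ → Fin n
  κ w = (p ℕ.* toℕ w) mod n

  incl : Fin n₁ → Fin n
  incl w = toℕ w mod n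

  n₁∣n : n₁ ∣ n
  n₁∣n = ≡.subst (n₁ ∣_) (≡.sym n≡) (ℕ.m∣m*n p)

  ρ-mod : ∀ a → ρ (a mod n) ≡ a mod n₁
  ρ-mod a = mod-cong n₁ (≡.trans (≡.cong (_% n₁) (toℕ-mod a n)) (ℕ.m∣n⇒o%n%m≡o%m n₁ n a n₁∣n))

  p*-% : ∀ a → (p ℕ.* (a % n₁)) % n ≡ (p ℕ.* a) % n
  p*-% a = ≡.trans (≡.sym (ℕ.[m+kn]%n≡m%n (p ℕ.* (a % n₁)) (a / n₁) n)) (≡.cong (_% n) (≡.trans (≡.cong (λ t → p ℕ.* (a % n₁) ℕ.+ (a / n₁) ℕ.* t) n≡)
    (≡.trans (+-*-Solver.solve 4 (λ p r k m → p :* r :+ k :* (m :* p) := p :* (r :+ k :* m)) ≡.refl p (a % n₁) (a / n₁) n₁) (≡.cong (p ℕ.*_) (≡.sym (ℕ.m≡m%n+[m/n]*n a n₁))))))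
    where open +-*-Solver

  κ-mod : ∀ a → κ (a mod n₁) ≡ (p ℕ.* a) mod n
  κ-mod a = mod-cong n (≡.trans (≡.cong (λ t → (p ℕ.* t) % n) (toℕ-mod a n₁)) (p*-% a))

  κρ : ∀ v → κ (ρ v) ≡ mul n p v
  κρ v = κ-mod (toℕ v)

  ρκ : ∀ w → ρ (κ w) ≡ mul n₁ p w
  ρκ w = ρ-mod (p ℕ.* toℕ w)

  ρ-incl : ∀ w → ρ (incl w) ≡ w
  ρ-incl w = ≡.trans (ρ-mod (toℕ w)) (toℕ-mod-self w)

  ρ-origin : ρ (origin n) ≡ origin n₁
  ρ-origin = ρ-mod 0

  κ-origin : κ (origin n₁) ≡ origin n
  κ-origin = ≡.trans (κ-mod 0) (≡.cong (_mod n) (ℕ.*-zeroʳ p))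

  ρ-⊕ : ∀ i j → ρ (i ⊕ j) ≡ ρ i ⊕ ρ j
  ρ-⊕ i j = ≡.trans (ρ-mod _) (≡.sym (mod-⊕ (toℕ i) (toℕ j)))

  κ-⊕ : ∀ i j → κ (i ⊕ j) ≡ κ i ⊕ κ j
  κ-⊕ i j = ≡.trans (κ-mod _) (≡.trans (≡.cong (_mod n) (ℕ.*-distribˡ-+ p (toℕ i) (toℕ j))) (≡.sym (mod-⊕ (p ℕ.* toℕ i) (p ℕ.* toℕ j))))

  κ-injective : .{{_ : NonZero p}} → ∀ {i j} → κ i ≡ κ j → i ≡ j
  κ-injective {i} {j} e = Fin.toℕ-injective (ℕ.*-cancelˡ-≡ (toℕ i) (toℕ j) p (≡.trans (≡.sym (ℕ.m<n⇒m%n≡m (bound i))) (≡.trans (mod-injective n e) (ℕ.m<n⇒m%n≡m (bound j)))))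
    where
    bound : ∀ i → p ℕ.* toℕ i ℕ.< n
    bound i = ≡.subst (p ℕ.* toℕ i ℕ.<_) (≡.trans (ℕ.*-comm p n₁) (≡.sym n≡)) (ℕ.*-monoʳ-< p (Fin.toℕ<n i))

module PrimeStep {p : ℕ} (pr : Prime p) (F : FiniteField p) (n₁ n : ℕ) .{{_ : NonZero n₁}} .{{_ : NonZero n}} (n≡ : n ≡ n₁ ℕ.* p) where

  open FiniteField F
  open FiniteFieldProperties F
  open PrimeField pr F using (cyclic; additive-order)
  instance
    p≢0 : NonZero p
    p≢0 = prime⇒nonZero pr
    p-nonTrivial : ℕ.NonTrivial p
    p-nonTrivial = prime⇒nonTrivial pr

  open IntegerPowers cyclic renaming (pow to cast; pow-+ to cast-+; pow-0 to cast-0; pow-cong to cast-cong)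
  open IndexMaps p n₁ n n≡
  module L = Lattice n p
  module L₁ = Lattice n₁ p
  module U = UnitGroup F n
  module U₁ = UnitGroup F n₁
  module G = GroupRing commRing n
  module G₁ = GroupRing commRing n₁
  module GF = GroupRingFrobenius commRing n
  module ℤS = Sums ℤ.+-*-commutativeRing
  module FS = Sums commRing
  module GR = CommutativeRing G.commutativeRing
  module GE = Exponent GR.semiring
  module FE = Exponent semiring
  module CG = Additive U.CGroup
  module XG = Additive U.XGroup
  module AF = Additive +-abelianGroup
  open L using (Vec; via) renaming (_∼_ to infix 4 _∼_; _∼S_ to infix 4 _∼S_)
  open U using (Unit; elt; inv; inverseʳ; augmentation; by)
  open G using (_≋_; _⋆_; δ)

  β : Vec → L₁.Vec
  β = ℤS.push ρ

  ι : L₁.Vec → Vec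
  ι = ℤS.push κ

  β-relator : ∀ b w → β (L.relator b) w ≡ L₁.relator (β b) w
  β-relator b w = ≡.trans (ℤS.push-+ ρ (λ v → + p ℤ.* b v) (λ v → ℤ.- ℤS.push L.σ b v) w)
    (≡.cong₂ ℤ._+_ (ℤS.push-* ρ (+ p) b w) (≡.trans (ℤS.push-neg ρ (ℤS.push L.σ b) w) (≡.cong ℤ.-_ (≡.trans (ℤS.push-push ρ L.σ b w)
      (≡.trans (ℤS.push-cong-fun b (λ v → ≡.trans (≡.cong ρ (≡.sym (κρ v))) (ρκ (ρ v))) w) (≡.sym (ℤS.push-push L₁.σ ρ b w)))))))

  ι-relator : ∀ b w → ι (L₁.relator b) w ≡ L.relator (ι b) w
  ι-relator b w = ≡.trans (ℤS.push-+ κ (λ v → + p ℤ.* b v) (λ v → ℤ.- ℤS.push L₁.σ b v) w)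
    (≡.cong₂ ℤ._+_ (ℤS.push-* κ (+ p) b w) (≡.trans (ℤS.push-neg κ (ℤS.push L₁.σ b) w) (≡.cong ℤ.-_ (≡.trans (ℤS.push-push κ L₁.σ b w)
      (≡.trans (ℤS.push-cong-fun b (λ v → ≡.trans (≡.cong κ (≡.sym (ρκ v))) (κρ (κ v))) w) (≡.sym (ℤS.push-push L.σ κ b w)))))))

  push-- : ∀ {k l} (f : Fin k → Fin l) x y w → ℤS.push f (λ v → x v ℤ.- y v) w ≡ ℤS.push f x w ℤ.- ℤS.push f y w
  push-- f x y w = ≡.trans (ℤS.push-+ f x (λ v → ℤ.- y v) w) (≡.cong (ℤ._+_ (ℤS.push f x w)) (ℤS.push-neg f y w))

  push-0 : ∀ {k l} (f : Fin k → Fin l) w → ℤS.push f (λ _ → 0ℤ) w ≡ 0ℤ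
  push-0 f w = ℤS.sum-0 (λ v → ℤ.*-zeroʳ (ℤS.ind (f v) w))

  β-cong : ∀ {x y} → x ∼ y → β x L₁.∼ β y
  β-cong {x} {y} (via b e) = L₁.via (β b) (λ w w≢ → ≡.trans (≡.sym (push-- ρ x y w))
    (≡.trans (push-≐ ρ ρ-origin e w w≢) (β-relator b w)))

  ι-cong : ∀ {x y} → x L₁.∼ y → ι x ∼ ι y
  ι-cong {x} {y} (L₁.via b e) = via (ι b) (λ w w≢ → ≡.trans (≡.sym (push-- κ x y w))
    (≡.trans (push-≐ κ κ-origin e w w≢) (ι-relator b w)))

  -- p x is x with v replaced by p v, that is, by `κ` after `ρ`. Together with `ι-injective` this
  -- makes the kernel of `β` exactly the p-torsion.
  p·∼ιβ : ∀ x → (p L.ΣG.· x) ∼ ι (β x)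
  p·∼ιβ x = L.∼-trans (L.≐⇒∼ (λ w _ → L.·-at p x w)) (L.∼-trans (L.d·∼push x) (L.≐⇒∼ (λ w _ →
    ≡.sym (≡.trans (ℤS.push-push κ ρ x w) (ℤS.push-cong-fun x κρ w)))))

  -- Off the image of `κ` the relation reads p b = 0, because ι z and the pushed witness live on
  -- that image. So the witness is itself an image, and the relation descends to n₁.
  ι-injective : ∀ z → ι z ∼ (λ _ → 0ℤ) → z L₁.∼ (λ _ → 0ℤ)
  ι-injective z (via b e) = L₁.via b₁ (λ u u≢ → ≡.trans (≡.cong (ℤ._- 0ℤ) (≡.sym (ℤS.push-injective κ κ-injective z u)))
      (≡.trans (e (κ u) (λ eq → u≢ (κ-injective (≡.trans eq (≡.sym κ-origin))))) (≡.cong (λ t → + p ℤ.* b (κ u) ℤ.- t) (pushes u u≢))))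
    where
    b₁ : L₁.Vec
    b₁ u = b (κ u)
    outside : ∀ w → w ≢ origin n → (∀ u → κ u ≢ w) → b w ≡ 0ℤ
    outside w w≢ miss = ℤ.*-cancelˡ-≡ (+ p) (b w) 0ℤ (≡.trans (≡.sym (ℤ.+-identityʳ _)) (≡.trans
      (≡.sym (≡.cong (λ t → + p ℤ.* b w ℤ.- t) (≡.trans (≡.trans (ℤS.push-cong-fun b (≡.sym ∘ κρ) w) (≡.sym (ℤS.push-push κ ρ b w)))
         (ℤS.push-outside κ (β b) w (λ u eq → ⊥-elim (miss u eq))))))
      (≡.trans (≡.sym (e w w≢)) (≡.trans (≡.cong (ℤ._- 0ℤ) (ℤS.push-outside κ z w (λ u eq → ⊥-elim (miss u eq)))) (≡.sym (ℤ.*-zeroʳ (+ p)))))))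
    recover : _≐_ n (ι b₁) b
    recover w w≢ with Fin.any? (λ u → κ u Fin.≟ w)
    ... | yes (u , ≡.refl) = ℤS.push-injective κ κ-injective b₁ u
    ... | no none = ≡.trans (ℤS.push-outside κ b₁ w (λ u eq → ⊥-elim (none (u , eq)))) (≡.sym (outside w w≢ (λ u eq → none (u , eq))))
    pushes : ∀ u → u ≢ origin n₁ → ℤS.push L.σ b (κ u) ≡ ℤS.push L₁.σ b₁ u
    pushes u u≢ = ≡.trans (≡.trans (ℤS.push-cong-fun b (≡.sym ∘ κρ) (κ u)) (≡.sym (ℤS.push-push κ ρ b (κ u))))
      (≡.trans (ℤS.push-injective κ κ-injective (β b) u) (≡.trans (≡.sym (push-≐ ρ ρ-origin recover u u≢))
        (≡.trans (ℤS.push-push ρ κ b₁ u) (ℤS.push-cong-fun b₁ ρκ u))))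

  β-ker : ∀ x → β x L₁.∼ (λ _ → 0ℤ) → (p L.ΣG.· x) ∼ (λ _ → 0ℤ)
  β-ker x e = L.∼-trans (p·∼ιβ x) (L.∼-trans (ι-cong e) (L.≐⇒∼ (λ w _ → push-0 κ w)))

  β-ker⁻ : ∀ x → (p L.ΣG.· x) ∼ (λ _ → 0ℤ) → β x L₁.∼ (λ _ → 0ℤ)
  β-ker⁻ x e = ι-injective (β x) (L.∼-trans (L.∼-sym (p·∼ιβ x)) e)

  β-surj : ∀ z → ∃ λ x → ∀ w → β x w ≡ z w
  β-surj z = ℤS.push incl z , λ w → ≡.trans (ℤS.push-push ρ incl z w) (ℤS.push-id ρ-incl z w)

  β-μ : ∀ x w → β (L.μ x) w ≡ L₁.μ (β x) w
  β-μ x w = ≡.trans (push-- ρ (λ v → ℤS.push (shift n) x v ℤ.- x v) (λ v → ℤS.sum x ℤ.* ℤS.ind (1 mod n) v) w)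
    (≡.cong₂ ℤ._-_ (≡.trans (push-- ρ (ℤS.push (shift n) x) x w) (≡.cong (ℤ._- β x w) (≡.trans (ℤS.push-push ρ (shift n) x w)
        (≡.trans (ℤS.push-cong-fun x shift-ρ w) (≡.sym (ℤS.push-push (shift n₁) ρ x w))))))
      (≡.trans (ℤS.push-* ρ (ℤS.sum x) (ℤS.ind (1 mod n)) w) (≡.cong₂ ℤ._*_ (≡.sym (ℤS.sum-push-total ρ x))
        (≡.trans (ℤS.push-ind ρ (1 mod n) w) (≡.cong (λ t → ℤS.ind t w) (ρ-mod 1))))))
    where
    shift-ρ : ∀ v → ρ (shift n v) ≡ shift n₁ (ρ v)
    shift-ρ v = ≡.trans (ρ-mod (suc (toℕ v))) (mod-cong n₁ (≡.trans (≡.sym (%-+ʳ 1 (toℕ v))) (≡.cong (λ t → suc t % n₁) (≡.sym (toℕ-mod (toℕ v) n₁)))))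

  βΣ : Hom L.ΣGroup L₁.ΣGroup
  βΣ = record { fun = β ; cong = β-cong ; homo = λ x y → L₁.≐⇒∼ (λ w _ → ℤS.push-+ ρ x y w) }

  βS : Hom L.SGroup L₁.SGroup
  βS = record
    { fun = β
    ; cong = λ {x} {y} e → L₁.∼-trans (L₁.≐⇒∼ (λ w _ → ≡.sym (β-μ x w))) (L₁.∼-trans (β-cong e) (L₁.≐⇒∼ (λ w _ → β-μ y w)))
    ; homo = λ x y → L₁.≐⇒∼ (L₁.μ-≐ (λ w _ → ℤS.push-+ ρ x y w)) }

  μ-0 : ∀ w → L.μ (λ _ → 0ℤ) w ≡ 0ℤ
  μ-0 w = L.μ-* 0ℤ (λ _ → 0ℤ) w

  μ₁-0 : ∀ w → L₁.μ (λ _ → 0ℤ) w ≡ 0ℤ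
  μ₁-0 w = L₁.μ-* 0ℤ (λ _ → 0ℤ) w

  module SG = Additive L.SGroup

  μ-· : ∀ k x → L.μ (k SG.· x) ∼ (k L.ΣG.· L.μ x)
  μ-· zero x = L.≐⇒∼ (λ w _ → μ-0 w)
  μ-· (suc k) x = L.∼-trans (L.≐⇒∼ (λ w _ → L.μ-+ x (k SG.· x) w)) (L.∼-+ {L.μ x} {L.μ x} {L.μ (k SG.· x)} {k L.ΣG.· L.μ x} L.∼-refl (μ-· k x))

  βS-ker : ∀ x → β x L₁.∼S (λ _ → 0ℤ) → (p SG.· x) ∼S (λ _ → 0ℤ)
  βS-ker x e = L.∼-trans (μ-· p x) (L.∼-trans (β-ker (L.μ x) (L₁.∼-trans (L₁.≐⇒∼ (λ w _ → β-μ x w)) (L₁.∼-trans e (L₁.≐⇒∼ (λ w _ → μ₁-0 w)))))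
    (L.≐⇒∼ (λ w _ → ≡.sym (μ-0 w))))

  torsion-μ : ∀ x → (p SG.· x) ∼S (λ _ → 0ℤ) → (p L.ΣG.· L.μ x) ∼ (λ _ → 0ℤ)
  torsion-μ x e = L.∼-trans (L.∼-sym (μ-· p x)) (L.∼-trans e (L.≐⇒∼ (λ w _ → μ-0 w)))

  βS-ker⁻ : ∀ x → (p SG.· x) ∼S (λ _ → 0ℤ) → β x L₁.∼S (λ _ → 0ℤ)
  βS-ker⁻ x e = L₁.∼-trans (L₁.≐⇒∼ (λ w _ → ≡.sym (β-μ x w))) (L₁.∼-trans (β-ker⁻ (L.μ x) (torsion-μ x e)) (L₁.≐⇒∼ (λ w _ → ≡.sym (μ₁-0 w))))

  frobenius : ∀ u → u GE.^ p ≋ FS.push L.σ u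
  frobenius u k = trans (GE.^-congʳ u (≡.sym (ℕ.*-identityʳ p)) k)
    (trans (GF.frobenius pr (characteristic p 1 (≡.sym (ℕ.*-identityʳ p))) 1 (λ c → trans (FE.^-congʳ c (ℕ.*-identityʳ p)) (fermat c)) u k)
      (FS.push-cong-fun u (λ v → ≡.cong (λ t → (t ℕ.* toℕ v) mod n) (ℕ.*-identityʳ p)) k))

  elt-· : ∀ k u → elt (k CG.· u) ≋ elt u GE.^ k
  elt-· zero u = GR.refl
  elt-· (suc k) u = GR.*-congˡ {elt u} (elt-· k u)

  elt-·X : ∀ k u → elt (k XG.· u) ≋ elt u GE.^ k
  elt-·X zero u = GR.refl
  elt-·X (suc k) u = GR.*-congˡ {elt u} (elt-·X k u)

  elt-p· : ∀ u → elt (p CG.· u) ≋ FS.push L.σ (elt u)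
  elt-p· u = GR.trans (elt-· p u) (frobenius (elt u))

  elt-p·X : ∀ u → elt (p XG.· u) ≋ FS.push L.σ (elt u)
  elt-p·X u = GR.trans (elt-·X p u) (frobenius (elt u))

  push-σ : ∀ u → FS.push L.σ u ≋ FS.push κ (FS.push ρ u)
  push-σ u k = sym (trans (FS.push-push κ ρ u k) (FS.push-cong-fun u κρ k))

  push-ρ-δ : ∀ a k → FS.push ρ (δ a) k ≈ G₁.δ a k
  push-ρ-δ a k = trans (FS.push-ind ρ (a mod n) k) (reflexive (≡.cong (λ t → FS.ind t k) (ρ-mod a)))

  push-κ-δ : ∀ a k → FS.push κ (G₁.δ a) k ≈ δ (p ℕ.* a) k
  push-κ-δ a k = trans (FS.push-ind κ (a mod n₁) k) (reflexive (≡.cong (λ t → FS.ind t k) (κ-mod a)))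

  push-κ-1 : ∀ k → FS.push κ (G₁.δ 0) k ≈ δ 0 k
  push-κ-1 k = trans (push-κ-δ 0 k) (reflexive (≡.cong (λ t → δ t k) (ℕ.*-zeroʳ p)))

  push-κ-injective : ∀ {u w} → FS.push κ u ≋ FS.push κ w → ∀ k → u k ≈ w k
  push-κ-injective {u} {w} e k = trans (sym (FS.push-injective κ κ-injective u k)) (trans (e (κ k)) (FS.push-injective κ κ-injective w k))

  -- Reduction modulo x^n₁ - 1. Since u^p is `push κ` of the reduction and `push κ` is injective,
  -- its kernel is that of u ↦ u^p.
  γ : Unit → U₁.Unit
  γ u = record
    { elt = FS.push ρ (elt u) ; inv = FS.push ρ (inv u)
    ; inverseʳ = λ k → trans (sym (push-⋆ commRing ρ ρ-⊕ (elt u) (inv u) k)) (trans (FS.push-cong ρ (inverseʳ u) k) (push-ρ-δ 0 k))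
    ; augmentation = trans (FS.sum-push-total ρ (elt u)) (augmentation u) }

  γC : Hom U.CGroup U₁.CGroup
  γC = record { fun = γ ; cong = FS.push-cong ρ ; homo = λ u w → push-⋆ commRing ρ ρ-⊕ (elt u) (elt w) }

  γX : Hom U.XGroup U₁.XGroup
  γX = record { fun = γ
    ; cong = λ { {u} {w} (by k e) → U₁.by k (λ l → trans (FS.push-cong ρ e l) (trans (push-⋆ commRing ρ ρ-⊕ (δ k) (elt w) l) (G₁.⋆-cong {w = FS.push ρ (elt w)} (push-ρ-δ k) (λ _ → refl) l))) }
    ; homo = λ u w → U₁.≈X-from (push-⋆ commRing ρ ρ-⊕ (elt u) (elt w)) }

  γ-surj : ∀ w → ∃ λ u → ∀ k → U₁.elt (γ u) k ≈ U₁.elt w k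
  γ-surj w = record
      -- u^p is `push κ` of w, whose inverse is `push κ` of w⁻¹; multiplied by u^(p-1) it inverts u.
      { elt = u ; inv = u GE.^ ℕ.pred p ⋆ FS.push κ (U₁.inv w)
      ; inverseʳ = GR.trans (GR.sym (G.⋆-assoc u (u GE.^ ℕ.pred p) (FS.push κ (U₁.inv w)))) (GR.trans (GR.*-congʳ {FS.push κ (U₁.inv w)} u^p)
          (λ k → trans (sym (push-⋆ commRing κ κ-⊕ (U₁.elt w) (U₁.inv w) k)) (trans (FS.push-cong κ (U₁.inverseʳ w) k) (push-κ-1 k))))
      ; augmentation = trans (FS.sum-push-total incl (U₁.elt w)) (U₁.augmentation w) } , ρu
    where
    u : G.Elt
    u = FS.push incl (U₁.elt w)
    ρu : ∀ k → FS.push ρ u k ≈ U₁.elt w k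
    ρu k = trans (FS.push-push ρ incl (U₁.elt w) k) (FS.push-id ρ-incl (U₁.elt w) k)
    u^p : u ⋆ u GE.^ ℕ.pred p ≋ FS.push κ (U₁.elt w)
    u^p = GR.trans (GE.^-congʳ u (ℕ.suc-pred p)) (GR.trans (frobenius u) (GR.trans (push-σ u) (FS.push-cong κ ρu)))

  γ-ker : ∀ u → U₁.elt (γ u) G₁.≋ G₁.δ 0 → elt (p CG.· u) ≋ δ 0
  γ-ker u e = GR.trans (elt-p· u) (GR.trans (push-σ (elt u)) (GR.trans (FS.push-cong κ e) push-κ-1))

  γ-ker⁻ : ∀ u → elt (p CG.· u) ≋ δ 0 → U₁.elt (γ u) G₁.≋ G₁.δ 0
  γ-ker⁻ u e = push-κ-injective (GR.trans (GR.sym (push-σ (elt u))) (GR.trans (GR.sym (elt-p· u)) (GR.trans e (GR.sym push-κ-1))))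

  γX-ker : ∀ u → γ u U₁.≈X U₁.1ᵤ → (p XG.· u) U.≈X U.1ᵤ
  γX-ker u (U₁.by k e) = by (p ℕ.* k) (GR.trans (elt-p·X u) (GR.trans (push-σ (elt u)) (GR.trans (FS.push-cong κ (λ l → trans (e l) (GR₁.*-identityʳ (G₁.δ k) l)))
      (GR.trans (push-κ-δ k) (GR.sym (GR.*-identityʳ (δ (p ℕ.* k))))))))
    where module GR₁ = CommutativeRing G₁.commutativeRing

  -- A monomial in the image of x ↦ x ^ p is the p-th power of a monomial.
  monomial-image : ∀ u k → FS.push κ u ≋ δ k → ∃ λ a → (∀ l → u l ≈ G₁.δ a l) × δ k ≋ δ (p ℕ.* a)
  monomial-image u k e with Fin.any? (λ w → κ w Fin.≟ (k mod n))
  ... | no none = ⊥-elim (0≉1 (trans (sym (FS.push-outside κ u (k mod n) (λ w eq → ⊥-elim (none (w , eq))))) (trans (e (k mod n)) (FS.ind-≡ {i = k mod n} ≡.refl))))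
  ... | yes (w , κw) = toℕ w , push-κ-injective (GR.trans e (GR.trans δk (GR.sym (push-κ-δ (toℕ w))))) , δk
    where
    δk : δ k ≋ δ (p ℕ.* toℕ w)
    δk l = reflexive (≡.cong (λ t → FS.ind t l) (≡.sym κw))

  γX-ker⁻ : ∀ u → (p XG.· u) U.≈X U.1ᵤ → γ u U₁.≈X U₁.1ᵤ
  γX-ker⁻ u (by k e) with monomial-image (FS.push ρ (elt u)) k
      (GR.trans (GR.sym (push-σ (elt u))) (GR.trans (GR.sym (elt-p·X u)) (GR.trans e (GR.*-identityʳ (δ k)))))
  ... | a , ea , _ = U₁.by a (λ l → trans (ea l) (sym (GR₁.*-identityʳ (G₁.δ a) l)))
    where module GR₁ = CommutativeRing G₁.commutativeRing

  cast-inj : ∀ k → cast k ≈ 0# → + p ℤ.∣ k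
  cast-inj k e = ≡.subst (+ p ℤ.∣_) (≡.sym (ℤ.a≡a%ℕn+[a/ℕn]*n k p)) (ℤ.∣m∣n⇒∣m+n (ℤ.∣ᵤ⇒∣ {+ p} {+ (k ℤ.%ℕ p)} (additive-order (k ℤ.%ℕ p) e)) (ℤ.∣n⇒∣m*n (k ℤ./ℕ p) ℤ.∣-refl))

  cast-neg : ∀ k → cast (ℤ.- k) ≈ - cast k
  cast-neg k = AF.neg-unique (cast k) (cast (ℤ.- k)) (trans (sym (cast-+ k (ℤ.- k))) (cast-0 (k ℤ.+ ℤ.- k) (≡.subst (+ p ℤ.∣_) (≡.sym (ℤ.+-inverseʳ k)) (ℤ.divides 0ℤ ≡.refl))))

  cast-sum : ∀ {k} (f : Fin k → ℤ) → cast (ℤS.sum f) ≈ FS.sum (cast ∘ f)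
  cast-sum {zero} f = trans (reflexive (≡.cong cast (ℤS.sum-zero f))) (trans (cast-0 0ℤ (ℤ.divides 0ℤ ≡.refl)) (sym (reflexive (FS.sum-zero (cast ∘ f)))))
  cast-sum {suc k} f = trans (reflexive (≡.cong cast (ℤS.sum-suc f))) (trans (cast-+ (f Fin.zero) (ℤS.sum (f ∘ Fin.suc)))
    (trans (+-congˡ (cast-sum (f ∘ Fin.suc))) (sym (reflexive (FS.sum-suc (cast ∘ f))))))

  cast-·ℕ : ∀ i k → cast (+ i ℤ.* k) ≈ i AF.· cast k
  cast-·ℕ zero k = cast-0 0ℤ (ℤ.divides 0ℤ ≡.refl)
  cast-·ℕ (suc i) k = trans (reflexive (≡.cong cast (ℤ.suc-* (+ i) k))) (trans (cast-+ k (+ i ℤ.* k)) (+-congˡ (cast-·ℕ i k)))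

  cast-push : ∀ {k l} (f : Fin k → Fin l) b w → cast (ℤS.push f b w) ≈ FS.push f (cast ∘ b) w
  cast-push f b w = trans (cast-sum (λ v → ℤS.ind (f v) w ℤ.* b v)) (FS.sum-cong term)
    where
    term : ∀ v → cast (ℤS.ind (f v) w ℤ.* b v) ≈ FS.ind (f v) w * cast (b v)
    term v with f v Fin.≟ w
    ... | yes _ = trans (reflexive (≡.cong cast (ℤ.*-identityˡ (b v)))) (sym (*-identityˡ _))
    ... | no _ = trans (cast-0 0ℤ (ℤ.divides 0ℤ ≡.refl)) (sym (zeroˡ _))

  -- Multiplying by p, an element of Σ[p] becomes relator b with b mod p in the kernel of
  -- x ↦ x ^ p; this identifies Σ[p] with that kernel, hence with C'[p] = 1 + kernel.
  module Torsion (a : Vec) (pa : (p L.ΣG.· a) ∼ (λ _ → 0ℤ)) where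
    open L._∼_ pa renaming (witness to b₀; equation to e₀)

    b : Vec
    -- The entry at the origin is free in Σ(n,p) but not in the group ring. This value makes
    -- `push σ b` vanish there, as membership in the kernel requires.
    b v = b₀ v ℤ.- ℤS.push L.σ b₀ (origin n) ℤ.* ℤS.ind (origin n) v

    b≐b₀ : _≐_ n b b₀
    b≐b₀ v v≢ = ≡.trans (≡.cong (λ t → b₀ v ℤ.- ℤS.push L.σ b₀ (origin n) ℤ.* t) (ℤS.ind-≢ {i = origin n} {v} (v≢ ∘ ≡.sym)))
      (≡.trans (≡.cong (λ t → b₀ v ℤ.- t) (ℤ.*-zeroʳ (ℤS.push L.σ b₀ (origin n)))) (ℤ.+-identityʳ (b₀ v)))

    p·a≐ : _≐_ n (λ w → + p ℤ.* a w) (L.relator b)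
    p·a≐ w w≢ = ≡.trans (≡.sym (≡.trans (ℤ.+-identityʳ _) (L.·-at p a w))) (≡.trans (e₀ w w≢)
      (≡.cong₂ (λ s t → + p ℤ.* s ℤ.- t) (≡.sym (b≐b₀ w w≢)) (≡.sym (push-≐ L.σ (mul-origin p) b≐b₀ w w≢))))

    in-kernel : ∀ w → FS.push L.σ (cast ∘ b) w ≈ 0#
    in-kernel w = trans (sym (cast-push L.σ b w)) (cast-0 _ (divisible (w Fin.≟ origin n)))
      where
      divisible : Dec (w ≡ origin n) → + p ℤ.∣ ℤS.push L.σ b w
      divisible (no w≢) = ℤ.divides (b w ℤ.- a w) (≡.trans (lemma (+ p ℤ.* b w) (ℤS.push L.σ b w)) (≡.trans (≡.cong (λ t → + p ℤ.* b w ℤ.- t) (≡.sym (p·a≐ w w≢))) (lemma′ (+ p) (b w) (a w))))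
        where
        lemma : ∀ x y → y ≡ x ℤ.- (x ℤ.- y)
        lemma = solve-∀
        lemma′ : ∀ p b a → p ℤ.* b ℤ.- p ℤ.* a ≡ (b ℤ.- a) ℤ.* p
        lemma′ = solve-∀
      divisible (yes ≡.refl) = ℤ.divides 0ℤ (≡.trans (push-- L.σ b₀ (λ v → s ℤ.* ℤS.ind (origin n) v) (origin n))
          (≡.trans (≡.cong (λ t → s ℤ.- t) (≡.trans (ℤS.push-* L.σ s (ℤS.ind (origin n)) (origin n)) (≡.trans (≡.cong (ℤ._*_ s)
            (≡.trans (ℤS.push-ind L.σ (origin n) (origin n)) (ℤS.ind-≡ {i = L.σ (origin n)} (mul-origin p)))) (ℤ.*-identityʳ s)))) (ℤ.+-inverseʳ s)))
        where s = ℤS.push L.σ b₀ (origin n)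

    u : G.Elt
    u v = δ 0 v + cast (b v)

    push-σ-δ : FS.push L.σ (δ 0) ≋ δ 0
    push-σ-δ k = trans (FS.push-ind L.σ (origin n) k) (reflexive (≡.cong (λ t → FS.ind t k) (mul-origin p)))

    push-σ-u : FS.push L.σ u ≋ δ 0
    push-σ-u k = trans (FS.push-+ L.σ (δ 0) (cast ∘ b) k) (trans (+-cong (push-σ-δ k) (in-kernel k)) (+-identityʳ _))

    unit : Unit
    unit = record
      { elt = u ; inv = u GE.^ ℕ.pred p
      ; inverseʳ = GR.trans (GE.^-congʳ u (ℕ.suc-pred p)) (GR.trans (frobenius u) push-σ-u)
      ; augmentation = trans (sym (FS.sum-push-total L.σ u)) (trans (FS.sum-cong push-σ-u) (U.sum-δ 0)) }

    torsion : elt (p CG.· unit) ≋ δ 0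
    torsion = GR.trans (elt-p· unit) push-σ-u

  relator-≐ : ∀ {x y} → _≐_ n x y → _≐_ n (L.relator x) (L.relator y)
  relator-≐ e w w≢ = ≡.cong₂ (λ s t → + p ℤ.* s ℤ.- t) (e w w≢) (push-≐ L.σ (mul-origin p) e w w≢)

  cancel-p : ∀ {x y} → + p ℤ.* x ≡ + p ℤ.* y → x ≡ y
  cancel-p {x} {y} = ℤ.*-cancelˡ-≡ (+ p) x y

  -- Equal units mean witnesses with b - b′ = p g; then p (a - a′) = relator (p g), and p cancels.
  τ-refl : ∀ a pa a′ pa′ → Torsion.u a pa ≋ Torsion.u a′ pa′ → a ∼ a′
  τ-refl a pa a′ pa′ e = via g (λ w w≢ → cancel-p (begin
      + p ℤ.* (a w ℤ.- a′ w)
        ≡⟨ lemma (+ p) (a w) (a′ w) ⟩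
      + p ℤ.* a w ℤ.- + p ℤ.* a′ w
        ≡⟨ ≡.cong₂ ℤ._-_ (T.p·a≐ w w≢) (T′.p·a≐ w w≢) ⟩
      L.relator T.b w ℤ.- L.relator T′.b w
        ≡⟨ ≡.sym (L.relator-- T.b T′.b w) ⟩
      L.relator (λ v → T.b v ℤ.- T′.b v) w
        ≡⟨ relator-≐ (λ v _ → ≡.trans (ℤ._∣_.equality (divisible v)) (ℤ.*-comm (g v) (+ p))) w w≢ ⟩
      L.relator (λ v → + p ℤ.* g v) w
        ≡⟨ L.relator-* (+ p) g w ⟩
      + p ℤ.* L.relator g w ∎))
    where
    open ≡.≡-Reasoning
    module T = Torsion a pa
    module T′ = Torsion a′ pa′
    lemma : ∀ p a b → p ℤ.* (a ℤ.- b) ≡ p ℤ.* a ℤ.- p ℤ.* b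
    lemma = solve-∀
    divisible : ∀ v → + p ℤ.∣ (T.b v ℤ.- T′.b v)
    divisible v = cast-inj _ (trans (cast-+ (T.b v) (ℤ.- T′.b v)) (trans (+-congˡ (cast-neg (T′.b v)))
      (AF.x≈y⇒x-y≈0 (AF.+-cancelˡ (δ 0 v) (cast (T.b v)) (cast (T′.b v)) (e v)))))
    g : Vec
    g v = ℤ.quotient (divisible v)

  -- The coefficients of u are lifted to integers b; u stands for u - 1, from which it differs only
  -- in the ignored entry. Since u^p = 1, the vector push σ b is p c off the origin, and a = b - c
  -- satisfies p a = relator b.
  module Untorsion (u : Unit) (pu : FS.push L.σ (elt u) ≋ δ 0) where

    b : Vec
    b v = + proj₁ (IsCyclic.log cyclic (elt u v))

    cast-b : ∀ v → cast (b v) ≈ elt u v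
    cast-b v = trans (pow-+n (proj₁ (IsCyclic.log cyclic (elt u v)))) (proj₂ (IsCyclic.log cyclic (elt u v)))

    divisible : ∀ w → w ≢ origin n → + p ℤ.∣ ℤS.push L.σ b w
    divisible w w≢ = cast-inj _ (trans (cast-push L.σ b w) (trans (FS.push-cong L.σ cast-b w) (trans (pu w) (FS.ind-≢ {i = origin n} {w} (w≢ ∘ ≡.sym)))))

    c : Vec
    c w with w Fin.≟ origin n
    ... | yes _ = 0ℤ
    ... | no w≢ = ℤ.quotient (divisible w w≢)

    c-spec : ∀ w → w ≢ origin n → ℤS.push L.σ b w ≡ + p ℤ.* c w
    c-spec w w≢ with w Fin.≟ origin n
    ... | yes e = ⊥-elim (w≢ e)
    ... | no ne = ≡.trans (ℤ._∣_.equality (divisible w ne)) (ℤ.*-comm _ (+ p))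

    a : Vec
    a w = b w ℤ.- c w

    p·a≐ : _≐_ n (λ w → + p ℤ.* a w) (L.relator b)
    p·a≐ w w≢ = ≡.trans (lemma (+ p) (b w) (c w)) (≡.cong (λ t → + p ℤ.* b w ℤ.- t) (≡.sym (c-spec w w≢)))
      where
      lemma : ∀ p a b → p ℤ.* (a ℤ.- b) ≡ p ℤ.* a ℤ.- p ℤ.* b
      lemma = solve-∀

    torsion : (p L.ΣG.· a) ∼ (λ _ → 0ℤ)
    torsion = L.∼-trans (L.≐⇒∼ (λ w w≢ → ≡.trans (L.·-at p a w) (p·a≐ w w≢))) (via b (λ w _ → ℤ.+-identityʳ (L.relator b w)))

  sum-at-origin : ∀ (z : G.Elt) → (∀ v → v ≢ origin n → z v ≈ 0#) → FS.sum z ≈ z (origin n)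
  sum-at-origin z e = trans (FS.sum-cong term) (FS.sum-ind (origin n) z)
    where
    term : ∀ v → z v ≈ FS.ind (origin n) v * z v
    term v with origin n Fin.≟ v
    ... | yes _ = sym (*-identityˡ _)
    ... | no ne = trans (e v (ne ∘ ≡.sym)) (sym (zeroˡ _))

  -- If a - a′ = relator g, then b - b′ - p g has relator 0 and so vanishes off the origin. The
  -- coefficients at 0 agree because both units have augmentation 1.
  τ′-refl : ∀ u pu u′ pu′ → Untorsion.a u pu ∼ Untorsion.a u′ pu′ → elt u ≋ elt u′
  τ′-refl u pu u′ pu′ (via g e) = λ v → AF.x-y≈0⇒x≈y (elt u v) (elt u′ v) (diff-0 v (v Fin.≟ origin n))
    where
    open ≡.≡-Reasoning
    module T = Untorsion u pu
    module T′ = Untorsion u′ pu′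
    lemma : ∀ p a b → p ℤ.* a ℤ.- p ℤ.* b ≡ p ℤ.* (a ℤ.- b)
    lemma = solve-∀
    relator-0 : _≐_ n (L.relator (λ v → T.b v ℤ.- T′.b v ℤ.- + p ℤ.* g v)) (λ _ → 0ℤ)
    relator-0 w w≢ = begin
      L.relator (λ v → T.b v ℤ.- T′.b v ℤ.- + p ℤ.* g v) w
        ≡⟨ L.relator-- (λ v → T.b v ℤ.- T′.b v) (λ v → + p ℤ.* g v) w ⟩
      L.relator (λ v → T.b v ℤ.- T′.b v) w ℤ.- L.relator (λ v → + p ℤ.* g v) w
        ≡⟨ ≡.cong₂ ℤ._-_ (≡.trans (L.relator-- T.b T′.b w) (≡.trans (≡.cong₂ ℤ._-_ (≡.sym (T.p·a≐ w w≢)) (≡.sym (T′.p·a≐ w w≢))) (lemma (+ p) (T.a w) (T′.a w)))) (L.relator-* (+ p) g w) ⟩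
      + p ℤ.* (T.a w ℤ.- T′.a w) ℤ.- + p ℤ.* L.relator g w
        ≡⟨ ≡.trans (≡.cong (λ t → + p ℤ.* t ℤ.- + p ℤ.* L.relator g w) (e w w≢)) (ℤ.+-inverseʳ (+ p ℤ.* L.relator g w)) ⟩
      0ℤ ∎
    off : ∀ v → v ≢ origin n → elt u v - elt u′ v ≈ 0#
    off v v≢ = trans (+-cong (sym (T.cast-b v)) (-‿cong (sym (T′.cast-b v)))) (trans (+-congˡ (sym (cast-neg (T′.b v)))) (trans (sym (cast-+ (T.b v) (ℤ.- T′.b v)))
      (cast-0 _ (ℤ.divides (g v) (≡.trans (ℤ.i-j≡0⇒i≡j (T.b v ℤ.- T′.b v) (+ p ℤ.* g v) (L.Periodic.relator-injective (λ v → T.b v ℤ.- T′.b v ℤ.- + p ℤ.* g v) relator-0 v v≢)) (ℤ.*-comm (+ p) (g v)))))))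
    diff-0 : ∀ v → Dec (v ≡ origin n) → elt u v - elt u′ v ≈ 0#
    diff-0 v (no v≢) = off v v≢
    diff-0 v (yes ≡.refl) = trans (sym (sum-at-origin (λ v → elt u v - elt u′ v) off)) (trans (FS.sum-+ (elt u) (λ v → - elt u′ v))
          (trans (+-cong (augmentation u) (trans (FS.sum-neg (elt u′)) (-‿cong (augmentation u′)))) (-‿inverseʳ 1#)))

  _≟C_ : ∀ (u w : Unit) → Dec (elt u ≋ elt w)
  u ≟C w = Fin.all? (λ k → elt u k ≟F elt w k)

  to-push : ∀ u → elt (p CG.· u) ≋ δ 0 → FS.push L.σ (elt u) ≋ δ 0
  to-push u pu = GR.trans (GR.sym (elt-p· u)) pu

  βΣ-surj : ∀ z → ∃ λ x → β x L₁.∼ z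
  βΣ-surj z = proj₁ (β-surj z) , L₁.≐⇒∼ (λ w _ → proj₂ (β-surj z) w)

  Σ-step : Iso L₁.ΣGroup U₁.CGroup → Iso L.ΣGroup U.CGroup
  Σ-step f = Lift.iso L.ΣGroup U.CGroup L₁.ΣGroup U₁.CGroup pr (L.Periodic.Σ-finite) _≟C_ βΣ γC f
    βΣ-surj β-ker β-ker⁻ γ-surj γ-ker γ-ker⁻
    (λ a pa → Torsion.unit a pa) (λ a pa → Torsion.torsion a pa) τ-refl
    (λ u pu → Untorsion.a u (to-push u pu)) (λ u pu → Untorsion.torsion u (to-push u pu)) (λ u pu u′ pu′ → τ′-refl u (to-push u pu) u′ (to-push u′ pu′))

-- The p-torsion of S(n,p) and of C'(n,p) / ⟨X⟩

module PrimeStepS {p : ℕ} (pr : Prime p) (F : FiniteField p) (n₁ n : ℕ) .{{_ : NonZero n₁}} .{{_ : NonZero n}} (n≡ : n ≡ n₁ ℕ.* p) where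

  open FiniteField F
  open FiniteFieldProperties F
  open PrimeField pr F using (cyclic; additive-order)
  open PrimeStep pr F n₁ n n≡
  open IntegerPowers cyclic renaming (pow to cast; pow-0 to cast-0) using ()
  open IndexMaps p n₁ n n≡
  open L using (Vec; via) renaming (_∼_ to infix 4 _∼_; _∼S_ to infix 4 _∼S_)
  open U using (Unit; elt; inv; inverseʳ; augmentation; by)
  open G using (_≋_; _⋆_; δ)
  open Multiple semiring using (×-comm-*; ×-congʳ)

  weight : Fin n → Carrier
  weight v = (toℕ v / n₁) AF.· 1#

  -- The powers of X whose p-th power is 1 are those of X^n₁. Λ detects them: in augmentation 1,
  -- multiplication by x^(n₁ t) adds t to it. Its weights ⌊v / n₁⌋ = ⌊p v / n⌋ are the quotients in
  -- `val-relator`.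
  Λ : G.Elt → Carrier
  Λ u = FS.sum (λ v → u v * weight v)

  -- Reducing an exponent modulo n = n₁ p changes its quotient by n₁ by a multiple of p, which is 0
  -- in F.
  weight-shift : ∀ t v → weight ((n₁ ℕ.* t ℕ.+ toℕ v) mod n) ≈ weight v + t AF.· 1#
  weight-shift t v = begin
    (toℕ (x mod n) / n₁) AF.· 1#
      ≈⟨ AF.×-congˡ (≡.cong (_/ n₁) (toℕ-mod x n)) ⟩
    ((x % n) / n₁) AF.· 1#
      ≈⟨ sym (trans (+-congˡ (AF.·-multiple {p} {(x / n) ℕ.* p} {1#} (IsCyclic.kill cyclic) (ℕ.n∣m*n (x / n)))) (+-identityʳ _)) ⟩
    ((x % n) / n₁) AF.· 1# + ((x / n) ℕ.* p) AF.· 1#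
      ≈⟨ sym (AF.×-homo-+ 1# ((x % n) / n₁) ((x / n) ℕ.* p)) ⟩
    ((x % n) / n₁ ℕ.+ (x / n) ℕ.* p) AF.· 1#
      ≈⟨ AF.×-congˡ (≡.sym quotients) ⟩
    (toℕ v / n₁ ℕ.+ t) AF.· 1#
      ≈⟨ AF.×-homo-+ 1# (toℕ v / n₁) t ⟩
    weight v + t AF.· 1# ∎
    where
    open import Relation.Binary.Reasoning.Setoid setoid
    x = n₁ ℕ.* t ℕ.+ toℕ v
    quotients : toℕ v / n₁ ℕ.+ t ≡ (x % n) / n₁ ℕ.+ (x / n) ℕ.* p
    quotients = ≡.trans (ℕ.+-comm (toℕ v / n₁) t) (≡.trans (≡.cong (ℕ._+ toℕ v / n₁) (≡.sym (≡.trans (≡.cong (_/ n₁) (ℕ.*-comm n₁ t)) (ℕ.m*n/n≡m t n₁))))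
      (≡.trans (≡.sym (ℕ.+-distrib-/-∣ˡ (toℕ v) (ℕ.m∣m*n t))) (≡.trans (≡.cong (_/ n₁) (≡.trans (ℕ.m≡m%n+[m/n]*n x n) (≡.cong (x % n ℕ.+_) (≡.trans (≡.cong ((x / n) ℕ.*_) (≡.trans n≡ (ℕ.*-comm n₁ p))) (≡.sym (ℕ.*-assoc (x / n) p n₁))))))
      (≡.trans (ℕ.+-distrib-/-∣ʳ (x % n) (ℕ.n∣m*n ((x / n) ℕ.* p))) (≡.cong ((x % n) / n₁ ℕ.+_) (ℕ.m*n/n≡m ((x / n) ℕ.* p) n₁))))))

  Λ-shift : ∀ t u → Λ (δ (n₁ ℕ.* t) ⋆ u) ≈ Λ u + (t AF.· 1#) * FS.sum u
  Λ-shift t u = begin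
    FS.sum (λ v → (δ (n₁ ℕ.* t) ⋆ u) v * weight v)
      ≈⟨ FS.sum-cong (λ v → *-congʳ (G.δ⋆ (n₁ ℕ.* t) u v)) ⟩
    FS.sum (λ v → FS.push f u v * weight v)
      ≈⟨ FS.sum-push f u weight ⟩
    FS.sum (λ v → u v * weight (f v))
      ≈⟨ FS.sum-cong (λ v → trans (*-congˡ (weight-shift t v)) (trans (distribˡ _ _ _) (+-congˡ (*-comm _ _)))) ⟩
    FS.sum (λ v → u v * weight v + (t AF.· 1#) * u v)
      ≈⟨ FS.sum-+ (λ v → u v * weight v) (λ v → (t AF.· 1#) * u v) ⟩
    Λ u + FS.sum (λ v → (t AF.· 1#) * u v)
      ≈⟨ +-congˡ (sym (FS.*-sum (t AF.· 1#) u)) ⟩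
    Λ u + (t AF.· 1#) * FS.sum u ∎
    where
    open import Relation.Binary.Reasoning.Setoid setoid
    f : Fin n → Fin n
    f j = (n₁ ℕ.* t ℕ.+ toℕ j) mod n

  Λ-cong : ∀ {u w} → u ≋ w → Λ u ≈ Λ w
  Λ-cong e = FS.sum-cong (λ v → *-congʳ (e v))

  Λ-1 : Λ (δ 0) ≈ 0#
  Λ-1 = trans (FS.sum-ind (0 mod n) weight) (AF.×-congˡ (≡.trans (≡.cong (_/ n₁) toℕ-origin) (ℕ.0/n≡0 n₁)))

  Λℤ : Vec → ℤ
  Λℤ b = ℤS.sum (λ v → + (toℕ v / n₁) ℤ.* b v)

  cast-Λ : ∀ b → cast (Λℤ b) ≈ Λ (cast ∘ b)
  cast-Λ b = trans (cast-sum (λ v → + (toℕ v / n₁) ℤ.* b v)) (FS.sum-cong (λ v → trans (cast-·ℕ (toℕ v / n₁) (b v))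
    (trans (×-congʳ (toℕ v / n₁) (sym (*-identityʳ (cast (b v))))) (sym (×-comm-* (toℕ v / n₁) (cast (b v)) 1#)))))

  -- `val` turns p a = relator b into p val a = n Σ ⌊p v / n⌋ b_v, where n = n₁ p. Hence n divides
  -- val a, so that a lies in the image of `μ`, exactly when Λ vanishes on b modulo p.
  val-Λ : ∀ a b → _≐_ n (λ w → + p ℤ.* a w) (L.relator b) → L.val a ≡ + n₁ ℤ.* Λℤ b
  val-Λ a b e = ℤ.*-cancelˡ-≡ (+ p) (L.val a) (+ n₁ ℤ.* Λℤ b) (begin
    + p ℤ.* L.val a
      ≡⟨ ≡.sym (L.val-* (+ p) a) ⟩
    L.val (λ w → + p ℤ.* a w)
      ≡⟨ L.val-≐ e ⟩
    L.val (L.relator b)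
      ≡⟨ L.val-relator b ⟩
    + n ℤ.* ℤS.sum (λ v → + ((p ℕ.* toℕ v) / n) ℤ.* b v)
      ≡⟨ ≡.cong₂ ℤ._*_ (≡.trans (≡.cong +_ n≡) (ℤ.pos-* n₁ p)) (ℤS.sum-cong (λ v → ≡.cong (λ t → + t ℤ.* b v) (quotient v))) ⟩
    + n₁ ℤ.* + p ℤ.* Λℤ b
      ≡⟨ lemma (+ n₁) (+ p) (Λℤ b) ⟩
    + p ℤ.* (+ n₁ ℤ.* Λℤ b) ∎)
    where
    open ≡.≡-Reasoning
    lemma : ∀ n p l → n ℤ.* p ℤ.* l ≡ p ℤ.* (n ℤ.* l)
    lemma = solve-∀
    instance
      n₁p≢0 : NonZero (n₁ ℕ.* p)
      n₁p≢0 = ℕ.m*n≢0 n₁ p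
    quotient : ∀ v → (p ℕ.* toℕ v) / n ≡ toℕ v / n₁
    quotient v = ≡.trans (≡.cong (_/ n) (ℕ.*-comm p (toℕ v))) (≡.trans (ℕ./-congʳ n≡) (ℕ.m*n/o*n≡m/o (toℕ v) p n₁))

  Λ⇒val : ∀ a b → _≐_ n (λ w → + p ℤ.* a w) (L.relator b) → Λ (cast ∘ b) ≈ 0# → + n ℤ.∣ L.val a
  Λ⇒val a b e z with cast-inj (Λℤ b) (trans (cast-Λ b) z)
  ... | ℤ.divides k eq = ℤ.divides k (≡.trans (val-Λ a b e) (≡.trans (≡.cong (+ n₁ ℤ.*_) eq) (≡.trans (lemma (+ n₁) k (+ p))
        (≡.cong (k ℤ.*_) (≡.sym (≡.trans (≡.cong +_ n≡) (ℤ.pos-* n₁ p)))))))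
    where
    lemma : ∀ n k p → n ℤ.* (k ℤ.* p) ≡ k ℤ.* (n ℤ.* p)
    lemma = solve-∀

  val⇒Λ : ∀ a b → _≐_ n (λ w → + p ℤ.* a w) (L.relator b) → + n ℤ.∣ L.val a → Λ (cast ∘ b) ≈ 0#
  val⇒Λ a b e (ℤ.divides k eq) = trans (sym (cast-Λ b)) (cast-0 (Λℤ b) (ℤ.divides k (ℤ.*-cancelˡ-≡ (+ n₁) (Λℤ b) (k ℤ.* + p)
      (≡.trans (≡.sym (val-Λ a b e)) (≡.trans eq (≡.trans (≡.cong (k ℤ.*_) (≡.trans (≡.cong +_ n≡) (ℤ.pos-* n₁ p))) (≡.sym (lemma (+ n₁) k (+ p)))))))))
    where
    lemma : ∀ n k p → n ℤ.* (k ℤ.* p) ≡ k ℤ.* (n ℤ.* p)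
    lemma = solve-∀

  Λ-torsion : ∀ a (pa : (p L.ΣG.· L.μ a) ∼ (λ _ → 0ℤ)) → Λ (Torsion.u (L.μ a) pa) ≈ 0#
  Λ-torsion a pa = trans (FS.sum-cong (λ v → distribʳ (weight v) (δ 0 v) (cast (T.b v)))) (trans (FS.sum-+ (λ v → δ 0 v * weight v) (λ v → cast (T.b v) * weight v))
      (trans (+-cong Λ-1 (val⇒Λ (L.μ a) T.b T.p·a≐ (L.val-μ a))) (+-identityʳ 0#)))
    where module T = Torsion (L.μ a) pa

  σ-⋆ : ∀ u w → FS.push L.σ (u ⋆ w) ≋ FS.push L.σ u ⋆ FS.push L.σ w
  σ-⋆ u w = push-⋆ commRing L.σ (λ i j → ≡.trans (mul-mod p (toℕ i ℕ.+ toℕ j)) (≡.trans (≡.cong (_mod n) (ℕ.*-distribˡ-+ p (toℕ i) (toℕ j)))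
    (≡.sym (mod-⊕ (p ℕ.* toℕ i) (p ℕ.* toℕ j))))) u w

  σ-δ : ∀ a → FS.push L.σ (δ a) ≋ δ (p ℕ.* a)
  σ-δ a k = trans (FS.push-ind L.σ (a mod n) k) (reflexive (≡.cong (λ t → FS.ind t k) (mul-mod p a)))

  δ-injective : ∀ {a b} → δ a ≋ δ b → a mod n ≡ b mod n
  δ-injective {a} {b} e with a mod n Fin.≟ b mod n
  ... | yes eq = eq
  ... | no ne = ⊥-elim (0≉1 (trans (sym (FS.ind-≢ {i = a mod n} {b mod n} ne)) (trans (e (b mod n)) (FS.ind-≡ {i = b mod n} ≡.refl))))

  δ-∣ : ∀ {a} → n ∣ a → δ a ≋ δ 0
  δ-∣ {a} d = G.δ-% (≡.trans (ℕ.n∣m⇒m%n≡0 a n d) (≡.sym (ℕ.m*n%n≡0 0 n)))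

  -- Taking p-th powers gives x^(p k) = 1, so k = n₁ t. Then Λ u = Λ w + t forces p to divide t, and
  -- x^k = 1.
  torsion-unique : ∀ u w k → FS.push L.σ u ≋ δ 0 → FS.push L.σ w ≋ δ 0 → FS.sum w ≈ 1# → Λ u ≈ 0# → Λ w ≈ 0# → u ≋ δ k ⋆ w → u ≋ w
  torsion-unique u w k σu σw sw Λu Λw e = GR.trans e (GR.trans (GR.*-congʳ {w} (δ-∣ n∣k)) (G.⋆-identityˡ w))
    where
    δ0≋δpk : δ 0 ≋ δ (p ℕ.* k)
    δ0≋δpk = GR.trans (GR.sym σu) (GR.trans (FS.push-cong L.σ e) (GR.trans (σ-⋆ (δ k) w) (GR.trans (G.⋆-cong (σ-δ k) σw) (GR.*-identityʳ (δ (p ℕ.* k))))))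
    n∣pk : n ∣ p ℕ.* k
    n∣pk = ℕ.m%n≡0⇒n∣m _ n (≡.trans (≡.sym (mod-injective n (δ-injective δ0≋δpk))) (ℕ.m*n%n≡0 0 n))
    n₁∣k : n₁ ∣ k
    n₁∣k = ℕ.*-cancelʳ-∣ p (≡.subst₂ _∣_ n≡ (ℕ.*-comm p k) n∣pk)
    t = ℕ.quotient n₁∣k
    k≡ : k ≡ n₁ ℕ.* t
    k≡ = ℕ.m∣n⇒n≡m*quotient n₁∣k
    t·1≈0 : t AF.· 1# ≈ 0#
    t·1≈0 = begin
      t AF.· 1#                        ≈⟨ sym (*-identityʳ _) ⟩
      (t AF.· 1#) * 1#                   ≈⟨ *-congˡ (sym sw) ⟩
      (t AF.· 1#) * FS.sum w             ≈⟨ sym (+-identityˡ _) ⟩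
      0# + (t AF.· 1#) * FS.sum w        ≈⟨ +-congʳ (sym Λw) ⟩
      Λ w + (t AF.· 1#) * FS.sum w       ≈⟨ sym (Λ-shift t w) ⟩
      Λ (δ (n₁ ℕ.* t) ⋆ w)             ≈⟨ Λ-cong (G.⋆-cong {w = w} (λ l → reflexive (≡.cong (λ s → δ s l) (≡.sym k≡))) (λ _ → refl)) ⟩
      Λ (δ k ⋆ w)                      ≈⟨ sym (Λ-cong e) ⟩
      Λ u                              ≈⟨ Λu ⟩
      0#                               ∎
      where open import Relation.Binary.Reasoning.Setoid setoid
    n∣k : n ∣ k
    n∣k = ≡.subst₂ _∣_ (≡.sym n≡) (≡.sym k≡) (ℕ.*-monoʳ-∣ n₁ (additive-order t t·1≈0))

  τS : ∀ a → (p SG.· a) ∼S (λ _ → 0ℤ) → Unit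
  τS a pa = Torsion.unit (L.μ a) (torsion-μ a pa)

  τS-tors : ∀ a pa → (p XG.· τS a pa) U.≈X U.1ᵤ
  τS-tors a pa = U.≈X-from (GR.trans (elt-p·X (τS a pa)) (Torsion.push-σ-u (L.μ a) (torsion-μ a pa)))

  τS-refl : ∀ a pa a′ pa′ → τS a pa U.≈X τS a′ pa′ → a ∼S a′
  τS-refl a pa a′ pa′ (by k e) = τ-refl (L.μ a) qa (L.μ a′) qa′ (torsion-unique (Torsion.u (L.μ a) qa) (Torsion.u (L.μ a′) qa′) k
      (Torsion.push-σ-u (L.μ a) qa) (Torsion.push-σ-u (L.μ a′) qa′) (augmentation (τS a′ pa′)) (Λ-torsion a qa) (Λ-torsion a′ qa′) e)
    where
    qa = torsion-μ a pa
    qa′ = torsion-μ a′ pa′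

  -- Every class of order p in C' / ⟨X⟩ has a representative u with u ^ p = 1 and Λ u = 0.
  record Normalised (u : Unit) : Set where
    field
      rep      : Unit
      rep≈     : rep U.≈X u
      rep-tors : FS.push L.σ (elt rep) ≋ δ 0
      rep-Λ    : Λ (elt rep) ≈ 0#

  X^ᵤ : ℕ → Unit
  X^ᵤ a = record { elt = δ a ; inv = δ (a ℕ.* ℕ.pred n) ; inverseʳ = GR.trans (G.⋆-comm (δ a) (δ (a ℕ.* ℕ.pred n))) (U.δ-inverse a) ; augmentation = U.sum-δ a }

  normalise : ∀ u → (p XG.· u) U.≈X U.1ᵤ → Normalised u
  normalise u (by k e) = record
    { rep = X^ᵤ (n₁ ℕ.* t) U.·ᵤ u₁
    ; rep≈ = by (n₁ ℕ.* t ℕ.+ c) (GR.trans (GR.sym (G.⋆-assoc (δ (n₁ ℕ.* t)) (δ c) (elt u))) (GR.*-congʳ {elt u} (G.δ-⋆ (n₁ ℕ.* t) c)))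
    ; rep-tors = GR.trans (σ-⋆ (δ (n₁ ℕ.* t)) (elt u₁)) (GR.trans (G.⋆-cong (GR.trans (σ-δ (n₁ ℕ.* t)) (δ-∣ n∣)) σu₁) (G.⋆-identityˡ (δ 0)))
    ; rep-Λ = begin
        Λ (δ (n₁ ℕ.* t) ⋆ elt u₁)                  ≈⟨ Λ-shift t (elt u₁) ⟩
        Λ (elt u₁) + (t AF.· 1#) * FS.sum (elt u₁)   ≈⟨ +-cong (sym (proj₂ l)) (trans (*-congˡ (augmentation u₁)) (*-identityʳ _)) ⟩
        i AF.· 1# + (i ℕ.* ℕ.pred p) AF.· 1#       ≈⟨ sym (AF.×-homo-+ 1# i (i ℕ.* ℕ.pred p)) ⟩
        (i ℕ.+ i ℕ.* ℕ.pred p) AF.· 1#             ≈⟨ AF.×-congˡ (≡.trans (≡.sym (ℕ.*-suc i (ℕ.pred p))) (≡.cong (i ℕ.*_) (ℕ.suc-pred p))) ⟩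
        (i ℕ.* p) AF.· 1#                          ≈⟨ AF.·-multiple {p} {i ℕ.* p} {1#} (IsCyclic.kill cyclic) (ℕ.n∣m*n i) ⟩
        0#                                         ∎ }
    where
    open import Relation.Binary.Reasoning.Setoid setoid
    σu : FS.push L.σ (elt u) ≋ δ k
    σu = GR.trans (GR.sym (elt-p·X u)) (GR.trans e (GR.*-identityʳ (δ k)))
    image = monomial-image (FS.push ρ (elt u)) k (GR.trans (GR.sym (push-σ (elt u))) σu)
    a c : ℕ
    a = proj₁ image
    -- x^c is x^(-a), where u^p = x^(p a); this makes u₁^p = 1.
    c = a ℕ.* ℕ.pred n
    u₁ : Unit
    u₁ = X^ᵤ c U.·ᵤ u
    σu₁ : FS.push L.σ (elt u₁) ≋ δ 0
    σu₁ = GR.trans (σ-⋆ (δ c) (elt u)) (GR.trans (G.⋆-cong {u = FS.push L.σ (δ c)} (λ _ → refl) (GR.trans σu (GR.trans (proj₂ (proj₂ image)) (GR.sym (σ-δ a)))))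
      (GR.trans (GR.sym (σ-⋆ (δ c) (δ a))) (GR.trans (FS.push-cong L.σ (U.δ-inverse a)) (GR.trans (σ-δ 0) (λ l → reflexive (≡.cong (λ s → δ s l) (ℕ.*-zeroʳ p)))))))
    l = IsCyclic.log cyclic (Λ (elt u₁))
    i t : ℕ
    i = proj₁ l
    -- t ≡ -i modulo p, where Λ u₁ = i · 1, so x^(n₁ t) brings Λ to 0 and keeps the p-th power equal
    -- to 1.
    t = i ℕ.* ℕ.pred p
    n∣ : n ∣ p ℕ.* (n₁ ℕ.* t)
    n∣ = divides t (≡.trans (+-*-Solver.solve 3 (λ p m t → p :* (m :* t) := t :* (m :* p)) ≡.refl p n₁ t) (≡.cong (t ℕ.*_) (≡.sym n≡)))
      where open +-*-Solver

  -- Λ = 0 puts the torsion element of Σ(n,p) that belongs to the representative into the image of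
  -- `μ`; its preimage is the required element of S(n,p).
  module Untwist (u : Unit) (pu : (p XG.· u) U.≈X U.1ᵤ) where
    open Normalised (normalise u pu) public
    module T = Untorsion rep rep-tors

    onto : ∃ λ x → _≐_ n (L.μ x) T.a
    onto = L.μ-onto T.a (Λ⇒val T.a T.b T.p·a≐ (trans (Λ-cong T.cast-b) rep-Λ))

    preimage : Vec
    preimage = proj₁ onto

    μ-preimage : L.μ preimage ∼ T.a
    μ-preimage = L.≐⇒∼ (proj₂ onto)

    torsion : (p SG.· preimage) ∼S (λ _ → 0ℤ)
    torsion = L.∼-trans (μ-· p preimage) (L.∼-trans (L.ΣG.×-congʳ p μ-preimage) (L.∼-trans T.torsion (L.≐⇒∼ (λ w _ → ≡.sym (μ-0 w)))))

  τS′-refl : ∀ u pu u′ pu′ → Untwist.preimage u pu ∼S Untwist.preimage u′ pu′ → u U.≈X u′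
  τS′-refl u pu u′ pu′ e = U.≈X-trans {u} {N.rep} {u′} (U.≈X-sym {N.rep} {u} N.rep≈) (U.≈X-trans {N.rep} {N′.rep} {u′} (U.≈X-from
      (τ′-refl N.rep N.rep-tors N′.rep N′.rep-tors (L.∼-trans (L.∼-sym N.μ-preimage) (L.∼-trans e N′.μ-preimage)))) N′.rep≈)
    where
    module N = Untwist u pu
    module N′ = Untwist u′ pu′

  _≟X_ : ∀ (u w : Unit) → Dec (u U.≈X w)
  u ≟X w with Fin.any? (λ (k : Fin n) → Fin.all? (λ l → elt u l ≟F (δ (toℕ k) ⋆ elt w) l))
  ... | yes (k , e) = yes (by (toℕ k) e)
  ... | no none = no λ { (by k e) → none (k mod n , GR.trans e (GR.*-congʳ {elt w} (G.δ-% (≡.sym (≡.trans (≡.cong (_% n) (toℕ-mod k n)) (ℕ.m%n%n≡m%n k n)))))) }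

  βS-surj : ∀ z → ∃ λ x → β x L₁.∼S z
  βS-surj z = proj₁ (β-surj z) , L₁.≐⇒∼ (L₁.μ-≐ (λ w _ → proj₂ (β-surj z) w))

  γX-surj : ∀ w → ∃ λ u → γ u U₁.≈X w
  γX-surj w = proj₁ (γ-surj w) , U₁.≈X-from (proj₂ (γ-surj w))

  S-step : Iso L₁.SGroup U₁.XGroup → Iso L.SGroup U.XGroup
  S-step f = Lift.iso L.SGroup U.XGroup L₁.SGroup U₁.XGroup pr (S-finite n p) _≟X_ βS γX f
    βS-surj βS-ker βS-ker⁻ γX-surj γX-ker γX-ker⁻
    τS τS-tors τS-refl Untwist.preimage Untwist.torsion τS′-refl

-- Comparison with Sandpile and Circulant

module IntegerSpans where

  open Sums ℤ.+-*-commutativeRing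

  ∑ℤ≡sum : ∀ {k} (g : Fin k → ℤ) → ∑ℤ g ≡ sum g
  ∑ℤ≡sum {zero} g = ≡.sym (sum-zero g)
  ∑ℤ≡sum {suc k} g = ≡.trans (≡.cong (ℤ._+_ (g Fin.zero)) (∑ℤ≡sum (g ∘ Fin.suc))) (≡.sym (sum-suc g))

  shift-injective : ∀ {n} .{{_ : NonZero n}} {v w : Fin n} → shift n v ≡ shift n w → v ≡ w
  shift-injective {n} {v} {w} e = ≡.trans (≡.sym (back v)) (≡.trans (≡.cong (λ t → (toℕ t ℕ.+ ℕ.pred n) mod n) e) (back w))
    where
    back : ∀ v → (toℕ (shift n v) ℕ.+ ℕ.pred n) mod n ≡ v
    back v = ≡.trans (mod-cong n (≡.trans (≡.cong (λ t → (t ℕ.+ ℕ.pred n) % n) (toℕ-mod (suc (toℕ v)) n)) (≡.trans (%-+ˡ (suc (toℕ v)) (ℕ.pred n))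
      (≡.trans (≡.cong (_% n) (≡.trans (≡.sym (ℕ.+-suc (toℕ v) (ℕ.pred n))) (≡.cong (toℕ v ℕ.+_) (ℕ.suc-pred n)))) (ℕ.[m+n]%n≡m%n (toℕ v) n))))) (toℕ-mod-self v)

  sum-const-ℤ : ∀ k x → sum {k} (λ _ → x) ≡ + k ℤ.* x
  sum-const-ℤ zero x = sum-zero (λ _ → x)
  sum-const-ℤ (suc k) x = ≡.trans (sum-suc (λ _ → x)) (≡.trans (≡.cong (ℤ._+_ x) (sum-const-ℤ k x)) (≡.sym (ℤ.suc-* (+ k) x)))

  -- n is suc n′, so that the index set Fin (n ∸ 1) of Sandpile reduces to Fin n′.
  module SpanComparison (n′ d : ℕ) {{_ : NonZero (suc n′)}} where
    open Sandpile (suc n′) d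
    open Lattice (suc n′) d using (Vec; _∼_; via; relator; relator-+; relator-*; relator--; μ; _∼S_; μ-+; μ-neg; μ-≐)

    ⟦_⟧ : Zn → Vec
    ⟦ a ⟧ Fin.zero = 0ℤ
    ⟦ a ⟧ (Fin.suc i) = a i

    mono≡ind : ∀ k j → mono k j ≡ ind (k mod (suc n′)) j
    mono≡ind k j with j Fin.≟ k mod (suc n′)
    ... | yes e = ≡.sym (ind-≡ {i = k mod (suc n′)} (≡.sym e))
    ... | no ne = ≡.sym (ind-≢ {i = k mod (suc n′)} (ne ∘ ≡.sym))

    idx-mod : ∀ i → idx i mod (suc n′) ≡ Fin.suc i
    idx-mod i = toℕ-mod-self (Fin.suc i)

    comb≡ : ∀ c g j → comb c g j ≡ sum (λ i → c i ℤ.* g (idx i) j)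
    comb≡ c g j = ∑ℤ≡sum (λ i → c i ℤ.* g (idx i) j)

    sum-ind-1 : ∀ (i : Fin (suc n′)) → sum (ind i) ≡ 1ℤ
    sum-ind-1 i = ≡.trans (sum-cong (λ j → ≡.sym (ℤ.*-identityʳ (ind i j)))) (sum-ind i (λ _ → 1ℤ))

    sum-mono : ∀ k → sum (mono k) ≡ 1ℤ
    sum-mono k = ≡.trans (sum-cong (mono≡ind k)) (sum-ind-1 (k mod (suc n′)))

    sum-- : ∀ {k} (x y : Fin k → ℤ) → sum (λ j → x j ℤ.- y j) ≡ sum x ℤ.- sum y
    sum-- x y = ≡.trans (sum-+ x (λ j → ℤ.- y j)) (≡.cong (ℤ._+_ (sum x)) (sum-neg y))

    sum-e : ∀ v → sum (e v) ≡ 0ℤ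
    sum-e v = ≡.trans (sum-- (mono v) (mono 0)) (≡.cong₂ ℤ._-_ (sum-mono v) (sum-mono 0))

    sum-ε : ∀ v → sum (ε v) ≡ 0ℤ
    sum-ε v = ≡.trans (sum-- (λ j → + d ℤ.* e v j) (e (d ℕ.* v))) (≡.trans (≡.cong₂ ℤ._-_ (≡.trans (≡.sym (*-sum (+ d) (e v))) (≡.cong (+ d ℤ.*_) (sum-e v))) (sum-e (d ℕ.* v)))
      (≡.trans (≡.cong (ℤ._- 0ℤ) (ℤ.*-zeroʳ (+ d))) ≡.refl))

    sum-comb : ∀ c g → (∀ v → sum (g v) ≡ 0ℤ) → sum (comb c g) ≡ 0ℤ
    sum-comb c g g-0 = ≡.trans (sum-cong (comb≡ c g)) (≡.trans (sum-swap (λ j i → c i ℤ.* g (idx i) j))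
      (sum-0 (λ i → ≡.trans (≡.sym (*-sum (c i) (g (idx i)))) (≡.trans (≡.cong (c i ℤ.*_) (g-0 (idx i))) (ℤ.*-zeroʳ (c i))))))

    sum-diff : ∀ a b → sum (ι a -ₚ ι b) ≡ 0ℤ
    sum-diff a b = ≡.trans (sum-- (ι a) (ι b)) (≡.cong₂ ℤ._-_ (sum-comb a e sum-e) (sum-comb b e sum-e))

    -- The ignored entry is recovered from the augmentation, which is 0 for all combinations of the
    -- e_v, ε_v and f_v.
    ≐⇒≡ : ∀ {x y : Vec} → _≐_ (suc n′) x y → sum x ≡ sum y → ∀ j → x j ≡ y j
    ≐⇒≡ {x} {y} eq s (Fin.suc j) = eq (Fin.suc j) (λ ())
    ≐⇒≡ {x} {y} eq s Fin.zero = GroupProperties.∙-cancelʳ (AbelianGroup.group ℤ.+-0-abelianGroup) (sum (y ∘ Fin.suc)) (x Fin.zero) (y Fin.zero)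
      (≡.trans (≡.cong (ℤ._+_ (x Fin.zero)) (≡.sym (sum-cong (λ j → eq (Fin.suc j) (λ ()))))) (≡.trans (≡.sym (sum-suc x)) (≡.trans s (sum-suc y))))

    e-off : ∀ v → _≐_ (suc n′) (e v) (ind (v mod (suc n′)))
    e-off v j j≢ = ≡.trans (≡.cong₂ ℤ._-_ (mono≡ind v j) (≡.trans (mono≡ind 0 j) (ind-≢ {i = origin (suc n′)} {j} (j≢ ∘ ≡.sym)))) (ℤ.+-identityʳ _)

    ε-off : ∀ v → _≐_ (suc n′) (ε v) (relator (ind (v mod (suc n′))))
    ε-off v j j≢ = ≡.cong₂ (λ s t → + d ℤ.* s ℤ.- t) (e-off v j j≢) (≡.trans (e-off (d ℕ.* v) j j≢) (≡.sym (≡.trans (push-ind (mul (suc n′) d) (v mod (suc n′)) j) (≡.cong (λ t → ind t j) (mul-mod d v)))))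

    relator-sum : ∀ {k} (c : Fin k → ℤ) (g : Fin k → Vec) w → relator (λ v → sum (λ i → c i ℤ.* g i v)) w ≡ sum (λ i → c i ℤ.* relator (g i) w)
    relator-sum {zero} c g w = ≡.trans (≡.cong₂ (λ s t → + d ℤ.* s ℤ.- t) (sum-zero (λ i → c i ℤ.* g i w)) (push-cong (mul (suc n′) d) (λ v → sum-zero (λ i → c i ℤ.* g i v)) w))
      (≡.trans (relator-* 0ℤ (λ _ → 0ℤ) w) (≡.sym (sum-zero (λ i → c i ℤ.* relator (g i) w))))
    relator-sum {suc k} c g w = ≡.trans (≡.cong₂ (λ s t → + d ℤ.* s ℤ.- t) (sum-suc (λ i → c i ℤ.* g i w)) (push-cong (mul (suc n′) d) (λ v → sum-suc (λ i → c i ℤ.* g i v)) w))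
      (≡.trans (relator-+ (λ v → c Fin.zero ℤ.* g Fin.zero v) (λ v → sum (λ i → c (Fin.suc i) ℤ.* g (Fin.suc i) v)) w)
        (≡.trans (≡.cong₂ ℤ._+_ (relator-* (c Fin.zero) (g Fin.zero) w) (relator-sum (c ∘ Fin.suc) (g ∘ Fin.suc) w)) (≡.sym (sum-suc (λ i → c i ℤ.* relator (g i) w)))))

    ι-off : ∀ a → _≐_ (suc n′) (ι a) ⟦ a ⟧
    ι-off a Fin.zero j≢ = ⊥-elim (j≢ ≡.refl)
    ι-off a (Fin.suc w) j≢ = ≡.trans (comb≡ a e (Fin.suc w)) (≡.trans (sum-cong (λ i → ≡.trans (≡.cong (a i ℤ.*_) (≡.trans (e-off (idx i) (Fin.suc w) j≢)
      (≡.cong (λ t → ind t (Fin.suc w)) (idx-mod i)))) (ℤ.*-comm (a i) (ind i w)))) (sum-ind′ w a))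

    diff-off : ∀ a b → _≐_ (suc n′) (ι a -ₚ ι b) (λ w → ⟦ a ⟧ w ℤ.- ⟦ b ⟧ w)
    diff-off a b w w≢ = ≡.cong₂ ℤ._-_ (ι-off a w w≢) (ι-off b w w≢)

    inds : (Idx → ℤ) → Vec
    inds c v = sum (λ i → c i ℤ.* ind (idx i mod (suc n′)) v)

    comb-ε-off : ∀ c → _≐_ (suc n′) (comb c ε) (relator (inds c))
    comb-ε-off c w w≢ = ≡.trans (comb≡ c ε w) (≡.trans (sum-cong (λ i → ≡.cong (c i ℤ.*_) (ε-off (idx i) w w≢))) (≡.sym (relator-sum c (λ i → ind (idx i mod (suc n′))) w)))

    inds-off : ∀ (b : Vec) → _≐_ (suc n′) (inds (b ∘ Fin.suc)) b
    inds-off b Fin.zero w≢ = ⊥-elim (w≢ ≡.refl)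
    inds-off b (Fin.suc w) w≢ = ≡.trans (sum-cong (λ i → ≡.trans (≡.cong (λ t → b (Fin.suc i) ℤ.* ind t (Fin.suc w)) (idx-mod i)) (ℤ.*-comm (b (Fin.suc i)) (ind i w)))) (sum-ind′ w (b ∘ Fin.suc))

    relator-≐ : ∀ {x y} → _≐_ (suc n′) x y → _≐_ (suc n′) (relator x) (relator y)
    relator-≐ eq w w≢ = ≡.cong₂ (λ s t → + d ℤ.* s ℤ.- t) (eq w w≢) (push-≐ (mul (suc n′) d) (mul-origin d) eq w w≢)

    ~Σ⇒∼ : ∀ a b → a ~Σ b → ⟦ a ⟧ ∼ ⟦ b ⟧
    ~Σ⇒∼ a b (c , eq) = via (inds c) (λ w w≢ → ≡.trans (≡.sym (diff-off a b w w≢)) (≡.trans (eq w) (comb-ε-off c w w≢)))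

    ∼⇒~Σ : ∀ a b → ⟦ a ⟧ ∼ ⟦ b ⟧ → a ~Σ b
    ∼⇒~Σ a b (via c eq) = c ∘ Fin.suc , ≐⇒≡ (λ w w≢ → ≡.trans (diff-off a b w w≢) (≡.trans (eq w w≢)
        (≡.sym (≡.trans (comb-ε-off (c ∘ Fin.suc) w w≢) (relator-≐ (inds-off c) w w≢)))))
      (≡.trans (sum-diff a b) (≡.sym (sum-comb (c ∘ Fin.suc) ε sum-ε)))

    -- Multiplication by x - 1 on all of ℤ[x]/(x^n - 1); in augmentation zero it agrees with `μ`.
    Δ : Vec → Vec
    Δ x w = push (shift (suc n′)) x w ℤ.- x w

    Δ-+ : ∀ x y w → Δ (λ v → x v ℤ.+ y v) w ≡ Δ x w ℤ.+ Δ y w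
    Δ-+ x y w = ≡.trans (≡.cong (ℤ._- (x w ℤ.+ y w)) (push-+ (shift (suc n′)) x y w)) (lemma (push (shift (suc n′)) x w) (push (shift (suc n′)) y w) (x w) (y w))
      where
      lemma : ∀ s t x y → s ℤ.+ t ℤ.- (x ℤ.+ y) ≡ s ℤ.- x ℤ.+ (t ℤ.- y)
      lemma = solve-∀

    Δ-* : ∀ k x w → Δ (λ v → k ℤ.* x v) w ≡ k ℤ.* Δ x w
    Δ-* k x w = ≡.trans (≡.cong (ℤ._- k ℤ.* x w) (push-* (shift (suc n′)) k x w)) (lemma k (push (shift (suc n′)) x w) (x w))
      where
      lemma : ∀ k s x → k ℤ.* s ℤ.- k ℤ.* x ≡ k ℤ.* (s ℤ.- x)
      lemma = solve-∀

    Δ-neg : ∀ x w → Δ (λ v → ℤ.- x v) w ≡ ℤ.- Δ x w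
    Δ-neg x w = ≡.trans (≡.cong (ℤ._- ℤ.- x w) (push-neg (shift (suc n′)) x w)) (lemma (push (shift (suc n′)) x w) (x w))
      where
      lemma : ∀ s x → ℤ.- s ℤ.- ℤ.- x ≡ ℤ.- (s ℤ.- x)
      lemma = solve-∀

    Δ-- : ∀ x y w → Δ (λ v → x v ℤ.- y v) w ≡ Δ x w ℤ.- Δ y w
    Δ-- x y w = ≡.trans (Δ-+ x (λ v → ℤ.- y v) w) (≡.cong (ℤ._+_ (Δ x w)) (Δ-neg y w))

    Δ-cong : ∀ {x y} → (∀ w → x w ≡ y w) → ∀ w → Δ x w ≡ Δ y w
    Δ-cong eq w = ≡.cong₂ ℤ._-_ (push-cong (shift (suc n′)) eq w) (eq w)

    Δ-sum : ∀ {k} (c : Fin k → ℤ) (g : Fin k → Vec) w → Δ (λ v → sum (λ i → c i ℤ.* g i v)) w ≡ sum (λ i → c i ℤ.* Δ (g i) w)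
    Δ-sum {zero} c g w = ≡.trans (Δ-cong (λ v → sum-zero (λ i → c i ℤ.* g i v)) w) (≡.trans (Δ-* 0ℤ (λ _ → 0ℤ) w) (≡.sym (sum-zero (λ i → c i ℤ.* Δ (g i) w))))
    Δ-sum {suc k} c g w = ≡.trans (Δ-cong (λ v → sum-suc (λ i → c i ℤ.* g i v)) w) (≡.trans (Δ-+ (λ v → c Fin.zero ℤ.* g Fin.zero v) (λ v → sum (λ i → c (Fin.suc i) ℤ.* g (Fin.suc i) v)) w)
      (≡.trans (≡.cong₂ ℤ._+_ (Δ-* (c Fin.zero) (g Fin.zero) w) (Δ-sum (c ∘ Fin.suc) (g ∘ Fin.suc) w)) (≡.sym (sum-suc (λ i → c i ℤ.* Δ (g i) w)))))

    sum-Δ : ∀ x → sum (Δ x) ≡ 0ℤ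
    sum-Δ x = ≡.trans (sum-- (push (shift (suc n′)) x) x) (≡.trans (≡.cong (ℤ._- sum x) (sum-push-total (shift (suc n′)) x)) (ℤ.+-inverseʳ (sum x)))

    μ≡Δ : ∀ x → sum x ≡ 0ℤ → ∀ w → μ x w ≡ Δ x w
    μ≡Δ x s w = ≡.trans (≡.cong (λ t → Δ x w ℤ.- t ℤ.* ind (1 mod (suc n′)) w) s) (≡.trans (≡.cong (λ t → Δ x w ℤ.- t) (ℤ.*-zeroˡ (ind (1 mod (suc n′)) w))) (ℤ.+-identityʳ (Δ x w)))

    -- Shift-invariant vectors are constant, so Δ is injective in augmentation zero.
    Δ-injective : ∀ x → sum x ≡ 0ℤ → _≐_ (suc n′) (Δ x) (λ _ → 0ℤ) → ∀ w → x w ≡ 0ℤ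
    Δ-injective x s eq w = ≡.trans (constant w) (ℤ.*-cancelˡ-≡ (+ (suc n′)) (x (origin (suc n′))) 0ℤ (≡.trans (≡.sym (sum-const-ℤ (suc n′) (x (origin (suc n′)))))
        (≡.trans (sum-cong (≡.sym ∘ constant)) (≡.trans s (≡.sym (ℤ.*-zeroʳ (+ (suc n′))))))))
      where
      vanish : ∀ w → Δ x w ≡ 0ℤ
      vanish = ≐⇒≡ eq (≡.trans (sum-Δ x) (≡.sym (sum-0 {(suc n′)} (λ _ → ≡.refl))))
      invariant : ∀ v → x v ≡ x (shift (suc n′) v)
      invariant v = ≡.trans (≡.sym (push-injective (shift (suc n′)) shift-injective x v)) (ℤ.i-j≡0⇒i≡j _ _ (vanish (shift (suc n′) v)))
      shift-mod : ∀ k → shift (suc n′) (k mod (suc n′)) ≡ suc k mod (suc n′)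
      shift-mod k = mod-cong {suc (toℕ (k mod (suc n′)))} {suc k} (suc n′) (≡.trans (≡.cong (λ t → suc t % (suc n′)) (toℕ-mod k (suc n′))) (%-+ʳ {(suc n′)} 1 k))
      at : ∀ k → x (k mod (suc n′)) ≡ x (origin (suc n′))
      at zero = ≡.refl
      at (suc k) = ≡.trans (≡.cong x (≡.sym (shift-mod k))) (≡.trans (≡.sym (invariant (k mod (suc n′)))) (at k))
      constant : ∀ w → x w ≡ x (origin (suc n′))
      constant w = ≡.trans (≡.cong x (≡.sym (toℕ-mod-self w))) (at (toℕ w))

    Δ-mono : ∀ k w → Δ (mono k) w ≡ mono (suc k) w ℤ.- mono k w
    Δ-mono k w = ≡.cong (ℤ._- mono k w) (≡.trans (push-cong (shift (suc n′)) (mono≡ind k) w) (≡.trans (push-ind (shift (suc n′)) (k mod (suc n′)) w)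
      (≡.trans (≡.cong (λ t → ind t w) (mod-cong {suc (toℕ (k mod (suc n′)))} {suc k} (suc n′) (≡.trans (≡.cong (λ t → suc t % (suc n′)) (toℕ-mod k (suc n′))) (%-+ʳ {(suc n′)} 1 k)))) (≡.sym (mono≡ind (suc k) w)))))

    block : ℕ → ℕ → Vec
    block k m j = ∑ℤ {m} (λ i → mono (k ℕ.+ toℕ i) j)

    block-suc : ∀ k m j → block k (suc m) j ≡ mono k j ℤ.+ block (suc k) m j
    block-suc k m j = ≡.cong₂ ℤ._+_ (≡.cong (λ t → mono t j) (ℕ.+-identityʳ k)) (≡.trans (∑ℤ≡sum (λ (i : Fin m) → mono (k ℕ.+ suc (toℕ i)) j))
      (≡.trans (sum-cong (λ i → ≡.cong (λ t → mono t j) (ℕ.+-suc k (toℕ i)))) (≡.sym (∑ℤ≡sum (λ (i : Fin m) → mono (suc k ℕ.+ toℕ i) j)))))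

    Δ-block : ∀ k m w → Δ (block k m) w ≡ mono (k ℕ.+ m) w ℤ.- mono k w
    Δ-block k zero w = ≡.trans (Δ-* 0ℤ (λ _ → 0ℤ) w) (≡.sym (≡.trans (≡.cong (λ t → mono t w ℤ.- mono k w) (ℕ.+-identityʳ k)) (ℤ.+-inverseʳ (mono k w))))
    Δ-block k (suc m) w = ≡.trans (Δ-cong (block-suc k m) w) (≡.trans (Δ-+ (mono k) (block (suc k) m) w) (≡.trans (≡.cong₂ ℤ._+_ (Δ-mono k w) (Δ-block (suc k) m w))
      (≡.trans (lemma (mono (suc k) w) (mono k w) (mono (suc k ℕ.+ m) w)) (≡.cong (λ t → mono t w ℤ.- mono k w) (≡.sym (ℕ.+-suc k m))))))
      where
      lemma : ∀ s k t → s ℤ.- k ℤ.+ (t ℤ.- s) ≡ t ℤ.- k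
      lemma = solve-∀

    sum-block : ∀ k m → sum (block k m) ≡ + m
    sum-block k m = ≡.trans (sum-cong (λ j → ∑ℤ≡sum (λ (i : Fin m) → mono (k ℕ.+ toℕ i) j))) (≡.trans (sum-swap (λ j (i : Fin m) → mono (k ℕ.+ toℕ i) j))
      (≡.trans (sum-cong (λ (i : Fin m) → sum-mono (k ℕ.+ toℕ i))) (≡.trans (sum-const-ℤ m 1ℤ) (ℤ.*-identityʳ (+ m)))))

    sum-f : ∀ v → sum (f v) ≡ 0ℤ
    sum-f v = ≡.trans (sum-- (λ j → + d ℤ.* mono v j) (block (d ℕ.* v) d)) (≡.trans (≡.cong₂ ℤ._-_ (≡.trans (≡.sym (*-sum (+ d) (mono v))) (≡.trans (≡.cong (+ d ℤ.*_) (sum-mono v)) (ℤ.*-identityʳ (+ d)))) (sum-block (d ℕ.* v) d))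
      (ℤ.+-inverseʳ (+ d)))

    -- The d consecutive powers in f_v telescope. This is why multiplication by x - 1 carries the
    -- relations of S(n,d) into those of Σ(n,d).
    Δ-f : ∀ v w → Δ (f v) w ≡ ε (suc v) w ℤ.- ε v w
    Δ-f v w = ≡.trans (Δ-- (λ j → + d ℤ.* mono v j) (block (d ℕ.* v) d) w) (≡.trans (≡.cong₂ ℤ._-_ (≡.trans (Δ-* (+ d) (mono v) w) (≡.cong (+ d ℤ.*_) (Δ-mono v w)))
        (≡.trans (Δ-block (d ℕ.* v) d w) (≡.cong (λ t → mono t w ℤ.- mono (d ℕ.* v) w) (≡.trans (ℕ.+-comm (d ℕ.* v) d) (≡.sym (ℕ.*-suc d v))))))
      (lemma (+ d) (mono (suc v) w) (mono v w) (mono (d ℕ.* suc v) w) (mono (d ℕ.* v) w) (mono 0 w)))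
      where
      lemma : ∀ d s t x y o → d ℤ.* (s ℤ.- t) ℤ.- (x ℤ.- y) ≡ d ℤ.* (s ℤ.- o) ℤ.- (x ℤ.- o) ℤ.- (d ℤ.* (t ℤ.- o) ℤ.- (y ℤ.- o))
      lemma = solve-∀

    Δ-diff : ∀ a b → _≐_ (suc n′) (Δ (ι a -ₚ ι b)) (λ w → μ ⟦ a ⟧ w ℤ.- μ ⟦ b ⟧ w)
    Δ-diff a b w w≢ = ≡.trans (≡.sym (μ≡Δ (ι a -ₚ ι b) (sum-diff a b) w)) (≡.trans (μ-≐ (diff-off a b) w w≢)
      (≡.trans (μ-+ ⟦ a ⟧ (λ v → ℤ.- ⟦ b ⟧ v) w) (≡.cong (ℤ._+_ (μ ⟦ a ⟧ w)) (μ-neg ⟦ b ⟧ w))))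

    ~S⇒∼S : ∀ a b → a ~S b → ⟦ a ⟧ ∼S ⟦ b ⟧
    ~S⇒∼S a b (c , eq) = via (λ v → sum (λ i → c i ℤ.* g i v)) (λ w w≢ → ≡.trans (≡.sym (Δ-diff a b w w≢)) (≡.trans (Δ-cong (λ v → ≡.trans (eq v) (comb≡ c f v)) w)
        (≡.trans (Δ-sum c (λ i → f (idx i)) w) (≡.trans (sum-cong (λ i → ≡.cong (c i ℤ.*_) (≡.trans (Δ-f (idx i) w)
          (≡.trans (≡.cong₂ ℤ._-_ (ε-off (suc (idx i)) w w≢) (ε-off (idx i) w w≢)) (≡.sym (relator-- (ind (suc (idx i) mod (suc n′))) (ind (idx i mod (suc n′))) w))))))
          (≡.sym (relator-sum c g w))))))
      where
      g : Idx → Vec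
      g i v = ind (suc (idx i) mod (suc n′)) v ℤ.- ind (idx i mod (suc n′)) v

    InSpan-cong : ∀ {x y} → (∀ j → x j ≡ y j) → InSpan f x → InSpan f y
    InSpan-cong eq (c , h) = c , λ j → ≡.trans (≡.sym (eq j)) (h j)

    InSpan-0 : InSpan f (λ _ → 0ℤ)
    InSpan-0 = (λ _ → 0ℤ) , λ j → ≡.sym (≡.trans (comb≡ (λ _ → 0ℤ) f j) (sum-0 (λ i → ℤ.*-zeroˡ (f (idx i) j))))

    InSpan-+ : ∀ {x y} → InSpan f x → InSpan f y → InSpan f (λ j → x j ℤ.+ y j)
    InSpan-+ {x} {y} (c , h) (c′ , h′) = (λ i → c i ℤ.+ c′ i) , λ j → ≡.trans (≡.cong₂ ℤ._+_ (≡.trans (h j) (comb≡ c f j)) (≡.trans (h′ j) (comb≡ c′ f j)))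
      (≡.trans (≡.sym (sum-+ (λ i → c i ℤ.* f (idx i) j) (λ i → c′ i ℤ.* f (idx i) j))) (≡.trans (sum-cong (λ i → ≡.sym (ℤ.*-distribʳ-+ (f (idx i) j) (c i) (c′ i)))) (≡.sym (comb≡ (λ i → c i ℤ.+ c′ i) f j))))

    InSpan-* : ∀ k {x} → InSpan f x → InSpan f (λ j → k ℤ.* x j)
    InSpan-* k (c , h) = (λ i → k ℤ.* c i) , λ j → ≡.trans (≡.cong (k ℤ.*_) (≡.trans (h j) (comb≡ c f j))) (≡.trans (*-sum k (λ i → c i ℤ.* f (idx i) j))
      (≡.trans (sum-cong (λ i → ≡.sym (ℤ.*-assoc k (c i) (f (idx i) j)))) (≡.sym (comb≡ (λ i → k ℤ.* c i) f j))))

    InSpan-sum : ∀ {k} (c : Fin k → ℤ) (g : Fin k → Vec) → (∀ i → InSpan f (g i)) → InSpan f (λ j → sum (λ i → c i ℤ.* g i j))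
    InSpan-sum {zero} c g h = InSpan-cong (λ j → ≡.sym (sum-zero (λ i → c i ℤ.* g i j))) InSpan-0
    InSpan-sum {suc k} c g h = InSpan-cong (λ j → ≡.sym (sum-suc (λ i → c i ℤ.* g i j))) (InSpan-+ (InSpan-* (c Fin.zero) (h Fin.zero)) (InSpan-sum (c ∘ Fin.suc) (g ∘ Fin.suc) (h ∘ Fin.suc)))

    InSpan-f : ∀ i → InSpan f (f (idx i))
    InSpan-f i = ind i , λ j → ≡.sym (≡.trans (comb≡ (ind i) f j) (sum-ind i (λ k → f (idx k) j)))

    -- Φ v = f_0 + … + f_{v-1}, so that Δ (Φ v) = ε_v - ε_0.
    Φ : ℕ → Vec
    Φ zero j = 0ℤ
    Φ (suc v) j = Φ v j ℤ.+ f v j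

    sum-Φ : ∀ v → sum (Φ v) ≡ 0ℤ
    sum-Φ zero = sum-0 {(suc n′)} (λ _ → ≡.refl)
    sum-Φ (suc v) = ≡.trans (sum-+ (Φ v) (f v)) (≡.cong₂ ℤ._+_ (sum-Φ v) (sum-f v))

    Δ-Φ : ∀ v w → Δ (Φ v) w ≡ ε v w ℤ.- ε 0 w
    Δ-Φ zero w = ≡.trans (Δ-* 0ℤ (λ _ → 0ℤ) w) (≡.sym (ℤ.+-inverseʳ (ε 0 w)))
    Δ-Φ (suc v) w = ≡.trans (Δ-+ (Φ v) (f v) w) (≡.trans (≡.cong₂ ℤ._+_ (Δ-Φ v w) (Δ-f v w)) (lemma (ε v w) (ε 0 w) (ε (suc v) w)))
      where
      lemma : ∀ a o b → a ℤ.- o ℤ.+ (b ℤ.- a) ≡ b ℤ.- o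
      lemma = solve-∀

    ε-off′ : ∀ v → _≐_ (suc n′) (λ w → ε v w ℤ.- ε 0 w) (relator (ind (v mod (suc n′))))
    ε-off′ v w w≢ = ≡.trans (≡.cong₂ ℤ._-_ (ε-off v w w≢) (≡.trans (ε-off 0 w w≢) (≡.trans (relator-≐ {ind (origin (suc n′))} {λ _ → 0ℤ}
      (λ u u≢ → ind-≢ {i = origin (suc n′)} {u} (u≢ ∘ ≡.sym)) w w≢) (relator-* 0ℤ (λ _ → 0ℤ) w)))) (ℤ.+-identityʳ _)

    -- x - 1 maps f_0 + ... + f_(n-1) to ε_n - ε_0 = 0, as n ≡ 0. It follows that f_0, which is not
    -- among the generators, lies in their span.
    Φ-n : ∀ j → Φ (suc n′) j ≡ 0ℤ
    Φ-n = Δ-injective (Φ (suc n′)) (sum-Φ (suc n′)) (λ w w≢ → ≡.trans (Δ-Φ (suc n′) w) (≡.trans (ε-off′ (suc n′) w w≢) (≡.trans (≡.cong (λ t → relator (ind t) w) (mod-cong {(suc n′)} {0} (suc n′) (ℕ.n%n≡0 (suc n′))))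
      (≡.trans (relator-≐ {ind (origin (suc n′))} {λ _ → 0ℤ} (λ u u≢ → ind-≢ {i = origin (suc n′)} {u} (u≢ ∘ ≡.sym)) w w≢) (relator-* 0ℤ (λ _ → 0ℤ) w)))))

    Φ-tail : ∀ v → v ℕ.≤ n′ → InSpan f (λ j → Φ (suc v) j ℤ.- f 0 j)
    Φ-tail zero _ = InSpan-cong (λ j → ≡.sym (lemma (f 0 j))) InSpan-0
      where
      lemma : ∀ a → 0ℤ ℤ.+ a ℤ.- a ≡ 0ℤ
      lemma = solve-∀
    Φ-tail (suc v) v< = InSpan-cong (λ j → lemma (Φ (suc v) j) (f 0 j) (f (suc v) j))
      (InSpan-+ (Φ-tail v (ℕ.<⇒≤ v<)) (InSpan-cong (λ j → ≡.cong (λ t → f t j) (≡.cong suc (Fin.toℕ-fromℕ< v<))) (InSpan-f (fromℕ< v<))))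
      where
      lemma : ∀ a o b → a ℤ.- o ℤ.+ b ≡ a ℤ.+ b ℤ.- o
      lemma = solve-∀

    InSpan-f0 : InSpan f (f 0)
    InSpan-f0 = InSpan-cong (λ j → ≡.trans (≡.cong (λ t → ℤ.- 1ℤ ℤ.* (t ℤ.- f 0 j)) (Φ-n j)) (lemma (f 0 j))) (InSpan-* (ℤ.- 1ℤ) (Φ-tail n′ ℕ.≤-refl))
      where
      lemma : ∀ a → ℤ.- 1ℤ ℤ.* (0ℤ ℤ.- a) ≡ a
      lemma = solve-∀

    InSpan-Φ : ∀ v → v ℕ.≤ (suc n′) → InSpan f (Φ v)
    InSpan-Φ zero _ = InSpan-0
    InSpan-Φ (suc v) (s≤s v≤) = InSpan-cong (λ j → lemma (Φ (suc v) j) (f 0 j)) (InSpan-+ (Φ-tail v v≤) InSpan-f0)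
      where
      lemma : ∀ a o → a ℤ.- o ℤ.+ o ≡ a
      lemma = solve-∀

    -- Under x - 1, Σ c_v (f_0 + ... + f_(v-1)) has the same image as the given difference, and x -
    -- 1 is injective in augmentation zero.
    ∼S⇒~S : ∀ a b → ⟦ a ⟧ ∼S ⟦ b ⟧ → a ~S b
    ∼S⇒~S a b (via c eq) = InSpan-cong (λ j → ≡.sym (ℤ.i-j≡0⇒i≡j (P j) (R j) (difference j))) (InSpan-sum c (λ v → Φ (toℕ v)) (λ v → InSpan-Φ (toℕ v) (ℕ.<⇒≤ (Fin.toℕ<n v))))
      where
      P R : Vec
      P = ι a -ₚ ι b
      R j = sum (λ v → c v ℤ.* Φ (toℕ v) j)
      sum-R : sum R ≡ 0ℤ
      sum-R = ≡.trans (sum-swap (λ j v → c v ℤ.* Φ (toℕ v) j)) (sum-0 (λ v → ≡.trans (≡.sym (*-sum (c v) (Φ (toℕ v)))) (≡.trans (≡.cong (c v ℤ.*_) (sum-Φ (toℕ v))) (ℤ.*-zeroʳ (c v)))))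
      Δ-R : _≐_ (suc n′) (Δ R) (relator c)
      Δ-R w w≢ = ≡.trans (Δ-sum c (λ v → Φ (toℕ v)) w) (≡.trans (sum-cong (λ v → ≡.cong (c v ℤ.*_) (≡.trans (Δ-Φ (toℕ v) w) (≡.trans (ε-off′ (toℕ v) w w≢)
        (≡.cong (λ t → relator (ind t) w) (toℕ-mod-self v)))))) (≡.trans (≡.sym (relator-sum c ind w))
        (≡.cong₂ (λ s t → + d ℤ.* s ℤ.- t) (recombine w) (push-cong (mul (suc n′) d) recombine w))))
        where
        recombine : ∀ u → sum (λ v → c v ℤ.* ind v u) ≡ c u
        recombine u = ≡.trans (sum-cong (λ v → ℤ.*-comm (c v) (ind v u))) (sum-ind′ u c)
      difference : ∀ j → P j ℤ.- R j ≡ 0ℤ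
      difference = Δ-injective (λ j → P j ℤ.- R j) (≡.trans (sum-- P R) (≡.cong₂ ℤ._-_ (sum-diff a b) sum-R))
        (λ w w≢ → ≡.trans (Δ-- P R w) (≡.trans (≡.cong₂ ℤ._-_ (≡.trans (Δ-diff a b w w≢) (eq w w≢)) (Δ-R w w≢)) (ℤ.+-inverseʳ (relator c w))))

open IntegerSpans

module CirculantMatrices {q : ℕ} (F : FiniteField q) (n : ℕ) {{_ : NonZero n}} where
  open FiniteField F
  open Circulant F n
  open Sums commRing
  open GroupRing commRing n
  open UnitGroup F n renaming (_≈X_ to _≈ᵤ_)
  open import Relation.Binary.Reasoning.Setoid setoid

  ∑F≡sum : ∀ {k} (g : Fin k → Carrier) → ∑F g ≈ sum g
  ∑F≡sum {zero} g = reflexive (≡.sym (sum-zero g))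
  ∑F≡sum {suc k} g = trans (+-congˡ (∑F≡sum (g ∘ Fin.suc))) (reflexive (≡.sym (sum-suc g)))

  Xₘ-entry : ∀ i j → Xₘ i j ≈ ind (suc (toℕ j) mod n) i
  Xₘ-entry i j = ind-sym i (suc (toℕ j) mod n)

  X^-entry : ∀ k i j → X^ k i j ≈ ind ((k ℕ.+ toℕ j) mod n) i
  X^-entry zero i j = trans (ind-sym i j) (reflexive (≡.cong (λ t → ind t i) (≡.sym (toℕ-mod-self j))))
  X^-entry (suc k) i j = begin
    ∑F (λ l → Xₘ i l * X^ k l j)
      ≈⟨ ∑F≡sum (λ l → Xₘ i l * X^ k l j) ⟩
    sum (λ l → Xₘ i l * X^ k l j)
      ≈⟨ sum-cong (λ l → trans (*-cong (Xₘ-entry i l) (X^-entry k l j)) (*-comm _ _)) ⟩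
    sum (λ l → ind ((k ℕ.+ toℕ j) mod n) l * ind (suc (toℕ l) mod n) i)
      ≈⟨ sum-ind ((k ℕ.+ toℕ j) mod n) (λ l → ind (suc (toℕ l) mod n) i) ⟩
    ind (suc (toℕ ((k ℕ.+ toℕ j) mod n)) mod n) i
      ≈⟨ reflexive (≡.cong (λ t → ind t i) (mod-cong n (≡.trans (≡.cong (λ t → suc t % n) (toℕ-mod (k ℕ.+ toℕ j) n)) (%-+ʳ 1 (k ℕ.+ toℕ j))))) ⟩
    ind ((suc k ℕ.+ toℕ j) mod n) i ∎

  mat : Elt → Mat
  mat u i j = ∑F (λ k → u k * X^ (toℕ k) i j)

  mat-entry : ∀ u i j → mat u i j ≈ sum (λ k → u k * ind (k ⊕ j) i)
  mat-entry u i j = trans (∑F≡sum (λ k → u k * X^ (toℕ k) i j)) (sum-cong (λ k → *-congˡ (X^-entry (toℕ k) i j)))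

  mat-cong : ∀ {u w} → u ≋ w → mat u ≈ₘ mat w
  mat-cong {u} {w} e i j = trans (mat-entry u i j) (trans (sum-cong (λ k → *-congʳ (e k))) (sym (mat-entry w i j)))

  mat-⊗ : ∀ u w → (mat u ⊗ mat w) ≈ₘ mat (u ⋆ w)
  mat-⊗ u w i j = begin
    ∑F (λ m → mat u i m * mat w m j)
      ≈⟨ ∑F≡sum (λ m → mat u i m * mat w m j) ⟩
    sum (λ m → mat u i m * mat w m j)
      ≈⟨ sum-cong (λ m → trans (*-cong (mat-entry u i m) (mat-entry w m j)) (trans (*-comm _ _) (*-congʳ (sum-cong (λ l → *-comm _ _))))) ⟩
    sum (λ m → push (_⊕ j) w m * sum (λ k → u k * ind (k ⊕ m) i))
      ≈⟨ sum-push (_⊕ j) w (λ m → sum (λ k → u k * ind (k ⊕ m) i)) ⟩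
    sum (λ l → w l * sum (λ k → u k * ind (k ⊕ (l ⊕ j)) i))
      ≈⟨ sum-cong (λ l → *-sum (w l) (λ k → u k * ind (k ⊕ (l ⊕ j)) i)) ⟩
    sum (λ l → sum (λ k → w l * (u k * ind (k ⊕ (l ⊕ j)) i)))
      ≈⟨ sum-swap (λ l k → w l * (u k * ind (k ⊕ (l ⊕ j)) i)) ⟩
    sum (λ k → sum (λ l → w l * (u k * ind (k ⊕ (l ⊕ j)) i)))
      ≈⟨ sum-cong (λ k → trans (sum-cong (λ l → trans (sym (*-assoc _ _ _)) (trans (*-congʳ (*-comm _ _)) (trans (*-assoc _ _ _)
           (*-congˡ (*-congˡ (reflexive (≡.cong (λ t → ind t i) (≡.sym (⊕-assoc k l j)))))))))) (sym (*-sum (u k) (λ l → w l * ind (k ⊕ l ⊕ j) i)))) ⟩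
    sum (λ k → u k * sum (λ l → w l * ind (k ⊕ l ⊕ j) i))
      ≈⟨ sym (integrate u w (λ m → ind (m ⊕ j) i)) ⟩
    sum (λ m → (u ⋆ w) m * ind (m ⊕ j) i)
      ≈⟨ sym (mat-entry (u ⋆ w) i j) ⟩
    mat (u ⋆ w) i j ∎

  mat-δ : ∀ a i j → mat (δ a) i j ≈ X^ a i j
  mat-δ a i j = trans (mat-entry (δ a) i j) (trans (sum-ind (a mod n) (λ k → ind (k ⊕ j) i))
    (trans (reflexive (≡.cong (λ t → ind t i) (⊕-modˡ a j))) (sym (X^-entry a i j))))

  -- The column at 0 of a circulant matrix lists its coefficients.
  mat-injective : ∀ {u w} → mat u ≈ₘ mat w → u ≋ w
  mat-injective {u} {w} e k = trans (sym (column u)) (trans (e k (0 mod n)) (column w))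
    where
    column : ∀ u → mat u k (0 mod n) ≈ u k
    column u = trans (mat-entry u k (0 mod n)) (trans (sum-cong (λ l → trans (*-comm _ _) (*-congʳ (reflexive (≡.cong (λ t → ind t k)
      (≡.trans (⊕-comm l (0 mod n)) (⊕-identityˡ l))))))) (sum-ind′ k u))

  ⊗-cong : ∀ {A A′ B B′} → A ≈ₘ A′ → B ≈ₘ B′ → (A ⊗ B) ≈ₘ (A′ ⊗ B′)
  ⊗-cong {A} {A′} {B} {B′} e f i j = trans (∑F≡sum (λ m → A i m * B m j)) (trans (sum-cong (λ m → *-cong (e i m) (f m j))) (sym (∑F≡sum (λ m → A′ i m * B′ m j))))

  -- Along row i every power X^k has exactly one entry 1.
  row-sum : ∀ u i → ∑F (λ j → mat u i j) ≈ sum u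
  row-sum u i = begin
    ∑F (λ j → mat u i j)
      ≈⟨ ∑F≡sum (λ j → mat u i j) ⟩
    sum (λ j → mat u i j)
      ≈⟨ sum-cong (mat-entry u i) ⟩
    sum (λ j → sum (λ k → u k * ind (k ⊕ j) i))
      ≈⟨ sum-swap (λ j k → u k * ind (k ⊕ j) i) ⟩
    sum (λ k → sum (λ j → u k * ind (k ⊕ j) i))
      ≈⟨ sum-cong (λ k → trans (sym (*-sum (u k) (λ j → ind (k ⊕ j) i))) (trans (*-congˡ (once k)) (*-identityʳ _))) ⟩
    sum u ∎
    where
    minus : Fin n → ℕ
    minus k = toℕ k ℕ.* ℕ.pred n
    k-k : ∀ k → (minus k ℕ.+ toℕ k) % n ≡ 0
    k-k k = ≡.trans (≡.cong (_% n) (≡.trans (ℕ.+-comm (minus k) (toℕ k)) (≡.trans (≡.sym (ℕ.*-suc (toℕ k) (ℕ.pred n))) (≡.cong (toℕ k ℕ.*_) (ℕ.suc-pred n))))) (ℕ.m*n%n≡0 (toℕ k) n)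
    cancel-k : ∀ k j → (minus k mod n) ⊕ (k ⊕ j) ≡ j
    cancel-k k j = ≡.trans (≡.sym (⊕-assoc (minus k mod n) k j)) (≡.trans (≡.cong (_⊕ j) (≡.trans (⊕-modˡ (minus k) k)
      (mod-cong n (≡.trans (k-k k) (≡.sym (ℕ.m*n%n≡0 0 n)))))) (⊕-identityˡ j))
    ⊕-cancel : ∀ k {j j′} → k ⊕ j ≡ k ⊕ j′ → j ≡ j′
    ⊕-cancel k {j} {j′} e = ≡.trans (≡.sym (cancel-k k j)) (≡.trans (≡.cong ((minus k mod n) ⊕_) e) (cancel-k k j′))
    hit : ∀ k → k ⊕ ((minus k mod n) ⊕ i) ≡ i
    hit k = ≡.trans (≡.sym (⊕-assoc k (minus k mod n) i)) (≡.trans (≡.cong (_⊕ i) (⊕-comm k (minus k mod n))) (≡.trans (⊕-assoc (minus k mod n) k i) (cancel-k k i)))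
    once : ∀ k → sum (λ j → ind (k ⊕ j) i) ≈ 1#
    once k = trans (sum-cong (λ j → sym (*-identityʳ _))) (trans (reflexive (≡.cong (push (k ⊕_) (λ _ → 1#)) (≡.sym (hit k))))
      (push-injective (k ⊕_) (⊕-cancel k) (λ _ → 1#) ((minus k mod n) ⊕ i)))

  one-mat : ∀ i j → mat (δ 0) i j ≈ Iₘ i j
  one-mat = mat-δ 0

  mat-InC′ : ∀ u → InC′ (mat (elt u))
  mat-InC′ u = (elt u , λ i j → refl)
    , (mat (inv u) , (inv u , λ i j → refl)
      , (λ i j → trans (mat-⊗ (elt u) (inv u) i j) (trans (mat-cong (inverseʳ u) i j) (one-mat i j)))
      , (λ i j → trans (mat-⊗ (inv u) (elt u) i j) (trans (mat-cong (GR.trans (⋆-comm (inv u) (elt u)) (inverseʳ u)) i j) (one-mat i j))))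
    , (λ i → trans (row-sum (elt u) i) (augmentation u))

  InC′-unit : ∀ B → InC′ B → ∃ λ u → mat (elt u) ≈ₘ B
  InC′-unit B ((c , B≈) , (D , (d , D≈) , CD , _) , fixes) = record
      { elt = c ; inv = d
      ; inverseʳ = mat-injective (λ i j → trans (sym (mat-⊗ c d i j)) (trans (⊗-cong (λ i j → sym (B≈ i j)) (λ i j → sym (D≈ i j)) i j) (trans (CD i j) (sym (one-mat i j)))))
      ; augmentation = trans (sym (row-sum c (0 mod n))) (trans (trans (∑F≡sum (λ j → mat c (0 mod n) j)) (trans (sum-cong (λ j → sym (B≈ (0 mod n) j))) (sym (∑F≡sum (λ j → B (0 mod n) j))))) (fixes (0 mod n))) }
    , λ i j → sym (B≈ i j)

  ≈X⇒ : ∀ u w → u ≈ᵤ w → mat (elt u) ≈X mat (elt w)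
  ≈X⇒ u w (by k e) = k , λ i j → trans (mat-cong e i j) (trans (sym (mat-⊗ (δ k) (elt w) i j)) (⊗-cong {B = mat (elt w)} (mat-δ k) (λ _ _ → refl) i j))

  ⇒≈X : ∀ u w → mat (elt u) ≈X mat (elt w) → u ≈ᵤ w
  ⇒≈X u w (k , e) = by k (mat-injective (λ i j → trans (e i j) (trans (⊗-cong {B = mat (elt w)} (λ i j → sym (mat-δ k i j)) (λ _ _ → refl) i j) (mat-⊗ (δ k) (elt w) i j))))

-- The period of q modulo n and the induction on the power of p in n

Isos : (n : ℕ) .{{_ : NonZero n}} {q : ℕ} → FiniteField q → Set
Isos n {q} F = Iso (Lattice.ΣGroup n q) (UnitGroup.CGroup F n) × Iso (Lattice.SGroup n q) (UnitGroup.XGroup F n)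

-- The powers of q repeat modulo n, and the common factor q^i of two equal ones is cancelled because
-- q is prime to n.
coprime-period : ∀ n .{{_ : NonZero n}} q → gcd n q ≡ 1 → ∃ λ m → NonZero m × n ∣ q ℕ.^ m ℕ.∸ 1
coprime-period n q coprime with Fin.pigeonhole (ℕ.n<1+n n) (λ (i : Fin (suc n)) → (q ℕ.^ toℕ i) mod n)
... | i , j , i<j , e = m , ℕ.>-nonZero (ℕ.m<n⇒0<n∸m i<j) , strip (toℕ i) (≡.subst (n ∣_) difference (∣-∸ (mod-injective n e)))
  where
  m = toℕ j ℕ.∸ toℕ i
  q^j : q ℕ.^ toℕ j ≡ q ℕ.^ toℕ i ℕ.* q ℕ.^ m
  q^j = ≡.trans (≡.cong (q ℕ.^_) (≡.sym (ℕ.m+[n∸m]≡n (ℕ.<⇒≤ i<j)))) (ℕ.^-distribˡ-+-* q (toℕ i) m)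
  difference : q ℕ.^ toℕ j ℕ.∸ q ℕ.^ toℕ i ≡ q ℕ.^ toℕ i ℕ.* (q ℕ.^ m ℕ.∸ 1)
  difference = ≡.trans (≡.cong₂ ℕ._∸_ q^j (≡.sym (ℕ.*-identityʳ (q ℕ.^ toℕ i)))) (≡.sym (ℕ.*-distribˡ-∸ (q ℕ.^ toℕ i) (q ℕ.^ m) 1))
  ∣-∸ : ∀ {a b} → a % n ≡ b % n → n ∣ b ℕ.∸ a
  ∣-∸ {a} {b} eq = divides (b / n ℕ.∸ a / n) (begin
    b ℕ.∸ a
      ≡⟨ ≡.cong₂ ℕ._∸_ (ℕ.m≡m%n+[m/n]*n b n) (ℕ.m≡m%n+[m/n]*n a n) ⟩
    (b % n ℕ.+ b / n ℕ.* n) ℕ.∸ (a % n ℕ.+ a / n ℕ.* n)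
      ≡⟨ ≡.cong (λ t → (b % n ℕ.+ b / n ℕ.* n) ℕ.∸ (t ℕ.+ a / n ℕ.* n)) eq ⟩
    (b % n ℕ.+ b / n ℕ.* n) ℕ.∸ (b % n ℕ.+ a / n ℕ.* n)
      ≡⟨ ℕ.[m+n]∸[m+o]≡n∸o (b % n) _ _ ⟩
    b / n ℕ.* n ℕ.∸ a / n ℕ.* n
      ≡⟨ ≡.sym (ℕ.*-distribʳ-∸ n (b / n) (a / n)) ⟩
    (b / n ℕ.∸ a / n) ℕ.* n ∎)
    where open ≡.≡-Reasoning
  strip : ∀ k → n ∣ q ℕ.^ k ℕ.* (q ℕ.^ m ℕ.∸ 1) → n ∣ q ℕ.^ m ℕ.∸ 1
  strip zero d = ≡.subst (n ∣_) (ℕ.*-identityˡ _) d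
  strip (suc k) d = strip k (ℕ.coprime-divisor (ℕ.gcd≡1⇒coprime coprime) (≡.subst (n ∣_) (ℕ.*-assoc q (q ℕ.^ k) _) d))

coprime-isos : ∀ {q} (F : FiniteField q) {p κ} (pr : Prime p) → 1 ℕ.≤ κ → q ≡ p ℕ.^ κ → ∀ n .{{_ : NonZero n}} → gcd n q ≡ 1 → Isos n F
coprime-isos {q} F {p} {κ} pr 1≤κ q≡ n coprime = from-period (coprime-period n q coprime)
  where
  from-period : (∃ λ m → NonZero m × n ∣ q ℕ.^ m ℕ.∸ 1) → Isos n F
  from-period (m , m≢0 , divides g Q≡gn) = CoprimeCase.isos F {p} {κ} pr q≡ {m} {Q} Q+1≡q^m (Splitting.splittingField F {p} {κ} pr q≡ m Q Q+1≡q^m) n g Q≡gn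
   where
    instance
      _ = m≢0
      κ≢0 : NonZero κ
      κ≢0 = ℕ.>-nonZero 1≤κ
      p-nonTrivial : ℕ.NonTrivial p
      p-nonTrivial = prime⇒nonTrivial pr
    1<^ : ∀ a k .{{_ : ℕ.NonTrivial a}} .{{_ : NonZero k}} → 1 ℕ.< a ℕ.^ k
    1<^ a k = ℕ.^-monoʳ-< a (ℕ.nonTrivial⇒n>1 a) (ℕ.>-nonZero⁻¹ k)
    instance
      q-nonTrivial : ℕ.NonTrivial q
      q-nonTrivial = ℕ.n>1⇒nonTrivial (≡.subst (1 ℕ.<_) (≡.sym q≡) (1<^ p κ))
    Q : ℕ
    Q = q ℕ.^ m ℕ.∸ 1
    Q+1≡q^m : suc Q ≡ q ℕ.^ m
    Q+1≡q^m = ℕ.m+[n∸m]≡n (ℕ.<⇒≤ (1<^ q m))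
    instance
      Q≢0 : NonZero Q
      Q≢0 = ℕ.>-nonZero (ℕ.m<n⇒0<n∸m (1<^ q m))

∤⇒gcd≡1 : ∀ {p} → Prime p → ∀ n → ¬ p ∣ n → gcd n p ≡ 1
∤⇒gcd≡1 {p} pr n p∤n with prime⇒irreducible pr (ℕ.gcd[m,n]∣n n p)
... | inj₁ e = e
... | inj₂ e = ⊥-elim (p∤n (≡.subst (_∣ n) e (ℕ.gcd[m,n]∣m n p)))

-- Each step replaces n by n / p, until p no longer divides it and the transform applies.
prime-isos : ∀ {p} (pr : Prime p) (F : FiniteField p) n .{{_ : NonZero n}} → Isos n F
prime-isos {p} pr F n {{n≢0}} = <-rec (λ n → .(nz : NonZero n) → Isos n {{nz}} F) step n n≢0
  where
  step : ∀ n → (∀ {k} → k ℕ.< n → .(nz : NonZero k) → Isos k {{nz}} F) → .(nz : NonZero n) → Isos n {{nz}} F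
  step n rec nz = decide (p ℕ.∣? n)
   where
   decide : Dec (p ∣ n) → Isos n {{nz}} F
   decide (no p∤n) = coprime-isos F pr ℕ.≤-refl (≡.sym (ℕ.*-identityʳ p)) n {{nz}} (∤⇒gcd≡1 pr n p∤n)
   decide (yes d@(divides n₁ n≡)) = PrimeStep.Σ-step pr F n₁ n {{n₁≢0}} {{nz}} n≡ (proj₁ ih) , PrimeStepS.S-step pr F n₁ n {{n₁≢0}} {{nz}} n≡ (proj₂ ih)
    where
    n₁≢0 : NonZero n₁
    n₁≢0 = ℕ.≢-nonZero λ { ≡.refl → ℕ.≢-nonZero⁻¹ n {{nz}} n≡ }
    ih : Isos n₁ {{n₁≢0}} F
    ih = rec (ℕ.quotient-< d {{prime⇒nonTrivial pr}} {{nz}}) n₁≢0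

module Conclusion (n′ : ℕ) {{nz : NonZero (suc n′)}} {q : ℕ} (F : FiniteField q) where
  open FiniteField F using (refl; sym; trans)
  open Sandpile (suc n′) {{nz}} q
  open SpanComparison n′ q {{nz}}
  open CirculantMatrices F (suc n′) {{nz}}
  open Circulant F (suc n′) {{nz}}
  open Lattice (suc n′) {{nz}} q using (Vec; ≐⇒∼; μ; μ-≐; _∼_; _∼S_)
  open GroupRing (FiniteField.commRing F) (suc n′) {{nz}} using (Elt; _≋_; _⋆_)
  open UnitGroup F (suc n′) {{nz}} using (Unit; elt; _·ᵤ_; CGroup; XGroup) renaming (_≈X_ to _≈ᵤ_)

  ⟦⟧-+ : ∀ a b w → ⟦ a +z b ⟧ w ≡ ⟦ a ⟧ w ℤ.+ ⟦ b ⟧ w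
  ⟦⟧-+ a b Fin.zero = ≡.refl
  ⟦⟧-+ a b (Fin.suc w) = ≡.refl

  ⟦⟧-tail : ∀ (x : Vec) → _≐_ (suc n′) {{nz}} ⟦ x ∘ Fin.suc ⟧ x
  ⟦⟧-tail x Fin.zero w≢ = ⊥-elim (w≢ ≡.refl)
  ⟦⟧-tail x (Fin.suc w) _ = ≡.refl

  module _ (I : Iso (Lattice.ΣGroup (suc n′) {{nz}} q) CGroup) where
    open Iso I

    image : Zn → Elt
    image a = elt (fun ⟦ a ⟧)

    image-+ : ∀ a b → image (a +z b) ≋ image a ⋆ image b
    image-+ a b k = trans (cong {⟦ a +z b ⟧} {λ w → ⟦ a ⟧ w ℤ.+ ⟦ b ⟧ w} (≐⇒∼ (λ w _ → ⟦⟧-+ a b w)) k) (homo ⟦ a ⟧ ⟦ b ⟧ k)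

    image-onto : ∀ B → InC′ B → ∃ λ a → mat (image a) ≈ₘ B
    image-onto B B∈ = x ∘ Fin.suc , λ i j → trans (mat-cong {image (x ∘ Fin.suc)} {elt u} same i j) (proj₂ (InC′-unit B B∈) i j)
      where
      u : Unit
      u = proj₁ (InC′-unit B B∈)
      x : Vec
      x = proj₁ (surj u)
      same : image (x ∘ Fin.suc) ≋ elt u
      same k = trans (cong {⟦ x ∘ Fin.suc ⟧} {x} (≐⇒∼ (⟦⟧-tail x)) k) (proj₂ (surj u) k)

    Σ-iso : Σ≅C′ (suc n′) {{nz}} q F
    Σ-iso = record
      { φ = λ a → mat (image a)
      ; φ-in = λ a → mat-InC′ (fun ⟦ a ⟧)
      ; φ-wd = λ a b e → mat-cong {image a} {image b} (cong {⟦ a ⟧} {⟦ b ⟧} (~Σ⇒∼ a b e))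
      ; φ-hom = λ a b i j → trans (mat-cong {image (a +z b)} {image a ⋆ image b} (image-+ a b) i j) (sym (mat-⊗ (image a) (image b) i j))
      ; φ-inj = λ a b e → ∼⇒~Σ a b (inj ⟦ a ⟧ ⟦ b ⟧ (mat-injective {image a} {image b} e))
      ; φ-surj = image-onto
      }

  ≈X-⊗ : ∀ A u w → A ≈X mat (elt (u ·ᵤ w)) → A ≈X (mat (elt u) ⊗ mat (elt w))
  ≈X-⊗ A u w (k , e) = k , λ i j → trans (e i j) (⊗-cong {X^ k} {X^ k} {mat (elt (u ·ᵤ w))} {mat (elt u) ⊗ mat (elt w)} (λ _ _ → refl) (λ i j → sym (mat-⊗ (elt u) (elt w) i j)) i j)

  module _ (I : Iso (Lattice.SGroup (suc n′) {{nz}} q) XGroup) where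
    open Iso I
    private module X = AbelianGroup XGroup

    class : Zn → Unit
    class a = fun ⟦ a ⟧

    class-+ : ∀ a b → class (a +z b) ≈ᵤ (class a ·ᵤ class b)
    class-+ a b = X.trans {class (a +z b)} {fun (λ w → ⟦ a ⟧ w ℤ.+ ⟦ b ⟧ w)} {class a ·ᵤ class b}
      (cong {⟦ a +z b ⟧} {λ w → ⟦ a ⟧ w ℤ.+ ⟦ b ⟧ w} (≐⇒∼ {μ ⟦ a +z b ⟧} {μ (λ w → ⟦ a ⟧ w ℤ.+ ⟦ b ⟧ w)} (μ-≐ {⟦ a +z b ⟧} {λ w → ⟦ a ⟧ w ℤ.+ ⟦ b ⟧ w} (λ w _ → ⟦⟧-+ a b w)))) (homo ⟦ a ⟧ ⟦ b ⟧)

    class-onto : ∀ B → InC′ B → ∃ λ a → mat (elt (class a)) ≈X B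
    class-onto B B∈ = x ∘ Fin.suc , proj₁ shifted , λ i j → trans (proj₂ shifted i j)
        (⊗-cong {X^ (proj₁ shifted)} {X^ (proj₁ shifted)} {mat (elt u)} {B} (λ _ _ → refl) (proj₂ (InC′-unit B B∈)) i j)
      where
      u : Unit
      u = proj₁ (InC′-unit B B∈)
      x : Vec
      x = proj₁ (surj u)
      shifted : mat (elt (class (x ∘ Fin.suc))) ≈X mat (elt u)
      shifted = ≈X⇒ (class (x ∘ Fin.suc)) u (X.trans {class (x ∘ Fin.suc)} {fun x} {u} (cong {⟦ x ∘ Fin.suc ⟧} {x} (≐⇒∼ {μ ⟦ x ∘ Fin.suc ⟧} {μ x} (μ-≐ {⟦ x ∘ Fin.suc ⟧} {x} (⟦⟧-tail x)))) (proj₂ (surj u)))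

    S-iso : S≅C′/X (suc n′) {{nz}} q F
    S-iso = record
      { φ = λ a → mat (elt (class a))
      ; φ-in = λ a → mat-InC′ (class a)
      ; φ-wd = λ a b e → ≈X⇒ (class a) (class b) (cong {⟦ a ⟧} {⟦ b ⟧} (~S⇒∼S a b e))
      ; φ-hom = λ a b → ≈X-⊗ (mat (elt (class (a +z b)))) (class a) (class b) (≈X⇒ (class (a +z b)) (class a ·ᵤ class b) (class-+ a b))
      ; φ-inj = λ a b e → ∼S⇒~S a b (inj ⟦ a ⟧ ⟦ b ⟧ (⇒≈X (class a) (class b) e))
      ; φ-surj = class-onto
      }

  both : Isos (suc n′) {{nz}} F → Σ≅C′ (suc n′) {{nz}} q F × S≅C′/X (suc n′) {{nz}} q F
  both (I , J) = Σ-iso I , S-iso J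

-- The instance is passed explicitly so that both sides agree syntactically; comparing them
-- after unfolding Σ≅C′ and S≅C′/X is prohibitively slow.
conclude : ∀ n {{_ : NonZero n}} {q} (F : FiniteField q) → Isos n F → Σ≅C′ n q F × S≅C′/X n q F
conclude zero {{nz}} F isos = ⊥-elim (ℕ.≢-nonZero⁻¹ 0 {{nz}} ≡.refl)
conclude (suc n′) {{nz}} {q} F isos = Conclusion.both n′ {{nz}} {q} F isos

-- 𝔽₄ = {0, 1, α, α + 1}, listed in this order.
module FourElements where

  table : Vec.Vec (Vec.Vec (Fin 4) 4) 4 → Fin 4 → Fin 4 → Fin 4
  table t x y = Vec.lookup (Vec.lookup t x) y

  pattern 2F′ = Fin.suc (Fin.suc Fin.zero)
  pattern 3F′ = Fin.suc (Fin.suc (Fin.suc Fin.zero))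

  _+₄_ _*₄_ : Fin 4 → Fin 4 → Fin 4
  _+₄_ = table ((0F ∷ 1F ∷ 2F′ ∷ 3F′ ∷ []) ∷ (1F ∷ 0F ∷ 3F′ ∷ 2F′ ∷ []) ∷ (2F′ ∷ 3F′ ∷ 0F ∷ 1F ∷ []) ∷ (3F′ ∷ 2F′ ∷ 1F ∷ 0F ∷ []) ∷ [])
  _*₄_ = table ((0F ∷ 0F ∷ 0F ∷ 0F ∷ []) ∷ (0F ∷ 1F ∷ 2F′ ∷ 3F′ ∷ []) ∷ (0F ∷ 2F′ ∷ 3F′ ∷ 1F ∷ []) ∷ (0F ∷ 3F′ ∷ 1F ∷ 2F′ ∷ []) ∷ [])

  commutativeRing₄ : CommutativeRing 0ℓ 0ℓ
  commutativeRing₄ = record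
    { Carrier = Fin 4 ; _≈_ = _≡_ ; _+_ = _+₄_ ; _*_ = _*₄_ ; -_ = λ x → x ; 0# = 0F ; 1# = 1F
    ; isCommutativeRing = record
      { isRing = record
        { +-isAbelianGroup = record
          { isGroup = record
            { isMonoid = record
              { isSemigroup = record
                { isMagma = record { isEquivalence = ≡.isEquivalence ; ∙-cong = ≡.cong₂ _+₄_ }
                ; assoc = from-yes (Fin.all? λ x → Fin.all? λ y → Fin.all? λ z → ((x +₄ y) +₄ z) Fin.≟ (x +₄ (y +₄ z))) }
              ; identity = from-yes (Fin.all? λ x → (0F +₄ x) Fin.≟ x) , from-yes (Fin.all? λ x → (x +₄ 0F) Fin.≟ x) }
            ; inverse = from-yes (Fin.all? λ x → (x +₄ x) Fin.≟ 0F) , from-yes (Fin.all? λ x → (x +₄ x) Fin.≟ 0F)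
            ; ⁻¹-cong = λ e → e }
          ; comm = from-yes (Fin.all? λ x → Fin.all? λ y → (x +₄ y) Fin.≟ (y +₄ x)) }
        ; *-cong = ≡.cong₂ _*₄_
        ; *-assoc = from-yes (Fin.all? λ x → Fin.all? λ y → Fin.all? λ z → ((x *₄ y) *₄ z) Fin.≟ (x *₄ (y *₄ z)))
        ; *-identity = from-yes (Fin.all? λ x → (1F *₄ x) Fin.≟ x) , from-yes (Fin.all? λ x → (x *₄ 1F) Fin.≟ x)
        ; distrib = from-yes (Fin.all? λ x → Fin.all? λ y → Fin.all? λ z → (x *₄ (y +₄ z)) Fin.≟ ((x *₄ y) +₄ (x *₄ z)))
                  , from-yes (Fin.all? λ x → Fin.all? λ y → Fin.all? λ z → ((y +₄ z) *₄ x) Fin.≟ ((y *₄ x) +₄ (z *₄ x))) }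
      ; *-comm = from-yes (Fin.all? λ x → Fin.all? λ y → (x *₄ y) Fin.≟ (y *₄ x)) } }

  F₄ : FiniteField 4
  F₄ = record
    { commRing = commutativeRing₄
    ; 0≉1 = λ ()
    ; inverse = from-yes (Fin.all? λ x → ¬? (x Fin.≟ 0F) →-dec Fin.any? λ y → (x *₄ y) Fin.≟ 1F)
    ; enum = λ i → i
    ; enum-inj = λ _ _ e → e
    ; enum-surj = λ x → x , ≡.refl }

  open Circulant F₄ 2
  open CirculantMatrices F₄ 2 using (mat; ⊗-cong)

  entries : Fin 4 → Fin 4 → Fin 2 → Fin 4
  entries x y 0F = x
  entries x y 1F = y

  -- In characteristic 2, (a + b x)² = a² + b² = (a + b)² modulo x² - 1.
  square : ∀ x y → ∑F (λ j → mat (entries x y) 0F j) ≡ 1F → ∀ i j → (mat (entries x y) ⊗ mat (entries x y)) i j ≡ Iₘ i j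
  square = from-yes (Fin.all? λ x → Fin.all? λ y → (∑F (λ j → mat (entries x y) 0F j) Fin.≟ 1F) →-dec
    Fin.all? λ i → Fin.all? λ j → (mat (entries x y) ⊗ mat (entries x y)) i j Fin.≟ Iₘ i j)

  involution : ∀ B → InC′ B → ∀ i j → (B ⊗ B) i j ≡ Iₘ i j
  involution B ((c , B≡) , _ , fixes) i j = ≡.trans (⊗-cong {B} {M} {B} {M} B≡ B≡ i j) (square (c 0F) (c 1F) row i j)
    where
    M = mat (entries (c 0F) (c 1F))
    row : ∑F (λ j → M 0F j) ≡ 1F
    row = ≡.trans (≡.cong₂ (λ s t → s +₄ (t +₄ 0F)) (≡.sym (B≡ 0F 0F)) (≡.sym (B≡ 0F 1F))) (fixes 0F)

  -- The relations are spanned by ε_1 = 4 e_1 - e_4 = 4 e_1. As the image of e_1 would be an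
  -- involution, 2 e_1 would be a multiple of 4 e_1; the coefficient of x^1 refutes this.
  not-iso : ¬ Σ≅C′ 2 4 F₄
  not-iso I = from-no (+ 4 ℤ.∣? + 2) (ℤ.divides (c 0F) (≡.trans eq (ℤ.+-identityʳ (c 0F ℤ.* + 4))))
    where
    open Sandpile 2 4
    open GroupIso I
    one zero₂ : Zn
    one _ = 1ℤ
    zero₂ _ = 0ℤ
    span : (one +z one) ~Σ (zero₂ +z zero₂)
    span = φ-inj _ _ (λ i j → ≡.trans (φ-hom one one i j) (≡.trans (involution (φ one) (φ-in one) i j)
      (≡.sym (≡.trans (φ-hom zero₂ zero₂ i j) (involution (φ zero₂) (φ-in zero₂) i j)))))
    c = proj₁ span
    eq : + 2 ≡ c 0F ℤ.* + 4 ℤ.+ 0ℤ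
    eq = proj₂ span 1F

theorem3p2 : ((d : ℕ) → Prime d → (n : ℕ) → {{_ : NonZero n}} → (F : FiniteField d) →
    Σ≅C′ n d F × S≅C′/X n d F)
    ×
    ((d : ℕ) → IsPrimePower d → ¬ Prime d → (n : ℕ) → {{_ : NonZero n}} → gcd n d ≡ 1 →
    (F : FiniteField d) → Σ≅C′ n d F × S≅C′/X n d F)
    ×
    ¬ ((d : ℕ) → IsPrimePower d → ¬ Prime d → (n : ℕ) → {{_ : NonZero n}} → ¬ (gcd n d ≡ 1) →
    (F : FiniteField d) → Σ≅C′ n d F × S≅C′/X n d F)
theorem3p2 =
    (λ d pr n F → conclude n F (prime-isos pr F n))
  , (λ { d (p , κ , pr , 1≤κ , d≡) _ n coprime F → conclude n F (coprime-isos F pr 1≤κ d≡ n coprime) })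
  , (λ h → FourElements.not-iso (proj₁ (h 4 (2 , 2 , prime[2] , s≤s z≤n , ≡.refl) (from-no (prime? 4)) 2 (λ ()) FourElements.F₄)))
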